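{- Let $e$ be a positive integer and $q = 3^{2e}$. With $\bm{p}$, $\pi$, $\mathcal{L}_{1}$, $\mathcal{L}_{2}$ as described in the context, put $\mathcal{P}_{1} = \{ \bm{r} \text{ point of } \mathrm{PG}(3,q) : |\mathrm{star}(\bm{r}) \cap \mathcal{L}_{1}| = \tfrac{1}{2}(3^{2e}+1)(3^{2e}-3^{e}) \}$ and $\mathcal{P}_{2} = \{ \bm{r} : |\mathrm{star}(\bm{r}) \cap\mathcal{L}_{1}| = \tfrac{1}{2}(3^{2e}+1) (3^{2e}+3^{e}) \}$. Then the partition of the lines of $\mathrm{PG}(3,q)$ into the four classes $\mathrm{star}(\bm{p})$, $\mathrm{line}(\pi)$, $\mathcal{L}_{1}$, $\mathcal{L}_{2}$ together with the partition of the points into the four classes $\{\bm{p}\}$, $\pi$, $\mathcal{P}_{1}$, $\mathcal{P}_{2}$ is a symmetric tactical decomposition of $\mathrm{PG}(3,q)$.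
   Context: Let $q\equiv 1 \pmod 4$, $q \not\equiv 1\pmod 3$ (this holds for $q=3^{2e}$), $\mathbb{F}=\mathbb{F}_q$, $\mathbb{E}=\mathbb{F}_{q^3}$, $\mathrm{T}(x)=x+x^q+x^{q^2}$ and $\mathrm{N}(x)=x^{q^2+q+1}$ for $x\in\mathbb{E}$. Fix a primitive element $\alpha$ of $\mathbb{E}$, put $\omega=\alpha^{q^2+q+1}$ (a primitive element of $\mathbb{F}$) and $\mu=\alpha^{q-1}$. Let $\chi_2$ be the quadratic character of $\mathbb{E}$ ($\chi_2(0)=0$). Consider $\mathrm{PG}(5,q)$ with underlying $\mathbb{F}$-space $V=\mathbb{E}^2$ and the quadratic form $\mathrm{Q}((u,v))=\mathrm{T}(uv)$; its quadric $\mathcal{Q}$ is a hyperbolic quadric $\mathcal{Q}^+(5,q)$, and $\pi_1=\{\langle (x,0)\rangle : x \in \mathbb{E}^*\}$, $\pi_2=\{\langle(0,y)\rangle : y\in\mathbb{E}^*\}$ are disjoint generators. Let $c:(u,v)\mapsto(\mu u,\mu^{ -1}v)$, $z:(u,v)\mapsto(u,\omega^4 v)$ and $G=\langle c,z\rangle$ acting on points of $\mathcal{Q}$. Let $\mathcal{S}=\{a\in\mathbb{E}^*: \mathrm{N}(a)=1,\ \mathrm{T}(a^2)=0\}$ (a set of $q+1$ elements), fix $a_1\in\mathcal{S}$, and let $X_1=\{a\in\mathcal{S}: \chi_2(2\mathrm{T}(a_1a))\neq -1\}$, $X_2=\mathcal{S}\setminus X_1$. Let $\mathcal{T}_1$ be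 the union of the $G$-orbits of the points $\langle(1,a^2)\rangle$, $\langle(1,\omega a^2)\rangle$ for $a\in X_1$ and of the points $\langle(1,\omega^2 a^2)\rangle$, $\langle(1,\omega^3a^2)\rangle$ for $a \in X_2$; let $\mathcal{T}_2$ be the set of points of $\mathcal{Q}$ not in $\pi_1\cup\pi_2\cup\mathcal{T}_1$. Fix a Klein correspondence, i.e. a bijection $\kappa$ from the points of $\mathcal{Q}$ to the lines of $\mathrm{PG}(3,q)$ such that two points are collinear on $\mathcal{Q}$ iff their image lines meet, chosen so that $\kappa(\pi_1)=\mathrm{star}(\bm{p})$ (the set of all lines through a point $\bm{p}$); then $\kappa(\pi_2)=\mathrm{line}(\pi)$ (the set of all lines contained in a plane $\pi$), with $\bm{p}\notin\pi$. Put $\mathcal{L}_1=\kappa(\mathcal{T}_1)$, $\mathcal{L}_2=\kappa(\mathcal{T}_2)$. A tactical decomposition of $\mathrm{PG}(3,q)$ is a partition of the points into point classes and of the lines into line classes such that the number of points of a given point class on a line depends only on the class of the line, and the number of lines of a given line class through a point depends only on the class of the point; it is symmetric if there are equally many point classes and line classes. -}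

module Defs where

open import Level using (Level; _⊔_; Lift)
open import Algebra.Bundles using (CommutativeRing; Semiring)
import Data.Nat as ℕ
open ℕ using (ℕ)
import Data.Fin as F
open F using (Fin)
open import Data.List using (List; length)
open import Data.List.Relation.Unary.All using (All)
open import Data.List.Relation.Unary.Any using (Any)
open import Data.List.Relation.Unary.AllPairs using (AllPairs)
open import Data.Product using (Σ; ∃; _×_; _,_; proj₁; proj₂)
open import Data.Sum using (_⊎_)
open import Data.Unit.Polymorphic using (⊤)
open import Relation.Nullary using (¬_; Dec)
open import Relation.Binary.PropositionalEquality using (_≡_)

HasCardMod : ∀ {a ℓ p} {A : Set a} (_∼_ : A → A → Set ℓ) (P : A → Set p) → ℕ → Set (a ⊔ ℓ ⊔ p)
HasCardMod {A = A} _∼_ P n =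
  Σ (List A) λ xs → length xs ≡ n × All P xs × AllPairs (λ x y → ¬ (x ∼ y)) xs
                  × (∀ x → P x → Any (x ∼_) xs)

record TacticalDecomposition {p l ℓp ℓl i c d : Level}
  (Pt : Set p) (_≈P_ : Pt → Pt → Set ℓp)
  (Ln : Set l) (_≈L_ : Ln → Ln → Set ℓl)
  (I : Pt → Ln → Set i)
  (m n : ℕ) (PC : Fin m → Pt → Set c) (LC : Fin n → Ln → Set d)
  : Set (p ⊔ l ⊔ ℓp ⊔ ℓl ⊔ i ⊔ c ⊔ d) where
  field
    pointClassNonempty : ∀ k → ∃ λ x → PC k x
    pointCovered       : ∀ x → ∃ λ k → PC k x
    pointDisjoint      : ∀ x k k′ → PC k x → PC k′ x → k ≡ k′
    lineClassNonempty  : ∀ k → ∃ λ L → LC k L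
    lineCovered        : ∀ L → ∃ λ k → LC k L
    lineDisjoint       : ∀ L k k′ → LC k L → LC k′ L → k ≡ k′
    pointsOnLine : ∀ k j → ∃ λ (N : ℕ) →
                     ∀ L → LC j L → HasCardMod _≈P_ (λ x → PC k x × I x L) N
    linesThroughPoint : ∀ k j → ∃ λ (N : ℕ) →
                     ∀ x → PC k x → HasCardMod _≈L_ (λ L → LC j L × I x L) N

SymmetricTacticalDecomposition : ∀ {p l ℓp ℓl i c d : Level}
  (Pt : Set p) (_≈P_ : Pt → Pt → Set ℓp)
  (Ln : Set l) (_≈L_ : Ln → Ln → Set ℓl)
  (I : Pt → Ln → Set i)
  (m n : ℕ) (PC : Fin m → Pt → Set c) (LC : Fin n → Ln → Set d)
  → Set (p ⊔ l ⊔ ℓp ⊔ ℓl ⊔ i ⊔ c ⊔ d)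
SymmetricTacticalDecomposition Pt _≈P_ Ln _≈L_ I m n PC LC =
  TacticalDecomposition Pt _≈P_ Ln _≈L_ I m n PC LC × m ≡ n

fourClasses : ∀ {a k} {A : Set a} → (A → Set k) → (A → Set k) → (A → Set k) → (A → Set k)
            → Fin 4 → A → Set k
fourClasses C₀ C₁ C₂ C₃ F.zero = C₀
fourClasses C₀ C₁ C₂ C₃ (F.suc F.zero) = C₁
fourClasses C₀ C₁ C₂ C₃ (F.suc (F.suc F.zero)) = C₂
fourClasses C₀ C₁ C₂ C₃ (F.suc (F.suc (F.suc F.zero))) = C₃

record IsFiniteField {c ℓ} (R : CommutativeRing c ℓ) (order : ℕ) : Set (c ⊔ ℓ) where
  open CommutativeRing R
  field
    nontrivial : ¬ (1# ≈ 0#)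
    inverse    : ∀ x → ¬ (x ≈ 0#) → ∃ λ y → x * y ≈ 1#
    decEq      : ∀ x y → Dec (x ≈ y)
    card       : HasCardMod _≈_ (λ (_ : Carrier) → ⊤ {ℓ}) order

-- The setup of the paper, for a field E (= F_{q^3}), the number q and a
-- fixed element α of E.

module Setup {c ℓ} (R : CommutativeRing c ℓ) (q : ℕ) (α : CommutativeRing.Carrier R) where
  open CommutativeRing R public
  open import Algebra.Definitions.RawSemiring (Semiring.rawSemiring semiring) public using (_^_)

  IsPrimitive : Carrier → Set (c ⊔ ℓ)
  IsPrimitive β = ∀ x → ¬ (x ≈ 0#) → ∃ λ (k : ℕ) → β ^ k ≈ x

  -- the subfield F = F_q = { x : x^q = x }
  InF : Carrier → Set ℓ
  InF x = x ^ q ≈ x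

  InF* : Carrier → Set ℓ
  InF* x = InF x × ¬ (x ≈ 0#)

  T : Carrier → Carrier
  T x = x + x ^ q + x ^ (q ℕ.* q)

  N : Carrier → Carrier
  N x = x ^ (q ℕ.* q ℕ.+ q ℕ.+ 1)

  ω : Carrier
  ω = α ^ (q ℕ.* q ℕ.+ q ℕ.+ 1)

  μ : Carrier
  μ = α ^ (q ℕ.∸ 1)

  two : Carrier
  two = 1# + 1#

  IsSquare : Carrier → Set (c ⊔ ℓ)
  IsSquare y = ∃ λ w → w * w ≈ y

  χ₂≡-1 : Carrier → Set (c ⊔ ℓ)
  χ₂≡-1 y = ¬ (y ≈ 0#) × ¬ IsSquare y

  E² : Set c
  E² = Carrier × Carrier

  _≈²_ : E² → E² → Set ℓ
  (u , v) ≈² (u′ , v′) = (u ≈ u′) × (v ≈ v′)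

  _·_ : Carrier → E² → E²
  s · (u , v) = (s * u , s * v)

  _⊕_ : E² → E² → E²
  (u , v) ⊕ (u′ , v′) = (u + u′ , v + v′)

  Qf : E² → Carrier
  Qf (u , v) = T (u * v)

  IsQPoint : E² → Set ℓ
  IsQPoint w = ¬ (w ≈² (0# , 0#)) × Qf w ≈ 0#

  QPt : Set (c ⊔ ℓ)
  QPt = Σ E² IsQPoint

  _∼_ : QPt → QPt → Set (c ⊔ ℓ)
  (w , _) ∼ (w′ , _) = ∃ λ s → InF* s × (w′ ≈² (s · w))

  Collinear : QPt → QPt → Set (c ⊔ ℓ)
  Collinear (w , _) (w′ , _) = ∀ s t → InF s → InF t → Qf ((s · w) ⊕ (t · w′)) ≈ 0#

  InΠ₁ : QPt → Set ℓ
  InΠ₁ ((u , v) , _) = v ≈ 0#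

  InΠ₂ : QPt → Set ℓ
  InΠ₂ ((u , v) , _) = u ≈ 0#

  -- w lies in the G-orbit of the point ⟨b⟩, G = ⟨c, z⟩ (abelian), i.e.
  -- ⟨w⟩ = ⟨c^i z^j b⟩ for some i j, where c^i z^j (b₁,b₂) = (μ^i b₁, μ^{-i} ω^{4j} b₂);
  -- the factor μ^{-i} is cleared by multiplying the second coordinate by μ^i.
  InOrbit : E² → E² → Set (c ⊔ ℓ)
  InOrbit (u , v) (b₁ , b₂) =
    ∃ λ (i : ℕ) → ∃ λ (j : ℕ) → ∃ λ s → InF* s ×
      (u ≈ s * (μ ^ i * b₁)) × (μ ^ i * v ≈ s * (ω ^ (4 ℕ.* j) * b₂))

  InS : Carrier → Set ℓ
  InS a = ¬ (a ≈ 0#) × N a ≈ 1# × T (a * a) ≈ 0#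

  module Classes (a₁ : Carrier) where
    InX₁ : Carrier → Set (c ⊔ ℓ)
    InX₁ a = InS a × ¬ χ₂≡-1 (two * T (a₁ * a))

    InX₂ : Carrier → Set (c ⊔ ℓ)
    InX₂ a = InS a × ¬ InX₁ a

    InT₁ : QPt → Set (c ⊔ ℓ)
    InT₁ (w , _) = ∃ λ a →
        (InX₁ a × (InOrbit w (1# , a * a) ⊎ InOrbit w (1# , ω * (a * a))))
      ⊎ (InX₂ a × (InOrbit w (1# , (ω ^ 2) * (a * a)) ⊎ InOrbit w (1# , (ω ^ 3) * (a * a))))

    InT₂ : QPt → Set (c ⊔ ℓ)
    InT₂ x = ¬ InΠ₁ x × ¬ InΠ₂ x × ¬ InT₁ x

  Vec4 : Set c
  Vec4 = Fin 4 → Carrier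

  Pt3 : Set (c ⊔ ℓ)
  Pt3 = Σ Vec4 λ r → (∀ i → InF (r i)) × ¬ (∀ i → r i ≈ 0#)

  _≈P_ : Pt3 → Pt3 → Set (c ⊔ ℓ)
  (r , _) ≈P (r′ , _) = ∃ λ s → InF* s × (∀ i → r′ i ≈ s * r i)

  Independent : Pt3 → Pt3 → Set (c ⊔ ℓ)
  Independent (a , _) (b , _) =
    ∀ s t → InF s → InF t → (∀ i → s * a i + t * b i ≈ 0#) → (s ≈ 0#) × (t ≈ 0#)

  Ln3 : Set (c ⊔ ℓ)
  Ln3 = Σ (Pt3 × Pt3) λ { (a , b) → Independent a b }

  _on_ : Pt3 → Ln3 → Set (c ⊔ ℓ)
  (r , _) on (((a , _) , (b , _)) , _) = ∃ λ s → ∃ λ t → InF s × InF t × (∀ i → r i ≈ s * a i + t * b i)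

  _≈L_ : Ln3 → Ln3 → Set (c ⊔ ℓ)
  L ≈L L′ = ∀ r → ((r on L) → (r on L′)) × ((r on L′) → (r on L))

  -- planes of PG(3,q): given by a nonzero coefficient vector γ ∈ F⁴,
  -- π_γ = { ⟨r⟩ : γ₀r₀ + γ₁r₁ + γ₂r₂ + γ₃r₃ = 0 }
  _onPlane_ : Pt3 → Pt3 → Set (c ⊔ ℓ)
  (r , _) onPlane (γ , _) = Lift c (
    γ i₀ * r i₀ + γ i₁ * r i₁ + γ i₂ * r i₂ + γ i₃ * r i₃ ≈ 0#)
    where
    i₀ i₁ i₂ i₃ : Fin 4
    i₀ = F.zero
    i₁ = F.suc F.zero
    i₂ = F.suc (F.suc F.zero)
    i₃ = F.suc (F.suc (F.suc F.zero))

  star : Pt3 → Ln3 → Set (c ⊔ ℓ)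
  star p L = p on L

  lineOf : Pt3 → Ln3 → Set (c ⊔ ℓ)
  lineOf π L = ∀ r → r on L → r onPlane π

  record IsKleinCorrespondence (κ : QPt → Ln3) : Set (c ⊔ ℓ) where
    field
      wellDefined : ∀ x y → x ∼ y → κ x ≈L κ y
      injective   : ∀ x y → κ x ≈L κ y → x ∼ y
      surjective  : ∀ L → ∃ λ x → κ x ≈L L
      collinear⇒meet : ∀ x y → Collinear x y → ∃ λ r → (r on κ x) × (r on κ y)
      meet⇒collinear : ∀ x y → (∃ λ r → (r on κ x) × (r on κ y)) → Collinear x y

  image : ∀ {k} (κ : QPt → Ln3) (𝒯 : QPt → Set k) → Ln3 → Set (c ⊔ ℓ ⊔ k)
  image κ 𝒯 L = ∃ λ x → 𝒯 x × κ x ≈L L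

{-# OPTIONS --safe #-}
-- Put q = Q² and w × u = w^q u^(q²) - w^(q²) u^q. For a point r ≠ p off π there is a unique w ∈ E* such that
-- the lines through r are the images of the points ⟨(u, w × u)⟩ of the quadric, and every w ∈ E* occurs.
-- A nonzero v with T v = 0 is λ b² with λ ∈ F* and b ∈ S; let G v = ±1 say whether ⟨(1, v)⟩ lies in 𝒯₁ or 𝒯₂,
-- and let ε (α^k) = 1, -1, -1, 1 for k = 0, 1, 2, 3 mod 4. The key identity is
--   Σ_{t ∈ F} ε (w + t u) = ± Q G (u (w × u))   for N u = 1.
-- It counts the points with ε w = ±1 on a line of 𝓛₁ or 𝓛₂. Summing it over the u of norm 1 gives
-- Σ_u G (u (w × u)) = ± Q (q + 1) ε w, which counts the lines of 𝓛₁ and 𝓛₂ through a point; so 𝒫₁ and 𝒫₂ are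
-- the points with ε w = 1 and with ε w = -1, in some order.
--
-- For the key identity, let R4 be the real part of the quartic character, χ the quadratic one, and c = ψ + ψ⁻¹
-- for an additive character ψ of F, so that all sums are integers. As ε x = R4 x + R4 (α x) and R4 (N x) = R4 x, it
-- is about the sums Σ_t R4 (P t) for the cubic P t = N (w + t), and expanding R4 into values of c leads to
-- K2 = Σ_s R4 s · c (r (s + s⁻¹)). In characteristic 3 the form r (W⁴ + W²) is quadratic over 𝔽₃, so
-- A z = Σ_W c (r (W⁴ + W²) + z) has a second moment given by the size 2 + χ m of a radical; as each A z is a
-- combination of K2 and a quadratic Gauss sum γ, this yields K2² - K2 γ + γ² = (2 + χ m) γ², and A (± r) being
-- odd selects the root K2 = - χ m γ.
module Submission where

open import Defs
open import Level using (Level; _⊔_; lift)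
import Level
open import Algebra.Bundles using (CommutativeRing; CommutativeMonoid; RawRing)
import Algebra.Solver.Ring.AlmostCommutativeRing as ACR
import Data.Nat as ℕ
import Data.Nat.Properties as ℕₚ
import Data.Nat.DivMod as DM
import Data.Nat.Divisibility as Div
open import Data.Nat using (ℕ)
import Data.Nat.Tactic.RingSolver as ℕSolver
import Data.Integer as ℤ
import Data.Integer.Properties as ℤₚ
open ℤ using (ℤ; 0ℤ; 1ℤ; -1ℤ)
import Data.Integer.Tactic.RingSolver as ℤSolver
import Data.Fin as F
import Data.Fin.Properties as Fₚ
open F using (Fin)
open import Data.Product using (Σ; ∃; _×_; _,_; proj₁; proj₂)
open import Data.Sum using (_⊎_; inj₁; inj₂; [_,_]′)
open import Data.Maybe using (Maybe; just; nothing)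
open import Data.Empty using (⊥; ⊥-elim)
open import Data.Unit.Polymorphic using (⊤; tt)
open import Data.List using (List; []; _∷_; _++_; length; filter; map; lookup; upTo)
import Data.List.Properties as Listₚ
open import Data.List.Membership.Propositional.Properties using (∈-upTo⁺)
open import Data.List.Relation.Unary.All using (All; []; _∷_)
import Data.List.Relation.Unary.All as All
import Data.List.Relation.Unary.All.Properties as Allₚ
open import Data.List.Relation.Unary.Any using (Any; here; there)
import Data.List.Relation.Unary.Any as Any
import Data.List.Relation.Unary.Any.Properties as Anyₚ
open import Data.List.Relation.Unary.AllPairs using (AllPairs; []; _∷_)
import Data.List.Relation.Unary.AllPairs as AllPairs
import Data.List.Relation.Unary.AllPairs.Properties as AllPairsₚ
import Data.List.Relation.Unary.Unique.Propositional.Properties as Uniqueₚ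
open import Relation.Nullary using (¬_; Dec; yes; no)
open import Relation.Nullary.Decidable using (¬?; _×-dec_)
open import Relation.Binary.PropositionalEquality using (_≡_; _≢_; module ≡-Reasoning)
import Relation.Binary.PropositionalEquality as ≡
open import Function.Bundles using (_⇔_; Equivalence)

-- The bridge between character sums and the conic is the number T b. Write w^q - w^(q²) = λ b² with
-- b in S. Up to a factor and a shift by F, the cubic N (w + t) is then t³ - t + r or t³ + t² - r².
-- In the second case the `m` that governs the radical turns out to be T b, so the sign of the sum
-- involves χ (T b), which is the sign that splits S into X₁ and X₂ for a₁ = 1. A Gram determinant
-- shows that another a₁ changes this splitting by a constant sign only. R4 is not multiplicative,
-- except against squares. It is preferred to the quartic character because all sums stay in ℤ,
-- where parity can be used; symmetries such as s ↦ s⁻¹ and cubing make up for the loss. No sign of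
-- a Gauss sum is ever determined: the quadratic one enters squared, and the quartic one, ± 2 Q,
-- decides only which value of ε belongs to 𝒫₁. The Klein correspondence is given by incidence
-- alone. That the lines through a point form a linear subspace of the quadric, and then the
-- parameter w, have to be derived from the fact that a point of the quadric collinear with all of
-- them is one of them.

-- Enumerations of finite sets up to an equivalence.

record Enum {a ℓ p} {A : Set a} (_∼_ : A → A → Set ℓ) (P : A → Set p) : Set (a ⊔ ℓ ⊔ p) where
  field
    elems    : List A
    sound    : All P elems
    uniq     : AllPairs (λ x y → ¬ (x ∼ y)) elems
    complete : ∀ x → P x → Any (x ∼_) elems

  size : ℕ
  size = length elems

open Enum public

any-with-all : ∀ {a p q r} {A : Set a} {P : A → Set p} {Q : A → Set q} {R : A → Set r} {xs} →
  All P xs → (∀ x → P x → R x → Q x) → Any R xs → Any Q xs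
any-with-all (p ∷ _)  f (here r)  = here (f _ p r)
any-with-all (_ ∷ ps) f (there i) = there (any-with-all ps f i)

any-witness : ∀ {a p q} {A : Set a} {P : A → Set p} {Q : A → Set q} {xs} →
  All P xs → Any Q xs → ∃ λ x → P x × Q x
any-witness (p ∷ _)  (here q)  = _ , p , q
any-witness (_ ∷ ps) (there i) = any-witness ps i

module _ {a ℓ p} {A : Set a} {_∼_ : A → A → Set ℓ} {P : A → Set p} where

  enum→card : (e : Enum _∼_ P) → HasCardMod _∼_ P (size e)
  enum→card e = elems e , ≡.refl , sound e , uniq e , complete e

  card→enum : ∀ {n} → HasCardMod _∼_ P n → Σ (Enum _∼_ P) λ e → size e ≡ n
  card→enum (xs , l , s , u , c) =
    record { elems = xs ; sound = s ; uniq = u ; complete = c } , l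

  -- Only the listed representatives get tested, so `Q` has to respect the equivalence.
  search : ∀ {q} {Q : A → Set q} → Enum _∼_ P → (∀ x → Dec (Q x)) →
    (∀ {x y} → x ∼ y → Q x → Q y) → Dec (∃ λ x → P x × Q x)
  search e Q? resp with Any.any? Q? (elems e)
  ... | yes i = yes (any-witness (sound e) i)
  ... | no ¬i = no λ (x , px , qx) → ¬i (Any.map (λ x∼y → resp x∼y qx) (complete e x px))

  filterEnum : ∀ {q} {Q : A → Set q} → (∀ x → Dec (Q x)) →
    (∀ {x y} → x ∼ y → Q x → Q y) → Enum _∼_ P → Enum _∼_ (λ x → P x × Q x)
  filterEnum {Q = Q} Q? resp e = record
    { elems = filter Q? (elems e)
    ; sound = All.zip (Allₚ.filter⁺ Q? (sound e) , Allₚ.all-filter Q? (elems e))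
    ; uniq = AllPairsₚ.filter⁺ Q? (uniq e)
    ; complete = λ x (px , qx) → go (elems e) qx (complete e x px)
    }
    where
    go : ∀ {x} xs → Q x → Any (x ∼_) xs → Any (x ∼_) (filter Q? xs)
    go (y ∷ ys) qx (here x∼y) with Q? y
    ... | yes _ = here x∼y
    ... | no ¬q = ⊥-elim (¬q (resp x∼y qx))
    go (y ∷ ys) qx (there i) with Q? y
    ... | yes _ = there (go ys qx i)
    ... | no _  = go ys qx i

  -- `onto` asks for `z ≋ φ y py` at every `y ∼ x`, because `complete` only provides some listed
  -- representative of `x`. This takes the place of congruence of `φ`, whose value may depend on the
  -- proof of `P`.
  mapEnum : ∀ {b ℓ′ p′} {B : Set b} {_≋_ : B → B → Set ℓ′} {P′ : B → Set p′} →
    (e : Enum _∼_ P) (φ : ∀ x → P x → B) → (∀ x px → P′ (φ x px)) →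
    (∀ x y px py → φ x px ≋ φ y py → x ∼ y) →
    (∀ z → P′ z → ∃ λ x → P x × (∀ y py → x ∼ y → z ≋ φ y py)) →
    Σ (Enum _≋_ P′) λ e′ → size e′ ≡ size e
  mapEnum {B = B} {_≋_} {P′} e φ into inj onto = record
    { elems = go (sound e)
    ; sound = go-all (sound e)
    ; uniq = go-uniq (sound e) (uniq e)
    ; complete = λ z pz → let (x , px , h) = onto z pz in go-any h (sound e) (complete e x px)
    } , go-length (sound e)
    where
    go : ∀ {xs} → All P xs → List B
    go [] = []
    go (px ∷ ps) = φ _ px ∷ go ps
    go-length : ∀ {xs} (ps : All P xs) → length (go ps) ≡ length xs
    go-length [] = ≡.refl
    go-length (_ ∷ ps) = ≡.cong ℕ.suc (go-length ps)
    go-all : ∀ {xs} (ps : All P xs) → All P′ (go ps)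
    go-all [] = []
    go-all (px ∷ ps) = into _ px ∷ go-all ps
    go-fresh : ∀ {x xs} px → All (λ y → ¬ (x ∼ y)) xs → (ps : All P xs) →
      All (λ z → ¬ (φ x px ≋ z)) (go ps)
    go-fresh px [] [] = []
    go-fresh px (n ∷ ns) (py ∷ ps) = (λ eq → n (inj _ _ px py eq)) ∷ go-fresh px ns ps
    go-uniq : ∀ {xs} (ps : All P xs) → AllPairs (λ x y → ¬ (x ∼ y)) xs →
      AllPairs (λ x y → ¬ (x ≋ y)) (go ps)
    go-uniq [] [] = []
    go-uniq (px ∷ ps) (n ∷ ns) = go-fresh px n ps ∷ go-uniq ps ns
    go-any : ∀ {x z} → (∀ y py → x ∼ y → z ≋ φ y py) →
      ∀ {xs} (ps : All P xs) → Any (x ∼_) xs → Any (z ≋_) (go ps)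
    go-any h (px ∷ ps) (here e) = here (h _ px e)
    go-any h (px ∷ ps) (there i) = there (go-any h ps i)

lookup-all : ∀ {a p} {A : Set a} {P : A → Set p} {xs} → All P xs → ∀ i → P (lookup xs i)
lookup-all (p ∷ ps) F.zero = p
lookup-all (p ∷ ps) (F.suc i) = lookup-all ps i

lookup-pairs : ∀ {a r} {A : Set a} {R : A → A → Set r} {xs} → AllPairs R xs →
  ∀ i j → i F.< j → R (lookup xs i) (lookup xs j)
lookup-pairs (n ∷ ns) F.zero (F.suc j) _ = lookup-all n j
lookup-pairs (n ∷ ns) (F.suc i) (F.suc j) (ℕ.s≤s i<j) = lookup-pairs ns i j i<j

module _ {a ℓ} {A : Set a} {_∼_ : A → A → Set ℓ}
  (∼-sym : ∀ {x y} → x ∼ y → y ∼ x) (∼-trans : ∀ {x y z} → x ∼ y → y ∼ z → x ∼ z) where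

  -- Pigeonhole: otherwise two entries of `xs` would be matched with the same entry of `ys` and so
  -- be equivalent.
  length-≤ : ∀ {xs ys : List A} → AllPairs (λ x y → ¬ (x ∼ y)) xs →
    All (λ x → Any (x ∼_) ys) xs → length xs ℕ.≤ length ys
  length-≤ {xs} {ys} u s with length xs ℕ.≤? length ys
  ... | yes le = le
  ... | no nle with Fₚ.pigeonhole (ℕₚ.≰⇒> nle) (λ i → Any.index (lookup-all s i))
  ...   | (i , j , i<j , eq) = ⊥-elim (lookup-pairs u i j i<j
            (∼-trans (at i) (∼-sym (≡.subst (λ k → lookup xs j ∼ lookup ys k) (≡.sym eq) (at j)))))
    where
    at′ : ∀ {x} {zs : List A} (i : Any (x ∼_) zs) → x ∼ lookup zs (Any.index i)
    at′ (here e) = e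
    at′ (there i) = at′ i
    at : ∀ i → lookup xs i ∼ lookup ys (Any.index (lookup-all s i))
    at i = at′ (lookup-all s i)

  card-unique : ∀ {p} {P : A → Set p} {m n} → HasCardMod _∼_ P m → HasCardMod _∼_ P n → m ≡ n
  card-unique (xs , ≡.refl , s , u , c) (ys , ≡.refl , s′ , u′ , c′) = ℕₚ.≤-antisym
    (length-≤ u (All.map (λ {x} → c′ x) s)) (length-≤ u′ (All.map (λ {x} → c x) s′))

module _ {a ℓ′ p p′} {A : Set a} {_∼_ : A → A → Set ℓ′} {P : A → Set p} {P′ : A → Set p′} where

  card-resp : ∀ {j} → (∀ x → P x → P′ x) → (∀ x → P′ x → P x) → HasCardMod _∼_ P j → HasCardMod _∼_ P′ j
  card-resp f g (xs , l , s , u , cm) = xs , l , All.map (λ {x} → f x) s , u , λ x px → cm x (g x px)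

card-empty : ∀ {a ℓ′ p} {A : Set a} {_∼_ : A → A → Set ℓ′} {P : A → Set p} → (∀ x → ¬ P x) → HasCardMod _∼_ P 0
card-empty none = [] , ≡.refl , [] , [] , λ x px → ⊥-elim (none x px)

card-one : ∀ {a ℓ′ p} {A : Set a} {_∼_ : A → A → Set ℓ′} {P : A → Set p} x → P x → (∀ y → P y → y ∼ x) → HasCardMod _∼_ P 1
card-one x px h = (x ∷ []) , ≡.refl , (px ∷ []) , ([] ∷ []) , λ y py → here (h y py)

card-of : ∀ {a ℓ′ p} {A : Set a} {_∼_ : A → A → Set ℓ′} {P : A → Set p} {j} → (Σ (Enum _∼_ P) λ en → size en ≡ j) → HasCardMod _∼_ P j
card-of (en , ≡.refl) = enum→card en

module _ {a b} {A : Set a} {B : Set b} where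

  pairs : List A → List B → List (A × B)
  pairs [] ys = []
  pairs (x ∷ xs) ys = map (x ,_) ys ++ pairs xs ys

  length-pairs : ∀ xs ys → length (pairs xs ys) ≡ length xs ℕ.* length ys
  length-pairs [] ys = ≡.refl
  length-pairs (x ∷ xs) ys = ≡.trans (Listₚ.length-++ (map (x ,_) ys)) (≡.cong₂ ℕ._+_ (Listₚ.length-map (x ,_) ys) (length-pairs xs ys))

module _ {a b ℓ₁ ℓ₂ p₁ p₂} {A : Set a} {B : Set b} {_∼₁_ : A → A → Set ℓ₁} {_∼₂_ : B → B → Set ℓ₂}
  {P₁ : A → Set p₁} {P₂ : B → Set p₂} where

  _∼×_ : A × B → A × B → Set (ℓ₁ ⊔ ℓ₂)
  (x , y) ∼× (x′ , y′) = x ∼₁ x′ × y ∼₂ y′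

  product : (e₁ : Enum _∼₁_ P₁) (e₂ : Enum _∼₂_ P₂) → Enum _∼×_ (λ (x , y) → P₁ x × P₂ y)
  product e₁ e₂ = record
    { elems = pairs (elems e₁) (elems e₂)
    ; sound = all (sound e₁)
    ; uniq = unique (uniq e₁)
    ; complete = λ (x , y) (px , py) → any (complete e₁ x px) (complete e₂ y py)
    }
    where
    all : ∀ {xs} → All P₁ xs → All (λ (x , y) → P₁ x × P₂ y) (pairs xs (elems e₂))
    all [] = []
    all (px ∷ ps) = Allₚ.++⁺ (Allₚ.map⁺ (All.map (λ py → px , py) (sound e₂))) (all ps)
    fresh : ∀ {x xs} ys → All (λ x′ → ¬ (x ∼₁ x′)) xs → ∀ y → All (λ z → ¬ ((x , y) ∼× z)) (pairs xs ys)
    fresh ys [] y = []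
    fresh ys (n ∷ ns) y = Allₚ.++⁺ (Allₚ.map⁺ (All.universal (λ _ p → n (proj₁ p)) ys)) (fresh ys ns y)
    unique : ∀ {xs} → AllPairs (λ x x′ → ¬ (x ∼₁ x′)) xs → AllPairs (λ z z′ → ¬ (z ∼× z′)) (pairs xs (elems e₂))
    unique [] = []
    unique (n ∷ ns) = AllPairsₚ.++⁺ (AllPairsₚ.map⁺ (AllPairs.map (λ m p → m (proj₂ p)) (uniq e₂))) (unique ns)
      (Allₚ.map⁺ (All.universal (fresh (elems e₂) n) (elems e₂)))
    any : ∀ {x y xs} → Any (x ∼₁_) xs → Any (y ∼₂_) (elems e₂) → Any ((x , y) ∼×_) (pairs xs (elems e₂))
    any (here p) j = Anyₚ.++⁺ˡ (Anyₚ.map⁺ (Any.map (λ p′ → p , p′) j))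
    any {xs = x ∷ xs} (there i) j = Anyₚ.++⁺ʳ (map (x ,_) (elems e₂)) (any i j)

-- Finite sums in a commutative monoid, used for ℤ and for both operations of the field.

module Sums {c ℓ} (M : CommutativeMonoid c ℓ) where
  open CommutativeMonoid M
  open import Relation.Binary.Reasoning.Setoid setoid
  open import Algebra.Properties.CommutativeSemigroup commutativeSemigroup using (interchange)

  sum : ∀ {a} {A : Set a} → List A → (A → Carrier) → Carrier
  sum [] f = ε
  sum (x ∷ xs) f = f x ∙ sum xs f

  -- An Iverson bracket; it serves to write delta functions under a sum.
  when : ∀ {p} {P : Set p} → Dec P → Carrier → Carrier
  when (yes _) x = x
  when (no _)  x = ε

  when-cong : ∀ {p q} {P : Set p} {Q : Set q} (d : Dec P) (d′ : Dec Q) {x y} →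
    (P → Q) → (Q → P) → (P → x ≈ y) → when d x ≈ when d′ y
  when-cong (yes p) (yes q) f g h = h p
  when-cong (yes p) (no ¬q) f g h = ⊥-elim (¬q (f p))
  when-cong (no ¬p) (yes q) f g h = ⊥-elim (¬p (g q))
  when-cong (no ¬p) (no ¬q) f g h = refl

  module _ {a} {A : Set a} where

    sum-cong : ∀ {p} {P : A → Set p} {xs f g} → All P xs → (∀ x → P x → f x ≈ g x) →
      sum xs f ≈ sum xs g
    sum-cong [] h = refl
    sum-cong (p ∷ ps) h = ∙-cong (h _ p) (sum-cong ps h)

    sum-cong′ : ∀ xs {f g : A → Carrier} → (∀ x → f x ≈ g x) → sum xs f ≈ sum xs g
    sum-cong′ [] h = refl
    sum-cong′ (x ∷ xs) h = ∙-cong (h x) (sum-cong′ xs h)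

    sum-ε : ∀ (xs : List A) → sum xs (λ _ → ε) ≈ ε
    sum-ε [] = refl
    sum-ε (x ∷ xs) = trans (identityˡ _) (sum-ε xs)

    sum-∙ : ∀ (xs : List A) f g → sum xs (λ x → f x ∙ g x) ≈ sum xs f ∙ sum xs g
    sum-∙ [] f g = sym (identityˡ _)
    sum-∙ (x ∷ xs) f g = trans (∙-congˡ (sum-∙ xs f g)) (interchange _ _ _ _)

    sum-swap : ∀ {b} {B : Set b} (xs : List A) (ys : List B) (f : A → B → Carrier) →
      sum xs (λ x → sum ys (f x)) ≈ sum ys (λ y → sum xs (λ x → f x y))
    sum-swap [] ys f = sym (sum-ε′ ys)
      where
      sum-ε′ : ∀ {b} {B : Set b} (xs : List B) → sum xs (λ _ → ε) ≈ ε
      sum-ε′ [] = refl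
      sum-ε′ (x ∷ xs) = trans (identityˡ _) (sum-ε′ xs)
    sum-swap (x ∷ xs) ys f = trans (∙-congˡ (sum-swap xs ys f)) (sym (go ys))
      where
      go : ∀ ys → sum ys (λ y → f x y ∙ sum xs (λ x → f x y)) ≈
           sum ys (f x) ∙ sum ys (λ y → sum xs (λ x → f x y))
      go [] = sym (identityˡ _)
      go (y ∷ ys) = trans (∙-congˡ (go ys)) (interchange _ _ _ _)

    sum-none : ∀ {p q} {P : A → Set p} {Q : A → Set q} (Q? : ∀ x → Dec (Q x)) (f : A → Carrier) {xs} →
      All P xs → (∀ x → P x → ¬ Q x) → sum xs (λ x → when (Q? x) (f x)) ≈ ε
    sum-none Q? f [] h = refl
    sum-none Q? f (_∷_ {x} p ps) h with Q? x
    ... | yes q = ⊥-elim (h _ p q)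
    ... | no _  = trans (identityˡ _) (sum-none Q? f ps h)

    -- `Q` meets a single equivalence class and the list has one entry per class, so exactly one
    -- summand survives.
    sum-delta : ∀ {ℓ′ p q} {_∼_ : A → A → Set ℓ′} {P : A → Set p} {Q : A → Set q}
      (Q? : ∀ x → Dec (Q x)) (f : A → Carrier) (k : Carrier) (e : Enum _∼_ P) →
      (∀ x y → P x → P y → Q x → Q y → x ∼ y) →
      Any Q (elems e) → (∀ x → P x → Q x → f x ≈ k) →
      sum (elems e) (λ x → when (Q? x) (f x)) ≈ k
    sum-delta {_∼_ = _∼_} {P} {Q} Q? f k e one any val = go (sound e) (uniq e) any
      where
      rest : ∀ {x xs} → P x → Q x → All P xs → All (λ y → ¬ (x ∼ y)) xs → All (λ y → P y × ¬ (x ∼ y)) xs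
      rest px qx ps ns = All.zip (ps , ns)
      go : ∀ {xs} → All P xs → AllPairs (λ x y → ¬ (x ∼ y)) xs → Any Q xs →
        sum xs (λ x → when (Q? x) (f x)) ≈ k
      go (_∷_ {x} p ps) (n ∷ ns) i with Q? x
      go (_∷_ {x} p ps) (n ∷ ns) i | yes q =
        trans (∙-congˡ (sum-none Q? f (rest p q ps n) (λ y (py , x≁y) qy → x≁y (one _ _ p py q qy))))
          (trans (identityʳ _) (val _ p q))
      go (_∷_ {x} p ps) (n ∷ ns) (here q) | no ¬q = ⊥-elim (¬q q)
      go (_∷_ {x} p ps) (n ∷ ns) (there i) | no ¬q = trans (identityˡ _) (go ps ns i)

  -- A double sum over the delta function of `φ x ≋ y` is evaluated in both orders, so that no
  -- permutation between the two lists has to be built.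
  sum-bij : ∀ {a b ℓ₁ ℓ₂ p₁ p₂} {A : Set a} {B : Set b} {_∼_ : A → A → Set ℓ₁} {_≋_ : B → B → Set ℓ₂}
    {P : A → Set p₁} {P′ : B → Set p₂} (eA : Enum _∼_ P) (eB : Enum _≋_ P′) →
    (∀ x y → Dec (x ≋ y)) → (∀ {x y} → x ∼ y → y ∼ x) → (∀ {x y z} → x ∼ y → y ∼ z → x ∼ z) →
    (∀ {x y} → x ≋ y → y ≋ x) → (∀ {x y z} → x ≋ y → y ≋ z → x ≋ z) →
    (φ : A → B) (ψ : B → A) → (∀ x → P x → P′ (φ x)) → (∀ y → P′ y → P (ψ y)) →
    (∀ x y → P x → P′ y → φ x ≋ y → ψ y ∼ x) →
    (∀ x y → P x → P′ y → ψ y ∼ x → φ x ≋ y) →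
    ∀ (f : B → Carrier) → (∀ x y → P′ x → P′ y → x ≋ y → f x ≈ f y) →
    sum (elems eA) (λ x → f (φ x)) ≈ sum (elems eB) f
  sum-bij {P = P} {P′} eA eB _≟_ symA transA symB transB φ ψ φ-in ψ-in φψ ψφ f f-cong = begin
    sum (elems eA) (λ x → f (φ x))
      ≈⟨ sum-cong (sound eA) (λ x px → sym (sum-delta (φ x ≟_) f (f (φ x)) eB
           (λ y z _ _ q r → transB (symB q) r) (complete eB (φ x) (φ-in x px))
           (λ y py q → f-cong y (φ x) py (φ-in x px) (symB q)))) ⟩
    sum (elems eA) (λ x → sum (elems eB) (λ y → when (φ x ≟ y) (f y)))
      ≈⟨ sum-swap (elems eA) (elems eB) _ ⟩
    sum (elems eB) (λ y → sum (elems eA) (λ x → when (φ x ≟ y) (f y)))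
      ≈⟨ sum-cong (sound eB) (λ y py → sum-delta (λ x → φ x ≟ y) (λ _ → f y) (f y) eA
           (λ x x′ px px′ q r → transA (symA (φψ x y px py q)) (φψ x′ y px′ py r))
           (any-with-all (sound eA) (λ x px → ψφ x y px py) (complete eA (ψ y) (ψ-in y py)))
           (λ _ _ _ → refl)) ⟩
    sum (elems eB) f ∎

-- Finite sums of integers.

module ΣM = Sums ℤₚ.+-0-commutativeMonoid
open ΣM using (sum; when; when-cong; sum-cong; sum-cong′; sum-swap; sum-none; sum-delta; sum-bij)

x≡-x : ∀ {x} → x ≡ ℤ.- x → x ≡ 0ℤ
x≡-x {x} p = ℤₚ.*-cancelˡ-≡ (ℤ.+ 2) x 0ℤ (≡.trans (2* x) (≡.trans (≡.cong (λ t → x ℤ.+ t) p) (ℤₚ.+-inverseʳ x)))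
  where
  2* : ∀ x → ℤ.+ 2 ℤ.* x ≡ x ℤ.+ x
  2* = ℤSolver.solve-∀

module _ {a} {A : Set a} where

  sum-+ : ∀ (xs : List A) f g → sum xs (λ x → f x ℤ.+ g x) ≡ sum xs f ℤ.+ sum xs g
  sum-+ = ΣM.sum-∙

  sum-*ˡ : ∀ (xs : List A) j f → sum xs (λ x → j ℤ.* f x) ≡ j ℤ.* sum xs f
  sum-*ˡ [] j f = ≡.sym (ℤₚ.*-zeroʳ j)
  sum-*ˡ (x ∷ xs) j f = ≡.trans (≡.cong (λ t → j ℤ.* f x ℤ.+ t) (sum-*ˡ xs j f)) (≡.sym (ℤₚ.*-distribˡ-+ j (f x) _))

  sum-*ʳ : ∀ (xs : List A) j f → sum xs (λ x → f x ℤ.* j) ≡ sum xs f ℤ.* j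
  sum-*ʳ xs j f = ≡.trans (sum-cong′ xs (λ x → ℤₚ.*-comm (f x) j)) (≡.trans (sum-*ˡ xs j f) (ℤₚ.*-comm j _))

  sum-const : ∀ (xs : List A) j → sum xs (λ _ → j) ≡ (ℤ.+ length xs) ℤ.* j
  sum-const [] j = ≡.refl
  sum-const (x ∷ xs) j = ≡.trans (≡.cong (λ t → j ℤ.+ t) (sum-const xs j)) (step j (ℤ.+ length xs))
    where
    step : ∀ j l → j ℤ.+ l ℤ.* j ≡ (1ℤ ℤ.+ l) ℤ.* j
    step = ℤSolver.solve-∀

when-* : ∀ {p} {P : Set p} (d : Dec P) j x → j ℤ.* when d x ≡ when d (j ℤ.* x)
when-* (yes _) j x = ≡.refl
when-* (no _) j x = ℤₚ.*-zeroʳ j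

when-yes : ∀ {p} {P : Set p} (d : Dec P) x → P → when d x ≡ x
when-yes (yes _) x p = ≡.refl
when-yes (no ¬p) x p = ⊥-elim (¬p p)

when-no : ∀ {p} {P : Set p} (d : Dec P) x → ¬ P → when d x ≡ 0ℤ
when-no (yes p) x ¬p = ⊥-elim (¬p p)
when-no (no _) x _ = ≡.refl

size-filter : ∀ {a ℓ′ p r} {A : Set a} {_∼_ : A → A → Set ℓ′} {P : A → Set p} {Q : A → Set r} (Q? : ∀ x → Dec (Q x))
  (resp : ∀ {x y} → x ∼ y → Q x → Q y) (en : Enum _∼_ P) →
  ℤ.+ size (filterEnum Q? resp en) ≡ sum (elems en) (λ x → when (Q? x) 1ℤ)
size-filter Q? resp en = go (elems en)
  where
  go : ∀ xs → ℤ.+ length (filter Q? xs) ≡ sum xs (λ x → when (Q? x) 1ℤ)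
  go [] = ≡.refl
  go (x ∷ xs) with Q? x
  ... | yes _ = ≡.cong (λ t → 1ℤ ℤ.+ t) (go xs)
  ... | no _ = ≡.trans (go xs) (≡.sym (ℤₚ.+-identityˡ _))

-- Counting by sums of signs.

Sign : ℤ → Set
Sign x = x ≡ 0ℤ ⊎ (x ≡ 1ℤ ⊎ x ≡ -1ℤ)

-- For x among 0, 1 and -1, twice the indicator of x = ±1 is x² ± x. So a sum and a sum of squares
-- determine both counts.
count-signs : ∀ {a p} {A : Set a} {P : A → Set p} {xs : List A} (g : A → ℤ) → All P xs → (∀ x → P x → Sign (g x)) →
  ℤ.+ 2 ℤ.* sum xs (λ x → when (g x ℤₚ.≟ 1ℤ) 1ℤ) ≡ sum xs (λ x → g x ℤ.* g x) ℤ.+ sum xs g ×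
  ℤ.+ 2 ℤ.* sum xs (λ x → when (g x ℤₚ.≟ -1ℤ) 1ℤ) ≡ sum xs (λ x → g x ℤ.* g x) ℤ.- sum xs g
count-signs {xs = xs} g ps sg =
  ≡.trans (≡.sym (sum-*ˡ xs (ℤ.+ 2) (λ x → when (g x ℤₚ.≟ 1ℤ) 1ℤ))) (≡.trans (sum-cong ps (λ x px → plus (g x) (sg x px))) (sum-+ xs (λ x → g x ℤ.* g x) g)) ,
  ≡.trans (≡.sym (sum-*ˡ xs (ℤ.+ 2) (λ x → when (g x ℤₚ.≟ -1ℤ) 1ℤ))) (≡.trans (sum-cong ps (λ x px → minus (g x) (sg x px)))
    (≡.trans (sum-+ xs (λ x → g x ℤ.* g x) (λ x → -1ℤ ℤ.* g x)) (≡.cong (λ t → sum xs (λ x → g x ℤ.* g x) ℤ.+ t) (≡.trans (sum-*ˡ xs -1ℤ g) (ℤₚ.-1*i≡-i (sum xs g))))))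
  where
  plus : ∀ x → Sign x → ℤ.+ 2 ℤ.* when (x ℤₚ.≟ 1ℤ) 1ℤ ≡ x ℤ.* x ℤ.+ x
  plus _ (inj₁ ≡.refl) = ≡.refl
  plus _ (inj₂ (inj₁ ≡.refl)) = ≡.refl
  plus _ (inj₂ (inj₂ ≡.refl)) = ≡.refl
  minus : ∀ x → Sign x → ℤ.+ 2 ℤ.* when (x ℤₚ.≟ -1ℤ) 1ℤ ≡ x ℤ.* x ℤ.+ -1ℤ ℤ.* x
  minus _ (inj₁ ≡.refl) = ≡.refl
  minus _ (inj₂ (inj₁ ≡.refl)) = ≡.refl
  minus _ (inj₂ (inj₂ ≡.refl)) = ≡.refl

-- Passes from identities over ℤ, which are kept free of division, to the truncated division by 2 of
-- the statement; the hypothesis makes `X` even.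
half-≡ : ∀ {j X} → ℤ.+ 2 ℤ.* ℤ.+ j ≡ ℤ.+ X → j ≡ X DM./ 2
half-≡ {j} {X} p = ≡.trans (≡.sym (DM.m*n/n≡m j 2)) (≡.cong (DM._/ 2) (≡.trans (ℕₚ.*-comm j 2) (ℤₚ.+-injective (≡.trans (ℤₚ.pos-* 2 j) p))))

1≢-1 : 1ℤ ≢ -1ℤ
1≢-1 ()

±1≢0 : ∀ {s} → s ≡ 1ℤ ⊎ s ≡ -1ℤ → s ≢ 0ℤ
±1≢0 (inj₁ ≡.refl) ()
±1≢0 (inj₂ ≡.refl) ()

±1-* : ∀ {a b} → a ≡ 1ℤ ⊎ a ≡ -1ℤ → b ≡ 1ℤ ⊎ b ≡ -1ℤ → a ℤ.* b ≡ 1ℤ ⊎ a ℤ.* b ≡ -1ℤ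
±1-* (inj₁ ≡.refl) (inj₁ ≡.refl) = inj₁ ≡.refl
±1-* (inj₁ ≡.refl) (inj₂ ≡.refl) = inj₂ ≡.refl
±1-* (inj₂ ≡.refl) (inj₁ ≡.refl) = inj₂ ≡.refl
±1-* (inj₂ ≡.refl) (inj₂ ≡.refl) = inj₁ ≡.refl

neg± : ∀ {s} → s ≡ 1ℤ ⊎ s ≡ -1ℤ → ℤ.- s ≡ 1ℤ ⊎ ℤ.- s ≡ -1ℤ
neg± (inj₁ ≡.refl) = inj₂ ≡.refl
neg± (inj₂ ≡.refl) = inj₁ ≡.refl

dichotomy : ∀ {x s} → x ≡ 1ℤ ⊎ x ≡ -1ℤ → s ≡ 1ℤ ⊎ s ≡ -1ℤ → x ≡ s ⊎ x ≡ ℤ.- s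
dichotomy (inj₁ ≡.refl) (inj₁ ≡.refl) = inj₁ ≡.refl
dichotomy (inj₁ ≡.refl) (inj₂ ≡.refl) = inj₂ ≡.refl
dichotomy (inj₂ ≡.refl) (inj₁ ≡.refl) = inj₂ ≡.refl
dichotomy (inj₂ ≡.refl) (inj₂ ≡.refl) = inj₁ ≡.refl

sq-1 : ∀ {x} → x ≡ 1ℤ ⊎ x ≡ -1ℤ → x ℤ.* x ≡ 1ℤ
sq-1 (inj₁ ≡.refl) = ≡.refl
sq-1 (inj₂ ≡.refl) = ≡.refl

div4 : ∀ l → ∃ λ j → l ≡ 4 ℕ.* j ⊎ l ≡ 4 ℕ.* j ℕ.+ 1 ⊎ l ≡ 4 ℕ.* j ℕ.+ 2 ⊎ l ≡ 4 ℕ.* j ℕ.+ 3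
div4 0 = 0 , inj₁ ≡.refl
div4 1 = 0 , inj₂ (inj₁ ≡.refl)
div4 2 = 0 , inj₂ (inj₂ (inj₁ ≡.refl))
div4 3 = 0 , inj₂ (inj₂ (inj₂ ≡.refl))
div4 (ℕ.suc (ℕ.suc (ℕ.suc (ℕ.suc l)))) with div4 l
... | j , inj₁ ≡.refl = ℕ.suc j , inj₁ (s0 j)
  where
  s0 : ∀ j → ℕ.suc (ℕ.suc (ℕ.suc (ℕ.suc (4 ℕ.* j)))) ≡ 4 ℕ.* ℕ.suc j
  s0 = ℕSolver.solve-∀
... | j , inj₂ (inj₁ ≡.refl) = ℕ.suc j , inj₂ (inj₁ (s0 j))
  where
  s0 : ∀ j → ℕ.suc (ℕ.suc (ℕ.suc (ℕ.suc (4 ℕ.* j ℕ.+ 1)))) ≡ 4 ℕ.* ℕ.suc j ℕ.+ 1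
  s0 = ℕSolver.solve-∀
... | j , inj₂ (inj₂ (inj₁ ≡.refl)) = ℕ.suc j , inj₂ (inj₂ (inj₁ (s0 j)))
  where
  s0 : ∀ j → ℕ.suc (ℕ.suc (ℕ.suc (ℕ.suc (4 ℕ.* j ℕ.+ 2)))) ≡ 4 ℕ.* ℕ.suc j ℕ.+ 2
  s0 = ℕSolver.solve-∀
... | j , inj₂ (inj₂ (inj₂ ≡.refl)) = ℕ.suc j , inj₂ (inj₂ (inj₂ (s0 j)))
  where
  s0 : ∀ j → ℕ.suc (ℕ.suc (ℕ.suc (ℕ.suc (4 ℕ.* j ℕ.+ 3)))) ≡ 4 ℕ.* ℕ.suc j ℕ.+ 3
  s0 = ℕSolver.solve-∀

-- The field with three elements and a ring solver for characteristic 3.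

data 𝔽₃ : Set where
  𝟘 𝟙 𝟚 : 𝔽₃

_+₃_ : 𝔽₃ → 𝔽₃ → 𝔽₃
𝟘 +₃ y = y
𝟙 +₃ 𝟘 = 𝟙
𝟙 +₃ 𝟙 = 𝟚
𝟙 +₃ 𝟚 = 𝟘
𝟚 +₃ 𝟘 = 𝟚
𝟚 +₃ 𝟙 = 𝟘
𝟚 +₃ 𝟚 = 𝟙

-₃_ : 𝔽₃ → 𝔽₃
-₃ 𝟘 = 𝟘
-₃ 𝟙 = 𝟚
-₃ 𝟚 = 𝟙

_*₃_ : 𝔽₃ → 𝔽₃ → 𝔽₃
𝟘 *₃ y = 𝟘
𝟙 *₃ y = y
𝟚 *₃ y = -₃ y

Characteristic3 : ∀ {c ℓ} → CommutativeRing c ℓ → Set ℓ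
Characteristic3 R = 1# + 1# + 1# ≈ 0#
  where open CommutativeRing R

-- Coefficients in 𝔽₃ let the ring solver decide identities that only hold in characteristic 3.
module Char3Solver {c ℓ} (R : CommutativeRing c ℓ)
  (three : Characteristic3 R) where
  open CommutativeRing R
  open import Algebra.Properties.Ring ring
  open import Relation.Binary.Reasoning.Setoid setoid

  coeff : RawRing _ _
  coeff = record { Carrier = 𝔽₃ ; _≈_ = _≡_ ; _+_ = _+₃_ ; _*_ = _*₃_ ; -_ = -₃_ ; 0# = 𝟘 ; 1# = 𝟙 }

  ⟦_⟧₃ : 𝔽₃ → Carrier
  ⟦ 𝟘 ⟧₃ = 0#
  ⟦ 𝟙 ⟧₃ = 1#
  ⟦ 𝟚 ⟧₃ = - 1#

  2≈-1 : 1# + 1# ≈ - 1#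
  2≈-1 = +-inverseˡ-unique _ _ three

  +-hom : ∀ x y → ⟦ x +₃ y ⟧₃ ≈ ⟦ x ⟧₃ + ⟦ y ⟧₃
  +-hom 𝟘 y = sym (+-identityˡ _)
  +-hom 𝟙 𝟘 = sym (+-identityʳ _)
  +-hom 𝟙 𝟙 = sym 2≈-1
  +-hom 𝟙 𝟚 = sym (-‿inverseʳ _)
  +-hom 𝟚 𝟘 = sym (+-identityʳ _)
  +-hom 𝟚 𝟙 = sym (-‿inverseˡ _)
  +-hom 𝟚 𝟚 = sym (trans (-‿+-comm _ _) (trans (-‿cong 2≈-1) (-‿involutive _)))

  -‿hom : ∀ x → ⟦ -₃ x ⟧₃ ≈ - ⟦ x ⟧₃
  -‿hom 𝟘 = sym -0#≈0#
  -‿hom 𝟙 = refl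
  -‿hom 𝟚 = sym (-‿involutive _)

  *-hom : ∀ x y → ⟦ x *₃ y ⟧₃ ≈ ⟦ x ⟧₃ * ⟦ y ⟧₃
  *-hom 𝟘 y = sym (zeroˡ _)
  *-hom 𝟙 y = sym (*-identityˡ _)
  *-hom 𝟚 y = trans (-‿hom y) (sym (-1*x≈-x _))

  morphism : coeff ACR.-Raw-AlmostCommutative⟶ ACR.fromCommutativeRing R
  morphism = record
    { ⟦_⟧ = ⟦_⟧₃ ; +-homo = +-hom ; *-homo = *-hom ; -‿homo = -‿hom ; 0-homo = refl ; 1-homo = refl }

  dec : ∀ x y → Maybe (⟦ x ⟧₃ ≈ ⟦ y ⟧₃)
  dec 𝟘 𝟘 = just refl
  dec 𝟙 𝟙 = just refl
  dec 𝟚 𝟚 = just refl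
  dec _ _ = nothing

  open import Algebra.Solver.Ring coeff (ACR.fromCommutativeRing R) morphism dec public
    using (solve; _:=_; _:+_; _:*_; :-_; _:-_; con; Polynomial)

  :1 : ∀ {n} → Polynomial n
  :1 = con 𝟙

  :0 : ∀ {n} → Polynomial n
  :0 = con 𝟘

-- s₂ and s₄ are the values of the quadratic character, and of the real part of the quartic
-- character, at the k-th power of a generator.
s₂ s₄ sε : ℕ → ℤ
s₂ ℕ.zero = 1ℤ
s₂ (ℕ.suc k) = ℤ.- s₂ k
s₄ ℕ.zero = 1ℤ
s₄ (ℕ.suc ℕ.zero) = 0ℤ
s₄ (ℕ.suc (ℕ.suc k)) = ℤ.- s₄ k
sε k = s₄ k ℤ.+ s₄ (ℕ.suc k)

Periodic : (ℕ → ℤ) → Set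
Periodic f = ∀ j k → f (4 ℕ.* j ℕ.+ k) ≡ f k

s₂-+ : ∀ j k → s₂ (j ℕ.+ k) ≡ s₂ j ℤ.* s₂ k
s₂-+ ℕ.zero k = ≡.sym (ℤₚ.*-identityˡ _)
s₂-+ (ℕ.suc j) k = ≡.trans (≡.cong ℤ.-_ (s₂-+ j k)) (ℤₚ.neg-distribˡ-* (s₂ j) (s₂ k))

s₂-² : ∀ k → s₂ k ℤ.* s₂ k ≡ 1ℤ
s₂-² ℕ.zero = ≡.refl
s₂-² (ℕ.suc k) = ≡.trans (neg² (s₂ k)) (s₂-² k)
  where
  neg² : ∀ x → ℤ.- x ℤ.* ℤ.- x ≡ x ℤ.* x
  neg² = ℤSolver.solve-∀

s₂-±1 : ∀ k → s₂ k ≡ 1ℤ ⊎ s₂ k ≡ -1ℤ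
s₂-±1 ℕ.zero = inj₁ ≡.refl
s₂-±1 (ℕ.suc k) with s₂-±1 k
... | inj₁ p = inj₂ (≡.cong ℤ.-_ p)
... | inj₂ p = inj₁ (≡.cong ℤ.-_ p)

suc-2* : ∀ j k → 2 ℕ.* ℕ.suc j ℕ.+ k ≡ ℕ.suc (ℕ.suc (2 ℕ.* j ℕ.+ k))
suc-2* = ℕSolver.solve-∀

s₄-2* : ∀ j k → s₄ (2 ℕ.* j ℕ.+ k) ≡ s₂ j ℤ.* s₄ k
s₄-2* ℕ.zero k = ≡.sym (ℤₚ.*-identityˡ _)
s₄-2* (ℕ.suc j) k = ≡.trans (≡.cong s₄ (suc-2* j k))
  (≡.trans (≡.cong ℤ.-_ (s₄-2* j k)) (ℤₚ.neg-distribˡ-* (s₂ j) (s₄ k)))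

s₂-2* : ∀ j → s₂ (2 ℕ.* j) ≡ 1ℤ
s₂-2* j = ≡.trans (≡.cong s₂ (≡.cong (j ℕ.+_) (ℕₚ.+-identityʳ j))) (≡.trans (s₂-+ j j) (s₂-² j))

s₂-odd : ∀ j → s₂ (ℕ.suc (2 ℕ.* j)) ≡ -1ℤ
s₂-odd j = ≡.cong ℤ.-_ (s₂-2* j)

s₂-periodic : Periodic s₂
s₂-periodic j k = ≡.trans (s₂-+ (4 ℕ.* j) k)
  (≡.trans (≡.cong (ℤ._* s₂ k) (≡.trans (≡.cong s₂ (4≡ j)) (s₂-2* (2 ℕ.* j)))) (ℤₚ.*-identityˡ _))
  where
  4≡ : ∀ j → 4 ℕ.* j ≡ 2 ℕ.* (2 ℕ.* j)
  4≡ = ℕSolver.solve-∀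

s₄-periodic : Periodic s₄
s₄-periodic j k = ≡.trans (≡.cong s₄ (4≡ j k)) (≡.trans (s₄-2* (2 ℕ.* j) k)
  (≡.trans (≡.cong (ℤ._* s₄ k) (s₂-2* j)) (ℤₚ.*-identityˡ _)))
  where
  4≡ : ∀ j k → 4 ℕ.* j ℕ.+ k ≡ 2 ℕ.* (2 ℕ.* j) ℕ.+ k
  4≡ = ℕSolver.solve-∀

sε-periodic : Periodic sε
sε-periodic j k = ≡.cong₂ ℤ._+_ (s₄-periodic j k)
  (≡.trans (≡.cong s₄ (≡.sym (ℕₚ.+-suc (4 ℕ.* j) k))) (s₄-periodic j (ℕ.suc k)))

-- `s₄` vanishes at odd `k`, which is where `s₂` is -1.
s₂*s₄ : ∀ k → s₂ k ℤ.* s₄ k ≡ s₄ k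
s₂*s₄ ℕ.zero = ≡.refl
s₂*s₄ (ℕ.suc ℕ.zero) = ≡.refl
s₂*s₄ (ℕ.suc (ℕ.suc k)) = ≡.trans (step (s₂ k) (s₄ k)) (≡.cong ℤ.-_ (s₂*s₄ k))
  where
  step : ∀ x y → ℤ.- ℤ.- x ℤ.* ℤ.- y ≡ ℤ.- (x ℤ.* y)
  step = ℤSolver.solve-∀

-- 3 k ≡ - k modulo 4, and a real part is even in the exponent.
s₄-3* : ∀ k → s₄ (3 ℕ.* k) ≡ s₄ k
s₄-3* ℕ.zero = ≡.refl
s₄-3* (ℕ.suc ℕ.zero) = ≡.refl
s₄-3* (ℕ.suc (ℕ.suc k)) = ≡.trans (≡.cong s₄ (6+ k))
  (≡.trans (ℤₚ.neg-involutive _) (≡.cong ℤ.-_ (s₄-3* k)))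
  where
  6+ : ∀ k → 3 ℕ.* ℕ.suc (ℕ.suc k) ≡ ℕ.suc (ℕ.suc (ℕ.suc (ℕ.suc (ℕ.suc (ℕ.suc (3 ℕ.* k))))))
  6+ = ℕSolver.solve-∀

sε-±1 : ∀ k → sε k ≡ 1ℤ ⊎ sε k ≡ -1ℤ
sε-±1 ℕ.zero = inj₁ ≡.refl
sε-±1 (ℕ.suc ℕ.zero) = inj₂ ≡.refl
sε-±1 (ℕ.suc (ℕ.suc k)) with sε-±1 k
... | inj₁ p = inj₂ (≡.trans (≡.sym (ℤₚ.neg-distrib-+ (s₄ k) (s₄ (ℕ.suc k)))) (≡.cong ℤ.-_ p))
... | inj₂ p = inj₁ (≡.trans (≡.sym (ℤₚ.neg-distrib-+ (s₄ k) (s₄ (ℕ.suc k)))) (≡.cong ℤ.-_ p))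

sε-2* : ∀ j k → sε (2 ℕ.* j ℕ.+ k) ≡ s₂ j ℤ.* sε k
sε-2* j k = ≡.trans (≡.cong₂ ℤ._+_ (s₄-2* j k) (≡.trans (≡.cong s₄ (≡.sym (ℕₚ.+-suc (2 ℕ.* j) k))) (s₄-2* j (ℕ.suc k))))
  (≡.sym (ℤₚ.*-distribˡ-+ (s₂ j) (s₄ k) (s₄ (ℕ.suc k))))

-- q is a field with q-pow, rather than 3 ^ (2 * e) itself, so that the power never unfolds during conversion checking.
record Setting c ℓ : Set (Level.suc (c ⊔ ℓ)) where
  no-eta-equality
  field
    R         : CommutativeRing c ℓ
    e k q m₁  : ℕ
    q-pow     : q ≡ 3 ℕ.^ (2 ℕ.* e)
    q-suc     : q ≡ ℕ.suc m₁
    -- Divisibility of q - 1 by 8, rather than by 4, makes -1 a fourth power, so that R4 is an even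
    -- function.
    m₁-mod8   : m₁ ≡ 8 ℕ.* ℕ.suc k
    fin       : IsFiniteField R (q ℕ.^ 3)
    α         : CommutativeRing.Carrier R
    generates : Setup.IsPrimitive R q α α

module TightSets {c ℓ} (𝔖 : Setting c ℓ) where

  open Setting 𝔖
  open Setup R q α
  open IsFiniteField fin
  open import Algebra.Properties.Ring ring
    using (-1*x≈-x; -‿involutive; -0#≈0#; x∙y⁻¹≈ε⇒x≈y; +-inverseˡ-unique)
  open import Algebra.Properties.Semiring.Exp semiring
    using (^-congˡ; ^-congʳ; ^-cong; ^-homo-*; ^-assocʳ)
  open import Algebra.Properties.CommutativeSemiring.Exp commutativeSemiring using (^-distrib-*)
  open import Algebra.Properties.Semiring.Mult semiring using (×1-homo-*) renaming (_×_ to _×′_; ×-congˡ to ×′-congˡ)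
  open import Relation.Binary.Reasoning.Setoid setoid

  infix 4 _≟_

  _≟_ : ∀ x y → Dec (x ≈ y)
  _≟_ = decEq

  -- Field arithmetic.

  1≉0 : 1# ≉ 0#
  1≉0 = nontrivial

  cancel-nonzero : ∀ {x y z} → x ≉ 0# → x * y ≈ x * z → y ≈ z
  cancel-nonzero {x} {y} {z} x≉0 eq = let (i , xi) = inverse x x≉0 in begin
    y            ≈⟨ sym (*-identityˡ y) ⟩
    1# * y       ≈⟨ *-congʳ (trans (sym xi) (*-comm x i)) ⟩
    i * x * y    ≈⟨ *-assoc i x y ⟩
    i * (x * y)  ≈⟨ *-congˡ eq ⟩
    i * (x * z)  ≈⟨ sym (*-assoc i x z) ⟩
    i * x * z    ≈⟨ *-congʳ (trans (*-comm i x) xi) ⟩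
    1# * z       ≈⟨ *-identityˡ z ⟩
    z            ∎

  domain : ∀ {x y} → x * y ≈ 0# → x ≉ 0# → y ≈ 0#
  domain {x} eq x≉0 = cancel-nonzero x≉0 (trans eq (sym (zeroʳ x)))

  *-nonzero : ∀ {x y} → x ≉ 0# → y ≉ 0# → x * y ≉ 0#
  *-nonzero x≉0 y≉0 eq = y≉0 (domain eq x≉0)

  ^-nonzero : ∀ {x} n → x ≉ 0# → x ^ n ≉ 0#
  ^-nonzero ℕ.zero x≉0 = 1≉0
  ^-nonzero (ℕ.suc n) x≉0 = *-nonzero x≉0 (^-nonzero n x≉0)

  -nonzero : ∀ {x} → x ≉ 0# → - x ≉ 0#
  -nonzero x≉0 eq = x≉0 (trans (sym (-‿involutive _)) (trans (-‿cong eq) -0#≈0#))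

  -- junk value: inv 0 = 0
  inv : Carrier → Carrier
  inv x with x ≟ 0#
  ... | yes _ = 0#
  ... | no x≉0 = proj₁ (inverse x x≉0)

  inv-right : ∀ {x} → x ≉ 0# → x * inv x ≈ 1#
  inv-right {x} x≉0 with x ≟ 0#
  ... | yes p = ⊥-elim (x≉0 p)
  ... | no x≉0′ = proj₂ (inverse x x≉0′)

  inv-unique : ∀ {x y} → x * y ≈ 1# → y ≈ inv x
  inv-unique {x} {y} eq = cancel-nonzero x≉0 (trans eq (sym (inv-right x≉0)))
    where
    x≉0 : x ≉ 0#
    x≉0 p = 1≉0 (trans (sym eq) (trans (*-congʳ p) (zeroˡ y)))

  inv-nonzero : ∀ {x} → x ≉ 0# → inv x ≉ 0#
  inv-nonzero {x} x≉0 p = 1≉0 (trans (sym (inv-right x≉0)) (trans (*-congˡ p) (zeroʳ x)))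

  inv-cong : ∀ {x y} → x ≈ y → inv x ≈ inv y
  inv-cong {x} {y} x≈y with x ≟ 0# | y ≟ 0#
  ... | yes _ | yes _ = refl
  ... | yes p | no ¬p = ⊥-elim (¬p (trans (sym x≈y) p))
  ... | no ¬p | yes p = ⊥-elim (¬p (trans x≈y p))
  ... | no a | no b = cancel-nonzero a (trans (proj₂ (inverse x a)) (sym (trans (*-congʳ x≈y) (proj₂ (inverse y b)))))

  x-y≈0 : ∀ {x y} → x + - y ≈ 0# → x ≈ y
  x-y≈0 {x} {y} = x∙y⁻¹≈ε⇒x≈y x y

  -- Characteristic 3.

  abstract
    Eₗ : Enum _≈_ (λ (_ : Carrier) → ⊤ {ℓ})
    Eₗ = proj₁ (card→enum card)

    Eₗ-size : size Eₗ ≡ q ℕ.^ 3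
    Eₗ-size = proj₂ (card→enum card)

  -- The shift x ↦ x + 1 permutes E, so the sum of all elements absorbs a further |E| · 1.
  card-×′1 : (q ℕ.^ 3) ×′ 1# ≈ 0#
  card-×′1 = begin
    (q ℕ.^ 3) ×′ 1#          ≈⟨ ×′-congˡ (≡.sym Eₗ-size) ⟩
    size Eₗ ×′ 1#            ≈⟨ sym (multiple (elems Eₗ)) ⟩
    Σ+.sum (elems Eₗ) (λ _ → 1#) ≈⟨ cancel ⟩
    0# ∎
    where
    module Σ+ = Sums +-commutativeMonoid
    multiple : ∀ (xs : List Carrier) → Σ+.sum xs (λ _ → 1#) ≈ length xs ×′ 1#
    multiple [] = refl
    multiple (x ∷ xs) = +-congˡ (multiple xs)
    s : Carrier
    s = Σ+.sum (elems Eₗ) (λ x → x)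
    shift : s + Σ+.sum (elems Eₗ) (λ _ → 1#) ≈ s
    shift = trans (sym (Σ+.sum-∙ (elems Eₗ) (λ x → x) (λ _ → 1#)))
      (Σ+.sum-bij Eₗ Eₗ _≟_ sym trans sym trans (_+ 1#) (_+ - 1#) (λ _ _ → tt) (λ _ _ → tt)
        (λ x y _ _ p → trans (+-congʳ (sym p)) (trans (+-assoc _ _ _) (trans (+-congˡ (-‿inverseʳ _)) (+-identityʳ _))))
        (λ x y _ _ p → trans (+-congʳ (sym p)) (trans (+-assoc _ _ _) (trans (+-congˡ (-‿inverseˡ _)) (+-identityʳ _))))
        (λ x → x) (λ _ _ _ _ p → p))
    cancel : Σ+.sum (elems Eₗ) (λ _ → 1#) ≈ 0#
    cancel = begin
      Σ+.sum (elems Eₗ) (λ _ → 1#)               ≈⟨ sym (+-identityˡ _) ⟩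
      0# + Σ+.sum (elems Eₗ) (λ _ → 1#)          ≈⟨ +-congʳ (sym (-‿inverseˡ s)) ⟩
      - s + s + Σ+.sum (elems Eₗ) (λ _ → 1#)     ≈⟨ +-assoc _ _ _ ⟩
      - s + (s + Σ+.sum (elems Eₗ) (λ _ → 1#))   ≈⟨ +-congˡ shift ⟩
      - s + s                                 ≈⟨ -‿inverseˡ s ⟩
      0# ∎

  -- A power of 3 annihilates 1, and there are no zero divisors to spread this over several factors.
  three : 1# + 1# + 1# ≈ 0#
  three = trans (trans (+-assoc _ _ _) (+-congˡ (+-congˡ (sym (+-identityʳ _))))) (go (2 ℕ.* e ℕ.* 3) (trans (×′-congˡ
    (≡.trans (≡.sym (ℕₚ.^-*-assoc 3 (2 ℕ.* e) 3)) (≡.cong (ℕ._^ 3) (≡.sym q-pow)))) card-×′1))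
    where
    go : ∀ j → (3 ℕ.^ j) ×′ 1# ≈ 0# → 3 ×′ 1# ≈ 0#
    go ℕ.zero eq = ⊥-elim (1≉0 (trans (sym (+-identityʳ 1#)) eq))
    go (ℕ.suc j) eq with 3 ×′ 1# ≟ 0#
    ... | yes p = p
    ... | no ¬p = go j (domain (trans (sym (×1-homo-* 3 (3 ℕ.^ j))) eq) ¬p)

  open Char3Solver R three using (solve; _:=_; _:+_; _:*_; :-_; _:-_; con; :1; :0)

  cube : Carrier → Carrier
  cube x = x * x * x

  cube-cong : ∀ {x y} → x ≈ y → cube x ≈ cube y
  cube-cong p = *-cong (*-cong p p) p

  frob : ℕ → Carrier → Carrier
  frob ℕ.zero x = x
  frob (ℕ.suc j) x = cube (frob j x)

  frob≈ : ∀ j x → frob j x ≈ x ^ (3 ℕ.^ j)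
  frob≈ ℕ.zero x = sym (*-identityʳ x)
  frob≈ (ℕ.suc j) x = begin
    cube (frob j x)            ≈⟨ cube-cong (frob≈ j x) ⟩
    cube (x ^ (3 ℕ.^ j))       ≈⟨ trans (*-assoc _ _ _) (*-congˡ (*-congˡ (sym (*-identityʳ _)))) ⟩
    (x ^ (3 ℕ.^ j)) ^ 3        ≈⟨ ^-assocʳ x (3 ℕ.^ j) 3 ⟩
    x ^ (3 ℕ.^ j ℕ.* 3)        ≈⟨ ^-congʳ x (ℕₚ.*-comm (3 ℕ.^ j) 3) ⟩
    x ^ (3 ℕ.^ ℕ.suc j)        ∎

  cube-+ : ∀ x y → cube (x + y) ≈ cube x + cube y
  cube-+ = solve 2 (λ x y → (x :+ y) :* (x :+ y) :* (x :+ y) := x :* x :* x :+ y :* y :* y) refl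

  frob-+ : ∀ j x y → frob j (x + y) ≈ frob j x + frob j y
  frob-+ ℕ.zero x y = refl
  frob-+ (ℕ.suc j) x y = trans (cube-cong (frob-+ j x y)) (cube-+ _ _)

  φ : Carrier → Carrier
  φ x = x ^ q

  φ-cong : ∀ {x y} → x ≈ y → φ x ≈ φ y
  φ-cong = ^-congˡ q

  φ-frob : ∀ x → φ x ≈ frob (2 ℕ.* e) x
  φ-frob x = trans (^-congʳ x q-pow) (sym (frob≈ (2 ℕ.* e) x))

  -- q is a power of 3, so `φ` is an iterated cubing, and cubing is additive in characteristic 3.
  φ-+ : ∀ x y → φ (x + y) ≈ φ x + φ y
  φ-+ x y = trans (φ-frob _) (trans (frob-+ (2 ℕ.* e) x y) (sym (+-cong (φ-frob x) (φ-frob y))))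

  φ-* : ∀ x y → φ (x * y) ≈ φ x * φ y
  φ-* x y = ^-distrib-* x y q

  1^ : ∀ n → 1# ^ n ≈ 1#
  1^ ℕ.zero = refl
  1^ (ℕ.suc n) = trans (*-identityˡ _) (1^ n)

  φ-1 : φ 1# ≈ 1#
  φ-1 = 1^ q

  0^ : ∀ n → 0# ^ ℕ.suc n ≈ 0#
  0^ n = zeroˡ _

  φ-0 : φ 0# ≈ 0#
  φ-0 = trans (^-congʳ 0# q-suc) (0^ m₁)

  φ-neg : ∀ x → φ (- x) ≈ - φ x
  φ-neg x = +-inverseˡ-unique _ _ (trans (sym (φ-+ (- x) x)) (trans (φ-cong (-‿inverseˡ x)) φ-0))

  φ-nonzero : ∀ {x} → x ≉ 0# → φ x ≉ 0#
  φ-nonzero = ^-nonzero q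

  φ-zero : ∀ {x} → φ x ≈ 0# → x ≈ 0#
  φ-zero {x} p with x ≟ 0#
  ... | yes z = z
  ... | no ¬z = ⊥-elim (φ-nonzero ¬z p)

  φ-injective : ∀ {x y} → φ x ≈ φ y → x ≈ y
  φ-injective {x} {y} p = x-y≈0 (φ-zero (begin
    φ (x + - y)      ≈⟨ φ-+ x (- y) ⟩
    φ x + φ (- y)    ≈⟨ +-cong p (φ-neg y) ⟩
    φ y + - φ y      ≈⟨ -‿inverseʳ _ ⟩
    0# ∎))

  φφ≈ : ∀ x → φ (φ x) ≈ x ^ (q ℕ.* q)
  φφ≈ x = ^-assocʳ x q q

  -- The multiplicative group.

  n d₁ : ℕ
  d₁ = q ℕ.* q ℕ.+ q ℕ.+ 1
  n = m₁ ℕ.* d₁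

  q³≡ : q ℕ.^ 3 ≡ ℕ.suc n
  q³≡ = ≡.subst (λ t → t ℕ.^ 3 ≡ ℕ.suc (m₁ ℕ.* (t ℕ.* t ℕ.+ t ℕ.+ 1))) (≡.sym q-suc) (identity m₁)
    where
    identity : ∀ m → ℕ.suc m ℕ.* (ℕ.suc m ℕ.* (ℕ.suc m ℕ.* 1)) ≡ ℕ.suc (m ℕ.* (ℕ.suc m ℕ.* ℕ.suc m ℕ.+ ℕ.suc m ℕ.+ 1))
    identity = ℕSolver.solve-∀

  instance
    n-nonZero : ℕ.NonZero n
    n-nonZero = ℕ.>-nonZero (ℕₚ.*-mono-< {0} {m₁} {0} {d₁}
      (≡.subst (0 ℕ.<_) (≡.sym m₁-mod8) (ℕ.s≤s ℕ.z≤n)) (≡.subst (0 ℕ.<_) (ℕₚ.+-comm 1 _) (ℕ.s≤s ℕ.z≤n)))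

  E*ₗ : Enum _≈_ (λ x → ⊤ {ℓ} × x ≉ 0#)
  E*ₗ = filterEnum (λ x → ¬? (x ≟ 0#)) (λ p x≉0 y≈0 → x≉0 (trans p y≈0)) Eₗ

  E*ₗ-size : size E*ₗ ≡ n
  E*ₗ-size = ℕₚ.suc-injective (≡.trans (card-unique sym trans (enum→card with0) (enum→card Eₗ)) (≡.trans Eₗ-size q³≡))
    where
    with0 : Enum _≈_ (λ (_ : Carrier) → ⊤ {ℓ})
    with0 = record
      { elems = 0# ∷ elems E*ₗ
      ; sound = All.universal (λ _ → tt) _
      ; uniq = All.map (λ (_ , x≉0) p → x≉0 (sym p)) (sound E*ₗ) ∷ uniq E*ₗ
      ; complete = comp
      }
      where
      comp : ∀ x → ⊤ {ℓ} → Any (x ≈_) (0# ∷ elems E*ₗ)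
      comp x _ with x ≟ 0#
      ... | yes p = here p
      ... | no ¬p = there (complete E*ₗ x (tt , ¬p))

  α≉0 : α ≉ 0#
  α≉0 p = 1≉0 (trans (sym (1-pow (proj₁ at-1) (proj₂ at-1))) (trans (proj₂ at-m) 0≈))
    where
    at-1 = generates 1# 1≉0
    at-m = generates (- 1#) (-nonzero 1≉0)
    -- if α were 0 its powers would be 1 and 0 only, so - 1# would be 1#
    pow : ∀ j → j ≡ 0 ⊎ α ^ j ≈ 0#
    pow ℕ.zero = inj₁ ≡.refl
    pow (ℕ.suc j) = inj₂ (trans (*-congʳ p) (zeroˡ _))
    1-pow : ∀ j → α ^ j ≈ 1# → α ^ proj₁ at-m ≈ 1#
    1-pow j _ with pow (proj₁ at-m)
    ... | inj₁ z = ^-congʳ α z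
    ... | inj₂ z = ⊥-elim (-nonzero 1≉0 (trans (sym (proj₂ at-m)) z))
    0≈ : - 1# ≈ 0#
    0≈ with pow (proj₁ at-m)
    ... | inj₂ z = trans (sym (proj₂ at-m)) z
    ... | inj₁ z = ⊥-elim (1≉0 (begin
      1#                   ≈⟨ sym (trans (+-congˡ three′) (+-identityʳ _)) ⟩
      1# + (1# + 1#)       ≈⟨ sym (+-assoc _ _ _) ⟩
      1# + 1# + 1#         ≈⟨ three ⟩
      0# ∎))
      where
      three′ : 1# + 1# ≈ 0#
      three′ = trans (+-congˡ (trans (^-congʳ α (≡.sym z)) (proj₂ at-m))) (-‿inverseʳ _)

  α^≉0 : ∀ j → α ^ j ≉ 0#
  α^≉0 j = ^-nonzero j α≉0

  -- Multiplication by α permutes E*, hence leaves the product of all nonzero elements unchanged.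
  α^n : α ^ n ≈ 1#
  α^n = cancel-nonzero prod≉0 (begin
    prod * α ^ n                        ≈⟨ *-comm _ _ ⟩
    α ^ n * prod                        ≈⟨ *-congʳ (^-congʳ α (≡.sym E*ₗ-size)) ⟩
    α ^ size E*ₗ * prod                 ≈⟨ sym (prod-scale (elems E*ₗ)) ⟩
    Π*.sum (elems E*ₗ) (λ x → α * x)       ≈⟨ Π*.sum-bij E*ₗ E*ₗ _≟_ sym trans sym trans (α *_) (inv α *_)
        (λ x (_ , x≉0) → tt , *-nonzero α≉0 x≉0) (λ x (_ , x≉0) → tt , *-nonzero (inv-nonzero α≉0) x≉0)
        (λ x y _ _ p → trans (*-congˡ (sym p)) (trans (sym (*-assoc _ _ _)) (trans (*-congʳ (trans (*-comm _ _) (inv-right α≉0))) (*-identityˡ _))))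
        (λ x y _ _ p → trans (*-congˡ (sym p)) (trans (sym (*-assoc _ _ _)) (trans (*-congʳ (inv-right α≉0)) (*-identityˡ _))))
        (λ x → x) (λ _ _ _ _ p → p) ⟩
    prod                                ≈⟨ sym (*-identityʳ _) ⟩
    prod * 1# ∎)
    where
    module Π* = Sums *-commutativeMonoid
    prod : Carrier
    prod = Π*.sum (elems E*ₗ) (λ x → x)
    prod-scale : ∀ xs → Π*.sum xs (λ x → α * x) ≈ α ^ length xs * Π*.sum xs (λ x → x)
    prod-scale [] = sym (*-identityˡ _)
    prod-scale (x ∷ xs) = trans (*-congˡ (prod-scale xs))
      (solve 4 (λ a b x y → (a :* x) :* (b :* y) := (a :* b) :* (x :* y)) refl α (α ^ length xs) x (Π*.sum xs (λ x → x)))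
    nonzero : ∀ {xs} → All (λ x → ⊤ {ℓ} × x ≉ 0#) xs → Π*.sum xs (λ x → x) ≉ 0#
    nonzero [] = 1≉0
    nonzero ((_ , p) ∷ ps) = *-nonzero p (nonzero ps)
    prod≉0 = nonzero (sound E*ₗ)

  α^-multiple : ∀ m j → α ^ m ≈ 1# → α ^ (j ℕ.* m) ≈ 1#
  α^-multiple m j p = begin
    α ^ (j ℕ.* m)   ≈⟨ ^-congʳ α (ℕₚ.*-comm j m) ⟩
    α ^ (m ℕ.* j)   ≈⟨ sym (^-assocʳ α m j) ⟩
    (α ^ m) ^ j     ≈⟨ ^-congˡ j p ⟩
    1# ^ j          ≈⟨ 1^ j ⟩
    1# ∎

  α^-mod : ∀ m .{{_ : ℕ.NonZero m}} j → α ^ m ≈ 1# → α ^ j ≈ α ^ (j DM.% m)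
  α^-mod m j p = begin
    α ^ j                                          ≈⟨ ^-congʳ α (DM.m≡m%n+[m/n]*n j m) ⟩
    α ^ (j DM.% m ℕ.+ j DM./ m ℕ.* m)              ≈⟨ ^-homo-* α (j DM.% m) _ ⟩
    α ^ (j DM.% m) * α ^ (j DM./ m ℕ.* m)          ≈⟨ *-congˡ (α^-multiple m (j DM./ m) p) ⟩
    α ^ (j DM.% m) * 1#                            ≈⟨ *-identityʳ _ ⟩
    α ^ (j DM.% m) ∎

  -- If α^m = 1, the powers of α take at most m values, yet they cover the n elements of E*.
  order-minimal : ∀ m .{{_ : ℕ.NonZero m}} → α ^ m ≈ 1# → n ℕ.≤ m
  order-minimal m p = ≡.subst₂ ℕ._≤_ E*ₗ-size (≡.trans (Listₚ.length-map (α ^_) (upTo m)) (Listₚ.length-upTo m))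
    (length-≤ sym trans (uniq E*ₗ) (All.map (λ {x} (_ , x≉0) → cover x x≉0) (sound E*ₗ)))
    where
    cover : ∀ x → x ≉ 0# → Any (x ≈_) (map (α ^_) (upTo m))
    cover x x≉0 = let (j , eq) = generates x x≉0 in
      Anyₚ.map⁺ (Any.map (λ { ≡.refl → trans (sym eq) (α^-mod m j p) }) (∈-upTo⁺ (DM.m%n<n j m)))

  order-divides : ∀ m → α ^ m ≈ 1# → n Div.∣ m
  order-divides m p = Div.m%n≡0⇒n∣m m n (go (m DM.% n) (DM.m%n<n m n) (trans (sym (α^-mod n m α^n)) p))
    where
    go : ∀ t → t ℕ.< n → α ^ t ≈ 1# → t ≡ 0
    go ℕ.zero _ _ = ≡.refl
    go (ℕ.suc t) t<n eq = ⊥-elim (ℕₚ.<⇒≱ t<n (order-minimal (ℕ.suc t) eq))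

  α^-cancel : ∀ i j → α ^ i ≈ α ^ (i ℕ.+ j) → n Div.∣ j
  α^-cancel i j p = order-divides j (cancel-nonzero (α^≉0 i)
    (trans (sym (^-homo-* α i j)) (trans (sym p) (sym (*-identityʳ _)))))

  α^-inj : ∀ i j → i ℕ.< n → j ℕ.< n → α ^ i ≈ α ^ j → i ≡ j
  α^-inj i j i<n j<n p with ℕₚ.≤-total i j
  ... | inj₁ i≤j = go i j j<n i≤j p
    where
    go : ∀ i j → j ℕ.< n → i ℕ.≤ j → α ^ i ≈ α ^ j → i ≡ j
    go i j j<n i≤j p with j ℕ.∸ i | ℕₚ.m+[n∸m]≡n i≤j
    ... | ℕ.zero  | ≡.refl = ≡.sym (ℕₚ.+-identityʳ i)
    ... | ℕ.suc t | ≡.refl = ⊥-elim (ℕₚ.<⇒≱ j<n (ℕₚ.≤-trans (Div.∣⇒≤ (α^-cancel i (ℕ.suc t) p)) (ℕₚ.m≤n+m _ i)))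
  ... | inj₂ j≤i = ≡.sym (go j i i<n j≤i (sym p))
    where
    go : ∀ i j → j ℕ.< n → i ℕ.≤ j → α ^ i ≈ α ^ j → i ≡ j
    go i j j<n i≤j p with j ℕ.∸ i | ℕₚ.m+[n∸m]≡n i≤j
    ... | ℕ.zero  | ≡.refl = ≡.sym (ℕₚ.+-identityʳ i)
    ... | ℕ.suc t | ≡.refl = ⊥-elim (ℕₚ.<⇒≱ j<n (ℕₚ.≤-trans (Div.∣⇒≤ (α^-cancel i (ℕ.suc t) p)) (ℕₚ.m≤n+m _ i)))

  x^n : ∀ x → x ≉ 0# → x ^ n ≈ 1#
  x^n x x≉0 = let (j , eq) = generates x x≉0 in
    trans (^-congˡ n (sym eq)) (trans (^-assocʳ α j n) (α^-multiple n j α^n))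

  φφφ : ∀ x → φ (φ (φ x)) ≈ x
  φφφ x with x ≟ 0#
  ... | yes p = trans (trans (φ-cong (trans (φ-cong (trans (φ-cong p) φ-0)) φ-0)) φ-0) (sym p)
  ... | no x≉0 = begin
    φ (φ (φ x))               ≈⟨ trans (φ-cong (φφ≈ x)) (^-assocʳ x (q ℕ.* q) q) ⟩
    x ^ (q ℕ.* q ℕ.* q)       ≈⟨ ^-congʳ x (≡.trans (q*q*q q) q³≡) ⟩
    x * x ^ n                 ≈⟨ *-congˡ (x^n x x≉0) ⟩
    x * 1#                    ≈⟨ *-identityʳ x ⟩
    x ∎
    where
    q*q*q : ∀ t → t ℕ.* t ℕ.* t ≡ t ℕ.* (t ℕ.* (t ℕ.* 1))
    q*q*q = ℕSolver.solve-∀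

  -- The roots are the powers of α^d. Used with m = q - 1 for F* and with m = q² + q + 1 for the
  -- elements of norm 1.
  roots : ∀ d m → .{{_ : ℕ.NonZero d}} .{{_ : ℕ.NonZero m}} → n ≡ d ℕ.* m →
    Σ (Enum _≈_ (λ x → x ^ m ≈ 1#)) λ en → size en ≡ m
  roots d m n≡ = let (en , eq) = mapEnum {_≋_ = _≈_} below (λ j _ → α ^ (d ℕ.* j)) into inj onto in
    en , ≡.trans eq (Listₚ.length-upTo m)
    where
    below : Enum _≡_ (ℕ._< m)
    below = record
      { elems = upTo m
      ; sound = Allₚ.all-upTo m
      ; uniq = Uniqueₚ.upTo⁺ m
      ; complete = λ x x<m → ∈-upTo⁺ x<m
      }
    d*<n : ∀ {j} → j ℕ.< m → d ℕ.* j ℕ.< n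
    d*<n {j} j<m = ≡.subst (λ t → d ℕ.* j ℕ.< t) (≡.sym n≡) (ℕₚ.*-monoʳ-< d j<m)
    into : ∀ j → j ℕ.< m → (α ^ (d ℕ.* j)) ^ m ≈ 1#
    into j _ = trans (^-assocʳ α (d ℕ.* j) m) (trans (^-congʳ α arith) (α^-multiple n j α^n))
      where
      lem : ∀ d j m → d ℕ.* j ℕ.* m ≡ j ℕ.* (d ℕ.* m)
      lem = ℕSolver.solve-∀
      arith : d ℕ.* j ℕ.* m ≡ j ℕ.* n
      arith = ≡.trans (lem d j m) (≡.cong (j ℕ.*_) (≡.sym n≡))
    inj : ∀ i j → i ℕ.< m → j ℕ.< m → α ^ (d ℕ.* i) ≈ α ^ (d ℕ.* j) → i ≡ j
    inj i j i<m j<m p = ℕₚ.*-cancelˡ-≡ i j d (α^-inj _ _ (d*<n i<m) (d*<n j<m) p)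
    onto : ∀ x → x ^ m ≈ 1# → ∃ λ i → i ℕ.< m × (∀ j → j ℕ.< m → i ≡ j → x ≈ α ^ (d ℕ.* j))
    onto x p = i DM.% m , DM.m%n<n i m , λ { j _ ≡.refl → begin
        x                                            ≈⟨ sym (proj₂ log) ⟩
        α ^ proj₁ log                                ≈⟨ ^-congʳ α (≡.trans (Div._∣_.equality d∣) (ℕₚ.*-comm i d)) ⟩
        α ^ (d ℕ.* i)                                ≈⟨ ^-congʳ α (≡.cong (d ℕ.*_) (DM.m≡m%n+[m/n]*n i m)) ⟩
        α ^ (d ℕ.* (i DM.% m ℕ.+ i DM./ m ℕ.* m))    ≈⟨ ^-congʳ α (≡.trans (lem d _ (i DM./ m) m) (≡.cong (λ t → d ℕ.* (i DM.% m) ℕ.+ i DM./ m ℕ.* t) (≡.sym n≡))) ⟩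
        α ^ (d ℕ.* (i DM.% m) ℕ.+ i DM./ m ℕ.* n)    ≈⟨ ^-homo-* α (d ℕ.* (i DM.% m)) _ ⟩
        α ^ (d ℕ.* (i DM.% m)) * α ^ (i DM./ m ℕ.* n) ≈⟨ *-congˡ (α^-multiple n (i DM./ m) α^n) ⟩
        α ^ (d ℕ.* (i DM.% m)) * 1#                  ≈⟨ *-identityʳ _ ⟩
        α ^ (d ℕ.* (i DM.% m)) ∎ }
      where
      lem : ∀ d a b m → d ℕ.* (a ℕ.+ b ℕ.* m) ≡ d ℕ.* a ℕ.+ b ℕ.* (d ℕ.* m)
      lem = ℕSolver.solve-∀
      x≉0 : x ≉ 0#
      x≉0 z = 1≉0 (trans (sym p) (trans (^-congˡ m z) (trans (^-congʳ 0# (≡.sym (ℕₚ.suc-pred m))) (0^ (ℕ.pred m)))))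
      log = generates x x≉0
      d∣ : d Div.∣ proj₁ log
      d∣ = Div.*-cancelʳ-∣ m (≡.subst (Div._∣ proj₁ log ℕ.* m) n≡ (order-divides (proj₁ log ℕ.* m)
        (trans (sym (^-assocʳ α (proj₁ log) m)) (trans (^-congˡ m (proj₂ log)) p))))
      i = Div._∣_.quotient d∣

  -- The subfield F, trace and norm.

  F-cong : ∀ {x y} → x ≈ y → InF x → InF y
  F-cong p fx = trans (φ-cong (sym p)) (trans fx p)

  F-0 : InF 0#
  F-0 = φ-0

  F-1 : InF 1#
  F-1 = φ-1

  F-+ : ∀ {x y} → InF x → InF y → InF (x + y)
  F-+ fx fy = trans (φ-+ _ _) (+-cong fx fy)

  F-* : ∀ {x y} → InF x → InF y → InF (x * y)
  F-* fx fy = trans (φ-* _ _) (*-cong fx fy)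

  F-neg : ∀ {x} → InF x → InF (- x)
  F-neg fx = trans (φ-neg _) (-‿cong fx)

  F-cube : ∀ {x} → InF x → InF (cube x)
  F-cube fx = F-* (F-* fx fx) fx

  inv-0 : ∀ {x} → x ≈ 0# → inv x ≈ 0#
  inv-0 {x} p with x ≟ 0#
  ... | yes _ = refl
  ... | no ¬p = ⊥-elim (¬p p)

  φ-inv : ∀ x → φ (inv x) ≈ inv (φ x)
  φ-inv x with x ≟ 0#
  ... | yes p = trans φ-0 (sym (inv-0 (trans (φ-cong p) φ-0)))
  ... | no x≉0 = inv-unique (trans (sym (φ-* x _)) (trans (φ-cong (proj₂ (inverse x x≉0))) φ-1))

  F-inv : ∀ {x} → InF x → InF (inv x)
  F-inv {x} fx = trans (φ-inv x) (inv-cong fx)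

  F-^ : ∀ {x} j → InF x → InF (x ^ j)
  F-^ ℕ.zero fx = F-1
  F-^ (ℕ.suc j) fx = F-* fx (F-^ j fx)

  InF? : ∀ x → Dec (InF x)
  InF? x = φ x ≟ x

  T≈ : ∀ x → T x ≈ x + φ x + φ (φ x)
  T≈ x = +-congˡ (sym (φφ≈ x))

  N≈ : ∀ x → N x ≈ x * φ x * φ (φ x)
  N≈ x = begin
    x ^ (q ℕ.* q ℕ.+ q ℕ.+ 1)         ≈⟨ ^-homo-* x (q ℕ.* q ℕ.+ q) 1 ⟩
    x ^ (q ℕ.* q ℕ.+ q) * x ^ 1       ≈⟨ *-cong (^-homo-* x (q ℕ.* q) q) (*-identityʳ x) ⟩
    x ^ (q ℕ.* q) * φ x * x           ≈⟨ *-congʳ (*-congʳ (sym (φφ≈ x))) ⟩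
    φ (φ x) * φ x * x                 ≈⟨ solve 3 (λ a b c → c :* b :* a := a :* b :* c) refl _ _ _ ⟩
    x * φ x * φ (φ x) ∎

  T-cong : ∀ {x y} → x ≈ y → T x ≈ T y
  T-cong p = +-cong (+-cong p (φ-cong p)) (^-congˡ (q ℕ.* q) p)

  N-cong : ∀ {x y} → x ≈ y → N x ≈ N y
  N-cong = ^-congˡ d₁

  N-* : ∀ x y → N (x * y) ≈ N x * N y
  N-* x y = ^-distrib-* x y d₁

  T-+ : ∀ x y → T (x + y) ≈ T x + T y
  T-+ x y = begin
    T (x + y)                                          ≈⟨ T≈ _ ⟩
    x + y + φ (x + y) + φ (φ (x + y))                  ≈⟨ +-cong (+-congˡ (φ-+ x y)) (trans (φ-cong (φ-+ x y)) (φ-+ _ _)) ⟩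
    x + y + (φ x + φ y) + (φ (φ x) + φ (φ y))          ≈⟨ solve 6 (λ a b c d e f → a :+ b :+ (c :+ d) :+ (e :+ f) := a :+ c :+ e :+ (b :+ d :+ f)) refl _ _ _ _ _ _ ⟩
    x + φ x + φ (φ x) + (y + φ y + φ (φ y))            ≈⟨ sym (+-cong (T≈ x) (T≈ y)) ⟩
    T x + T y ∎

  T-scale : ∀ {s} x → InF s → T (s * x) ≈ s * T x
  T-scale {s} x fs = begin
    T (s * x)                                     ≈⟨ T≈ _ ⟩
    s * x + φ (s * x) + φ (φ (s * x))             ≈⟨ +-cong (+-congˡ φs) (trans (φ-cong φs) (trans (φ-* s _) (*-congʳ fs))) ⟩
    s * x + s * φ x + s * φ (φ x)                 ≈⟨ solve 4 (λ s a b c → s :* a :+ s :* b :+ s :* c := s :* (a :+ b :+ c)) refl _ _ _ _ ⟩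
    s * (x + φ x + φ (φ x))                       ≈⟨ *-congˡ (sym (T≈ x)) ⟩
    s * T x ∎
    where
    φs : φ (s * x) ≈ s * φ x
    φs = trans (φ-* s x) (*-congʳ fs)

  T-0 : T 0# ≈ 0#
  T-0 = trans (T≈ 0#) (trans (+-cong (+-congˡ φ-0) (trans (φ-cong φ-0) φ-0)) (trans (+-identityʳ _) (+-identityʳ _)))

  T-inF : ∀ x → InF (T x)
  T-inF x = trans (φ-cong (T≈ x)) (begin
    φ (x + φ x + φ (φ x))                  ≈⟨ trans (φ-+ _ _) (+-congʳ (φ-+ _ _)) ⟩
    φ x + φ (φ x) + φ (φ (φ x))            ≈⟨ +-congˡ (φφφ x) ⟩
    φ x + φ (φ x) + x                      ≈⟨ solve 3 (λ a b c → b :+ c :+ a := a :+ b :+ c) refl _ _ _ ⟩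
    x + φ x + φ (φ x)                      ≈⟨ sym (T≈ x) ⟩
    T x ∎)

  N-inF : ∀ x → InF (N x)
  N-inF x = trans (φ-cong (N≈ x)) (begin
    φ (x * φ x * φ (φ x))                  ≈⟨ trans (φ-* _ _) (*-congʳ (φ-* _ _)) ⟩
    φ x * φ (φ x) * φ (φ (φ x))            ≈⟨ *-congˡ (φφφ x) ⟩
    φ x * φ (φ x) * x                      ≈⟨ solve 3 (λ a b c → b :* c :* a := a :* b :* c) refl _ _ _ ⟩
    x * φ x * φ (φ x)                      ≈⟨ sym (N≈ x) ⟩
    N x ∎)

  N-F : ∀ {s} → InF s → N s ≈ cube s
  N-F {s} fs = trans (N≈ s) (*-cong (*-congˡ fs) (trans (φ-cong fs) fs))

  instance
    d₁-nonZero : ℕ.NonZero d₁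
    d₁-nonZero = ℕ.>-nonZero (≡.subst (0 ℕ.<_) (ℕₚ.+-comm 1 _) (ℕ.s≤s ℕ.z≤n))

    m₁-nonZero : ℕ.NonZero m₁
    m₁-nonZero = ℕ.>-nonZero (≡.subst (0 ℕ.<_) (≡.sym m₁-mod8) (ℕ.s≤s ℕ.z≤n))

  F*-pow : ∀ {x} → InF x → x ≉ 0# → x ^ m₁ ≈ 1#
  F*-pow {x} fx x≉0 = cancel-nonzero x≉0 (trans (trans (^-congʳ x (≡.sym q-suc)) fx) (sym (*-identityʳ x)))

  with-0 : Enum _≈_ (λ x → x ^ m₁ ≈ 1#) → Enum _≈_ InF
  with-0 en = record
    { elems = 0# ∷ elems en
    ; sound = F-0 ∷ All.map (λ {x} p → trans (^-congʳ x q-suc) (trans (*-congˡ p) (*-identityʳ x))) (sound en)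
    ; uniq = All.map (λ {x} p z → 1≉0 (trans (sym p) (trans (^-congˡ m₁ (sym z))
        (trans (^-congʳ 0# (≡.sym (ℕₚ.suc-pred m₁))) (0^ (ℕ.pred m₁)))))) (sound en) ∷ uniq en
    ; complete = comp
    }
    where
    comp : ∀ x → InF x → Any (x ≈_) (0# ∷ elems en)
    comp x fx with x ≟ 0#
    ... | yes p = here p
    ... | no ¬p = there (complete en x (F*-pow fx ¬p))

  abstract
    Fₗ : Enum _≈_ InF
    Fₗ = with-0 (proj₁ (roots d₁ m₁ (ℕₚ.*-comm m₁ d₁)))

    Fₗ-size : size Fₗ ≡ q
    Fₗ-size = ≡.trans (≡.cong ℕ.suc (proj₂ (roots d₁ m₁ (ℕₚ.*-comm m₁ d₁)))) (≡.sym q-suc)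

    𝒩ₗ : Enum _≈_ (λ x → N x ≈ 1#)
    𝒩ₗ = proj₁ (roots m₁ d₁ ≡.refl)

    𝒩ₗ-size : size 𝒩ₗ ≡ d₁
    𝒩ₗ-size = proj₂ (roots m₁ d₁ ≡.refl)

  -- Class functions.

  log : ∀ {x} → x ≉ 0# → ∃ λ j → α ^ j ≈ x
  log {x} = generates x

  -- `log` returns some exponent, which is determined only modulo n. As 4 divides n, the value is
  -- canonical for functions of period 4; hence `Periodic` in the lemmas below.
  Cl : (ℕ → ℤ) → Carrier → ℤ
  Cl f x with x ≟ 0#
  ... | yes _ = 0ℤ
  ... | no x≉0 = f (proj₁ (log x≉0))

  log-class : ∀ {f} → Periodic f → ∀ i j → α ^ i ≈ α ^ j → f i ≡ f j
  log-class {f} per i j p = [ (λ i≤j → ≡.sym (go i j i≤j p)) , (λ j≤i → go j i j≤i (sym p)) ]′ (ℕₚ.≤-total i j)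
    where
    arith : ∀ t m d → t ℕ.* (8 ℕ.* m ℕ.* d) ≡ 4 ℕ.* (t ℕ.* (2 ℕ.* m ℕ.* d))
    arith = ℕSolver.solve-∀
    go : ∀ i j → i ℕ.≤ j → α ^ i ≈ α ^ j → f j ≡ f i
    go i j i≤j p with j ℕ.∸ i | ℕₚ.m+[n∸m]≡n i≤j
    ... | d | ≡.refl = conclude (α^-cancel i d p)
      where
      conclude : n Div.∣ d → f (i ℕ.+ d) ≡ f i
      conclude (Div.divides t ≡.refl) = ≡.trans (≡.cong f (≡.trans (ℕₚ.+-comm i _) (≡.cong (ℕ._+ i) (≡.trans (≡.cong (λ m → t ℕ.* (m ℕ.* d₁)) m₁-mod8) (arith t (ℕ.suc k) d₁))))) (per (t ℕ.* (2 ℕ.* ℕ.suc k ℕ.* d₁)) i)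

  Cl-log : ∀ {f} → Periodic f → ∀ {x} j → α ^ j ≈ x → Cl f x ≡ f j
  Cl-log {f} per {x} j p with x ≟ 0#
  ... | yes z = ⊥-elim (α^≉0 j (trans p z))
  ... | no x≉0 = log-class per _ j (trans (proj₂ (log x≉0)) (sym p))

  Cl-0 : ∀ f {x} → x ≈ 0# → Cl f x ≡ 0ℤ
  Cl-0 f {x} p with x ≟ 0#
  ... | yes _ = ≡.refl
  ... | no x≉0 = ⊥-elim (x≉0 p)

  Cl-cong : ∀ {f} → Periodic f → ∀ {x y} → x ≈ y → Cl f x ≡ Cl f y
  Cl-cong {f} per {x} {y} p with x ≟ 0#
  ... | yes z = ≡.sym (Cl-0 f (trans (sym p) z))
  ... | no x≉0 = ≡.sym (Cl-log per _ (trans (proj₂ (log x≉0)) p))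

  χ R4 ε : Carrier → ℤ
  χ = Cl s₂
  R4 = Cl s₄
  ε = Cl sε

  χ-cong : ∀ {x y} → x ≈ y → χ x ≡ χ y
  χ-cong = Cl-cong s₂-periodic

  R4-cong : ∀ {x y} → x ≈ y → R4 x ≡ R4 y
  R4-cong = Cl-cong s₄-periodic

  ε-cong : ∀ {x y} → x ≈ y → ε x ≡ ε y
  ε-cong = Cl-cong sε-periodic

  χ-0 : ∀ {x} → x ≈ 0# → χ x ≡ 0ℤ
  χ-0 = Cl-0 s₂

  R4-0 : ∀ {x} → x ≈ 0# → R4 x ≡ 0ℤ
  R4-0 = Cl-0 s₄

  *-0ˡ : ∀ {x y} → x ≈ 0# → x * y ≈ 0#
  *-0ˡ p = trans (*-congʳ p) (zeroˡ _)

  *-0ʳ : ∀ {x y} → y ≈ 0# → x * y ≈ 0#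
  *-0ʳ p = trans (*-congˡ p) (zeroʳ _)

  log-* : ∀ {x y} i j → α ^ i ≈ x → α ^ j ≈ y → α ^ (i ℕ.+ j) ≈ x * y
  log-* i j p p′ = trans (^-homo-* α i j) (*-cong p p′)

  χ-* : ∀ x y → χ (x * y) ≡ χ x ℤ.* χ y
  χ-* x y with x ≟ 0#
  ... | yes p = χ-0 (*-0ˡ p)
  ... | no x≉0 with y ≟ 0#
  ...   | yes p = ≡.trans (χ-0 (*-0ʳ p)) (≡.sym (ℤₚ.*-zeroʳ (s₂ (proj₁ (log x≉0)))))
  ...   | no y≉0 = let (i , p) = log x≉0 ; (j , p′) = log y≉0 in
            ≡.trans (Cl-log s₂-periodic (i ℕ.+ j) (log-* i j p p′)) (s₂-+ i j)

  χ-±1 : ∀ {x} → x ≉ 0# → χ x ≡ 1ℤ ⊎ χ x ≡ -1ℤ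
  χ-±1 {x} x≉0 with x ≟ 0#
  ... | yes p = ⊥-elim (x≉0 p)
  ... | no x≉0′ = s₂-±1 (proj₁ (log x≉0′))

  χ-² : ∀ {x} → x ≉ 0# → χ x ℤ.* χ x ≡ 1ℤ
  χ-² {x} x≉0 = [ (λ p → ≡.cong₂ ℤ._*_ p p) , (λ p → ≡.cong₂ ℤ._*_ p p) ]′ (χ-±1 x≉0)

  χ-sq : ∀ {x} → x ≉ 0# → χ (x * x) ≡ 1ℤ
  χ-sq {x} x≉0 = ≡.trans (χ-* x x) (χ-² x≉0)

  -- At z² the quartic character is real, with value χ z. This is all the multiplicativity that its
  -- real part, and `ε`, retain.
  Cl-sq-* : ∀ {f} → Periodic f → (∀ j k → f (2 ℕ.* j ℕ.+ k) ≡ s₂ j ℤ.* f k) →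
    ∀ z y → Cl f (z * z * y) ≡ χ z ℤ.* Cl f y
  Cl-sq-* {f} per h z y with z ≟ 0#
  ... | yes p = Cl-0 f (*-0ˡ (*-0ˡ p))
  ... | no z≉0 with y ≟ 0#
  ...   | yes p = ≡.trans (Cl-0 f (*-0ʳ p)) (≡.sym (ℤₚ.*-zeroʳ (s₂ (proj₁ (log z≉0)))))
  ...   | no y≉0 = let (i , p) = log z≉0 ; (j , p′) = log y≉0 in
            ≡.trans (Cl-log per (2 ℕ.* i ℕ.+ j) (log-* (2 ℕ.* i) j
              (trans (^-congʳ α (≡.cong (i ℕ.+_) (ℕₚ.+-identityʳ i))) (log-* i i p p)) p′)) (h i j)

  R4-sq-* : ∀ z y → R4 (z * z * y) ≡ χ z ℤ.* R4 y
  R4-sq-* = Cl-sq-* s₄-periodic s₄-2*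

  ε-sq-* : ∀ z y → ε (z * z * y) ≡ χ z ℤ.* ε y
  ε-sq-* = Cl-sq-* sε-periodic sε-2*

  R4-1 : R4 1# ≡ 1ℤ
  R4-1 = Cl-log s₄-periodic 0 refl

  χ-1 : χ 1# ≡ 1ℤ
  χ-1 = Cl-log s₂-periodic 0 refl

  R4-sq : ∀ z → R4 (z * z) ≡ χ z
  R4-sq z = ≡.trans (R4-cong (sym (*-identityʳ _))) (≡.trans (R4-sq-* z 1#)
    (≡.trans (≡.cong (χ z ℤ.*_) R4-1) (ℤₚ.*-identityʳ _)))

  χ*R4 : ∀ x → χ x ℤ.* R4 x ≡ R4 x
  χ*R4 x with x ≟ 0#
  ... | yes p = ≡.refl
  ... | no x≉0 = s₂*s₄ (proj₁ (log x≉0))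

  R4-cube : ∀ x → R4 (cube x) ≡ R4 x
  R4-cube x with x ≟ 0#
  ... | yes p = R4-0 (*-0ʳ p)
  ... | no x≉0 = let (i , p) = log x≉0 in
    ≡.trans (Cl-log s₄-periodic (3 ℕ.* i) (trans (^-congʳ α (3* i)) (log-* (i ℕ.+ i) i (log-* i i p p) p))) (s₄-3* i)
    where
    3* : ∀ i → 3 ℕ.* i ≡ i ℕ.+ i ℕ.+ i
    3* = ℕSolver.solve-∀

  R4-inv : ∀ x → R4 (inv x) ≡ R4 x
  R4-inv x with x ≟ 0#
  ... | yes p = R4-0 refl
  ... | no x≉0 = ≡.trans (R4-cong eq) (≡.trans (R4-sq-* (i * i) (cube x))
      (≡.trans (≡.cong₂ ℤ._*_ (χ-sq i≉0) (R4-cube x)) (≡.trans (ℤₚ.*-identityˡ _) (Cl-log s₄-periodic (proj₁ (log x≉0)) (proj₂ (log x≉0))))))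
    where
    i = proj₁ (inverse x x≉0)
    xi = proj₂ (inverse x x≉0)
    i≉0 : i ≉ 0#
    i≉0 p = 1≉0 (trans (sym xi) (*-0ʳ p))
    -- x⁻¹ = (x⁻²)² · x³, which reduces the inverse to a square factor and a cube.
    eq : i ≈ i * i * (i * i) * cube x
    eq = begin
      i                                     ≈⟨ solve 1 (λ i → i := :1 :* :1 :* :1 :* i) refl i ⟩
      1# * 1# * 1# * i                      ≈⟨ *-congʳ (*-cong (*-cong (sym xi) (sym xi)) (sym xi)) ⟩
      x * i * (x * i) * (x * i) * i         ≈⟨ solve 2 (λ x i → x :* i :* (x :* i) :* (x :* i) :* i := i :* i :* (i :* i) :* (x :* x :* x)) refl x i ⟩
      i * i * (i * i) * cube x ∎

  -- A square root of -1: the exponent is n / 4. That this exponent is even makes ι a square itself.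
  ι : Carrier
  ι = α ^ (2 ℕ.* (ℕ.suc k ℕ.* d₁))

  -- The exponent is n / 2. The square of this power is 1, but the power is not 1 since no smaller
  -- positive exponent than n gives 1.
  α^half : α ^ (4 ℕ.* (ℕ.suc k ℕ.* d₁)) ≈ - 1#
  α^half = +-inverseˡ-unique′ (domain fact (λ z → notone (x-y≈0 z)))
    where
    h : ℕ
    h = 4 ℕ.* (ℕ.suc k ℕ.* d₁)
    +-inverseˡ-unique′ : α ^ h + 1# ≈ 0# → α ^ h ≈ - 1#
    +-inverseˡ-unique′ = +-inverseˡ-unique _ _
    2h : ∀ m d → 4 ℕ.* (m ℕ.* d) ℕ.+ 4 ℕ.* (m ℕ.* d) ≡ 8 ℕ.* m ℕ.* d
    2h = ℕSolver.solve-∀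
    h+h : h ℕ.+ h ≡ n
    h+h = ≡.trans (2h (ℕ.suc k) d₁) (≡.cong (ℕ._* d₁) (≡.sym m₁-mod8))
    h≢0 : ℕ.NonZero h
    h≢0 = ℕ.>-nonZero (ℕₚ.*-mono-< {0} {4} {0} (ℕ.s≤s ℕ.z≤n) (ℕₚ.*-mono-< {0} {ℕ.suc k} {0} (ℕ.s≤s ℕ.z≤n) (ℕ.>-nonZero⁻¹ d₁)))
    notone : α ^ h ≉ 1#
    notone p = ℕₚ.<⇒≱ (ℕₚ.m<m+n h (ℕ.>-nonZero⁻¹ h {{h≢0}})) (≡.subst (ℕ._≤ h) (≡.sym h+h) (order-minimal h {{h≢0}} p))
    fact : (α ^ h + - 1#) * (α ^ h + 1#) ≈ 0#
    fact = begin
      (α ^ h + - 1#) * (α ^ h + 1#)   ≈⟨ solve 1 (λ x → (x :- :1) :* (x :+ :1) := x :* x :- :1) refl _ ⟩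
      α ^ h * α ^ h + - 1#            ≈⟨ +-congʳ (trans (sym (^-homo-* α h h)) (trans (^-congʳ α h+h) α^n)) ⟩
      1# + - 1#                       ≈⟨ -‿inverseʳ _ ⟩
      0# ∎

  ι² : ι * ι ≈ - 1#
  ι² = trans (sym (^-homo-* α (2 ℕ.* (ℕ.suc k ℕ.* d₁)) (2 ℕ.* (ℕ.suc k ℕ.* d₁)))) (trans (^-congʳ α (4h (ℕ.suc k ℕ.* d₁))) α^half)
    where
    4h : ∀ m → 2 ℕ.* m ℕ.+ 2 ℕ.* m ≡ 4 ℕ.* m
    4h = ℕSolver.solve-∀

  χ-ι : χ ι ≡ 1ℤ
  χ-ι = ≡.trans (Cl-log s₂-periodic (2 ℕ.* (ℕ.suc k ℕ.* d₁)) refl) (s₂-2* (ℕ.suc k ℕ.* d₁))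

  -- ι^8 = 1 and q ≡ 1 modulo 8.
  F-ι : InF ι
  F-ι = begin
    ι ^ q                                    ≈⟨ ^-congʳ ι (≡.trans q-suc (≡.cong ℕ.suc m₁-mod8)) ⟩
    ι * ι ^ (8 ℕ.* ℕ.suc k)                  ≈⟨ *-congˡ (sym (^-assocʳ ι 8 (ℕ.suc k))) ⟩
    ι * (ι ^ 8) ^ ℕ.suc k                    ≈⟨ *-congˡ (^-congˡ (ℕ.suc k) ι^8) ⟩
    ι * 1# ^ ℕ.suc k                         ≈⟨ *-congˡ (1^ (ℕ.suc k)) ⟩
    ι * 1#                                   ≈⟨ *-identityʳ ι ⟩
    ι ∎
    where
    ι^8 : ι ^ 8 ≈ 1#
    ι^8 = begin
      ι ^ 8                                  ≈⟨ solve 1 (λ x → x :* (x :* (x :* (x :* (x :* (x :* (x :* (x :* :1))))))) := (x :* x) :* (x :* x) :* ((x :* x) :* (x :* x))) refl ι ⟩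
      (ι * ι) * (ι * ι) * ((ι * ι) * (ι * ι)) ≈⟨ *-cong (*-cong ι² ι²) (*-cong ι² ι²) ⟩
      - 1# * - 1# * (- 1# * - 1#)            ≈⟨ solve 0 (:- :1 :* :- :1 :* (:- :1 :* :- :1) := :1) refl ⟩
      1# ∎

  χ-neg : ∀ x → χ (- x) ≡ χ x
  χ-neg x = ≡.trans (χ-cong (trans (sym (-1*x≈-x x)) (*-congʳ (sym ι²)))) (≡.trans (χ-* (ι * ι) x)
    (≡.trans (≡.cong (ℤ._* χ x) (≡.trans (χ-* ι ι) (≡.cong₂ ℤ._*_ χ-ι χ-ι))) (ℤₚ.*-identityˡ _)))

  R4-neg : ∀ x → R4 (- x) ≡ R4 x
  R4-neg x = ≡.trans (R4-cong (trans (sym (-1*x≈-x x)) (*-congʳ (sym ι²)))) (≡.trans (R4-sq-* ι x)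
    (≡.trans (≡.cong (ℤ._* R4 x) χ-ι) (ℤₚ.*-identityˡ _)))

  square-root : ∀ {x} → χ x ≡ 1ℤ → ∃ λ m → m * m ≈ x
  square-root {x} p with x ≟ 0#
  square-root {x} () | yes _
  square-root {x} p | no x≉0 with log x≉0
  ... | (j , eq) with parity j
    where
    parity : ∀ j → (∃ λ i → j ≡ 2 ℕ.* i) ⊎ (∃ λ i → j ≡ ℕ.suc (2 ℕ.* i))
    parity ℕ.zero = inj₁ (0 , ≡.refl)
    parity (ℕ.suc j) with parity j
    ... | inj₁ (i , ≡.refl) = inj₂ (i , ≡.refl)
    ... | inj₂ (i , ≡.refl) = inj₁ (ℕ.suc i , ≡.cong ℕ.suc (≡.sym (ℕₚ.+-suc i (i ℕ.+ 0))))
  ...   | inj₁ (i , ≡.refl) = α ^ i , trans (sym (^-homo-* α i i)) (trans (^-congʳ α (≡.cong (i ℕ.+_) (≡.sym (ℕₚ.+-identityʳ i)))) eq)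
  ...   | inj₂ (i , ≡.refl) with ≡.trans (≡.sym p) (s₂-odd i)
  ...     | ()

  -- a square root in E of an element of F lies in F because [E:F] is odd
  F-root : ∀ {m} → InF (m * m) → InF m
  F-root {m} f with φ m + - m ≟ 0#
  ... | yes p = x-y≈0 p
  ... | no ¬p = ⊥-elim (¬p (trans (+-congʳ φm) (begin
      - m + - m          ≈⟨ solve 1 (λ x → :- x :- x := x) refl m ⟩
      m                  ≈⟨ m≈0 ⟩
      0# ∎)))
    where
    φm : φ m ≈ - m
    φm = +-inverseˡ-unique _ _ (domain (begin
      (φ m + - m) * (φ m + m)  ≈⟨ solve 2 (λ x y → (x :- y) :* (x :+ y) := x :* x :- y :* y) refl _ _ ⟩
      φ m * φ m + - (m * m)    ≈⟨ +-congʳ (trans (sym (φ-* m m)) f) ⟩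
      m * m + - (m * m)        ≈⟨ -‿inverseʳ _ ⟩
      0# ∎) ¬p)
    m≈-m : m ≈ - m
    m≈-m = begin
      m                  ≈⟨ sym (φφφ m) ⟩
      φ (φ (φ m))        ≈⟨ φ-cong (trans (φ-cong φm) (trans (φ-neg m) (-‿cong φm))) ⟩
      φ (- - m)          ≈⟨ φ-cong (-‿involutive m) ⟩
      φ m                ≈⟨ φm ⟩
      - m ∎
    m≈0 : m ≈ 0#
    m≈0 = begin
      m                  ≈⟨ solve 1 (λ x → x := :- x :- x) refl m ⟩
      - m + - m          ≈⟨ +-congˡ (sym m≈-m) ⟩
      - m + m            ≈⟨ -‿inverseˡ m ⟩
      0# ∎

  F-square-root : ∀ {x} → InF x → χ x ≡ 1ℤ → ∃ λ m → InF m × m * m ≈ x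
  F-square-root fx p = let (m , eq) = square-root p in m , F-root (F-cong (sym eq) fx) , eq

  -- q ≡ 1 modulo 4 gives q² + q + 1 ≡ 3. Hence taking norms, or passing from α to ω, multiplies
  -- classes modulo 4 by 3.
  d₁≡ : ∃ λ m → d₁ ≡ ℕ.suc (ℕ.suc (ℕ.suc (4 ℕ.* m)))
  d₁≡ = 2 ℕ.* ℕ.suc k ℕ.* (8 ℕ.* ℕ.suc k) ℕ.+ 6 ℕ.* ℕ.suc k , ≡.trans (≡.cong (λ t → t ℕ.* t ℕ.+ t ℕ.+ 1) (≡.trans q-suc (≡.cong ℕ.suc m₁-mod8))) (arith (ℕ.suc k))
    where
    arith : ∀ m → ℕ.suc (8 ℕ.* m) ℕ.* ℕ.suc (8 ℕ.* m) ℕ.+ ℕ.suc (8 ℕ.* m) ℕ.+ 1 ≡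
      ℕ.suc (ℕ.suc (ℕ.suc (4 ℕ.* (2 ℕ.* m ℕ.* (8 ℕ.* m) ℕ.+ 6 ℕ.* m))))
    arith = ℕSolver.solve-∀

  ω≉0 : ω ≉ 0#
  ω≉0 = α^≉0 d₁

  F-ω : InF ω
  F-ω = N-inF α

  d₁-class : ∀ {f} → Periodic f → ∀ j i → f (j ℕ.* d₁ ℕ.+ i) ≡ f (3 ℕ.* j ℕ.+ i)
  d₁-class {f} per j i = let (m , eq) = d₁≡ in
    ≡.trans (≡.cong (λ t → f (j ℕ.* t ℕ.+ i)) eq) (≡.trans (≡.cong f (arith j m i)) (per (j ℕ.* m) (3 ℕ.* j ℕ.+ i)))
    where
    arith : ∀ j m i → j ℕ.* ℕ.suc (ℕ.suc (ℕ.suc (4 ℕ.* m))) ℕ.+ i ≡ 4 ℕ.* (j ℕ.* m) ℕ.+ (3 ℕ.* j ℕ.+ i)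
    arith = ℕSolver.solve-∀

  ω^-log : ∀ j → α ^ (j ℕ.* d₁) ≈ ω ^ j
  ω^-log j = trans (^-congʳ α (ℕₚ.*-comm j d₁)) (sym (^-assocʳ α d₁ j))

  χ-ω : χ ω ≡ -1ℤ
  χ-ω = ≡.trans (Cl-log s₂-periodic (d₁ ℕ.+ 0) (^-congʳ α (ℕₚ.+-identityʳ d₁)))
    (≡.trans (≡.cong (λ t → s₂ (t ℕ.+ 0)) (≡.sym (ℕₚ.*-identityˡ d₁))) (d₁-class s₂-periodic 1 0))

  -- The class of ω³ modulo 4 is 3 · 3 ≡ 1, the same as that of α. Taking the factor inside F allows
  -- sums over F to be rescaled by it.
  ε-split : ∀ x → ε x ≡ R4 x ℤ.+ R4 (ω ^ 3 * x)
  ε-split x with x ≟ 0#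
  ... | yes p = ≡.sym (≡.trans (ℤₚ.+-identityˡ _) (R4-0 (*-0ʳ p)))
  ... | no x≉0 = let (j , p) = log x≉0 in ≡.cong (λ t → s₄ j ℤ.+ t) (≡.sym
      (≡.trans (Cl-log s₄-periodic (3 ℕ.* d₁ ℕ.+ j) (log-* (3 ℕ.* d₁) j (ω^-log 3) p))
        (≡.trans (d₁-class s₄-periodic 3 j) (s₄-periodic 2 (ℕ.suc j)))))

  ε-±1 : ∀ {x} → x ≉ 0# → ε x ≡ 1ℤ ⊎ ε x ≡ -1ℤ
  ε-±1 {x} x≉0 with x ≟ 0#
  ... | yes p = ⊥-elim (x≉0 p)
  ... | no x≉0′ = sε-±1 (proj₁ (log x≉0′))

  ε-ω^ : ∀ j → ε (ω ^ j) ≡ sε (3 ℕ.* j)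
  ε-ω^ j = ≡.trans (Cl-log sε-periodic (j ℕ.* d₁ ℕ.+ 0) (trans (^-congʳ α (ℕₚ.+-identityʳ (j ℕ.* d₁))) (ω^-log j)))
    (≡.trans (d₁-class sε-periodic j 0) (≡.cong sε (ℕₚ.+-identityʳ (3 ℕ.* j))))

  -- The norm multiplies exponents by d₁ ≡ -1 modulo 4, and R4 is even in the exponent.
  R4-N : ∀ x → R4 (N x) ≡ R4 x
  R4-N x with x ≟ 0#
  ... | yes p = R4-0 (trans (N-cong p) (trans (^-congʳ 0# (ℕₚ.+-comm (q ℕ.* q ℕ.+ q) 1)) (0^ (q ℕ.* q ℕ.+ q))))
  ... | no x≉0 = let (j , p) = log x≉0 in
    ≡.trans (Cl-log s₄-periodic (j ℕ.* d₁ ℕ.+ 0) (trans (^-congʳ α (ℕₚ.+-identityʳ (j ℕ.* d₁)))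
        (trans (sym (^-assocʳ α j d₁)) (^-congˡ d₁ p))))
      (≡.trans (d₁-class s₄-periodic j 0) (≡.trans (≡.cong s₄ (ℕₚ.+-identityʳ (3 ℕ.* j))) (s₄-3* j)))

  Resp : (Carrier → ℤ) → Set (c ⊔ ℓ)
  Resp f = ∀ {x y} → x ≈ y → f x ≡ f y

  -- Sums over F.

  ΣF : (Carrier → ℤ) → ℤ
  ΣF = sum (elems Fₗ)

  qℤ : ℤ
  qℤ = ℤ.+ q

  ΣF-cong : ∀ {f g} → (∀ x → InF x → f x ≡ g x) → ΣF f ≡ ΣF g
  ΣF-cong = sum-cong (sound Fₗ)

  ΣF-+ : ∀ f g → ΣF (λ x → f x ℤ.+ g x) ≡ ΣF f ℤ.+ ΣF g
  ΣF-+ = sum-+ (elems Fₗ)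

  ΣF-*ˡ : ∀ j f → ΣF (λ x → j ℤ.* f x) ≡ j ℤ.* ΣF f
  ΣF-*ˡ = sum-*ˡ (elems Fₗ)

  ΣF-*ʳ : ∀ j f → ΣF (λ x → f x ℤ.* j) ≡ ΣF f ℤ.* j
  ΣF-*ʳ = sum-*ʳ (elems Fₗ)

  ΣF-const : ∀ j → ΣF (λ _ → j) ≡ qℤ ℤ.* j
  ΣF-const j = ≡.trans (sum-const (elems Fₗ) j) (≡.cong (λ t → (ℤ.+ t) ℤ.* j) Fₗ-size)

  ΣF-swap : ∀ f → ΣF (λ x → ΣF (f x)) ≡ ΣF (λ y → ΣF (λ x → f x y))
  ΣF-swap = sum-swap (elems Fₗ) (elems Fₗ)

  ΣF-delta : ∀ {f a} → InF a → Resp f → ΣF (λ x → when (x ≟ a) (f x)) ≡ f a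
  ΣF-delta {f} {a} fa rf = sum-delta (_≟ a) f (f a) Fₗ (λ x y _ _ p p′ → trans p (sym p′))
    (Any.map sym (complete Fₗ a fa)) (λ x _ → rf)

  ΣF-none : ∀ {p} {Q : Carrier → Set p} (Q? : ∀ x → Dec (Q x)) f → (∀ x → InF x → ¬ Q x) →
    ΣF (λ x → when (Q? x) (f x)) ≡ 0ℤ
  ΣF-none Q? f = sum-none Q? f (sound Fₗ)

  ΣF-bij : ∀ {f} (g h : Carrier → Carrier) → (∀ {x y} → x ≈ y → g x ≈ g y) → (∀ {x y} → x ≈ y → h x ≈ h y) →
    (∀ {x} → InF x → InF (g x)) → (∀ {x} → InF x → InF (h x)) →
    (∀ x → InF x → h (g x) ≈ x) → (∀ x → InF x → g (h x) ≈ x) → Resp f →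
    ΣF (λ x → f (g x)) ≡ ΣF f
  ΣF-bij {f} g h gc hc gF hF hg gh rf = sum-bij Fₗ Fₗ _≟_ sym trans sym trans g h (λ _ → gF) (λ _ → hF)
    (λ x y fx fy p → trans (hc (sym p)) (hg x fx)) (λ x y fx fy p → trans (gc (sym p)) (gh y fy))
    f (λ _ _ _ _ → rf)

  ΣF-shift : ∀ {f} a → InF a → Resp f → ΣF (λ x → f (x + a)) ≡ ΣF f
  ΣF-shift a fa = ΣF-bij (_+ a) (_+ - a) +-congʳ +-congʳ (λ fx → F-+ fx fa) (λ fx → F-+ fx (F-neg fa))
    (λ x _ → solve 2 (λ x a → x :+ a :- a := x) refl x a) (λ x _ → solve 2 (λ x a → x :- a :+ a := x) refl x a)

  ΣF-scale : ∀ {f} a → InF a → a ≉ 0# → Resp f → ΣF (λ x → f (a * x)) ≡ ΣF f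
  ΣF-scale a fa a≉0 = ΣF-bij (a *_) (inv a *_) *-congˡ *-congˡ (F-* fa) (F-* (F-inv fa))
    (λ x _ → trans (sym (*-assoc _ _ _)) (trans (*-congʳ (trans (*-comm _ _) (inv-right a≉0))) (*-identityˡ x)))
    (λ x _ → trans (sym (*-assoc _ _ _)) (trans (*-congʳ (inv-right a≉0)) (*-identityˡ x)))

  -1≉0 : - 1# ≉ 0#
  -1≉0 = -nonzero 1≉0

  ΣF-neg : ∀ {f} → Resp f → ΣF (λ x → f (- x)) ≡ ΣF f
  ΣF-neg {f} rf = ≡.trans (sum-cong′ (elems Fₗ) (λ x → rf (sym (-1*x≈-x x)))) (ΣF-scale (- 1#) (F-neg F-1) -1≉0 rf)

  inv-inv : ∀ x → inv (inv x) ≈ x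
  inv-inv x = go (x ≟ 0#)
    where
    go : Dec (x ≈ 0#) → inv (inv x) ≈ x
    go (yes p) = trans (inv-0 (inv-0 p)) (sym p)
    go (no ¬p) = sym (inv-unique (trans (*-comm _ _) (inv-right ¬p)))

  ΣF-inv : ∀ {f} → Resp f → ΣF (λ x → f (inv x)) ≡ ΣF f
  ΣF-inv = ΣF-bij inv inv inv-cong inv-cong F-inv F-inv (λ x _ → inv-inv x) (λ x _ → inv-inv x)

  frob-cong : ∀ j {x y} → x ≈ y → frob j x ≈ frob j y
  frob-cong ℕ.zero p = p
  frob-cong (ℕ.suc j) p = cube-cong (frob-cong j p)

  frob-cube : ∀ j x → frob j (cube x) ≈ cube (frob j x)
  frob-cube ℕ.zero x = refl
  frob-cube (ℕ.suc j) x = cube-cong (frob-cube j x)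

  frob-F : ∀ j {x} → InF x → InF (frob j x)
  frob-F ℕ.zero fx = fx
  frob-F (ℕ.suc j) fx = F-cube (frob-F j fx)

  -- e = 0 would make q equal to 1, while q - 1 is a positive multiple of 8.
  2e-pred : ∃ λ j → 2 ℕ.* e ≡ ℕ.suc j
  2e-pred = go (2 ℕ.* e) ≡.refl
    where
    go : ∀ t → 2 ℕ.* e ≡ t → ∃ λ j → t ≡ ℕ.suc j
    go (ℕ.suc j) _ = j , ≡.refl
    go ℕ.zero p = ⊥-elim (absurd (≡.trans (≡.sym m₁-mod8) (ℕₚ.suc-injective
      (≡.trans (≡.sym q-suc) (≡.trans q-pow (≡.cong (3 ℕ.^_) p))))))
      where
      absurd : 8 ℕ.* ℕ.suc k ≡ 0 → ⊥
      absurd ()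

  e₂ : ℕ
  e₂ = proj₁ 2e-pred

  -- The power with exponent 3^(2e - 1) = q / 3, which inverts cubing on F.
  cube-root : Carrier → Carrier
  cube-root = frob e₂

  cube-cube-root : ∀ x → InF x → cube (cube-root x) ≈ x
  cube-cube-root x fx = trans (reflexive (≡.cong (λ t → frob t x) (≡.sym (proj₂ 2e-pred)))) (trans (sym (φ-frob x)) fx)

  ΣF-cube : ∀ {f} → Resp f → ΣF (λ x → f (cube x)) ≡ ΣF f
  ΣF-cube = ΣF-bij cube cube-root cube-cong (frob-cong e₂) F-cube (frob-F e₂)
    (λ x fx → trans (frob-cube e₂ x) (cube-cube-root x fx)) cube-cube-root

  -- The absolute trace of F and the function c = ψ + ψ⁻¹ for an additive character ψ.

  open Char3Solver R three using (⟦_⟧₃; +-hom; -‿hom)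

  trs : ℕ → Carrier → Carrier
  trs ℕ.zero x = 0#
  trs (ℕ.suc j) x = trs j x + frob j x

  tr : Carrier → Carrier
  tr = trs (2 ℕ.* e)

  trs-cong : ∀ j {x y} → x ≈ y → trs j x ≈ trs j y
  trs-cong ℕ.zero p = refl
  trs-cong (ℕ.suc j) p = +-cong (trs-cong j p) (frob-cong j p)

  trs-+ : ∀ j x y → trs j (x + y) ≈ trs j x + trs j y
  trs-+ ℕ.zero x y = sym (+-identityˡ _)
  trs-+ (ℕ.suc j) x y = trans (+-cong (trs-+ j x y) (frob-+ j x y))
    (solve 4 (λ a b c d → a :+ b :+ (c :+ d) := a :+ c :+ (b :+ d)) refl _ _ _ _)

  trs-0 : ∀ j → trs j 0# ≈ 0#
  trs-0 ℕ.zero = refl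
  trs-0 (ℕ.suc j) = trans (+-cong (trs-0 j) (f0 j)) (+-identityˡ _)
    where
    f0 : ∀ j → frob j 0# ≈ 0#
    f0 ℕ.zero = refl
    f0 (ℕ.suc j) = *-0ʳ (f0 j)

  trs-neg : ∀ j x → trs j (- x) ≈ - trs j x
  trs-neg j x = +-inverseˡ-unique _ _ (trans (sym (trs-+ j (- x) x)) (trans (trs-cong j (-‿inverseˡ x)) (trs-0 j)))

  -- A telescoping sum. It yields both the invariance of the trace under cubing on F and, for an
  -- element with φ σ = σ + 1, an element of F of trace 1.
  trs-shift : ∀ j x → trs j (cube x + - x) ≈ frob j x + - x
  trs-shift ℕ.zero x = sym (-‿inverseʳ x)
  trs-shift (ℕ.suc j) x = begin
    trs j (cube x + - x) + frob j (cube x + - x)           ≈⟨ +-cong (trs-shift j x) (frob-+ j (cube x) (- x)) ⟩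
    frob j x + - x + (frob j (cube x) + frob j (- x))      ≈⟨ +-congˡ (+-cong (frob-cube j x) (fneg j)) ⟩
    frob j x + - x + (cube (frob j x) + - frob j x)        ≈⟨ solve 3 (λ a b c → a :- b :+ (c :- a) := c :- b) refl _ _ _ ⟩
    cube (frob j x) + - x ∎
    where
    fneg : ∀ j → frob j (- x) ≈ - frob j x
    fneg ℕ.zero = refl
    fneg (ℕ.suc j) = trans (cube-cong (fneg j)) (solve 1 (λ x → :- x :* :- x :* :- x := :- (x :* x :* x)) refl _)

  tr-shift : ∀ x → tr (cube x + - x) ≈ φ x + - x
  tr-shift x = trans (trs-shift (2 ℕ.* e) x) (+-congʳ (sym (φ-frob x)))

  cube-trs : ∀ j x → cube (trs j x) ≈ trs j (cube x)
  cube-trs ℕ.zero x = zeroʳ _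
  cube-trs (ℕ.suc j) x = trans (cube-+ _ _) (+-cong (cube-trs j x) (sym (frob-cube j x)))

  tr-cube : ∀ {x} → InF x → tr (cube x) ≈ tr x
  tr-cube {x} fx = x-y≈0 (begin
    tr (cube x) + - tr x           ≈⟨ +-congˡ (sym (trs-neg (2 ℕ.* e) x)) ⟩
    tr (cube x) + tr (- x)         ≈⟨ sym (trs-+ (2 ℕ.* e) _ _) ⟩
    tr (cube x + - x)              ≈⟨ tr-shift x ⟩
    φ x + - x                      ≈⟨ +-congʳ fx ⟩
    x + - x                        ≈⟨ -‿inverseʳ x ⟩
    0# ∎)

  -- The trace of an element of F is fixed by cubing, so it is a root of t³ - t.
  tr-𝔽₃ : ∀ {x} → InF x → ∃ λ a → tr x ≈ ⟦ a ⟧₃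
  tr-𝔽₃ {x} fx = go (t ≟ 0#) (t + - 1# ≟ 0#)
    where
    t = tr x
    ct : cube t ≈ t
    ct = trans (cube-trs (2 ℕ.* e) x) (tr-cube fx)
    factors : t * ((t + - 1#) * (t + 1#)) ≈ 0#
    factors = trans (solve 1 (λ t → t :* ((t :- :1) :* (t :+ :1)) := t :* t :* t :- t) refl t)
      (trans (+-congʳ ct) (-‿inverseʳ t))
    go : Dec (t ≈ 0#) → Dec (t + - 1# ≈ 0#) → ∃ λ a → t ≈ ⟦ a ⟧₃
    go (yes p) _ = 𝟘 , p
    go (no _) (yes p) = 𝟙 , x-y≈0 p
    go (no a) (no b) = 𝟚 , +-inverseˡ-unique _ _ (domain (domain factors a) b)

  c₃ : 𝔽₃ → ℤ
  c₃ 𝟘 = ℤ.+ 2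
  c₃ 𝟙 = -1ℤ
  c₃ 𝟚 = -1ℤ

  -- The product formula for twice the cosine; it stands in for the multiplicativity of ψ.
  c₃-+ : ∀ a b → c₃ a ℤ.* c₃ b ≡ c₃ (a +₃ b) ℤ.+ c₃ (a +₃ (-₃ b))
  c₃-+ 𝟘 𝟘 = ≡.refl
  c₃-+ 𝟘 𝟙 = ≡.refl
  c₃-+ 𝟘 𝟚 = ≡.refl
  c₃-+ 𝟙 𝟘 = ≡.refl
  c₃-+ 𝟙 𝟙 = ≡.refl
  c₃-+ 𝟙 𝟚 = ≡.refl
  c₃-+ 𝟚 𝟘 = ≡.refl
  c₃-+ 𝟚 𝟙 = ≡.refl
  c₃-+ 𝟚 𝟚 = ≡.refl

  -- Twice the real part of a cube root of unity, hence an integer.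
  cos : Carrier → ℤ
  cos x with tr x ≟ 0#
  ... | yes _ = ℤ.+ 2
  ... | no _ = -1ℤ

  cos-val : ∀ {x} a → tr x ≈ ⟦ a ⟧₃ → cos x ≡ c₃ a
  cos-val {x} a p with tr x ≟ 0#
  cos-val 𝟘 p | yes z = ≡.refl
  cos-val 𝟙 p | yes z = ⊥-elim (1≉0 (trans (sym p) z))
  cos-val 𝟚 p | yes z = ⊥-elim (-1≉0 (trans (sym p) z))
  cos-val 𝟘 p | no ¬z = ⊥-elim (¬z p)
  cos-val 𝟙 p | no ¬z = ≡.refl
  cos-val 𝟚 p | no ¬z = ≡.refl

  cos-tr : ∀ {x y} → tr x ≈ tr y → cos x ≡ cos y
  cos-tr {x} {y} p with tr x ≟ 0# | tr y ≟ 0#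
  ... | yes _ | yes _ = ≡.refl
  ... | no _  | no _ = ≡.refl
  ... | yes z | no ¬z = ⊥-elim (¬z (trans (sym p) z))
  ... | no ¬z | yes z = ⊥-elim (¬z (trans p z))

  cos-cong : Resp cos
  cos-cong p = cos-tr (trs-cong (2 ℕ.* e) p)

  cos-0 : ∀ {x} → x ≈ 0# → cos x ≡ ℤ.+ 2
  cos-0 p = cos-val 𝟘 (trans (trs-cong (2 ℕ.* e) p) (trs-0 (2 ℕ.* e)))

  cos-+ : ∀ {x y} → InF x → InF y → cos x ℤ.* cos y ≡ cos (x + y) ℤ.+ cos (x + - y)
  cos-+ {x} {y} fx fy = let (a , p) = tr-𝔽₃ fx ; (b , p′) = tr-𝔽₃ fy in
    ≡.trans (≡.cong₂ ℤ._*_ (cos-val a p) (cos-val b p′)) (≡.trans (c₃-+ a b) (≡.sym (≡.cong₂ ℤ._+_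
      (cos-val (a +₃ b) (trans (trs-+ (2 ℕ.* e) x y) (trans (+-cong p p′) (sym (+-hom a b)))))
      (cos-val (a +₃ (-₃ b)) (trans (trs-+ (2 ℕ.* e) x (- y)) (trans (+-cong p (trans (trs-neg (2 ℕ.* e) y)
        (trans (-‿cong p′) (sym (-‿hom b))))) (sym (+-hom a (-₃ b)))))))))

  cos-neg : ∀ {x} → InF x → cos (- x) ≡ cos x
  cos-neg {x} fx = let (a , p) = tr-𝔽₃ fx in
    ≡.trans (cos-val (-₃ a) (trans (trs-neg (2 ℕ.* e) x) (trans (-‿cong p) (sym (-‿hom a)))))
      (≡.trans (c₃-neg a) (≡.sym (cos-val a p)))
    where
    c₃-neg : ∀ a → c₃ (-₃ a) ≡ c₃ a
    c₃-neg 𝟘 = ≡.refl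
    c₃-neg 𝟙 = ≡.refl
    c₃-neg 𝟚 = ≡.refl

  cos-cube : ∀ {x} z → InF x → cos (cube x + z) ≡ cos (x + z)
  cos-cube {x} z fx = cos-tr (trans (trs-+ (2 ℕ.* e) _ _) (trans (+-congʳ (tr-cube fx)) (sym (trs-+ (2 ℕ.* e) _ _))))

  -- Averaging over x ↦ a x, which negates h, removes the shift z.
  even-sum : ∀ a {w : Carrier → ℤ} {h : Carrier → Carrier} z → InF a → a ≉ 0# → InF z → (∀ x → InF x → w (a * x) ≡ w x) →
    (∀ x → InF x → h (a * x) ≈ - h x) → (∀ x → InF x → InF (h x)) → Resp w → (∀ {x y} → x ≈ y → h x ≈ h y) →
    ℤ.+ 2 ℤ.* ΣF (λ x → w x ℤ.* cos (h x + z)) ≡ cos z ℤ.* ΣF (λ x → w x ℤ.* cos (h x))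
  even-sum a {w} {h} z fa a≉0 fz wa ha hF rw rh = ≡-Reasoning.begin
    ℤ.+ 2 ℤ.* S                                                     ≡-Reasoning.≡⟨ two* S ⟩
    S ℤ.+ S                                                         ≡-Reasoning.≡⟨ ≡.cong (λ t → S ℤ.+ t) flip ⟩
    S ℤ.+ ΣF (λ x → w x ℤ.* cos (h x + - z))                        ≡-Reasoning.≡⟨ ≡.sym (ΣF-+ _ _) ⟩
    ΣF (λ x → w x ℤ.* cos (h x + z) ℤ.+ w x ℤ.* cos (h x + - z))    ≡-Reasoning.≡⟨ ΣF-cong (λ x fx →
        ≡.trans (≡.sym (ℤₚ.*-distribˡ-+ (w x) _ _)) (≡.trans (≡.cong (w x ℤ.*_) (≡.sym (cos-+ (hF x fx) fz))) (move (w x) (cos (h x)) (cos z)))) ⟩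
    ΣF (λ x → cos z ℤ.* (w x ℤ.* cos (h x)))                        ≡-Reasoning.≡⟨ ΣF-*ˡ (cos z) _ ⟩
    cos z ℤ.* ΣF (λ x → w x ℤ.* cos (h x)) ≡-Reasoning.∎
    where
    S = ΣF (λ x → w x ℤ.* cos (h x + z))
    two* : ∀ s → ℤ.+ 2 ℤ.* s ≡ s ℤ.+ s
    two* = ℤSolver.solve-∀
    move : ∀ w c d → w ℤ.* (c ℤ.* d) ≡ d ℤ.* (w ℤ.* c)
    move = ℤSolver.solve-∀
    flip : S ≡ ΣF (λ x → w x ℤ.* cos (h x + - z))
    flip = ≡.trans (≡.sym (ΣF-scale a fa a≉0 (λ p → ≡.cong₂ ℤ._*_ (rw p) (cos-cong (+-congʳ (rh p))))))
      (ΣF-cong (λ x fx → ≡.cong₂ ℤ._*_ (wa x fx) (≡.trans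
        (cos-cong (trans (+-congʳ (ha x fx)) (solve 2 (λ h z → :- h :+ z := :- (h :- z)) refl (h x) z)))
        (cos-neg (F-+ (hF x fx) (F-neg fz))))))

  -- Square roots in F and sums over squares.

  root-sum-none : ∀ {u} h → χ u ≡ -1ℤ → ΣF (λ x → when (x * x ≟ u) (h x)) ≡ 0ℤ
  root-sum-none {u} h p = ΣF-none (λ x → x * x ≟ u) h λ x _ eq →
    [ (λ z → absurd (≡.trans (≡.sym p) (χ-0 (trans (sym eq) (*-0ˡ z))))) ,
      (λ nz → absurd′ (≡.trans (≡.sym p) (≡.trans (χ-cong (sym eq)) (χ-sq nz)))) ]′ (cases (x ≟ 0#))
    where
    absurd : -1ℤ ≡ 0ℤ → ⊥
    absurd ()
    absurd′ : -1ℤ ≡ 1ℤ → ⊥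
    absurd′ ()
    cases : ∀ {x} → Dec (x ≈ 0#) → x ≈ 0# ⊎ x ≉ 0#
    cases (yes p) = inj₁ p
    cases (no p) = inj₂ p

  square-zero : ∀ {x} → x * x ≈ 0# → x ≈ 0#
  square-zero {x} p with x ≟ 0#
  ... | yes z = z
  ... | no ¬z = domain p ¬z

  root-sum-0 : ∀ {u} h → Resp h → u ≈ 0# → ΣF (λ x → when (x * x ≟ u) (h x)) ≡ h 0#
  root-sum-0 {u} h rh p = ≡.trans
    (sum-cong′ (elems Fₗ) (λ x → when-cong (x * x ≟ u) (x ≟ 0#)
      (λ eq → square-zero (trans eq p)) (λ z → trans (*-0ˡ z) (sym p)) (λ _ → ≡.refl)))
    (ΣF-delta F-0 rh)

  x≉-x : ∀ {m} → m ≉ 0# → m ≉ - m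
  x≉-x {m} m≉0 p = m≉0 (begin
    m               ≈⟨ solve 1 (λ m → m := :- m :- m) refl m ⟩
    - m + - m       ≈⟨ +-congʳ (sym p) ⟩
    m + - m         ≈⟨ -‿inverseʳ m ⟩
    0# ∎)

  square-eq : ∀ {x m} → x * x ≈ m * m → x ≈ m ⊎ x ≈ - m
  square-eq {x} {m} p with x + - m ≟ 0#
  ... | yes z = inj₁ (x-y≈0 z)
  ... | no ¬z = inj₂ (+-inverseˡ-unique _ _ (domain (begin
    (x + - m) * (x + m)     ≈⟨ solve 2 (λ x m → (x :- m) :* (x :+ m) := x :* x :- m :* m) refl x m ⟩
    x * x + - (m * m)       ≈⟨ +-congʳ p ⟩
    m * m + - (m * m)       ≈⟨ -‿inverseʳ _ ⟩
    0# ∎) ¬z))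

  root-sum-sq : ∀ {u m} h → Resp h → InF m → m ≉ 0# → m * m ≈ u →
    ΣF (λ x → when (x * x ≟ u) (h x)) ≡ h m ℤ.+ h (- m)
  root-sum-sq {u} {m} h rh fm m≉0 eq = ≡.trans (sum-cong′ (elems Fₗ) split)
    (≡.trans (ΣF-+ _ _) (≡.cong₂ ℤ._+_ (ΣF-delta fm rh) (ΣF-delta (F-neg fm) rh)))
    where
    split : ∀ x → when (x * x ≟ u) (h x) ≡ when (x ≟ m) (h x) ℤ.+ when (x ≟ - m) (h x)
    split x with x ≟ m | x ≟ - m
    ... | yes a | yes b = ⊥-elim (x≉-x m≉0 (trans (sym a) b))
    ... | yes a | no b = ≡.trans (when-yes (x * x ≟ u) (h x) (trans (*-cong a a) eq)) (≡.sym (ℤₚ.+-identityʳ _))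
    ... | no a | yes b = ≡.trans (when-yes (x * x ≟ u) (h x) (trans (*-cong b b)
            (trans (solve 1 (λ m → :- m :* :- m := m :* m) refl m) eq))) (≡.sym (ℤₚ.+-identityˡ _))
    ... | no a | no b = when-no (x * x ≟ u) (h x) (λ p → [ a , b ]′ (square-eq (trans p (sym eq))))

  data SquareClass (u : Carrier) : Set (c ⊔ ℓ) where
    zeroᶜ  : u ≈ 0# → SquareClass u
    squareᶜ : ∀ m → InF m → m ≉ 0# → m * m ≈ u → χ u ≡ 1ℤ → SquareClass u
    nonsqᶜ : u ≉ 0# → χ u ≡ -1ℤ → SquareClass u

  classify : ∀ {u} → InF u → SquareClass u
  classify {u} fu = go (u ≟ 0#)
    where
    go : Dec (u ≈ 0#) → SquareClass u
    go (yes p) = zeroᶜ p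
    go (no u≉0) = [ (λ p → let (m , fm , eq) = F-square-root fu p in
        squareᶜ m fm (λ z → u≉0 (trans (sym eq) (*-0ˡ z))) eq p) , nonsqᶜ u≉0 ]′ (χ-±1 u≉0)

  R4-nonsq : ∀ {u} → χ u ≡ -1ℤ → R4 u ≡ 0ℤ
  R4-nonsq {u} p = x≡-x (≡.trans (≡.sym (χ*R4 u)) (≡.trans (≡.cong (ℤ._* R4 u) p) (ℤₚ.-1*i≡-i (R4 u))))

  root-count : ∀ {u} → InF u → ΣF (λ x → when (x * x ≟ u) 1ℤ) ≡ 1ℤ ℤ.+ χ u
  root-count {u} fu with classify fu
  ... | zeroᶜ p = ≡.trans (root-sum-0 (λ _ → 1ℤ) (λ _ → ≡.refl) p) (≡.cong (λ t → 1ℤ ℤ.+ t) (≡.sym (χ-0 p)))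
  ... | squareᶜ m fm m≉0 eq p = ≡.trans (root-sum-sq (λ _ → 1ℤ) (λ _ → ≡.refl) fm m≉0 eq) (≡.cong (λ t → 1ℤ ℤ.+ t) (≡.sym p))
  ... | nonsqᶜ _ p = ≡.trans (root-sum-none (λ _ → 1ℤ) p) (≡.cong (λ t → 1ℤ ℤ.+ t) (≡.sym p))

  -- χ is even, so both roots ± m of u contribute χ m = R4 (m²).
  root-χ : ∀ {u} → InF u → ΣF (λ x → when (x * x ≟ u) (χ x)) ≡ R4 u ℤ.+ R4 u
  root-χ {u} fu with classify fu
  ... | zeroᶜ p = ≡.trans (root-sum-0 χ χ-cong p) (≡.trans (χ-0 refl) (≡.sym (≡.cong₂ ℤ._+_ (R4-0 p) (R4-0 p))))
  ... | squareᶜ m fm m≉0 eq p = ≡.trans (root-sum-sq χ χ-cong fm m≉0 eq) (≡.cong₂ ℤ._+_ r (≡.trans (χ-neg m) r))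
    where
    r : χ m ≡ R4 u
    r = ≡.trans (≡.sym (R4-sq m)) (R4-cong eq)
  ... | nonsqᶜ _ p = ≡.trans (root-sum-none χ p) (≡.sym (≡.cong₂ ℤ._+_ (R4-nonsq p) (R4-nonsq p)))

  fiber-sum : ∀ (h : Carrier → ℤ) {g} → Resp g → ΣF (λ x → h x ℤ.* g (x * x)) ≡
    ΣF (λ u → ΣF (λ x → when (x * x ≟ u) (h x)) ℤ.* g u)
  fiber-sum h {g} rg = ≡.trans (ΣF-cong (λ x fx → ≡.sym (sum-delta (x * x ≟_) (λ u → h x ℤ.* g u) (h x ℤ.* g (x * x)) Fₗ
      (λ _ _ _ _ p p′ → trans (sym p) p′) (complete Fₗ (x * x) (F-* fx fx)) (λ u _ p → ≡.cong (h x ℤ.*_) (rg (sym p))))))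
    (≡.trans (ΣF-swap _) (sum-cong′ (elems Fₗ) (λ u → ≡.trans
      (sum-cong′ (elems Fₗ) (λ x → ≡.trans (when-cong (x * x ≟ u) (x * x ≟ u) (λ p → p) (λ p → p) (λ _ → ℤₚ.*-comm (h x) (g u)))
        (≡.trans (≡.sym (when-* (x * x ≟ u) (g u) (h x))) (ℤₚ.*-comm (g u) (when (x * x ≟ u) (h x))))))
      (ΣF-*ʳ (g u) _))))

  -- Sorting by u = x², with 1 + χ u square roots for each u.
  sum-squares : ∀ {g} → Resp g → ΣF (λ x → g (x * x)) ≡ ΣF g ℤ.+ ΣF (λ u → χ u ℤ.* g u)
  sum-squares {g} rg = ≡.trans (sum-cong′ (elems Fₗ) (λ x → ≡.sym (ℤₚ.*-identityˡ _)))
    (≡.trans (fiber-sum (λ _ → 1ℤ) rg) (≡.trans (ΣF-cong (λ u fu → ≡.trans (≡.cong (ℤ._* g u) (root-count fu))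
      (expand (χ u) (g u)))) (ΣF-+ _ _)))
    where
    expand : ∀ a b → (1ℤ ℤ.+ a) ℤ.* b ≡ b ℤ.+ a ℤ.* b
    expand = ℤSolver.solve-∀

  -- Read from right to left, this trades R4 for the genuine character χ at the price of squaring
  -- the argument.
  sum-χ-squares : ∀ {g} → Resp g → ΣF (λ x → χ x ℤ.* g (x * x)) ≡ ℤ.+ 2 ℤ.* ΣF (λ u → R4 u ℤ.* g u)
  sum-χ-squares {g} rg = ≡.trans (fiber-sum χ rg) (≡.trans (ΣF-cong (λ u fu → ≡.trans (≡.cong (ℤ._* g u) (root-χ fu))
      (expand (R4 u) (g u)))) (ΣF-*ˡ (ℤ.+ 2) _))
    where
    expand : ∀ a b → (a ℤ.+ a) ℤ.* b ≡ ℤ.+ 2 ℤ.* (a ℤ.* b)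
    expand = ℤSolver.solve-∀

  -- Gauss sums for χ and R4.

  module Additive (σ : Carrier) (φσ : φ σ ≈ σ + 1#) where

    -- The norm of σ and the constant in its equation x³ - x = `r₀`. It lies in F and has absolute
    -- trace 1, which shows that ψ is not trivial.
    r₀ : Carrier
    r₀ = cube σ + - σ

    tr-r₀ : tr r₀ ≈ 1#
    tr-r₀ = trans (tr-shift σ) (trans (+-congʳ φσ) (solve 1 (λ s → s :+ :1 :- s := :1) refl σ))

    F-r₀ : InF r₀
    F-r₀ = begin
      φ (cube σ + - σ)                  ≈⟨ trans (φ-+ _ _) (+-cong (trans (φ-* _ _) (*-congʳ (φ-* _ _))) (φ-neg σ)) ⟩
      cube (φ σ) + - φ σ                ≈⟨ +-cong (cube-cong φσ) (-‿cong φσ) ⟩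
      cube (σ + 1#) + - (σ + 1#)        ≈⟨ solve 1 (λ s → (s :+ :1) :* (s :+ :1) :* (s :+ :1) :- (s :+ :1) := s :* s :* s :- s) refl σ ⟩
      cube σ + - σ ∎

    cos-r₀ : cos r₀ ≡ -1ℤ
    cos-r₀ = cos-val 𝟙 tr-r₀

    r₀≉0 : r₀ ≉ 0#
    r₀≉0 p with ≡.trans (≡.sym cos-r₀) (cos-0 p)
    ... | ()

    -- Multiplication by cos `r₀` = -1 turns the sum S into two shifted copies of itself, so - S = 2
    -- S.
    ΣF-cos : ΣF cos ≡ 0ℤ
    ΣF-cos = ℤₚ.*-cancelˡ-≡ (ℤ.+ 3) S 0ℤ (≡.trans (3* S) (≡.trans (≡.cong (λ t → t ℤ.+ S) (≡.sym doubled)) (≡.trans (cancel S) ≡.refl)))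
      where
      S = ΣF cos
      3* : ∀ s → ℤ.+ 3 ℤ.* s ≡ (s ℤ.+ s) ℤ.+ s
      3* = ℤSolver.solve-∀
      cancel : ∀ s → -1ℤ ℤ.* s ℤ.+ s ≡ 0ℤ
      cancel = ℤSolver.solve-∀
      doubled : -1ℤ ℤ.* S ≡ S ℤ.+ S
      doubled = ≡.trans (≡.sym (ΣF-*ˡ -1ℤ cos)) (≡.trans (ΣF-cong (λ x fx → ≡.trans (≡.cong (ℤ._* cos x) (≡.sym cos-r₀))
        (≡.trans (ℤₚ.*-comm (cos r₀) (cos x)) (cos-+ fx F-r₀))))
        (≡.trans (ΣF-+ _ _) (≡.cong₂ ℤ._+_ (ΣF-shift r₀ F-r₀ cos-cong) (ΣF-shift (- r₀) (F-neg F-r₀) cos-cong))))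

    orth : ∀ {x} → InF x → ΣF (λ u → cos (x * u)) ≡ when (x ≟ 0#) (ℤ.+ 2 ℤ.* qℤ)
    orth {x} fx with x ≟ 0#
    ... | yes p = ≡.trans (sum-cong′ (elems Fₗ) (λ u → cos-0 (*-0ˡ p))) (≡.trans (ΣF-const (ℤ.+ 2)) (ℤₚ.*-comm qℤ (ℤ.+ 2)))
    ... | no ¬p = ≡.trans (ΣF-scale x fx ¬p cos-cong) ΣF-cos

    linear-sum : ∀ {x z} → InF x → InF z → ΣF (λ u → cos (x * u + z)) ≡ when (x ≟ 0#) (qℤ ℤ.* cos z)
    linear-sum {x} {z} fx fz = ℤₚ.*-cancelˡ-≡ (ℤ.+ 2) _ _ (≡.trans
      (≡.cong (λ t → ℤ.+ 2 ℤ.* t) (sum-cong′ (elems Fₗ) (λ u → ≡.sym (ℤₚ.*-identityˡ _))))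
      (≡.trans (even-sum (- 1#) {λ _ → 1ℤ} {λ u → x * u} z (F-neg F-1) -1≉0 fz (λ _ _ → ≡.refl)
        (λ u _ → solve 2 (λ x u → x :* (:- :1 :* u) := :- (x :* u)) refl x u) (λ _ → F-* fx) (λ _ → ≡.refl) *-congˡ)
      (≡.trans (≡.cong (cos z ℤ.*_) (≡.trans (sum-cong′ (elems Fₗ) (λ u → ℤₚ.*-identityˡ _)) (orth fx)))
      (≡.trans (when-* (x ≟ 0#) (cos z) (ℤ.+ 2 ℤ.* qℤ)) (≡.trans
        (when-cong (x ≟ 0#) (x ≟ 0#) (λ p → p) (λ p → p) (λ _ → move (cos z) qℤ)) (≡.sym (when-* (x ≟ 0#) (ℤ.+ 2) _)))))))
      where
      move : ∀ c q → c ℤ.* (ℤ.+ 2 ℤ.* q) ≡ ℤ.+ 2 ℤ.* (q ℤ.* c)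
      move = ℤSolver.solve-∀

    gauss : (Carrier → ℤ) → ℤ
    gauss f = ΣF (λ u → f u ℤ.* cos u)

    -- The factor 4 arises because ψ + ψ⁻¹ doubles the classical Gauss sum of an even function. The
    -- twisting rule is a hypothesis because R4 is no character and needs an argument of its own.
    gauss² : ∀ f → Resp f → f 1# ≡ 1ℤ → f (- 1#) ≡ 1ℤ →
      (∀ {y} → InF y → ΣF (λ u → f u ℤ.* cos (u * y)) ≡ f y ℤ.* gauss f) →
      gauss f ℤ.* gauss f ≡ ℤ.+ 4 ℤ.* qℤ
    gauss² f rf f1 f-1 twist = ≡-Reasoning.begin
      gauss f ℤ.* gauss f                                      ≡-Reasoning.≡⟨ ≡.sym (ΣF-*ʳ (gauss f) _) ⟩
      ΣF (λ u → f u ℤ.* cos u ℤ.* gauss f)                     ≡-Reasoning.≡⟨ ΣF-cong (λ u fu → ≡.trans (swap₁ (f u) (cos u) (gauss f))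
          (≡.trans (≡.cong (cos u ℤ.*_) (≡.sym (twist fu))) (≡.sym (ΣF-*ˡ (cos u) _)))) ⟩
      ΣF (λ u → ΣF (λ w → cos u ℤ.* (f w ℤ.* cos (w * u))))    ≡-Reasoning.≡⟨ ΣF-swap _ ⟩
      ΣF (λ w → ΣF (λ u → cos u ℤ.* (f w ℤ.* cos (w * u))))    ≡-Reasoning.≡⟨ ΣF-cong (λ w fw → ≡.trans
          (ΣF-cong (λ u fu → ≡.trans (swap₁′ (cos u) (f w) (cos (w * u))) (≡.cong (f w ℤ.*_) (≡.trans (cos-+ (F-* fw fu) fu)
            (≡.cong₂ ℤ._+_ (cos-cong (solve 2 (λ w u → w :* u :+ u := (w :+ :1) :* u) refl w u))
               (cos-cong (solve 2 (λ w u → w :* u :- u := (w :- :1) :* u) refl w u)))))))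
          (≡.trans (ΣF-*ˡ (f w) _) (≡.trans (≡.cong (f w ℤ.*_) (≡.trans (ΣF-+ _ _)
            (≡.cong₂ ℤ._+_ (orth (F-+ fw F-1)) (orth (F-+ fw (F-neg F-1)))))) (ℤₚ.*-distribˡ-+ (f w) _ _)))) ⟩
      ΣF (λ w → f w ℤ.* when (w + 1# ≟ 0#) 2q ℤ.+ f w ℤ.* when (w + - 1# ≟ 0#) 2q)  ≡-Reasoning.≡⟨ ΣF-+ _ _ ⟩
      ΣF (λ w → f w ℤ.* when (w + 1# ≟ 0#) 2q) ℤ.+ ΣF (λ w → f w ℤ.* when (w + - 1# ≟ 0#) 2q)
          ≡-Reasoning.≡⟨ ≡.cong₂ ℤ._+_ (pick (- 1#) (λ w → w + 1#) (F-neg F-1) (λ p → +-inverseˡ-unique _ _ p) (λ p → trans (+-congʳ p) (-‿inverseˡ 1#)) f-1)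
               (pick 1# (λ w → w + - 1#) F-1 x-y≈0 (λ p → trans (+-congʳ p) (-‿inverseʳ 1#)) f1) ⟩
      2q ℤ.+ 2q                                                ≡-Reasoning.≡⟨ four qℤ ⟩
      ℤ.+ 4 ℤ.* qℤ ≡-Reasoning.∎
      where
      2q = ℤ.+ 2 ℤ.* qℤ
      four : ∀ q → ℤ.+ 2 ℤ.* q ℤ.+ ℤ.+ 2 ℤ.* q ≡ ℤ.+ 4 ℤ.* q
      four = ℤSolver.solve-∀
      swap₁ : ∀ a b c → a ℤ.* b ℤ.* c ≡ b ℤ.* (a ℤ.* c)
      swap₁ = ℤSolver.solve-∀
      swap₁′ : ∀ a b c → a ℤ.* (b ℤ.* c) ≡ b ℤ.* (c ℤ.* a)
      swap₁′ = ℤSolver.solve-∀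
      pick : ∀ a (g : Carrier → Carrier) → InF a → (∀ {w} → g w ≈ 0# → w ≈ a) → (∀ {w} → w ≈ a → g w ≈ 0#) → f a ≡ 1ℤ →
        ΣF (λ w → f w ℤ.* when (g w ≟ 0#) 2q) ≡ 2q
      pick a g fa to from fa1 = ≡.trans (sum-cong′ (elems Fₗ) (λ w → ≡.trans (when-* (g w ≟ 0#) (f w) 2q)
          (when-cong (g w ≟ 0#) (w ≟ a) to from (λ p → ≡.trans (≡.cong (ℤ._* 2q) (≡.trans (rf (to p)) fa1)) (ℤₚ.*-identityˡ 2q)))))
        (ΣF-delta fa (λ _ → ≡.refl))

    γ₀ Γ : ℤ
    γ₀ = gauss χ
    Γ = gauss R4

    χ-twist : ∀ {y} → InF y → y ≉ 0# → ΣF (λ u → χ u ℤ.* cos (y * u)) ≡ χ y ℤ.* γ₀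
    χ-twist {y} fy y≉0 = ≡.trans (ΣF-cong (λ u _ → ≡.trans (≡.sym (ℤₚ.*-identityˡ _)) (≡.trans (≡.cong (ℤ._* (χ u ℤ.* cos (y * u))) (≡.sym (χ-² y≉0)))
        (≡.trans (regroup (χ y) (χ u) _) (≡.cong (λ t → χ y ℤ.* (t ℤ.* cos (y * u))) (≡.sym (χ-* y u)))))))
      (≡.trans (ΣF-*ˡ (χ y) _) (≡.cong (χ y ℤ.*_) (ΣF-scale y fy y≉0 (λ p → ≡.cong₂ ℤ._*_ (χ-cong p) (cos-cong p)))))
      where
      regroup : ∀ a b c → a ℤ.* a ℤ.* (b ℤ.* c) ≡ a ℤ.* (a ℤ.* b ℤ.* c)
      regroup = ℤSolver.solve-∀

    ΣF-χ : ΣF χ ≡ 0ℤ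
    ΣF-χ = x≡-x (≡.trans (≡.sym (ΣF-scale ω F-ω ω≉0 χ-cong)) (≡.trans (sum-cong′ (elems Fₗ) (λ u →
      ≡.trans (χ-* ω u) (≡.cong (ℤ._* χ u) χ-ω))) (≡.trans (ΣF-*ˡ -1ℤ χ) (ℤₚ.-1*i≡-i _))))

    ΣF-R4 : ΣF R4 ≡ 0ℤ
    ΣF-R4 = x≡-x (≡.trans (≡.sym (ΣF-scale (ω * ω) (F-* F-ω F-ω) (*-nonzero ω≉0 ω≉0) R4-cong)) (≡.trans (sum-cong′ (elems Fₗ) (λ u →
      ≡.trans (R4-sq-* ω u) (≡.cong (ℤ._* R4 u) χ-ω))) (≡.trans (ΣF-*ˡ -1ℤ R4) (ℤₚ.-1*i≡-i _))))

    γ₀² : γ₀ ℤ.* γ₀ ≡ ℤ.+ 4 ℤ.* qℤ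
    γ₀² = gauss² χ χ-cong χ-1 (≡.trans (χ-neg 1#) χ-1) (λ {y} fy → twist fy (y ≟ 0#))
      where
      twist : ∀ {y} → InF y → Dec (y ≈ 0#) → ΣF (λ u → χ u ℤ.* cos (u * y)) ≡ χ y ℤ.* γ₀
      twist fy (yes p) = ≡.trans (sum-cong′ (elems Fₗ) (λ u → ≡.cong (χ u ℤ.*_) (cos-0 (*-0ʳ p))))
        (≡.trans (ΣF-*ʳ (ℤ.+ 2) χ) (≡.trans (≡.cong (ℤ._* (ℤ.+ 2)) ΣF-χ) (≡.sym (≡.cong (ℤ._* γ₀) (χ-0 p)))))
      twist {y} fy (no ¬p) = ≡.trans (sum-cong′ (elems Fₗ) (λ u → ≡.cong (χ u ℤ.*_) (cos-cong (*-comm u y)))) (χ-twist fy ¬p)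

    R4-twist : ∀ {y} → InF y → ΣF (λ u → R4 u ℤ.* cos (u * y)) ≡ R4 y ℤ.* Γ
    R4-twist {y} fy = go (classify fy)
      where
      Y = ΣF (λ u → R4 u ℤ.* cos (u * y))
      go : SquareClass y → Y ≡ R4 y ℤ.* Γ
      go (zeroᶜ p) = ≡.trans (sum-cong′ (elems Fₗ) (λ u → ≡.cong (R4 u ℤ.*_) (cos-0 (*-0ʳ p))))
        (≡.trans (ΣF-*ʳ (ℤ.+ 2) R4) (≡.trans (≡.cong (ℤ._* (ℤ.+ 2)) ΣF-R4) (≡.sym (≡.cong (ℤ._* Γ) (R4-0 p)))))
      go (squareᶜ m fm m≉0 eq p) = ≡.trans (ΣF-cong (λ u _ → ≡.trans (≡.sym (ℤₚ.*-identityˡ _)) (≡.trans (≡.cong (ℤ._* (R4 u ℤ.* cos (u * y))) (≡.sym (χ-² m≉0)))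
            (≡.trans (regroup (χ m) (R4 u) _) (≡.cong₂ (λ s t → χ m ℤ.* (s ℤ.* t)) (≡.sym (R4-sq-* m u)) (cos-cong (trans (*-comm u y) (*-congʳ (sym eq)))))))))
          (≡.trans (ΣF-*ˡ (χ m) _) (≡.cong₂ ℤ._*_ (≡.trans (≡.sym (R4-sq m)) (R4-cong eq))
            (ΣF-scale (m * m) (F-* fm fm) (*-nonzero m≉0 m≉0) (λ p → ≡.cong₂ ℤ._*_ (R4-cong p) (cos-cong p)))))
        where
        regroup : ∀ a b c → a ℤ.* a ℤ.* (b ℤ.* c) ≡ a ℤ.* (a ℤ.* b ℤ.* c)
        regroup = ℤSolver.solve-∀
      -- Frobenius sends the sum for y to the sum for y³, scaling by y² negates it
      go (nonsqᶜ y≉0 p) = ≡.trans (x≡-x (≡.trans by-frobenius (≡.trans (≡.sym (ℤₚ.neg-involutive _)) (≡.cong ℤ.-_ (≡.sym by-scaling)))))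
          (≡.sym (≡.cong (ℤ._* Γ) (R4-nonsq p)))
        where
        Y′ = ΣF (λ v → R4 v ℤ.* cos (v * cube y))
        by-frobenius : Y ≡ Y′
        by-frobenius = ≡.trans (ΣF-cong (λ u fu → ≡.cong₂ ℤ._*_ (≡.sym (R4-cube u))
            (cos-tr (trans (sym (tr-cube (F-* fu fy))) (trs-cong (2 ℕ.* e) (solve 2 (λ u y → (u :* y) :* (u :* y) :* (u :* y) := u :* u :* u :* (y :* y :* y)) refl u y))))))
          (ΣF-cube {f = λ v → R4 v ℤ.* cos (v * cube y)} (λ p → ≡.cong₂ ℤ._*_ (R4-cong p) (cos-cong (*-congʳ p))))
        by-scaling : Y ≡ ℤ.- Y′
        by-scaling = ≡.trans (≡.sym (ΣF-scale (y * y) (F-* fy fy) (*-nonzero y≉0 y≉0) (λ p → ≡.cong₂ ℤ._*_ (R4-cong p) (cos-cong (*-congʳ p)))))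
          (≡.trans (sum-cong′ (elems Fₗ) (λ v → ≡.trans (≡.cong₂ ℤ._*_ (≡.trans (R4-sq-* y v) (≡.cong (ℤ._* R4 v) p))
              (cos-cong (solve 2 (λ y v → y :* y :* v :* y := v :* (y :* y :* y)) refl y v))) (ℤₚ.*-assoc -1ℤ (R4 v) _)))
            (≡.trans (ΣF-*ˡ -1ℤ _) (ℤₚ.-1*i≡-i _)))

    Γ² : Γ ℤ.* Γ ≡ ℤ.+ 4 ℤ.* qℤ
    Γ² = gauss² R4 R4-cong R4-1 (≡.trans (R4-neg 1#) R4-1) R4-twist

    -- Here -1 = ι² is used.
    quadratic-sum : ∀ {u z} → InF u → u ≉ 0# → InF z →
      ℤ.+ 2 ℤ.* ΣF (λ t → cos (u * (t * t) + z)) ≡ cos z ℤ.* (χ u ℤ.* γ₀)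
    quadratic-sum {u} {z} fu u≉0 fz = ≡.trans
      (≡.cong (λ t → ℤ.+ 2 ℤ.* t) (sum-cong′ (elems Fₗ) (λ t → ≡.sym (ℤₚ.*-identityˡ _))))
      (≡.trans (even-sum ι {λ _ → 1ℤ} {λ t → u * (t * t)} z F-ι (α^≉0 (2 ℕ.* (ℕ.suc k ℕ.* d₁))) fz (λ _ _ → ≡.refl)
        (λ t _ → trans (solve 3 (λ u i t → u :* ((i :* t) :* (i :* t)) := i :* i :* (u :* (t :* t))) refl u ι t)
           (trans (*-congʳ ι²) (-1*x≈-x _))) (λ t ft → F-* fu (F-* ft ft)) (λ _ → ≡.refl) (λ p → *-congˡ (*-cong p p)))
      (≡.cong (cos z ℤ.*_) (≡.trans (sum-cong′ (elems Fₗ) (λ t → ℤₚ.*-identityˡ _))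
        (≡.trans (sum-squares {λ x → cos (u * x)} (λ p → cos-cong (*-congˡ p)))
          (≡.trans (≡.cong₂ ℤ._+_ (≡.trans (ΣF-scale u fu u≉0 cos-cong) ΣF-cos) (χ-twist fu u≉0)) (ℤₚ.+-identityˡ _))))))

  infixr 2 stepℤ′
  stepℤ′ : ∀ (x : ℤ) {y z} → y ≡ z → x ≡ y → x ≡ z
  stepℤ′ x p p′ = ≡.trans p′ p
  syntax stepℤ′ x p p′ = x ≡⟪ p′ ⟫ p

  2* : ∀ x → x ℤ.+ x ≡ ℤ.+ 2 ℤ.* x
  2* = ℤSolver.solve-∀

  cancel-2 : ∀ {x y} → ℤ.+ 2 ℤ.* x ≡ ℤ.+ 2 ℤ.* y → x ≡ y
  cancel-2 {x} {y} = ℤₚ.*-cancelˡ-≡ (ℤ.+ 2) x y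

  sign-eq : ∀ {a b} → a ℤ.* a ≡ 1ℤ → a ℤ.* b ≡ 1ℤ → a ≡ b
  sign-eq {a} {b} p p′ = ≡.trans (≡.sym (ℤₚ.*-identityʳ a)) (≡.trans (≡.cong (a ℤ.*_) (≡.sym p′))
    (≡.trans (≡.sym (ℤₚ.*-assoc a a b)) (≡.trans (≡.cong (ℤ._* b) p) (ℤₚ.*-identityˡ b))))

  sign-neg : ∀ {a b} → a ℤ.* a ≡ 1ℤ → a ℤ.* b ≡ -1ℤ → a ℤ.+ b ≡ 0ℤ
  sign-neg {a} {b} p p′ = ≡.trans (≡.cong (λ t → a ℤ.+ t) b≡) (ℤₚ.+-inverseʳ a)
    where
    neg1 : ∀ a → a ℤ.* -1ℤ ≡ ℤ.- a
    neg1 = ℤSolver.solve-∀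
    b≡ : b ≡ ℤ.- a
    b≡ = ≡.trans (≡.sym (ℤₚ.*-identityˡ b)) (≡.trans (≡.cong (ℤ._* b) (≡.sym p))
      (≡.trans (ℤₚ.*-assoc a a b) (≡.trans (≡.cong (a ℤ.*_) p′) (neg1 a))))

  inv-cancel : ∀ {x} y → x ≉ 0# → x * (inv x * y) ≈ y
  inv-cancel y x≉0 = trans (sym (*-assoc _ _ _)) (trans (*-congʳ (inv-right x≉0)) (*-identityˡ y))

  inv-* : ∀ {x y} → x ≉ 0# → y ≉ 0# → inv (x * y) ≈ inv x * inv y
  inv-* {x} {y} x≉0 y≉0 = sym (inv-unique (trans
    (solve 4 (λ x y a b → x :* y :* (a :* b) := x :* a :* (y :* b)) refl x y (inv x) (inv y))
    (trans (*-cong (inv-right x≉0) (inv-right y≉0)) (*-identityˡ 1#))))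

  inv-neg : ∀ x → inv (- x) ≈ - inv x
  inv-neg x = go (x ≟ 0#)
    where
    go : Dec (x ≈ 0#) → inv (- x) ≈ - inv x
    go (yes p) = trans (inv-0 (trans (-‿cong p) -0#≈0#)) (sym (trans (-‿cong (inv-0 p)) -0#≈0#))
    go (no ¬p) = sym (inv-unique (trans (solve 2 (λ x y → :- x :* :- y := x :* y) refl x (inv x)) (inv-right ¬p)))

  χ-inv : ∀ x → χ (inv x) ≡ χ x
  χ-inv x = go (x ≟ 0#)
    where
    go : Dec (x ≈ 0#) → χ (inv x) ≡ χ x
    go (yes p) = χ-cong (trans (inv-0 p) (sym p))
    go (no ¬p) = ≡.sym (sign-eq (χ-² ¬p) (≡.trans (≡.sym (χ-* x (inv x))) (≡.trans (χ-cong (inv-right ¬p)) χ-1)))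

  -- For m² = y² - 1 the element x = y + m has inverse y - m, and (y - 1) x = - (1 - x)². So if y² -
  -- 1 is not 0, every root gives the sign χ (y - 1). As χ (y - 1) χ (y + 1) = χ (y² - 1), the two
  -- signs on the right agree when there are two roots and cancel when there is none.
  disc-sum : ∀ {y} → InF y → ΣF (λ m → when (m * m ≟ y * y + - 1#) (χ (y + m))) ≡ χ (y + - 1#) ℤ.+ χ (y + 1#)
  disc-sum {y} fy = go (classify (F-+ (F-* fy fy) (F-neg F-1)))
    where
    D = y * y + - 1#
    χD : χ (y + - 1#) ℤ.* χ (y + 1#) ≡ χ D
    χD = ≡.trans (≡.sym (χ-* _ _)) (χ-cong (solve 1 (λ y → (y :- :1) :* (y :+ :1) := y :* y :- :1) refl y))
    rh : Resp (λ m → χ (y + m))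
    rh p = χ-cong (+-congˡ p)
    y-1≉0 : D ≉ 0# → y + - 1# ≉ 0#
    y-1≉0 D≉0 p = D≉0 (trans (solve 1 (λ y → y :* y :- :1 := (y :- :1) :* (y :+ :1)) refl y) (*-0ˡ p))
    at-root : ∀ m → D ≉ 0# → m * m ≈ D → χ (y + m) ≡ χ (y + - 1#)
    at-root m D≉0 eq = ≡.sym (sign-eq (χ-² (y-1≉0 D≉0)) (≡.trans (≡.sym (χ-* _ _)) (≡.trans (χ-cong shape)
        (≡.trans (χ-neg _) (χ-sq x≉1)))))
      where
      x = y + m
      shape : (y + - 1#) * x ≈ - ((1# + - x) * (1# + - x))
      shape = x-y≈0 (begin
        (y + - 1#) * x + - - ((1# + - x) * (1# + - x))
          ≈⟨ solve 2 (λ y m → (y :- :1) :* (y :+ m) :- :- ((:1 :- (y :+ m)) :* (:1 :- (y :+ m))) := m :* m :- (y :* y :- :1)) refl y m ⟩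
        m * m + - D    ≈⟨ +-congʳ eq ⟩
        D + - D        ≈⟨ -‿inverseʳ D ⟩
        0# ∎)
      x≉1 : 1# + - x ≉ 0#
      x≉1 p = y-1≉0 D≉0 (trans (sym (*-identityʳ _)) (trans (*-congˡ (x-y≈0 p))
        (trans shape (trans (-‿cong (*-0ˡ p)) -0#≈0#))))
    go : SquareClass D → ΣF (λ m → when (m * m ≟ D) (χ (y + m))) ≡ χ (y + - 1#) ℤ.+ χ (y + 1#)
    go (zeroᶜ p) = ≡.trans (root-sum-0 _ rh p) (≡.trans (χ-cong (+-identityʳ y))
      ([ (λ y≈1 → ≡.trans (≡.trans (χ-cong y≈1) χ-1) (≡.sym (≡.cong₂ ℤ._+_ (χ-0 (trans (+-congʳ y≈1) (-‿inverseʳ 1#)))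
             (≡.trans (χ-cong (trans (+-congʳ y≈1) (solve 0 (:1 :+ :1 := :- :1) refl))) (≡.trans (χ-neg 1#) χ-1)))))
       , (λ y≈-1 → ≡.trans (≡.trans (χ-cong y≈-1) (≡.trans (χ-neg 1#) χ-1)) (≡.sym (≡.cong₂ ℤ._+_
             (≡.trans (χ-cong (trans (+-congʳ y≈-1) (solve 0 (:- :1 :- :1 := :1) refl))) χ-1)
             (χ-0 (trans (+-congʳ y≈-1) (-‿inverseˡ 1#)))))) ]′
       (square-eq {y} {1#} (trans (x-y≈0 p) (sym (*-identityʳ 1#))))))
    go (squareᶜ m fm m≉0 eq p) = ≡.trans (root-sum-sq _ rh fm m≉0 eq) (≡.cong₂ ℤ._+_ (at-root m D≉0 eq)
        (≡.trans (at-root (- m) D≉0 (trans (solve 1 (λ m → :- m :* :- m := m :* m) refl m) eq))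
          (sign-eq (χ-² (y-1≉0 D≉0)) (≡.trans χD p))))
      where
      D≉0 : D ≉ 0#
      D≉0 z = *-nonzero m≉0 m≉0 (trans eq z)
    go (nonsqᶜ D≉0 p) = ≡.trans (root-sum-none _ p) (≡.sym (sign-neg {χ (y + - 1#)} {χ (y + 1#)} (χ-² (y-1≉0 D≉0)) (≡.trans χD p)))

  -- The fibre of x ↦ x + x⁻¹ over y consists of the roots of x² - x y + 1, whose discriminant is y²
  -- - 4 = y² - 1.
  sum-x+1/x : ∀ {f} → Resp f → ΣF (λ x → χ x ℤ.* f (x + inv x)) ≡ ΣF (λ y → (χ (y + - 1#) ℤ.+ χ (y + 1#)) ℤ.* f y)
  sum-x+1/x {f} rf =
    ΣF (λ x → χ x ℤ.* f (x + inv x))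
      ≡⟪ ΣF-cong (λ x fx → ≡.sym (inner x fx (x ≟ 0#))) ⟫
    ΣF (λ x → ΣF (λ y → when (x * x + 1# ≟ x * y) (χ x ℤ.* f y)))
      ≡⟪ ΣF-swap (λ x y → when (x * x + 1# ≟ x * y) (χ x ℤ.* f y)) ⟫
    ΣF (λ y → ΣF (λ x → when (x * x + 1# ≟ x * y) (χ x ℤ.* f y)))
      ≡⟪ ΣF-cong (λ y fy → ≡.trans (sum-cong′ (elems Fₗ) (λ x → ≡.trans (when-cong (x * x + 1# ≟ x * y) (x * x + 1# ≟ x * y)
           (λ p → p) (λ p → p) (λ _ → ℤₚ.*-comm (χ x) (f y))) (≡.trans (≡.sym (when-* (x * x + 1# ≟ x * y) (f y) (χ x))) (ℤₚ.*-comm (f y) (when (x * x + 1# ≟ x * y) (χ x))))))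
         (≡.trans (ΣF-*ʳ (f y) (λ x → when (x * x + 1# ≟ x * y) (χ x))) (≡.cong (ℤ._* f y) (outer y fy)))) ⟫
    ΣF (λ y → (χ (y + - 1#) ℤ.+ χ (y + 1#)) ℤ.* f y) ≡⟪ ≡.refl ⟫ ≡.refl
    where
    inner : ∀ x → InF x → Dec (x ≈ 0#) → ΣF (λ y → when (x * x + 1# ≟ x * y) (χ x ℤ.* f y)) ≡ χ x ℤ.* f (x + inv x)
    inner x fx (yes p) = ≡.trans (ΣF-cong (λ y _ → zero-term y (x * x + 1# ≟ x * y))) (≡.trans (ΣF-const 0ℤ) (≡.trans (ℤₚ.*-zeroʳ qℤ)
        (≡.sym (≡.cong (ℤ._* f (x + inv x)) (χ-0 p)))))
      where
      zero-term : ∀ y (d : Dec (x * x + 1# ≈ x * y)) → when d (χ x ℤ.* f y) ≡ 0ℤ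
      zero-term y (yes _) = ≡.cong (ℤ._* f y) (χ-0 p)
      zero-term y (no _) = ≡.refl
    inner x fx (no ¬p) = sum-delta (λ y → x * x + 1# ≟ x * y) (λ y → χ x ℤ.* f y) (χ x ℤ.* f (x + inv x)) Fₗ
      (λ y y′ _ _ a b → cancel-nonzero ¬p (trans (sym a) b))
      (Any.map (λ p → trans eq (*-congˡ p)) (complete Fₗ (x + inv x) (F-+ fx (F-inv fx))))
      (λ y _ p → ≡.cong (χ x ℤ.*_) (rf (cancel-nonzero ¬p (trans (sym p) eq))))
      where
      eq : x * x + 1# ≈ x * (x + inv x)
      eq = sym (trans (distribˡ x x (inv x)) (+-congˡ (inv-right ¬p)))
    G : Carrier → Carrier → ℤ
    G y m = when (m * m ≟ y * y + - 1#) (χ (y + m))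
    rG : ∀ y → Resp (G y)
    rG y {m} {m′} p = when-cong (m * m ≟ y * y + - 1#) (m′ * m′ ≟ y * y + - 1#) (λ a → trans (sym (*-cong p p)) a) (λ a → trans (*-cong p p) a) (λ _ → χ-cong (+-congˡ p))
    outer : ∀ y → InF y → ΣF (λ x → when (x * x + 1# ≟ x * y) (χ x)) ≡ χ (y + - 1#) ℤ.+ χ (y + 1#)
    -- Completing the square with -1/2 = 1: x² + 1 = x y holds exactly if (x + y)² = y² - 1. The
    -- sign of - (x + y) turns x into a value y + m up to sign, as `disc-sum` requires.
    outer y fy = ≡.trans (sum-cong′ (elems Fₗ) (λ x → when-cong (x * x + 1# ≟ x * y) ((- (x + y)) * (- (x + y)) ≟ y * y + - 1#)
        (λ a → x-y≈0 (trans (flip x) (trans (+-congʳ a) (-‿inverseʳ _))))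
        (λ a → x-y≈0 (trans (sym (flip x)) (trans (+-congʳ a) (-‿inverseʳ _))))
        (λ _ → ≡.trans (≡.sym (χ-neg x)) (χ-cong (solve 2 (λ x y → :- x := y :+ :- (x :+ y)) refl x y)))))
      (≡.trans (ΣF-shift {λ x → G y (- x)} y fy (λ p → rG y (-‿cong p))) (≡.trans (ΣF-neg (rG y)) (disc-sum fy)))
      where
      flip : ∀ x → (- (x + y)) * (- (x + y)) + - (y * y + - 1#) ≈ x * x + 1# + - (x * y)
      flip x = solve 2 (λ x y → :- (x :+ y) :* :- (x :+ y) :- (y :* y :- :1) := x :* x :+ :1 :- x :* y) refl x y

  -- The Kloosterman-type sum K2 and a quadratic form over 𝔽₃.

  module Kloosterman (σ : Carrier) (φσ : φ σ ≈ σ + 1#) where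
    open Additive σ φσ public renaming (r₀ to r; F-r₀ to F-r; r₀≉0 to r≉0; cos-r₀ to cos-r)

    -- By `χ-twist`, `γ` is the quadratic Gauss sum of cos (r u).
    K2 γ : ℤ
    K2 = ΣF (λ s → R4 s ℤ.* cos (r * (s + inv s)))
    γ = χ r ℤ.* γ₀

    -- W⁴ = W · W³ is a product of two additive maps; this is why tr Q is a quadratic form over 𝔽₃.
    Q : Carrier → Carrier
    Q W = r * (W * W * (W * W) + W * W)

    Q-cong : ∀ {x y} → x ≈ y → Q x ≈ Q y
    Q-cong p = *-congˡ (+-cong (*-cong (*-cong p p) (*-cong p p)) (*-cong p p))

    F-Q : ∀ {W} → InF W → InF (Q W)
    F-Q f = F-* F-r (F-+ (F-* (F-* f f) (F-* f f)) (F-* f f))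

    A : Carrier → ℤ
    A z = ΣF (λ W → cos (Q W + z))

    module _ {z} (fz : InF z) where
      private
        f g : Carrier → ℤ
        f y = cos (r * (y * y + 1#) + z)
        g y = f (y + - 1#)

        f-cong : Resp f
        f-cong p = cos-cong (+-congʳ (*-congˡ (+-congʳ (*-cong p p))))

        g-cong : Resp g
        g-cong p = f-cong (+-congʳ p)

      Kz : ℤ
      Kz = ΣF (λ s → R4 s ℤ.* cos (r * (s + inv s) + z))

      Kz-K2 : ℤ.+ 2 ℤ.* Kz ≡ cos z ℤ.* K2
      Kz-K2 = even-sum (- 1#) {R4} {λ s → r * (s + inv s)} z (F-neg F-1) -1≉0 fz
        (λ s _ → ≡.trans (R4-cong (-1*x≈-x s)) (R4-neg s))
        (λ s _ → trans (*-congˡ (+-cong (-1*x≈-x s) (trans (inv-cong (-1*x≈-x s)) (inv-neg s))))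
           (solve 3 (λ r s t → r :* (:- s :+ :- t) := :- (r :* (s :+ t))) refl r s (inv s)))
        (λ s fs → F-* F-r (F-+ fs (F-inv fs))) R4-cong (λ p → *-congˡ (+-cong p (inv-cong p)))

      -- Putting s = x² trades R4 for χ, and x² + x⁻² = (x + x⁻¹)² + 1 brings in `sum-x+1/x`. The
      -- function f is even, so y ↦ - y merges the two characters that this produces.
      Kz-χ : ℤ.+ 2 ℤ.* Kz ≡ ℤ.+ 2 ℤ.* ΣF (λ y → χ (y + 1#) ℤ.* f y)
      Kz-χ =
        ℤ.+ 2 ℤ.* Kz
          ≡⟪ ≡.sym (sum-χ-squares {λ s → cos (r * (s + inv s) + z)} (λ p → cos-cong (+-congʳ (*-congˡ (+-cong p (inv-cong p)))))) ⟫
        ΣF (λ x → χ x ℤ.* cos (r * (x * x + inv (x * x)) + z))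
          ≡⟪ sum-cong′ (elems Fₗ) (λ x → at x (x ≟ 0#)) ⟫
        ΣF (λ x → χ x ℤ.* f (x + inv x))
          ≡⟪ sum-x+1/x f-cong ⟫
        ΣF (λ y → (χ (y + - 1#) ℤ.+ χ (y + 1#)) ℤ.* f y)
          ≡⟪ ≡.trans (sum-cong′ (elems Fₗ) (λ y → ℤₚ.*-distribʳ-+ (f y) (χ (y + - 1#)) (χ (y + 1#)))) (ΣF-+ (λ y → χ (y + - 1#) ℤ.* f y) (λ y → χ (y + 1#) ℤ.* f y)) ⟫
        ΣF (λ y → χ (y + - 1#) ℤ.* f y) ℤ.+ ΣF (λ y → χ (y + 1#) ℤ.* f y)
          ≡⟪ ≡.cong (ℤ._+ ΣF (λ y → χ (y + 1#) ℤ.* f y)) mirror ⟫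
        ΣF (λ y → χ (y + 1#) ℤ.* f y) ℤ.+ ΣF (λ y → χ (y + 1#) ℤ.* f y)
          ≡⟪ 2* _ ⟫ ≡.refl
        where
        at : ∀ x → Dec (x ≈ 0#) → χ x ℤ.* cos (r * (x * x + inv (x * x)) + z) ≡ χ x ℤ.* f (x + inv x)
        at x (yes p) = ≡.trans (≡.cong (ℤ._* cos (r * (x * x + inv (x * x)) + z)) (χ-0 p)) (≡.sym (≡.cong (ℤ._* f (x + inv x)) (χ-0 p)))
        at x (no ¬p) = ≡.cong (χ x ℤ.*_) (cos-cong (+-congʳ (*-congˡ (begin
          x * x + inv (x * x)                                   ≈⟨ +-congˡ (inv-* ¬p ¬p) ⟩
          x * x + i * i                                         ≈⟨ solve 2 (λ x i → x :* x :+ i :* i := (x :+ i) :* (x :+ i) :+ x :* i) refl x i ⟩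
          (x + i) * (x + i) + x * i                             ≈⟨ +-congˡ (inv-right ¬p) ⟩
          (x + i) * (x + i) + 1# ∎))))
          where i = inv x
        mirror : ΣF (λ y → χ (y + - 1#) ℤ.* f y) ≡ ΣF (λ y → χ (y + 1#) ℤ.* f y)
        mirror = ≡.trans (≡.sym (ΣF-neg {λ y → χ (y + - 1#) ℤ.* f y} (λ p → ≡.cong₂ ℤ._*_ (χ-cong (+-congʳ p)) (f-cong p))))
          (sum-cong′ (elems Fₗ) (λ y → ≡.cong₂ ℤ._*_
            (≡.trans (χ-cong (solve 1 (λ y → :- y :- :1 := :- (y :+ :1)) refl y)) (χ-neg (y + 1#)))
            (cos-cong (+-congʳ (*-congˡ (+-congʳ (solve 1 (λ y → :- y :* :- y := y :* y) refl y)))))))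

      Σχg : ΣF (λ y → χ (y + 1#) ℤ.* f y) ≡ ΣF (λ Y → χ Y ℤ.* g Y)
      Σχg = ≡.trans (≡.sym (ΣF-shift {λ y → χ (y + 1#) ℤ.* f y} (- 1#) (F-neg F-1) (λ p → ≡.cong₂ ℤ._*_ (χ-cong (+-congʳ p)) (f-cong p))))
        (sum-cong′ (elems Fₗ) (λ Y → ≡.cong (ℤ._* g Y) (χ-cong (solve 1 (λ Y → Y :- :1 :+ :1 := Y) refl Y))))

      -- In characteristic 3, W⁴ + W² - 1 = (W² - 1)² + 1.
      A-g : A (z + - r) ≡ ΣF (λ W → g (W * W))
      A-g = sum-cong′ (elems Fₗ) (λ W → cos-cong (solve 3 (λ r z W →
        r :* (W :* W :* (W :* W) :+ W :* W) :+ (z :- r) := r :* ((W :* W :- :1) :* (W :* W :- :1) :+ :1) :+ z) refl r z W))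

      Σg : ℤ.+ 2 ℤ.* ΣF g ≡ cos (r + z) ℤ.* γ
      Σg = ≡.trans (≡.cong (ℤ.+ 2 ℤ.*_) (≡.trans (ΣF-shift (- 1#) (F-neg F-1) f-cong) (sum-cong′ (elems Fₗ) (λ t →
          cos-cong (solve 3 (λ r z t → r :* (t :* t :+ :1) :+ z := r :* (t :* t) :+ (r :+ z)) refl r z t)))))
        (quadratic-sum F-r r≉0 (F-+ F-r fz))

      -- `sum-squares` splits `A` into a sum without character, which is a quadratic Gauss sum, and
      -- a sum with χ, which is `Kz`.
      A-value : ℤ.+ 2 ℤ.* A (z + - r) ≡ cos z ℤ.* K2 ℤ.+ cos (r + z) ℤ.* γ
      A-value = ≡.trans (≡.cong (ℤ.+ 2 ℤ.*_) (≡.trans A-g (sum-squares g-cong))) (≡.trans (ℤₚ.*-distribˡ-+ (ℤ.+ 2) (ΣF g) _)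
        (≡.trans (ℤₚ.+-comm (ℤ.+ 2 ℤ.* ΣF g) _) (≡.cong₂ ℤ._+_
          (≡.trans (≡.cong (ℤ.+ 2 ℤ.*_) (≡.trans (≡.sym Σχg) (≡.sym (cancel-2 {Kz} Kz-χ)))) Kz-K2) Σg)))

      -- W and - W contribute equally, so modulo 2 only the term W = 0 remains. Hence `A` is odd
      -- wherever cos is -1, in particular at ± r.
      odd : ∃ λ t → A z ≡ cos z ℤ.+ ℤ.+ 2 ℤ.* t
      odd = ΣF b , ≡.trans (sum-squares {h} h-cong) (≡.trans (≡.sym (ΣF-+ h (λ u → χ u ℤ.* h u))) (≡.trans
          (ΣF-cong (λ u fu → split u (u ≟ 0#))) (≡.trans (ΣF-+ (λ u → when (u ≟ 0#) (h u)) (λ u → ℤ.+ 2 ℤ.* b u))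
          (≡.cong₂ ℤ._+_ (≡.trans (ΣF-delta F-0 h-cong) (cos-cong (solve 2 (λ r z → r :* (:0 :* :0 :+ :0) :+ z := z) refl r z)))
            (ΣF-*ˡ (ℤ.+ 2) b)))))
        where
        h b : Carrier → ℤ
        h u = cos (r * (u * u + u) + z)
        half : ∀ u → χ u ≡ 1ℤ ⊎ χ u ≡ -1ℤ → ℤ
        half u = [ (λ _ → h u) , (λ _ → 0ℤ) ]′
        half-no : ∀ u → Dec (u ≈ 0#) → ℤ
        half-no u (yes _) = 0ℤ
        half-no u (no u≉0) = half u (χ-±1 u≉0)
        b u = half-no u (u ≟ 0#)
        h-cong : Resp h
        h-cong p = cos-cong (+-congʳ (*-congˡ (+-cong (*-cong p p) p)))
        split-half : ∀ u s → h u ℤ.+ χ u ℤ.* h u ≡ 0ℤ ℤ.+ ℤ.+ 2 ℤ.* half u s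
        split-half u (inj₁ p) = ≡.trans (≡.cong (λ t → h u ℤ.+ t ℤ.* h u) p) (lem (h u))
          where
          lem : ∀ x → x ℤ.+ 1ℤ ℤ.* x ≡ 0ℤ ℤ.+ ℤ.+ 2 ℤ.* x
          lem = ℤSolver.solve-∀
        split-half u (inj₂ p) = ≡.trans (≡.cong (λ t → h u ℤ.+ t ℤ.* h u) p) (lem (h u))
          where
          lem : ∀ x → x ℤ.+ -1ℤ ℤ.* x ≡ 0ℤ
          lem = ℤSolver.solve-∀
        split : ∀ u (d : Dec (u ≈ 0#)) → h u ℤ.+ χ u ℤ.* h u ≡ when d (h u) ℤ.+ ℤ.+ 2 ℤ.* half-no u d
        split u (yes p) = ≡.cong (λ t → h u ℤ.+ t) (≡.cong (ℤ._* h u) (χ-0 p))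
        split u (no u≉0) = split-half u (χ-±1 u≉0)

    -- The radical of the quadratic form tr Q over 𝔽₃.

    -- tr (W³ · X V) is the polar form of tr Q: the terms linear in W are cubed under the trace so
    -- that they join the term in W³. The radical is therefore given by X V = 0.
    X : Carrier → Carrier
    X V = r * V + cube (r * V * V * V) + - (cube (r * V))

    F-X : ∀ {V} → InF V → InF (X V)
    F-X f = F-+ (F-+ (F-* F-r f) (F-cube (F-* (F-* (F-* F-r f) f) f))) (F-neg (F-cube (F-* F-r f)))

    nrad : ℤ
    nrad = ΣF (λ V → when (X V ≟ 0#) 1ℤ)

    polar : ∀ {W V} → InF W → InF V → cos (Q (W + V) + - Q W) ≡ cos (cube W * X V + Q V)
    polar {W} {V} fW fV = ≡.trans (cos-cong expand) (≡.trans (≡.sym (cos-cube z fx)) (cos-cong collect))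
      where
      x z : Carrier
      x = r * W * (V * V * V) + - (r * W * V)
      z = Q V + r * (W * W * W) * V
      fx : InF x
      fx = F-+ (F-* (F-* F-r fW) (F-* (F-* fV fV) fV)) (F-neg (F-* (F-* F-r fW) fV))
      expand : Q (W + V) + - Q W ≈ x + z
      expand = solve 3 (λ r W V → let Q = λ W → r :* (W :* W :* (W :* W) :+ W :* W) in
        Q (W :+ V) :- Q W := r :* W :* (V :* V :* V) :- r :* W :* V :+ (Q V :+ r :* (W :* W :* W) :* V)) refl r W V
      collect : cube x + z ≈ cube W * X V + Q V
      collect = solve 3 (λ r W V → let Q = λ W → r :* (W :* W :* (W :* W) :+ W :* W)
                                       c = λ x → x :* x :* x
                                       x = r :* W :* (V :* V :* V) :- r :* W :* V in
        c x :+ (Q V :+ r :* (W :* W :* W) :* V) := c W :* (r :* V :+ c (r :* V :* V :* V) :- c (r :* V)) :+ Q V) refl r W V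

    -- on the radical tr (V³ X V) = - tr (Q V) vanishes
    cos-rad : ∀ {V} → InF V → X V ≈ 0# → cos (Q V) ≡ ℤ.+ 2
    cos-rad {V} fV p = ≡.trans (≡.sym (cos-neg (F-Q fV))) (≡.trans (cos-cong shape₁)
      (≡.trans (≡.sym (cos-cube _ fQ₁)) (≡.trans (cos-cong shape₂) (cos-0 (*-0ʳ p)))))
      where
      Q₁ : Carrier
      Q₁ = r * (V * V * (V * V)) + - (r * (V * V))
      fQ₁ : InF Q₁
      fQ₁ = F-+ (F-* F-r (F-* (F-* fV fV) (F-* fV fV))) (F-neg (F-* F-r (F-* fV fV)))
      shape₁ : - Q V ≈ Q₁ + r * (V * V * (V * V))
      shape₁ = solve 2 (λ r V → :- (r :* (V :* V :* (V :* V) :+ V :* V)) :=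
        r :* (V :* V :* (V :* V)) :- r :* (V :* V) :+ r :* (V :* V :* (V :* V))) refl r V
      shape₂ : cube Q₁ + r * (V * V * (V * V)) ≈ cube V * X V
      shape₂ = solve 2 (λ r V → let c = λ x → x :* x :* x in
        c (r :* (V :* V :* (V :* V)) :- r :* (V :* V)) :+ r :* (V :* V :* (V :* V)) :=
        c V :* (r :* V :+ c (r :* V :* V :* V) :- c (r :* V))) refl r V

    -- With W = W′ + V the inner sum depends on W′ through tr (W′³ · X V) only. It vanishes unless V
    -- is in the radical, where Q V has trace 0.
    differences : ΣF (λ W → ΣF (λ W′ → cos (Q W + - Q W′))) ≡ qℤ ℤ.* ℤ.+ 2 ℤ.* nrad
    differences =
      ΣF (λ W → ΣF (λ W′ → cos (Q W + - Q W′)))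
        ≡⟪ ΣF-swap (λ W W′ → cos (Q W + - Q W′)) ⟫
      ΣF (λ W′ → ΣF (λ W → cos (Q W + - Q W′)))
        ≡⟪ ΣF-cong (λ W′ fW′ → ≡.sym (ΣF-shift {λ W → cos (Q W + - Q W′)} W′ fW′ (λ p → cos-cong (+-congʳ (Q-cong p))))) ⟫
      ΣF (λ W′ → ΣF (λ V → cos (Q (V + W′) + - Q W′)))
        ≡⟪ ΣF-cong (λ W′ fW′ → ΣF-cong (λ V fV → ≡.trans (cos-cong (+-congʳ (Q-cong (+-comm V W′)))) (polar fW′ fV))) ⟫
      ΣF (λ W′ → ΣF (λ V → cos (cube W′ * X V + Q V)))
        ≡⟪ ΣF-swap (λ W′ V → cos (cube W′ * X V + Q V)) ⟫
      ΣF (λ V → ΣF (λ W′ → cos (cube W′ * X V + Q V)))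
        ≡⟪ ΣF-cong (λ V fV → ≡.trans (ΣF-cube {λ u → cos (u * X V + Q V)} (λ p → cos-cong (+-congʳ (*-congʳ p))))
             (≡.trans (sum-cong′ (elems Fₗ) (λ u → cos-cong (+-congʳ (*-comm u (X V))))) (≡.trans (linear-sum (F-X fV) (F-Q fV))
               (≡.trans (when-cong (X V ≟ 0#) (X V ≟ 0#) (λ p → p) (λ p → p) (λ p → ≡.trans (≡.cong (qℤ ℤ.*_) (cos-rad fV p)) (≡.sym (ℤₚ.*-identityʳ (qℤ ℤ.* ℤ.+ 2)))))
                 (≡.sym (when-* (X V ≟ 0#) (qℤ ℤ.* ℤ.+ 2) 1ℤ)))))) ⟫
      ΣF (λ V → qℤ ℤ.* ℤ.+ 2 ℤ.* when (X V ≟ 0#) 1ℤ)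
        ≡⟪ ΣF-*ˡ (qℤ ℤ.* ℤ.+ 2) (λ V → when (X V ≟ 0#) 1ℤ) ⟫ ≡.refl

    A-cong : Resp A
    A-cong p = sum-cong′ (elems Fₗ) (λ W → cos-cong (+-congˡ p))

    cos--r : cos (- r) ≡ -1ℤ
    cos--r = ≡.trans (cos-neg F-r) cos-r

    cos-2r : cos (r + r) ≡ -1ℤ
    cos-2r = ≡.trans (cos-cong (solve 1 (λ r → r :+ r := :- r) refl r)) cos--r

    A-square : ∀ {z} → InF z → A z ℤ.* A z ≡
      ΣF (λ W → ΣF (λ W′ → cos (Q W + Q W′ + (z + z)) ℤ.+ cos (Q W + - Q W′)))
    A-square {z} fz = ≡.trans (≡.sym (ΣF-*ʳ (A z) (λ W → cos (Q W + z)))) (ΣF-cong (λ W fW →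
      ≡.trans (≡.sym (ΣF-*ˡ (cos (Q W + z)) (λ W′ → cos (Q W′ + z)))) (ΣF-cong (λ W′ fW′ →
      ≡.trans (cos-+ (F-+ (F-Q fW) fz) (F-+ (F-Q fW′) fz)) (≡.cong₂ ℤ._+_
        (cos-cong (solve 3 (λ a b z → a :+ z :+ (b :+ z) := a :+ b :+ (z :+ z)) refl (Q W) (Q W′) z))
        (cos-cong (solve 3 (λ a b z → a :+ z :- (b :+ z) := a :- b) refl (Q W) (Q W′) z)))))))

    -- The three shifts multiply ψ by the three cube roots of unity. Summing over z = 0, r, - r thus
    -- removes the terms in Q W + Q W′ from the squares of `A` and leaves the differences.
    cancel-shifts : ∀ {x} → InF x → cos (x + (0# + 0#)) ℤ.+ cos (x + (r + r)) ℤ.+ cos (x + (- r + - r)) ≡ 0ℤ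
    cancel-shifts {x} fx = ≡.trans (≡.cong₂ (λ s t → s ℤ.+ cos (x + (r + r)) ℤ.+ t)
        (cos-cong (solve 1 (λ x → x :+ (:0 :+ :0) := x) refl x))
        (cos-cong (solve 2 (λ x r → x :+ (:- r :+ :- r) := x :- (r :+ r)) refl x r)))
      (≡.trans (ℤₚ.+-assoc (cos x) (cos (x + (r + r))) (cos (x + - (r + r)))) (≡.trans
        (≡.cong (λ t → cos x ℤ.+ t) (≡.trans (≡.sym (cos-+ fx (F-+ F-r F-r))) (≡.cong (cos x ℤ.*_) cos-2r)))
        (lem (cos x))))
      where
      lem : ∀ a → a ℤ.+ a ℤ.* -1ℤ ≡ 0ℤ
      lem = ℤSolver.solve-∀

    A-squares : A 0# ℤ.* A 0# ℤ.+ A r ℤ.* A r ℤ.+ A (- r) ℤ.* A (- r) ≡ ℤ.+ 3 ℤ.* (qℤ ℤ.* ℤ.+ 2 ℤ.* nrad)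
    A-squares =
      A 0# ℤ.* A 0# ℤ.+ A r ℤ.* A r ℤ.+ A (- r) ℤ.* A (- r)
        ≡⟪ ≡.cong₂ ℤ._+_ (≡.cong₂ ℤ._+_ (A-square F-0) (A-square F-r)) (A-square (F-neg F-r)) ⟫
      ΣF (λ W → ΣF (T₀ W)) ℤ.+ ΣF (λ W → ΣF (T₁ W)) ℤ.+ ΣF (λ W → ΣF (T₂ W))
        ≡⟪ ≡.sym (≡.trans (ΣF-+ (λ W → ΣF (T₀ W) ℤ.+ ΣF (T₁ W)) (λ W → ΣF (T₂ W))) (≡.cong (ℤ._+ ΣF (λ W → ΣF (T₂ W))) (ΣF-+ (λ W → ΣF (T₀ W)) (λ W → ΣF (T₁ W))))) ⟫
      ΣF (λ W → ΣF (T₀ W) ℤ.+ ΣF (T₁ W) ℤ.+ ΣF (T₂ W))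
        ≡⟪ ΣF-cong (λ W fW → ≡.trans (≡.sym (≡.trans (ΣF-+ (λ W′ → T₀ W W′ ℤ.+ T₁ W W′) (T₂ W)) (≡.cong (ℤ._+ ΣF (T₂ W)) (ΣF-+ (T₀ W) (T₁ W)))))
             (≡.trans (ΣF-cong (λ W′ fW′ → ≡.trans (collect (cos (Q W + Q W′ + (0# + 0#))) (cos (Q W + Q W′ + (r + r))) (cos (Q W + Q W′ + (- r + - r))) (cos (Q W + - Q W′)))
                (≡.trans (≡.cong (ℤ._+ ℤ.+ 3 ℤ.* cos (Q W + - Q W′)) (cancel-shifts (F-+ (F-Q fW) (F-Q fW′)))) (ℤₚ.+-identityˡ _))))
               (ΣF-*ˡ (ℤ.+ 3) (λ W′ → cos (Q W + - Q W′))))) ⟫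
      ΣF (λ W → ℤ.+ 3 ℤ.* ΣF (λ W′ → cos (Q W + - Q W′)))
        ≡⟪ ≡.trans (ΣF-*ˡ (ℤ.+ 3) (λ W → ΣF (λ W′ → cos (Q W + - Q W′)))) (≡.cong (ℤ.+ 3 ℤ.*_) differences) ⟫ ≡.refl
      where
      T₀ T₁ T₂ : Carrier → Carrier → ℤ
      T₀ W W′ = cos (Q W + Q W′ + (0# + 0#)) ℤ.+ cos (Q W + - Q W′)
      T₁ W W′ = cos (Q W + Q W′ + (r + r)) ℤ.+ cos (Q W + - Q W′)
      T₂ W W′ = cos (Q W + Q W′ + (- r + - r)) ℤ.+ cos (Q W + - Q W′)
      collect : ∀ a b c d → a ℤ.+ d ℤ.+ (b ℤ.+ d) ℤ.+ (c ℤ.+ d) ≡ a ℤ.+ b ℤ.+ c ℤ.+ ℤ.+ 3 ℤ.* d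
      collect = ℤSolver.solve-∀

    γ² : γ ℤ.* γ ≡ ℤ.+ 4 ℤ.* qℤ
    γ² = ≡.trans (regroup (χ r) γ₀) (≡.trans (≡.cong (ℤ._* (γ₀ ℤ.* γ₀)) (χ-² r≉0)) (≡.trans (ℤₚ.*-identityˡ (γ₀ ℤ.* γ₀)) γ₀²))
      where
      regroup : ∀ a b → a ℤ.* b ℤ.* (a ℤ.* b) ≡ a ℤ.* a ℤ.* (b ℤ.* b)
      regroup = ℤSolver.solve-∀

    2A0 : ℤ.+ 2 ℤ.* A 0# ≡ ℤ.- K2 ℤ.- γ
    2A0 = ≡.trans (≡.cong (ℤ.+ 2 ℤ.*_) (A-cong (sym (-‿inverseʳ r)))) (≡.trans (A-value F-r)
      (≡.trans (≡.cong₂ (λ s t → s ℤ.* K2 ℤ.+ t ℤ.* γ) cos-r cos-2r) (lem K2 γ)))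
      where
      lem : ∀ a b → -1ℤ ℤ.* a ℤ.+ -1ℤ ℤ.* b ≡ ℤ.- a ℤ.- b
      lem = ℤSolver.solve-∀

    2A-r : ℤ.+ 2 ℤ.* A (- r) ≡ ℤ.+ 2 ℤ.* K2 ℤ.- γ
    2A-r = ≡.trans (≡.cong (ℤ.+ 2 ℤ.*_) (A-cong (sym (+-identityˡ (- r))))) (≡.trans (A-value F-0)
      (≡.trans (≡.cong₂ (λ s t → s ℤ.* K2 ℤ.+ t ℤ.* γ) (cos-0 refl) (≡.trans (cos-cong (+-identityʳ r)) cos-r)) (lem K2 γ)))
      where
      lem : ∀ a b → ℤ.+ 2 ℤ.* a ℤ.+ -1ℤ ℤ.* b ≡ ℤ.+ 2 ℤ.* a ℤ.- b
      lem = ℤSolver.solve-∀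

    2Ar : ℤ.+ 2 ℤ.* A r ≡ ℤ.+ 2 ℤ.* γ ℤ.- K2
    2Ar = ≡.trans (≡.cong (ℤ.+ 2 ℤ.*_) (A-cong (solve 1 (λ r → r := :- r :- r) refl r))) (≡.trans (A-value (F-neg F-r))
      (≡.trans (≡.cong₂ (λ s t → s ℤ.* K2 ℤ.+ t ℤ.* γ) cos--r (cos-0 (-‿inverseʳ r))) (lem K2 γ)))
      where
      lem : ∀ a b → -1ℤ ℤ.* a ℤ.+ ℤ.+ 2 ℤ.* b ≡ ℤ.+ 2 ℤ.* b ℤ.- a
      lem = ℤSolver.solve-∀

    -- The three values of 2 A are integer combinations of K2 and γ whose squares add up to 6 (K2² -
    -- K2 γ + γ²).
    K2-quadratic : K2 ℤ.* K2 ℤ.- K2 ℤ.* γ ℤ.+ γ ℤ.* γ ≡ γ ℤ.* γ ℤ.* nrad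
    K2-quadratic = ℤₚ.*-cancelˡ-≡ (ℤ.+ 6) _ _ (≡.trans (lem₁ K2 γ)
      (≡.trans (≡.sym (≡.cong₂ ℤ._+_ (≡.cong₂ ℤ._+_ (≡.cong₂ ℤ._*_ 2A0 2A0) (≡.cong₂ ℤ._*_ 2Ar 2Ar)) (≡.cong₂ ℤ._*_ 2A-r 2A-r)))
      (≡.trans (lem₂ (A 0#) (A r) (A (- r))) (≡.trans (≡.cong (ℤ.+ 4 ℤ.*_) A-squares) (≡.trans (lem₃ qℤ nrad)
        (≡.cong (λ t → ℤ.+ 6 ℤ.* (t ℤ.* nrad)) (≡.sym γ²)))))))
      where
      lem₁ : ∀ a b → ℤ.+ 6 ℤ.* (a ℤ.* a ℤ.- a ℤ.* b ℤ.+ b ℤ.* b) ≡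
        (ℤ.- a ℤ.- b) ℤ.* (ℤ.- a ℤ.- b) ℤ.+ (ℤ.+ 2 ℤ.* b ℤ.- a) ℤ.* (ℤ.+ 2 ℤ.* b ℤ.- a) ℤ.+ (ℤ.+ 2 ℤ.* a ℤ.- b) ℤ.* (ℤ.+ 2 ℤ.* a ℤ.- b)
      lem₁ = ℤSolver.solve-∀
      lem₂ : ∀ a b c → ℤ.+ 2 ℤ.* a ℤ.* (ℤ.+ 2 ℤ.* a) ℤ.+ ℤ.+ 2 ℤ.* b ℤ.* (ℤ.+ 2 ℤ.* b) ℤ.+ ℤ.+ 2 ℤ.* c ℤ.* (ℤ.+ 2 ℤ.* c) ≡
        ℤ.+ 4 ℤ.* (a ℤ.* a ℤ.+ b ℤ.* b ℤ.+ c ℤ.* c)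
      lem₂ = ℤSolver.solve-∀
      lem₃ : ∀ q n → ℤ.+ 4 ℤ.* (ℤ.+ 3 ℤ.* (q ℤ.* ℤ.+ 2 ℤ.* n)) ≡ ℤ.+ 6 ℤ.* (ℤ.+ 4 ℤ.* q ℤ.* n)
      lem₃ = ℤSolver.solve-∀

    2x≢1 : ∀ x → ℤ.+ 2 ℤ.* x ≢ 1ℤ
    2x≢1 x p = even≢odd ℤ.∣ x ∣ (≡.trans (≡.sym (ℤₚ.abs-* (ℤ.+ 2) x)) (≡.cong ℤ.∣_∣ p))
      where
      even≢odd : ∀ j → 2 ℕ.* j ≢ 1
      even≢odd (ℕ.suc j) p with ≡.trans (≡.sym p) (suc-2*′ j)
        where
        suc-2*′ : ∀ j → 2 ℕ.* ℕ.suc j ≡ ℕ.suc (ℕ.suc (2 ℕ.* j))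
        suc-2*′ = ℕSolver.solve-∀
      ... | ()

    A-odd : ∀ {z} → InF z → cos z ≡ -1ℤ → ∀ x → A z ≢ ℤ.+ 2 ℤ.* x
    A-odd fz cz x p = let (t , eq) = odd fz in
      2x≢1 (t ℤ.- x) (≡.trans (lem t x) (≡.trans (≡.cong (λ y → 1ℤ ℤ.+ y ℤ.- ℤ.+ 2 ℤ.* x) (≡.trans (≡.cong (ℤ._+ ℤ.+ 2 ℤ.* t) (≡.sym cz)) (≡.sym eq)))
        (≡.trans (≡.cong (λ y → 1ℤ ℤ.+ y ℤ.- ℤ.+ 2 ℤ.* x) p) (lem′ x))))
      where
      lem : ∀ t x → ℤ.+ 2 ℤ.* (t ℤ.- x) ≡ 1ℤ ℤ.+ (-1ℤ ℤ.+ ℤ.+ 2 ℤ.* t) ℤ.- ℤ.+ 2 ℤ.* x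
      lem = ℤSolver.solve-∀
      lem′ : ∀ x → 1ℤ ℤ.+ ℤ.+ 2 ℤ.* x ℤ.- ℤ.+ 2 ℤ.* x ≡ 1ℤ
      lem′ = ℤSolver.solve-∀

    -- K2 = 0 would give A r = - 2 A (- r), but A r is odd.
    K2≢0 : K2 ≢ 0ℤ
    K2≢0 p = A-odd F-r cos-r (ℤ.- A (- r)) (cancel-2 (≡.trans 2Ar (≡.trans (≡.cong (λ t → ℤ.+ 2 ℤ.* γ ℤ.- t) p)
      (≡.trans (lem γ (A (- r)) (≡.trans 2A-r (≡.cong (λ t → ℤ.+ 2 ℤ.* t ℤ.- γ) p))) ≡.refl))))
      where
      lem : ∀ g a → ℤ.+ 2 ℤ.* a ≡ ℤ.+ 2 ℤ.* 0ℤ ℤ.- g → ℤ.+ 2 ℤ.* g ℤ.- 0ℤ ≡ ℤ.+ 2 ℤ.* (ℤ.+ 2 ℤ.* (ℤ.- a))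
      lem g a eq = ≡.trans (l₁ g) (≡.trans (≡.cong (λ t → ℤ.- (ℤ.+ 2 ℤ.* t)) (≡.sym eq)) (l₂ a))
        where
        l₁ : ∀ g → ℤ.+ 2 ℤ.* g ℤ.- 0ℤ ≡ ℤ.- (ℤ.+ 2 ℤ.* (ℤ.+ 2 ℤ.* 0ℤ ℤ.- g))
        l₁ = ℤSolver.solve-∀
        l₂ : ∀ a → ℤ.- (ℤ.+ 2 ℤ.* (ℤ.+ 2 ℤ.* a)) ≡ ℤ.+ 2 ℤ.* (ℤ.+ 2 ℤ.* (ℤ.- a))
        l₂ = ℤSolver.solve-∀

    -- K2 = 2 γ would give A r = 0, which is not odd.
    K2≢2γ : K2 ≢ ℤ.+ 2 ℤ.* γ
    K2≢2γ p = A-odd F-r cos-r 0ℤ (cancel-2 {A r} {0ℤ} (≡.trans 2Ar (≡.trans (≡.cong (λ t → ℤ.+ 2 ℤ.* γ ℤ.- t) p) (ℤₚ.+-inverseʳ (ℤ.+ 2 ℤ.* γ)))))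

    -- The quadratic equation factors as K2 (K2 - γ) = 0 for s = -1 and as (K2 - 2 γ) (K2 + γ) = 0
    -- for s = 1; parity rules out the first factor each time.
    K2-value : ∀ s → s ≡ 1ℤ ⊎ s ≡ -1ℤ → nrad ≡ ℤ.+ 2 ℤ.+ s → K2 ≡ ℤ.- (s ℤ.* γ)
    K2-value s (inj₂ ≡.refl) p = [ (λ z → ⊥-elim (K2≢0 z)) , (λ z → ≡.trans (ℤₚ.i-j≡0⇒i≡j K2 γ z) (l₂ γ)) ]′
        (ℤₚ.i*j≡0⇒i≡0∨j≡0 K2 (≡.trans (l₁ K2 γ) (≡.trans (≡.cong (λ t → t ℤ.- γ ℤ.* γ) (≡.trans K2-quadratic (≡.cong (γ ℤ.* γ ℤ.*_) p))) (l₃ (γ ℤ.* γ)))))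
      where
      l₁ : ∀ a b → a ℤ.* (a ℤ.- b) ≡ a ℤ.* a ℤ.- a ℤ.* b ℤ.+ b ℤ.* b ℤ.- b ℤ.* b
      l₁ = ℤSolver.solve-∀
      l₂ : ∀ b → b ≡ ℤ.- (-1ℤ ℤ.* b)
      l₂ = ℤSolver.solve-∀
      l₃ : ∀ b → b ℤ.* (ℤ.+ 2 ℤ.+ -1ℤ) ℤ.- b ≡ 0ℤ
      l₃ = ℤSolver.solve-∀
    K2-value s (inj₁ ≡.refl) p = [ (λ z → ⊥-elim (K2≢2γ (ℤₚ.i-j≡0⇒i≡j K2 (ℤ.+ 2 ℤ.* γ) z))) , (λ z → ℤₚ.i-j≡0⇒i≡j K2 (ℤ.- (1ℤ ℤ.* γ)) (≡.trans (l₂ K2 γ) z)) ]′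
        (ℤₚ.i*j≡0⇒i≡0∨j≡0 (K2 ℤ.- ℤ.+ 2 ℤ.* γ) (≡.trans (l₁ K2 γ) (≡.trans (≡.cong (λ t → t ℤ.- ℤ.+ 3 ℤ.* (γ ℤ.* γ)) (≡.trans K2-quadratic (≡.cong (γ ℤ.* γ ℤ.*_) p))) (l₃ (γ ℤ.* γ)))))
      where
      l₁ : ∀ a b → (a ℤ.- ℤ.+ 2 ℤ.* b) ℤ.* (a ℤ.+ b) ≡ a ℤ.* a ℤ.- a ℤ.* b ℤ.+ b ℤ.* b ℤ.- ℤ.+ 3 ℤ.* (b ℤ.* b)
      l₁ = ℤSolver.solve-∀
      l₂ : ∀ a b → a ℤ.- ℤ.- (1ℤ ℤ.* b) ≡ a ℤ.+ b
      l₂ = ℤSolver.solve-∀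
      l₃ : ∀ b → b ℤ.* (ℤ.+ 2 ℤ.+ 1ℤ) ℤ.- ℤ.+ 3 ℤ.* b ≡ 0ℤ
      l₃ = ℤSolver.solve-∀

    σ∉F : ¬ InF σ
    σ∉F p = 1≉0 (begin
      1#                ≈⟨ solve 1 (λ s → :1 := s :+ :1 :- s) refl σ ⟩
      σ + 1# + - σ      ≈⟨ +-congʳ (trans (sym φσ) p) ⟩
      σ + - σ           ≈⟨ -‿inverseʳ σ ⟩
      0# ∎)

    -- The data come from a decomposition λ b² rescaled to σ = n b². As N b = 1, the norm r of σ is
    -- n³. The conjugates of b have product 1 and, because σ, σ + 1, σ + 2 add up to 0, squares with
    -- sum 0; only their sum `m` remains free.
    module Radical (b n : Carrier) (Fn : InF n) (n≉0 : n ≉ 0#) (n³ : cube n ≈ r)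
      (nb² : n * (b * b) ≈ σ) (Nb : N b ≈ 1#) where

      b₁ b₂ p₂ m : Carrier
      b₁ = φ b
      b₂ = φ b₁
      p₂ = b * b + b₁ * b₁ + b₂ * b₂
      m = b + b₁ + b₂

      Fm : InF m
      Fm = F-cong (T≈ b) (T-inF b)

      b∉F : ¬ InF b
      b∉F f = σ∉F (F-cong nb² (F-* Fn (F-* f f)))

      nb₁² : n * (b₁ * b₁) ≈ σ + 1#
      nb₁² = trans (*-cong (sym Fn) (sym (φ-* b b))) (trans (sym (φ-* n (b * b))) (trans (φ-cong nb²) φσ))

      nb₂² : n * (b₂ * b₂) ≈ σ + 1# + 1#
      nb₂² = trans (*-cong (sym Fn) (sym (φ-* b₁ b₁))) (trans (sym (φ-* n (b₁ * b₁))) (trans (φ-cong nb₁²)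
        (trans (φ-+ σ 1#) (+-cong φσ φ-1))))

      p₂≈0 : p₂ ≈ 0#
      p₂≈0 = domain (begin
        n * p₂                                                 ≈⟨ trans (distribˡ _ _ _) (+-congʳ (distribˡ _ _ _)) ⟩
        n * (b * b) + n * (b₁ * b₁) + n * (b₂ * b₂)            ≈⟨ +-cong (+-cong nb² nb₁²) nb₂² ⟩
        σ + (σ + 1#) + (σ + 1# + 1#)                           ≈⟨ solve 1 (λ s → s :+ (s :+ :1) :+ (s :+ :1 :+ :1) := :0) refl σ ⟩
        0# ∎) n≉0

      e₃ : b * b₁ * b₂ ≈ 1#
      e₃ = trans (sym (N≈ b)) Nb

      -- The second elementary symmetric function of b², b₁², b₂² in two ways: in terms of `m`,
      -- using the product 1 and `p₂` = 0, and from the conjugates σ, σ + 1, σ + 2 of n b².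
      quartic : 1# + n * n * (m * m * (m * m) + m) ≈ 0#
      quartic = begin
        1# + n * n * (m * m * (m * m) + m)
          ≈⟨ +-congˡ (*-congˡ (sym power-sum)) ⟩
        1# + n * n * (b * b * (b₁ * b₁) + b₁ * b₁ * (b₂ * b₂) + b * b * (b₂ * b₂))
          ≈⟨ solve 4 (λ n a b c → :1 :+ n :* n :* (a :* b :+ b :* c :+ a :* c) := :1 :+ (n :* a :* (n :* b) :+ n :* b :* (n :* c) :+ n :* a :* (n :* c))) refl n (b * b) (b₁ * b₁) (b₂ * b₂) ⟩
        1# + (n * (b * b) * (n * (b₁ * b₁)) + n * (b₁ * b₁) * (n * (b₂ * b₂)) + n * (b * b) * (n * (b₂ * b₂)))
          ≈⟨ +-congˡ (+-cong (+-cong (*-cong nb² nb₁²) (*-cong nb₁² nb₂²)) (*-cong nb² nb₂²)) ⟩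
        1# + (σ * (σ + 1#) + (σ + 1#) * (σ + 1# + 1#) + σ * (σ + 1# + 1#))
          ≈⟨ solve 1 (λ s → :1 :+ (s :* (s :+ :1) :+ (s :+ :1) :* (s :+ :1 :+ :1) :+ s :* (s :+ :1 :+ :1)) := :0) refl σ ⟩
        0# ∎
        where
        power-sum : b * b * (b₁ * b₁) + b₁ * b₁ * (b₂ * b₂) + b * b * (b₂ * b₂) ≈ m * m * (m * m) + m
        power-sum = begin
          b * b * (b₁ * b₁) + b₁ * b₁ * (b₂ * b₂) + b * b * (b₂ * b₂)
            ≈⟨ solve 3 (λ a b c → let p = a :* a :+ b :* b :+ c :* c ; m = a :+ b :+ c in
                 a :* a :* (b :* b) :+ b :* b :* (c :* c) :+ a :* a :* (c :* c) := (p :- m :* m) :* (p :- m :* m) :+ a :* b :* c :* m) refl b b₁ b₂ ⟩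
          (p₂ + - (m * m)) * (p₂ + - (m * m)) + b * b₁ * b₂ * m
            ≈⟨ +-cong (*-cong (+-congʳ p₂≈0) (+-congʳ p₂≈0)) (*-congʳ e₃) ⟩
          (0# + - (m * m)) * (0# + - (m * m)) + 1# * m
            ≈⟨ solve 1 (λ m → (:0 :- m :* m) :* (:0 :- m :* m) :+ :1 :* m := m :* m :* (m :* m) :+ m) refl m ⟩
          m * m * (m * m) + m ∎

      -- The cubic is the norm of x - m + b, and b is not in F. It arises as the cofactor of x in
      -- the difference of the quartic at m + x and at m, so that m is its only root in F.
      cubic≉0 : ∀ {x} → InF x → x * x * x + m * (x * x) + m * m * m + 1# ≉ 0#
      cubic≉0 {x} fx p = y≉0 (N-zero (trans (N≈ y) (trans (*-cong (*-congˡ φy) (trans (φ-cong φy) φφy)) (begin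
        (x + - m + b) * (x + - m + b₁) * (x + - m + b₂)
          ≈⟨ solve 4 (λ x a b c → let p = a :* a :+ b :* b :+ c :* c ; m = a :+ b :+ c in
               (x :- m :+ a) :* (x :- m :+ b) :* (x :- m :+ c) := x :* x :* x :+ m :* (x :* x) :+ m :* m :* m :+ a :* b :* c :+ p :* (x :- m)) refl x b b₁ b₂ ⟩
        x * x * x + m * (x * x) + m * m * m + b * b₁ * b₂ + p₂ * (x + - m)
          ≈⟨ +-cong (+-congˡ e₃) (*-0ˡ p₂≈0) ⟩
        x * x * x + m * (x * x) + m * m * m + 1# + 0#
          ≈⟨ trans (+-identityʳ _) p ⟩
        0# ∎))))
        where
        y : Carrier
        y = x + - m + b
        φxm : ∀ z → φ (x + - m + z) ≈ x + - m + φ z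
        φxm z = trans (φ-+ _ _) (+-congʳ (F-+ fx (F-neg Fm)))
        φy : φ y ≈ x + - m + b₁
        φy = φxm b
        φφy : φ (x + - m + b₁) ≈ x + - m + b₂
        φφy = φxm b₁
        y≉0 : y ≉ 0#
        y≉0 z = b∉F (F-cong (sym (+-inverseˡ-unique b (x + - m) (trans (+-comm b _) z))) (F-neg (F-+ fx (F-neg Fm))))
        N-zero : N y ≈ 0# → y ≈ 0#
        N-zero z with y ≟ 0#
        ... | yes p = p
        ... | no ¬p = ⊥-elim (^-nonzero d₁ ¬p z)

      quartic-unique : ∀ {m′} → InF m′ → 1# + n * n * (m′ * m′ * (m′ * m′) + m′) ≈ 0# → m′ ≈ m
      quartic-unique {m′} fm′ p = go (m′ + - m ≟ 0#)
        where
        x = m′ + - m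
        go : Dec (x ≈ 0#) → m′ ≈ m
        go (yes z) = x-y≈0 z
        go (no x≉0) = ⊥-elim (cubic≉0 (F-+ fm′ (F-neg Fm)) (domain (domain (begin
          n * n * (x * (x * x * x + m * (x * x) + m * m * m + 1#))
            ≈⟨ solve 3 (λ n m′ m → let x = m′ :- m in n :* n :* (x :* (x :* x :* x :+ m :* (x :* x) :+ m :* m :* m :+ :1)) :=
                 (:1 :+ n :* n :* (m′ :* m′ :* (m′ :* m′) :+ m′)) :- (:1 :+ n :* n :* (m :* m :* (m :* m) :+ m))) refl n m′ m ⟩
          1# + n * n * (m′ * m′ * (m′ * m′) + m′) + - (1# + n * n * (m * m * (m * m) + m))
            ≈⟨ +-cong p (-‿cong quartic) ⟩
          0# + - 0#
            ≈⟨ -‿inverseʳ 0# ⟩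
          0# ∎) (*-nonzero n≉0 n≉0)) x≉0))

      -- The value of V² at the nonzero V in the radical: with r = n³ and V² = - m′³, the factor of
      -- X V beside r V is the cube of the quartic at m′.
      M : Carrier
      M = - (m * m * m)

      m≉0 : m ≉ 0#
      m≉0 z = 1≉0 (trans (sym (trans (+-congˡ (*-0ʳ (trans (+-cong (*-0ˡ (*-0ˡ z)) z) (+-identityˡ 0#)))) (+-identityʳ 1#))) quartic)

      X-root : ∀ {V} → InF V → V * V ≈ M → X V ≈ 0#
      X-root {V} fV p = begin
        X V
          ≈⟨ solve 2 (λ r V → let c = λ x → x :* x :* x ; u = V :* V in
               r :* V :+ c (r :* V :* V :* V) :- c (r :* V) := r :* V :* (:1 :+ r :* r :* (u :* u :* (u :* u) :- u))) refl r V ⟩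
        r * V * (1# + r * r * (V * V * (V * V) * (V * V * (V * V)) + - (V * V)))
          ≈⟨ *-congˡ (+-congˡ (*-cong (*-cong (sym n³) (sym n³)) (+-cong (*-cong (*-cong p p) (*-cong p p)) (-‿cong p)))) ⟩
        r * V * (1# + cube n * cube n * (M * M * (M * M) + - M))
          ≈⟨ *-congˡ (solve 2 (λ n m → let c = λ x → x :* x :* x ; M = :- (m :* m :* m) in
               :1 :+ c n :* c n :* (M :* M :* (M :* M) :- M) := c (:1 :+ n :* n :* (m :* m :* (m :* m) :+ m))) refl n m) ⟩
        r * V * cube (1# + n * n * (m * m * (m * m) + m))
          ≈⟨ *-0ʳ (*-0ʳ quartic) ⟩
        0# ∎

      X-zero : ∀ {V} → InF V → V ≉ 0# → X V ≈ 0# → V * V ≈ M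
      X-zero {V} fV V≉0 p = begin
        V * V                   ≈⟨ sym (-‿involutive _) ⟩
        - - (V * V)             ≈⟨ -‿cong (sym (cube-cube-root _ (F-neg (F-* fV fV)))) ⟩
        - cube m′               ≈⟨ -‿cong (cube-cong (quartic-unique fm′ (cube-zero (domain (begin
            r * V * cube (1# + n * n * (m′ * m′ * (m′ * m′) + m′))
              ≈⟨ *-congˡ (solve 2 (λ n m → let c = λ x → x :* x :* x ; M = :- (m :* m :* m) in
                   c (:1 :+ n :* n :* (m :* m :* (m :* m) :+ m)) := :1 :+ c n :* c n :* (M :* M :* (M :* M) :- M)) refl n m′) ⟩
            r * V * (1# + cube n * cube n * (- cube m′ * - cube m′ * (- cube m′ * - cube m′) + - - cube m′))
              ≈⟨ *-congˡ (+-congˡ (*-cong (*-cong n³ n³) (+-cong (*-cong (*-cong u≈ u≈) (*-cong u≈ u≈)) (-‿cong u≈)))) ⟩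
            r * V * (1# + r * r * (V * V * (V * V) * (V * V * (V * V)) + - (V * V)))
              ≈⟨ solve 2 (λ r V → let c = λ x → x :* x :* x ; u = V :* V in
                   r :* V :* (:1 :+ r :* r :* (u :* u :* (u :* u) :- u)) := r :* V :+ c (r :* V :* V :* V) :- c (r :* V)) refl r V ⟩
            X V
              ≈⟨ p ⟩
            0# ∎) (*-nonzero r≉0 V≉0))))) ⟩
        - cube m                ∎
        where
        m′ : Carrier
        m′ = cube-root (- (V * V))
        fm′ : InF m′
        fm′ = frob-F e₂ (F-neg (F-* fV fV))
        u≈ : - cube m′ ≈ V * V
        u≈ = trans (-‿cong (cube-cube-root _ (F-neg (F-* fV fV)))) (-‿involutive _)
        cube-zero : ∀ {x} → cube x ≈ 0# → x ≈ 0#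
        cube-zero {x} z with x ≟ 0#
        ... | yes p = p
        ... | no ¬p = ⊥-elim (*-nonzero (*-nonzero ¬p ¬p) ¬p z)

      FM : InF M
      FM = F-neg (F-cube Fm)

      M≉0 : M ≉ 0#
      M≉0 = -nonzero (*-nonzero (*-nonzero m≉0 m≉0) m≉0)

      χM : χ M ≡ χ m
      χM = ≡.trans (χ-neg _) (≡.trans (χ-* (m * m) m) (≡.trans (≡.cong (ℤ._* χ m) (χ-sq m≉0)) (ℤₚ.*-identityˡ (χ m))))

      nrad-value : nrad ≡ ℤ.+ 2 ℤ.+ χ m
      nrad-value = ≡.trans (ΣF-cong (λ V fV → split V fV (V ≟ 0#))) (≡.trans (ΣF-+ (λ V → when (V ≟ 0#) 1ℤ) (λ V → when (V * V ≟ M) 1ℤ))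
        (≡.trans (≡.cong₂ ℤ._+_ (ΣF-delta {λ _ → 1ℤ} F-0 (λ _ → ≡.refl)) (≡.trans (root-count FM) (≡.cong (λ t → 1ℤ ℤ.+ t) χM)))
          (≡.sym (ℤₚ.+-assoc 1ℤ 1ℤ (χ m)))))
        where
        split : ∀ V → InF V → (d : Dec (V ≈ 0#)) → when (X V ≟ 0#) 1ℤ ≡ when d 1ℤ ℤ.+ when (V * V ≟ M) 1ℤ
        split V fV (yes p) = ≡.trans (when-yes (X V ≟ 0#) 1ℤ (trans (+-cong (+-cong (*-0ʳ p) (*-0ʳ (*-0ʳ p))) (-‿cong (*-0ʳ (*-0ʳ p))))
            (solve 0 (:0 :+ :0 :- :0 := :0) refl)))
          (≡.sym (≡.cong (λ t → 1ℤ ℤ.+ t) (when-no (V * V ≟ M) 1ℤ (λ z → M≉0 (trans (sym z) (*-0ˡ p))))))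
        split V fV (no ¬p) = ≡.trans (when-cong (X V ≟ 0#) (V * V ≟ M) (X-zero fV ¬p) (X-root fV) (λ _ → ≡.refl)) (≡.sym (ℤₚ.+-identityˡ _))

      K2≡ : K2 ≡ ℤ.- (χ m ℤ.* γ)
      K2≡ = K2-value (χ m) (χ-±1 m≉0) nrad-value

  R4-zero-factor : ∀ {u} x → u ≈ 0# → R4 u ℤ.* x ≡ 0ℤ
  R4-zero-factor x p = ≡.cong (ℤ._* x) (R4-0 p)

  -- Expanding R4 (P t) into cosines by R4-twist.
  expand-R4 : ∀ Γ′ → (∀ {y} → InF y → ΣF (λ u → R4 u ℤ.* cos (u * y)) ≡ R4 y ℤ.* Γ′) →
    ∀ (P : Carrier → Carrier) → (∀ {t} → InF t → InF (P t)) →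
    Γ′ ℤ.* ΣF (λ t → R4 (P t)) ≡ ΣF (λ u → R4 u ℤ.* ΣF (λ t → cos (u * P t)))
  expand-R4 Γ′ twist P FP =
    Γ′ ℤ.* ΣF (λ t → R4 (P t))
      ≡⟪ ≡.trans (≡.sym (ΣF-*ˡ Γ′ (λ t → R4 (P t)))) (ΣF-cong (λ t ft → ≡.trans (ℤₚ.*-comm Γ′ (R4 (P t))) (≡.sym (twist (FP ft))))) ⟫
    ΣF (λ t → ΣF (λ u → R4 u ℤ.* cos (u * P t)))
      ≡⟪ ΣF-swap (λ t u → R4 u ℤ.* cos (u * P t)) ⟫
    ΣF (λ u → ΣF (λ t → R4 u ℤ.* cos (u * P t)))
      ≡⟪ sum-cong′ (elems Fₗ) (λ u → ΣF-*ˡ (R4 u) (λ t → cos (u * P t))) ⟫ ≡.refl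

  -- Sums of R4 over a cubic in its two normal forms.

  module CubicSum (σ : Carrier) (φσ : φ σ ≈ σ + 1#) where
    open Kloosterman σ φσ public

    N-shift : ∀ {t} → InF t → N (σ + t) ≈ cube t + - t + r
    N-shift {t} ft = trans (N≈ _) (trans (*-cong (*-congˡ φ1) (trans (φ-cong φ1) φ2))
      (solve 2 (λ s t → (s :+ t) :* (s :+ :1 :+ t) :* (s :+ :1 :+ :1 :+ t) := t :* t :* t :- t :+ (s :* s :* s :- s)) refl σ t))
      where
      φ1 : φ (σ + t) ≈ σ + 1# + t
      φ1 = trans (φ-+ σ t) (+-cong φσ ft)
      φ2 : φ (σ + 1# + t) ≈ σ + 1# + 1# + t
      φ2 = trans (φ-+ (σ + 1#) t) (+-cong (trans (φ-+ σ 1#) (+-cong φσ φ-1)) ft)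

    cube-root-fixed : ∀ {w} → InF w → cube-root w ≈ w → w ≈ 0# ⊎ (w ≈ 1# ⊎ w ≈ - 1#)
    cube-root-fixed {w} fw p = go (w ≟ 0#)
      where
      cw : cube w ≈ w
      cw = trans (cube-cong (sym p)) (cube-cube-root w fw)
      go : Dec (w ≈ 0#) → w ≈ 0# ⊎ (w ≈ 1# ⊎ w ≈ - 1#)
      go (yes z) = inj₁ z
      go (no w≉0) = inj₂ (square-eq (cancel-nonzero w≉0 (trans (sym (*-assoc w w w)) (trans cw (trans (sym (*-identityʳ w)) (*-congˡ (sym (*-identityʳ 1#))))))))

    frob-1 : ∀ j → frob j 1# ≈ 1#
    frob-1 ℕ.zero = refl
    frob-1 (ℕ.suc j) = trans (cube-cong (frob-1 j)) (trans (*-identityʳ _) (*-identityʳ _))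

    frob--1 : ∀ j → frob j (- 1#) ≈ - 1#
    frob--1 ℕ.zero = refl
    frob--1 (ℕ.suc j) = trans (cube-cong (frob--1 j)) (solve 0 (:- :1 :* :- :1 :* :- :1 := :- :1) refl)

    -- Up to its constant, t³ - t + r is additive. Under the trace, w times it becomes linear in t
    -- with coefficient w^(1/3) - w, so only w in 𝔽₃ survives; R4 kills w = 0, and w = ± 1
    -- contribute equally.
    additive-case : ∀ {λ₀} → InF λ₀ → λ₀ ≉ 0# →
      Γ ℤ.* ΣF (λ t → R4 (λ₀ * σ + t)) ≡ ℤ.- (ℤ.+ 2 ℤ.* qℤ) ℤ.* R4 λ₀
    additive-case {λ₀} fλ λ≉0 =
      Γ ℤ.* ΣF (λ t → R4 (λ₀ * σ + t))
        ≡⟪ ≡.cong (Γ ℤ.*_) (≡.trans (≡.sym (ΣF-scale {λ t → R4 (λ₀ * σ + t)} λ₀ fλ λ≉0 (λ p → R4-cong (+-congˡ p))))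
             (ΣF-cong (λ t ft → ≡.trans (R4-cong (sym (distribˡ λ₀ σ t))) (≡.trans (≡.sym (R4-N _))
               (R4-cong (trans (N-* λ₀ (σ + t)) (*-cong (N-F fλ) (N-shift ft)))))))) ⟫
      Γ ℤ.* ΣF (λ t → R4 (P t))
        ≡⟪ expand-R4 Γ R4-twist P (λ ft → F-* Fl (F-+ (F-+ (F-cube ft) (F-neg ft)) F-r)) ⟫
      ΣF (λ u → R4 u ℤ.* ΣF (λ t → cos (u * P t)))
        ≡⟪ ΣF-cong (λ u fu → ≡.cong (R4 u ℤ.*_) (inner u fu)) ⟫
      ΣF (λ u → R4 u ℤ.* g (u * l))
        ≡⟪ ≡.sym (ΣF-scale {λ u → R4 u ℤ.* g (u * l)} (inv l) (F-inv Fl) (inv-nonzero l≉0) (λ p → ≡.cong₂ ℤ._*_ (R4-cong p) (g-cong (*-congʳ p)))) ⟫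
      ΣF (λ w → R4 (inv l * w) ℤ.* g (inv l * w * l))
        ≡⟪ ΣF-cong (λ w fw → ≡.trans (≡.cong (R4 (inv l * w) ℤ.*_) (g-cong (trans (*-comm _ l) (inv-cancel w l≉0)))) (split w fw)) ⟫
      ΣF (λ w → when (w ≟ 1#) v ℤ.+ when (w ≟ - 1#) v)
        ≡⟪ ≡.trans (ΣF-+ (λ w → when (w ≟ 1#) v) (λ w → when (w ≟ - 1#) v)) (≡.cong₂ ℤ._+_ (ΣF-delta {λ _ → v} F-1 (λ _ → ≡.refl)) (ΣF-delta {λ _ → v} (F-neg F-1) (λ _ → ≡.refl))) ⟫
      v ℤ.+ v
        ≡⟪ lem (R4 λ₀) qℤ ⟫ ≡.refl
      where
      l : Carrier
      l = cube λ₀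
      Fl : InF l
      Fl = F-cube fλ
      l≉0 : l ≉ 0#
      l≉0 = *-nonzero (*-nonzero λ≉0 λ≉0) λ≉0
      P : Carrier → Carrier
      P t = l * (cube t + - t + r)
      g : Carrier → ℤ
      g w = when (cube-root w + - w ≟ 0#) (qℤ ℤ.* cos (w * r))
      g-cong : Resp g
      g-cong {w} {w′} p = when-cong (cube-root w + - w ≟ 0#) (cube-root w′ + - w′ ≟ 0#)
        (trans (sym (+-cong (frob-cong e₂ p) (-‿cong p)))) (trans (+-cong (frob-cong e₂ p) (-‿cong p))) (λ _ → ≡.cong (qℤ ℤ.*_) (cos-cong (*-congʳ p)))
      inner : ∀ u → InF u → ΣF (λ t → cos (u * P t)) ≡ g (u * l)
      inner u fu = ≡.trans (ΣF-cong (λ t ft → ≡.trans (cos-cong (shape t)) (≡.trans (cos-cube _ (F-* fw₃ ft))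
          (cos-cong (solve 4 (λ a w t r → a :* t :+ (:- (w :* t) :+ w :* r) := (a :- w) :* t :+ w :* r) refl w₃ w t r)))))
        (linear-sum (F-+ fw₃ (F-neg fw)) (F-* fw F-r))
        where
        w w₃ : Carrier
        w = u * l
        w₃ = cube-root w
        fw : InF w
        fw = F-* fu Fl
        fw₃ : InF w₃
        fw₃ = frob-F e₂ fw
        shape : ∀ t → u * P t ≈ cube (w₃ * t) + (- (w * t) + w * r)
        shape t = trans (solve 4 (λ u l t r → u :* (l :* (t :* t :* t :- t :+ r)) := u :* l :* (t :* t :* t) :+ (:- (u :* l :* t) :+ u :* l :* r)) refl u l t r)
          (+-congʳ (trans (*-congʳ (sym (cube-cube-root w fw))) (solve 2 (λ a t → a :* a :* a :* (t :* t :* t) := (a :* t) :* (a :* t) :* (a :* t)) refl w₃ t)))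
      v : ℤ
      v = R4 λ₀ ℤ.* (qℤ ℤ.* -1ℤ)
      lem : ∀ a q → a ℤ.* (q ℤ.* -1ℤ) ℤ.+ a ℤ.* (q ℤ.* -1ℤ) ≡ ℤ.- (ℤ.+ 2 ℤ.* q) ℤ.* a
      lem = ℤSolver.solve-∀
      R4-il : R4 (inv l) ≡ R4 λ₀
      R4-il = ≡.trans (R4-inv l) (R4-cube λ₀)
      split : ∀ w → InF w → R4 (inv l * w) ℤ.* g w ≡ when (w ≟ 1#) v ℤ.+ when (w ≟ - 1#) v
      split w fw = by (cube-root w + - w ≟ 0#)
        where
        none : (¬ w ≈ 1#) → (¬ w ≈ - 1#) → when (w ≟ 1#) v ℤ.+ when (w ≟ - 1#) v ≡ 0ℤ
        none a b = ≡.cong₂ ℤ._+_ (when-no (w ≟ 1#) v a) (when-no (w ≟ - 1#) v b)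
        by : (d : Dec (cube-root w + - w ≈ 0#)) → R4 (inv l * w) ℤ.* when d (qℤ ℤ.* cos (w * r)) ≡ when (w ≟ 1#) v ℤ.+ when (w ≟ - 1#) v
        by (no ¬p) = ≡.trans (ℤₚ.*-zeroʳ (R4 (inv l * w))) (≡.sym (none
          (λ z → ¬p (trans (+-cong (trans (frob-cong e₂ z) (frob-1 e₂)) (-‿cong z)) (-‿inverseʳ 1#)))
          (λ z → ¬p (trans (+-cong (trans (frob-cong e₂ z) (frob--1 e₂)) (-‿cong z)) (-‿inverseʳ (- 1#))))))
        by (yes p) with cube-root-fixed fw (x-y≈0 p)
        ... | inj₁ z = ≡.trans (R4-zero-factor (qℤ ℤ.* cos (w * r)) (*-0ʳ z)) (≡.sym (none (λ o → 1≉0 (trans (sym o) z)) (λ o → -1≉0 (trans (sym o) z))))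
        ... | inj₂ (inj₁ o) = ≡.trans (≡.cong₂ (λ x y → x ℤ.* (qℤ ℤ.* y)) (≡.trans (R4-cong (trans (*-congˡ o) (*-identityʳ (inv l)))) R4-il)
                (≡.trans (cos-cong (trans (*-congʳ o) (*-identityˡ r))) cos-r))
              (≡.sym (≡.trans (≡.cong₂ ℤ._+_ (when-yes (w ≟ 1#) v o) (when-no (w ≟ - 1#) v (λ o′ → x≉-x 1≉0 (trans (sym o) o′)))) (ℤₚ.+-identityʳ v)))
        ... | inj₂ (inj₂ o) = ≡.trans (≡.cong₂ (λ x y → x ℤ.* (qℤ ℤ.* y)) (≡.trans (R4-cong (trans (*-congˡ o) (solve 1 (λ x → x :* :- :1 := :- x) refl (inv l)))) (≡.trans (R4-neg (inv l)) R4-il))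
                (≡.trans (cos-cong (trans (*-congʳ o) (-1*x≈-x r))) cos--r))
              (≡.sym (≡.trans (≡.cong₂ ℤ._+_ (when-no (w ≟ 1#) v (λ o′ → x≉-x 1≉0 (trans (sym o′) o))) (when-yes (w ≟ - 1#) v o)) (ℤₚ.+-identityˡ v)))

    -- R4 is only multiplicative against squares; the symmetry s ↦ s⁻¹ repairs this.
    R4-χ-sum : ∀ {β f} → InF β → β ≉ 0# → Resp f → (∀ s → f (inv s) ≡ f s) →
      ΣF (λ s → χ s ℤ.* R4 (β * s) ℤ.* f s) ≡ R4 β ℤ.* ΣF (λ s → R4 s ℤ.* f s)
    R4-χ-sum {β} {f} fβ β≉0 rf finv = go (classify fβ)
      where
      L = ΣF (λ s → χ s ℤ.* R4 (β * s) ℤ.* f s)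
      go : SquareClass β → L ≡ R4 β ℤ.* ΣF (λ s → R4 s ℤ.* f s)
      go (zeroᶜ p) = ⊥-elim (β≉0 p)
      go (squareᶜ m fm m≉0 eq p) = ≡.trans (sum-cong′ (elems Fₗ) (λ s → ≡.trans (≡.cong (λ t → χ s ℤ.* t ℤ.* f s)
            (≡.trans (R4-cong (*-congʳ (sym eq))) (R4-sq-* m s))) (≡.trans (regroup (χ s) (χ m) (R4 s) (f s))
            (≡.cong₂ (λ x y → x ℤ.* (y ℤ.* f s)) (≡.trans (≡.sym (R4-sq m)) (R4-cong eq)) (χ*R4 s)))))
          (ΣF-*ˡ (R4 β) (λ s → R4 s ℤ.* f s))
        where
        regroup : ∀ a b c d → a ℤ.* (b ℤ.* c) ℤ.* d ≡ b ℤ.* (a ℤ.* c ℤ.* d)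
        regroup = ℤSolver.solve-∀
      go (nonsqᶜ _ p) = ≡.trans (x≡-x (≡.trans by-inversion (≡.sym by-sign))) (≡.sym (≡.cong (ℤ._* ΣF (λ s → R4 s ℤ.* f s)) (R4-nonsq p)))
        where
        L′ = ΣF (λ s → R4 (β * s) ℤ.* f s)
        by-inversion : L ≡ L′
        by-inversion = ≡.trans (sum-cong′ (elems Fₗ) (λ s → at s (s ≟ 0#))) (ΣF-inv {λ s → R4 (β * s) ℤ.* f s} (λ p → ≡.cong₂ ℤ._*_ (R4-cong (*-congˡ p)) (rf p)))
          where
          at : ∀ s → Dec (s ≈ 0#) → χ s ℤ.* R4 (β * s) ℤ.* f s ≡ R4 (β * inv s) ℤ.* f (inv s)
          at s (yes z) = ≡.trans (≡.cong (λ t → t ℤ.* R4 (β * s) ℤ.* f s) (χ-0 z)) (≡.sym (R4-zero-factor (f (inv s)) (*-0ʳ (inv-0 z))))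
          at s (no s≉0) = ≡.cong₂ ℤ._*_ (≡.trans (≡.cong (ℤ._* R4 (β * s)) (≡.sym (χ-inv s))) (≡.trans (≡.sym (R4-sq-* (inv s) (β * s)))
            (R4-cong (trans (solve 3 (λ i b s → i :* i :* (b :* s) := b :* i :* (s :* i)) refl (inv s) β s) (trans (*-congˡ (inv-right s≉0)) (*-identityʳ _))))))
            (≡.sym (finv s))
        by-sign : ℤ.- L ≡ L′
        by-sign = ≡.trans (≡.sym (≡.trans (ΣF-*ˡ -1ℤ (λ s → χ s ℤ.* R4 (β * s) ℤ.* f s)) (ℤₚ.-1*i≡-i L))) (sum-cong′ (elems Fₗ) (λ s → at s))
          where
          at : ∀ s → -1ℤ ℤ.* (χ s ℤ.* R4 (β * s) ℤ.* f s) ≡ R4 (β * s) ℤ.* f s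
          at s = ≡.trans (regroup (χ s) (R4 (β * s)) (f s)) (≡.cong (ℤ._* f s) (≡.trans (≡.cong (λ t → t ℤ.* χ s ℤ.* R4 (β * s)) (≡.sym p))
            (≡.trans (≡.cong (ℤ._* R4 (β * s)) (≡.sym (χ-* β s))) (χ*R4 (β * s)))))
            where
            regroup : ∀ a b c → -1ℤ ℤ.* (a ℤ.* b ℤ.* c) ≡ -1ℤ ℤ.* a ℤ.* b ℤ.* c
            regroup = ℤSolver.solve-∀

    -- The constant 1 in 1 - σ² is chosen so that the cubic in t has no linear term.
    N-conic : ∀ {B t} → InF B → InF t → N (B * (1# + - (σ * σ)) + B * t) ≈ cube B * (cube t + t * t + - (r * r))
    N-conic {B} {t} fB ft = trans (N≈ _) (trans (*-cong (*-congˡ φ1) (trans (φ-cong φ1) φ2))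
      (solve 3 (λ s B t → let r = s :* s :* s :- s ; f = λ s → B :* (:1 :- s :* s) :+ B :* t in
        f s :* f (s :+ :1) :* f (s :+ :1 :+ :1) := B :* B :* B :* (t :* t :* t :+ t :* t :- r :* r)) refl σ B t))
      where
      φ-form : ∀ {s s′} → φ s ≈ s′ → φ (B * (1# + - (s * s)) + B * t) ≈ B * (1# + - (s′ * s′)) + B * t
      φ-form {s} p = trans (φ-+ _ _) (+-cong (trans (φ-* _ _) (*-cong fB (trans (φ-+ _ _) (+-cong φ-1 (trans (φ-neg _) (-‿cong (trans (φ-* s s) (*-cong p p)))))))) (trans (φ-* _ _) (*-cong fB ft)))
      φ1 = φ-form φσ
      φ2 = φ-form (trans (φ-+ σ 1#) (+-cong φσ φ-1))

    module _ {B} (fB : InF B) (B≉0 : B ≉ 0#) where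
      -- Putting u = β s makes u B³ equal to s / r. This turns w r² + w⁻¹ into r (s + s⁻¹), the
      -- argument in K2.
      cB β : Carrier
      cB = cube B
      β = inv (cB * r)

      FcB : InF cB
      FcB = F-cube fB

      cB≉0 : cB ≉ 0#
      cB≉0 = *-nonzero (*-nonzero B≉0 B≉0) B≉0

      cBr≉0 : cB * r ≉ 0#
      cBr≉0 = *-nonzero cB≉0 r≉0

      P : Carrier → Carrier
      P t = cB * (cube t + t * t + - (r * r))

      -- With a³ = w, the term w t³ has the same trace as a t, so the sum over t is quadratic.
      -- Completing the square leaves - a² / w = - a⁻¹, and cubing under the trace turns this into -
      -- w⁻¹.
      inner : ∀ {u} → InF u → u ≉ 0# →
        ℤ.+ 2 ℤ.* ΣF (λ t → cos (u * P t)) ≡ cos (u * cB * (r * r) + inv (u * cB)) ℤ.* (χ (u * cB) ℤ.* γ₀)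
      inner {u} fu u≉0 = ≡.trans (≡.cong (ℤ.+ 2 ℤ.*_) (≡.trans
          (ΣF-cong (λ t ft → ≡.trans (cos-cong (shape₁ t)) (≡.trans (cos-cube _ (F-* fa ft)) (cos-cong (shape₂ t)))))
          (ΣF-shift {λ t → cos (w * (t * t) + z)} (- (a * inv w)) (F-neg (F-* fa (F-inv fw))) (λ p → cos-cong (+-congʳ (*-congˡ (*-cong p p)))))))
        (≡.trans (quadratic-sum fw w≉0 fz) (≡.cong (ℤ._* (χ w ℤ.* γ₀)) cos-z))
        where
        w a z : Carrier
        w = u * cB
        a = cube-root w
        z = - (w * (r * r)) + - (a * a * inv w)
        fw : InF w
        fw = F-* fu FcB
        w≉0 : w ≉ 0#
        w≉0 = *-nonzero u≉0 cB≉0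
        fa : InF a
        fa = frob-F e₂ fw
        fz : InF z
        fz = F-+ (F-neg (F-* fw (F-* F-r F-r))) (F-neg (F-* (F-* fa fa) (F-inv fw)))
        ca : cube a ≈ w
        ca = cube-cube-root w fw
        a≉0 : a ≉ 0#
        a≉0 p = w≉0 (trans (sym ca) (*-0ʳ p))
        shape₁ : ∀ t → u * P t ≈ cube (a * t) + (w * (t * t) + - (w * (r * r)))
        shape₁ t = trans (solve 4 (λ u l t r → u :* (l :* (t :* t :* t :+ t :* t :- r :* r)) := u :* l :* (t :* t :* t) :+ (u :* l :* (t :* t) :- u :* l :* (r :* r))) refl u cB t r)
          (+-congʳ (trans (*-congʳ (sym ca)) (solve 2 (λ a t → a :* a :* a :* (t :* t :* t) := (a :* t) :* (a :* t) :* (a :* t)) refl a t)))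
        -- completing the square, with 2 = - 1
        shape₂ : ∀ t → a * t + (w * (t * t) + - (w * (r * r))) ≈ w * ((t + - (a * inv w)) * (t + - (a * inv w))) + z
        shape₂ t = sym (begin
          w * ((t + - (a * inv w)) * (t + - (a * inv w))) + z
            ≈⟨ solve 5 (λ w i a t r → w :* ((t :- a :* i) :* (t :- a :* i)) :+ (:- (w :* (r :* r)) :- a :* a :* i)
                 := (w :* i) :* (a :* t) :+ (w :* (t :* t) :- w :* (r :* r)) :+ (w :* i :- :1) :* (a :* a :* i)) refl w (inv w) a t r ⟩
          (w * inv w) * (a * t) + (w * (t * t) + - (w * (r * r))) + (w * inv w + - 1#) * (a * a * inv w)
            ≈⟨ +-cong (+-congʳ (trans (*-congʳ (inv-right w≉0)) (*-identityˡ _))) (*-0ˡ (trans (+-congʳ (inv-right w≉0)) (-‿inverseʳ 1#))) ⟩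
          a * t + (w * (t * t) + - (w * (r * r))) + 0#
            ≈⟨ +-identityʳ _ ⟩
          a * t + (w * (t * t) + - (w * (r * r))) ∎)
        aaw : a * a * inv w ≈ inv a
        aaw = inv-unique (trans (solve 2 (λ a i → a :* (a :* a :* i) := a :* a :* a :* i) refl a (inv w)) (trans (*-congʳ ca) (inv-right w≉0)))
        cube-inv-a : cube (inv a) ≈ inv w
        cube-inv-a = trans (inv-unique (trans (solve 2 (λ a i → a :* a :* a :* (i :* i :* i) := (a :* i) :* (a :* i) :* (a :* i)) refl a (inv a))
          (trans (cube-cong (inv-right a≉0)) (trans (*-identityʳ _) (*-identityʳ _))))) (inv-cong ca)
        cos-z : cos z ≡ cos (w * (r * r) + inv w)
        cos-z = ≡.trans (cos-cong (trans (+-congˡ (-‿cong aaw)) (solve 2 (λ x y → :- x :- y := :- (y :+ x)) refl (w * (r * r)) (inv a))))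
          (≡.trans (cos-neg (F-+ (F-inv fa) (F-* fw (F-* F-r F-r)))) (≡.trans (≡.sym (cos-cube _ (F-inv fa)))
            (cos-cong (trans (+-congʳ cube-inv-a) (+-comm _ _)))))

      conic-sum : ℤ.+ 2 ℤ.* (Γ ℤ.* ΣF (λ t → R4 (B * (1# + - (σ * σ)) + t))) ≡ γ ℤ.* (R4 β ℤ.* K2)
      conic-sum =
        ℤ.+ 2 ℤ.* (Γ ℤ.* ΣF (λ t → R4 (B * (1# + - (σ * σ)) + t)))
          ≡⟪ ≡.cong (λ x → ℤ.+ 2 ℤ.* (Γ ℤ.* x)) (≡.trans (≡.sym (ΣF-scale {λ t → R4 (B * (1# + - (σ * σ)) + t)} B fB B≉0 (λ p → R4-cong (+-congˡ p))))
               (ΣF-cong (λ t ft → ≡.trans (≡.sym (R4-N _)) (R4-cong (N-conic fB ft))))) ⟫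
        ℤ.+ 2 ℤ.* (Γ ℤ.* ΣF (λ t → R4 (P t)))
          ≡⟪ ≡.cong (ℤ.+ 2 ℤ.*_) (expand-R4 Γ R4-twist P (λ ft → F-* FcB (F-+ (F-+ (F-cube ft) (F-* ft ft)) (F-neg (F-* F-r F-r))))) ⟫
        ℤ.+ 2 ℤ.* ΣF (λ u → R4 u ℤ.* ΣF (λ t → cos (u * P t)))
          ≡⟪ ≡.trans (≡.sym (ΣF-*ˡ (ℤ.+ 2) (λ u → R4 u ℤ.* ΣF (λ t → cos (u * P t))))) (ΣF-cong (λ u fu → at u fu (u ≟ 0#))) ⟫
        ΣF h
          ≡⟪ ≡.sym (ΣF-scale {h} β (F-inv (F-* FcB F-r)) (inv-nonzero cBr≉0) h-cong) ⟫
        ΣF (λ s → h (β * s))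
          ≡⟪ ΣF-cong (λ s _ → substitute s) ⟫
        ΣF (λ s → γ ℤ.* (χ s ℤ.* R4 (β * s) ℤ.* cos (r * (s + inv s))))
          ≡⟪ ≡.trans (ΣF-*ˡ γ (λ s → χ s ℤ.* R4 (β * s) ℤ.* cos (r * (s + inv s)))) (≡.cong (γ ℤ.*_)
               (R4-χ-sum {β} {λ s → cos (r * (s + inv s))} (F-inv (F-* FcB F-r)) (inv-nonzero cBr≉0) (λ p → cos-cong (*-congˡ (+-cong p (inv-cong p))))
                 (λ s → cos-cong (*-congˡ (trans (+-congˡ (inv-inv s)) (+-comm _ _)))))) ⟫ ≡.refl
        where
        h : Carrier → ℤ
        h u = R4 u ℤ.* (cos (u * cB * (r * r) + inv (u * cB)) ℤ.* (χ (u * cB) ℤ.* γ₀))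
        h-cong : Resp h
        h-cong p = ≡.cong₂ ℤ._*_ (R4-cong p) (≡.cong₂ ℤ._*_ (cos-cong (+-cong (*-congʳ (*-congʳ p)) (inv-cong (*-congʳ p)))) (≡.cong (ℤ._* γ₀) (χ-cong (*-congʳ p))))
        at : ∀ u → InF u → Dec (u ≈ 0#) → ℤ.+ 2 ℤ.* (R4 u ℤ.* ΣF (λ t → cos (u * P t))) ≡ h u
        at u fu (yes z) = ≡.trans (≡.cong (ℤ.+ 2 ℤ.*_) (R4-zero-factor (ΣF (λ t → cos (u * P t))) z)) (≡.sym (R4-zero-factor (cos (u * cB * (r * r) + inv (u * cB)) ℤ.* (χ (u * cB) ℤ.* γ₀)) z))
        at u fu (no u≉0) = ≡.trans (move (R4 u) (ΣF (λ t → cos (u * P t)))) (≡.cong (R4 u ℤ.*_) (inner fu u≉0))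
          where
          move : ∀ a b → ℤ.+ 2 ℤ.* (a ℤ.* b) ≡ a ℤ.* (ℤ.+ 2 ℤ.* b)
          move = ℤSolver.solve-∀
        w≈ : ∀ s → β * s * cB ≈ s * inv r
        w≈ s = trans (*-congʳ (*-congʳ (inv-* cB≉0 r≉0))) (trans (solve 4 (λ i j s c → i :* j :* s :* c := c :* i :* (s :* j)) refl (inv cB) (inv r) s cB)
          (trans (*-congʳ (inv-right cB≉0)) (*-identityˡ _)))
        substitute : ∀ s → h (β * s) ≡ γ ℤ.* (χ s ℤ.* R4 (β * s) ℤ.* cos (r * (s + inv s)))
        substitute s = ≡.trans (≡.cong₂ (λ x y → R4 (β * s) ℤ.* (x ℤ.* (y ℤ.* γ₀)))
            (cos-cong (trans (+-cong (*-congʳ (w≈ s)) (inv-cong (w≈ s))) (trans (+-cong arg₁ (arg₂ (s ≟ 0#))) (sym (distribˡ r s (inv s))))))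
            (≡.trans (χ-cong (w≈ s)) (≡.trans (χ-* s (inv r)) (≡.cong (χ s ℤ.*_) (χ-inv r)))))
          (regroup (R4 (β * s)) (cos (r * (s + inv s))) (χ s) (χ r) γ₀)
          where
          arg₁ : s * inv r * (r * r) ≈ r * s
          arg₁ = trans (solve 3 (λ s i r → s :* i :* (r :* r) := r :* s :* (r :* i)) refl s (inv r) r) (trans (*-congˡ (inv-right r≉0)) (*-identityʳ _))
          arg₂ : Dec (s ≈ 0#) → inv (s * inv r) ≈ r * inv s
          arg₂ (yes z) = trans (inv-0 (*-0ˡ z)) (sym (*-0ʳ (inv-0 z)))
          arg₂ (no s≉0) = trans (inv-* s≉0 (inv-nonzero r≉0)) (trans (*-congˡ (inv-inv r)) (*-comm _ _))
          regroup : ∀ a b c d g → a ℤ.* (b ℤ.* (c ℤ.* d ℤ.* g)) ≡ d ℤ.* g ℤ.* (c ℤ.* a ℤ.* b)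
          regroup = ℤSolver.solve-∀

    module _ (b n : Carrier) (Fn : InF n) (n≉0 : n ≉ 0#) (n³ : cube n ≈ r)
      (nb² : n * (b * b) ≈ σ) (Nb : N b ≈ 1#) where
      open Radical b n Fn n≉0 n³ nb² Nb

      -- γ occurs once in `conic-sum` and once in the value of K2, so only γ² = 4 q remains and its
      -- sign drops out.
      conic-case : ∀ {B} → InF B → B ≉ 0# →
        Γ ℤ.* ΣF (λ t → R4 (B * (1# + - (σ * σ)) + t)) ≡ ℤ.- (ℤ.+ 2 ℤ.* qℤ) ℤ.* (R4 (B * n) ℤ.* χ m)
      conic-case {B} fB B≉0 = cancel-2 (≡.trans (conic-sum fB B≉0) (≡.trans (≡.cong (λ x → γ ℤ.* (R4 (β fB B≉0) ℤ.* x)) K2≡)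
        (≡.trans (regroup γ (R4 (β fB B≉0)) (χ m)) (≡.trans (≡.cong₂ (λ x y → ℤ.- (x ℤ.* (y ℤ.* χ m))) γ² R4β) (final qℤ (R4 (B * n)) (χ m))))))
        where
        R4β : R4 (β fB B≉0) ≡ R4 (B * n)
        R4β = ≡.trans (R4-inv _) (≡.trans (R4-cong (trans (*-congˡ (sym n³)) (solve 2 (λ B n → B :* B :* B :* (n :* n :* n) := (B :* n) :* (B :* n) :* (B :* n)) refl B n))) (R4-cube (B * n)))
        regroup : ∀ g a x → g ℤ.* (a ℤ.* (ℤ.- (x ℤ.* g))) ≡ ℤ.- (g ℤ.* g ℤ.* (a ℤ.* x))
        regroup = ℤSolver.solve-∀
        final : ∀ q a x → ℤ.- (ℤ.+ 4 ℤ.* q ℤ.* (a ℤ.* x)) ≡ ℤ.+ 2 ℤ.* (ℤ.- (ℤ.+ 2 ℤ.* q) ℤ.* (a ℤ.* x))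
        final = ℤSolver.solve-∀

  -- The cross product, with respect to the trace form.

  -- The first coordinate of the usual cross product of (w, φ w, φ² w) and (u, φ u, φ² u); its
  -- conjugates are the other two coordinates.
  cross : Carrier → Carrier → Carrier
  cross w u = φ w * φ (φ u) + - (φ (φ w) * φ u)

  cross-cong : ∀ {w w′ u u′} → w ≈ w′ → u ≈ u′ → cross w u ≈ cross w′ u′
  cross-cong p p′ = +-cong (*-cong (φ-cong p) (φ-cong (φ-cong p′))) (-‿cong (*-cong (φ-cong (φ-cong p)) (φ-cong p′)))

  φ-cross : ∀ a b → φ (cross a b) ≈ φ (φ a) * b + - (a * φ (φ b))
  φ-cross a b = trans (φ-+ _ _) (+-cong (trans (φ-* _ _) (*-congˡ (φφφ b)))
    (trans (φ-neg _) (-‿cong (trans (φ-* _ _) (*-congʳ (φφφ a))))))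

  φφ-cross : ∀ a b → φ (φ (cross a b)) ≈ a * φ b + - (φ a * b)
  φφ-cross a b = trans (φ-cong (φ-cross a b)) (trans (φ-+ _ _) (+-cong (trans (φ-* _ _) (*-congʳ (φφφ a)))
    (trans (φ-neg _) (-‿cong (trans (φ-* _ _) (*-congˡ (φφφ b)))))))

  ratio-F : ∀ {x y} → y ≉ 0# → x * φ y ≈ φ x * y → InF (x * inv y)
  ratio-F {x} {y} y≉0 p = cancel-nonzero (*-nonzero y≉0 (φ-nonzero y≉0)) (begin
    y * φ y * φ (x * inv y)          ≈⟨ *-congˡ (trans (φ-* x (inv y)) (*-congˡ (φ-inv y))) ⟩
    y * φ y * (φ x * inv (φ y))      ≈⟨ solve 4 (λ y f x i → y :* f :* (x :* i) := x :* y :* (f :* i)) refl y (φ y) (φ x) (inv (φ y)) ⟩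
    φ x * y * (φ y * inv (φ y))      ≈⟨ *-cong (sym p) (trans (inv-right (φ-nonzero y≉0)) (sym (inv-right y≉0))) ⟩
    x * φ y * (y * inv y)            ≈⟨ solve 4 (λ x f y i → x :* f :* (y :* i) := y :* f :* (x :* i)) refl x (φ y) y (inv y) ⟩
    y * φ y * (x * inv y)            ∎)

  ratio-≈ : ∀ {y} x → y ≉ 0# → x ≈ x * inv y * y
  ratio-≈ {y} x y≉0 = sym (trans (*-assoc _ _ _) (trans (*-congˡ (trans (*-comm _ _) (inv-right y≉0))) (*-identityʳ x)))

  cross-zero : ∀ {a b} → cross a b ≈ 0# → b ≉ 0# → ∃ λ s → InF s × a ≈ s * b
  cross-zero {a} {b} p b≉0 = a * inv b , ratio-F b≉0 (x-y≈0 (trans (sym (φφ-cross a b)) (trans (φ-cong (trans (φ-cong p) φ-0)) φ-0))) , ratio-≈ a b≉0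

  -- Eliminating v between T (a v) = 0 and T (b v) = 0 gives (v / C)^q = (v / C)^(q²) for C = a × b.
  perp : ∀ {a b v} → cross a b ≉ 0# → T (a * v) ≈ 0# → T (b * v) ≈ 0# → ∃ λ s → InF s × v ≈ s * cross a b
  perp {a} {b} {v} C≉0 Ta Tb = v * inv C , ratio-F C≉0 (sym eq) , ratio-≈ v C≉0
    where
    C = cross a b
    expand : ∀ x → T (x * v) ≈ x * v + φ x * φ v + φ (φ x) * φ (φ v)
    expand x = trans (T≈ _) (+-cong (+-congˡ (φ-* x v)) (trans (φ-cong (φ-* x v)) (φ-* _ _)))
    eq : φ v * C ≈ v * φ C
    eq = φ-injective (x-y≈0 (begin
      φ (φ v * C) + - φ (v * φ C)
        ≈⟨ +-cong (trans (φ-* _ _) (*-congˡ (φ-cross a b))) (-‿cong (trans (φ-* _ _) (*-congˡ (φφ-cross a b)))) ⟩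
      φ (φ v) * (φ (φ a) * b + - (a * φ (φ b))) + - (φ v * (a * φ b + - (φ a * b)))
        ≈⟨ solve 9 (λ a a₁ a₂ b b₁ b₂ v v₁ v₂ → v₂ :* (a₂ :* b :- a :* b₂) :- v₁ :* (a :* b₁ :- a₁ :* b) :=
             b :* (a :* v :+ a₁ :* v₁ :+ a₂ :* v₂) :- a :* (b :* v :+ b₁ :* v₁ :+ b₂ :* v₂)) refl a (φ a) (φ (φ a)) b (φ b) (φ (φ b)) v (φ v) (φ (φ v)) ⟩
      b * (a * v + φ a * φ v + φ (φ a) * φ (φ v)) + - (a * (b * v + φ b * φ v + φ (φ b) * φ (φ v)))
        ≈⟨ +-cong (*-0ʳ (trans (sym (expand a)) Ta)) (-‿cong (*-0ʳ (trans (sym (expand b)) Tb))) ⟩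
      0# + - 0#
        ≈⟨ -‿inverseʳ 0# ⟩
      0# ∎))

  cross-neg : ∀ w u → cross u w ≈ - cross w u
  cross-neg w u = solve 4 (λ a b c d → c :* b :- d :* a := :- (a :* d :- b :* c)) refl (φ w) (φ (φ w)) (φ u) (φ (φ u))

  cross-self : ∀ w → cross w w ≈ 0#
  cross-self w = solve 2 (λ a b → a :* b :- b :* a := :0) refl (φ w) (φ (φ w))

  cross-+ʳ : ∀ w u u′ → cross w (u + u′) ≈ cross w u + cross w u′
  cross-+ʳ w u u′ = trans (+-cong (*-congˡ (trans (φ-cong (φ-+ u u′)) (φ-+ _ _))) (-‿cong (*-congˡ (φ-+ u u′))))
    (solve 6 (λ a b c d e f → a :* (c :+ d) :- b :* (e :+ f) := a :* c :- b :* e :+ (a :* d :- b :* f)) refl _ _ _ _ _ _)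

  cross-scaleʳ : ∀ {s} w u → InF s → cross w (s * u) ≈ s * cross w u
  cross-scaleʳ {s} w u fs = trans (+-cong (*-congˡ (trans (φ-cong φs) (trans (φ-* _ _) (*-congʳ fs)))) (-‿cong (*-congˡ φs)))
    (solve 5 (λ s a b c d → a :* (s :* c) :- b :* (s :* d) := s :* (a :* c :- b :* d)) refl s _ _ _ _)
    where
    φs : φ (s * u) ≈ s * φ u
    φs = trans (φ-* s u) (*-congʳ fs)

  cross-+ˡ : ∀ w w′ u → cross (w + w′) u ≈ cross w u + cross w′ u
  cross-+ˡ w w′ u = trans (cross-neg u (w + w′)) (trans (-‿cong (cross-+ʳ u w w′))
    (trans (solve 2 (λ a b → :- (a :+ b) := :- a :- b) refl _ _) (sym (+-cong (cross-neg u w) (cross-neg u w′)))))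

  cross-scaleˡ : ∀ {s} w u → InF s → cross (s * w) u ≈ s * cross w u
  cross-scaleˡ {s} w u fs = trans (cross-neg u (s * w)) (trans (-‿cong (cross-scaleʳ u w fs))
    (trans (solve 2 (λ s x → :- (s :* x) := s :* :- x) refl s _) (*-congˡ (sym (cross-neg u w)))))

  T-cross : ∀ x w u → T (x * cross w u) ≈
    x * (φ w * φ (φ u) + - (φ (φ w) * φ u)) + φ x * (φ (φ w) * u + - (w * φ (φ u))) + φ (φ x) * (w * φ u + - (φ w * u))
  T-cross x w u = trans (T≈ _) (+-cong (+-congˡ (trans (φ-* _ _) (*-congˡ (φ-cross w u))))
    (trans (φ-cong (φ-* _ _)) (trans (φ-* _ _) (*-congˡ (φφ-cross w u)))))

  T-cross-right : ∀ w u → T (u * cross w u) ≈ 0#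
  T-cross-right w u = trans (T-cross u w u) (solve 6 (λ a b c x y z →
    a :* (y :* c :- z :* b) :+ b :* (z :* a :- x :* c) :+ c :* (x :* b :- y :* a) := :0) refl u (φ u) (φ (φ u)) w (φ w) (φ (φ w)))

  T-cross-left : ∀ w u → T (w * cross w u) ≈ 0#
  T-cross-left w u = trans (T-cross w w u) (solve 6 (λ a b c x y z →
    x :* (y :* c :- z :* b) :+ y :* (z :* a :- x :* c) :+ z :* (x :* b :- y :* a) := :0) refl u (φ u) (φ (φ u)) w (φ w) (φ (φ w)))

  -- T (x (w × u)) is the determinant of the conjugate vectors of x, w and u, hence alternating.
  T-cross-swap : ∀ x w u → T (x * cross w u) + T (u * cross w x) ≈ 0#
  T-cross-swap x w u = trans (+-cong (T-cross x w u) (T-cross u w x)) (solve 9 (λ a b c x y z p q r →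
    p :* (y :* c :- z :* b) :+ q :* (z :* a :- x :* c) :+ r :* (x :* b :- y :* a) :+
    (a :* (y :* r :- z :* q) :+ b :* (z :* p :- x :* r) :+ c :* (x :* q :- y :* p)) := :0) refl u (φ u) (φ (φ u)) w (φ w) (φ (φ w)) x (φ x) (φ (φ x)))

  cube-injective : ∀ {x y} → cube x ≈ cube y → x ≈ y
  cube-injective {x} {y} p = x-y≈0 (go (x + - y ≟ 0#))
    where
    z : cube (x + - y) ≈ 0#
    z = trans (solve 2 (λ x y → (x :- y) :* (x :- y) :* (x :- y) := x :* x :* x :- y :* y :* y) refl x y) (trans (+-congʳ p) (-‿inverseʳ _))
    go : Dec (x + - y ≈ 0#) → x + - y ≈ 0#
    go (yes q) = q
    go (no ¬q) = ⊥-elim (*-nonzero (*-nonzero ¬q ¬q) ¬q z)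

  -- Surjectivity of the trace, additive Hilbert 90 and Artin-Schreier elements.

  α∉F : ¬ InF α
  α∉F f = ℕₚ.<⇒≱ (ℕₚ.m<m*n m₁ d₁ 1<d₁) (order-minimal m₁ (F*-pow f α≉0))
    where
    1<d₁ : 1 ℕ.< d₁
    1<d₁ = ≡.subst (1 ℕ.<_) (≡.sym (proj₂ d₁≡)) (ℕ.s≤s (ℕ.s≤s ℕ.z≤n))

  -- If T vanished everywhere, then T α = T (α²) = 0 would reduce the cubic equation of α over F to
  -- α³ = N α. Cubing is injective, so α would lie in F.
  trace-nonzero : ∃ λ θ → T θ ≉ 0#
  trace-nonzero = go (search Eₗ (λ x → ¬? (T x ≟ 0#)) (λ p ¬z z → ¬z (trans (T-cong p) z)))
    where
    go : Dec (∃ λ x → ⊤ {ℓ} × T x ≉ 0#) → ∃ λ θ → T θ ≉ 0#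
    go (yes (θ , _ , p)) = θ , p
    go (no none) = ⊥-elim (α∉F (cube-injective (trans (sym (trans (φ-* _ _) (*-congʳ (φ-* _ _)))) (F-cong (sym cube-N) (N-inF α)))))
      where
      T0 : ∀ x → T x ≈ 0#
      T0 x with T x ≟ 0#
      ... | yes p = p
      ... | no ¬p = ⊥-elim (none (x , tt , ¬p))
      cube-N : cube α ≈ N α
      cube-N = begin
        cube α
          ≈⟨ solve 3 (λ a b c → let e = a :+ b :+ c ; p = a :* a :+ b :* b :+ c :* c in
               a :* a :* a := a :* b :* c :+ e :* (a :* a) :+ (e :* e :- p) :* a) refl α (φ α) (φ (φ α)) ⟩
        α * φ α * φ (φ α) + (α + φ α + φ (φ α)) * (α * α) + ((α + φ α + φ (φ α)) * (α + φ α + φ (φ α)) + - (α * α + φ α * φ α + φ (φ α) * φ (φ α))) * α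
          ≈⟨ +-cong (+-congˡ (*-0ˡ e0)) (*-0ˡ (trans (+-cong (*-0ˡ e0) (-‿cong p0)) (-‿inverseʳ 0#))) ⟩
        α * φ α * φ (φ α) + 0# + 0#
          ≈⟨ trans (+-identityʳ _) (+-identityʳ _) ⟩
        α * φ α * φ (φ α)
          ≈⟨ sym (N≈ α) ⟩
        N α ∎
        where
        e0 : α + φ α + φ (φ α) ≈ 0#
        e0 = trans (sym (T≈ α)) (T0 α)
        p0 : α * α + φ α * φ α + φ (φ α) * φ (φ α) ≈ 0#
        p0 = trans (sym (trans (T≈ _) (+-cong (+-congˡ (φ-* α α)) (trans (φ-cong (φ-* α α)) (φ-* _ _))))) (T0 (α * α))

  -- The usual averaging with an element θ of nonzero trace gives y with y - φ y = v, and w = φ² y.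
  -- The difference is taken in the form w × 1.
  hilbert-90 : ∀ {v} → T v ≈ 0# → ∃ λ w → φ w + - φ (φ w) ≈ v
  hilbert-90 {v} Tv = φ (φ y) , (begin
    φ (φ (φ y)) + - φ (φ (φ (φ y)))     ≈⟨ +-cong (φφφ y) (-‿cong (φ-cong (φφφ y))) ⟩
    y + - φ y                           ≈⟨ +-congˡ (-‿cong φy) ⟩
    y + - (inv τ * (φ v * φ (φ θ) + (φ v + φ (φ v)) * θ))
      ≈⟨ solve 7 (λ i v v₁ v₂ t t₁ t₂ → i :* (v :* t₁ :+ (v :+ v₁) :* t₂) :- i :* (v₁ :* t₂ :+ (v₁ :+ v₂) :* t) :=
           i :* (t :+ t₁ :+ t₂) :* v :- i :* t :* (v :+ v₁ :+ v₂)) refl (inv τ) v (φ v) (φ (φ v)) θ (φ θ) (φ (φ θ)) ⟩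
    inv τ * (θ + φ θ + φ (φ θ)) * v + - (inv τ * θ * (v + φ v + φ (φ v)))
      ≈⟨ +-cong (*-congʳ (trans (*-congˡ (sym (T≈ θ))) (trans (*-comm _ _) (inv-right τ≉0)))) (-‿cong (*-0ʳ (trans (sym (T≈ v)) Tv))) ⟩
    1# * v + - 0#                       ≈⟨ solve 1 (λ v → :1 :* v :- :0 := v) refl v ⟩
    v ∎)
    where
    θ = proj₁ trace-nonzero
    τ = T θ
    τ≉0 = proj₂ trace-nonzero
    y : Carrier
    y = inv τ * (v * φ θ + (v + φ v) * φ (φ θ))
    φy : φ y ≈ inv τ * (φ v * φ (φ θ) + (φ v + φ (φ v)) * θ)
    φy = trans (φ-* _ _) (*-cong (F-inv (T-inF θ)) (trans (φ-+ _ _) (+-cong (φ-* _ _)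
      (trans (φ-* _ _) (*-cong (φ-+ _ _) (φφφ θ))))))

  unshift : ∀ {w v} → φ w + - φ (φ w) ≈ v → InF v → φ w ≈ w + - v
  unshift {w} {v} p fv = begin
    φ w                                 ≈⟨ solve 2 (λ a b → b := a :- (a :- b)) refl w (φ w) ⟩
    w + - (w + - φ w)                   ≈⟨ +-congˡ (-‿cong (begin
      w + - φ w                         ≈⟨ sym (+-cong (φφφ w) (-‿cong (φ-cong (φφφ w)))) ⟩
      φ (φ (φ w)) + - φ (φ (φ (φ w)))   ≈⟨ sym (trans (φ-cong (trans (φ-+ _ _) (+-congˡ (φ-neg _)))) (trans (φ-+ _ _) (+-congˡ (φ-neg _)))) ⟩
      φ (φ (φ w + - φ (φ w)))           ≈⟨ φ-cong (φ-cong p) ⟩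
      φ (φ v)                           ≈⟨ trans (φ-cong fv) fv ⟩
      v ∎)) ⟩
    w + - v ∎

  T-F : ∀ {x} → InF x → T x ≈ 0#
  T-F {x} fx = trans (T≈ x) (trans (+-cong (+-congˡ fx) (trans (φ-cong fx) fx)) (solve 1 (λ x → x :+ x :+ x := :0) refl x))

  -- In characteristic 3 all of F, in particular -1, has trace 0 from E to F, so Hilbert 90 applies.
  artin-schreier : ∃ λ δ → φ δ ≈ δ + 1#
  artin-schreier = let (δ , p) = hilbert-90 (T-F (F-neg F-1)) in
    δ , trans (unshift p (F-neg F-1)) (+-congˡ (-‿involutive 1#))

  -- The conic S.

  -- A scalar of F with norm 1 satisfies s³ = 1, hence s = 1. So elements of norm 1 represent the
  -- points of the projective plane of E over F once each; all later normalizations rest on this.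
  S-F-ratio : ∀ {a b s} → N a ≈ 1# → N b ≈ 1# → InF s → a ≈ s * b → a ≈ b
  S-F-ratio {a} {b} {s} Na Nb fs p = trans p (trans (*-congʳ (cube-injective (begin
    cube s               ≈⟨ sym (N-F fs) ⟩
    N s                  ≈⟨ sym (*-identityʳ _) ⟩
    N s * 1#             ≈⟨ *-congˡ (sym Nb) ⟩
    N s * N b            ≈⟨ sym (N-* s b) ⟩
    N (s * b)            ≈⟨ N-cong (sym p) ⟩
    N a                  ≈⟨ Na ⟩
    1#                   ≈⟨ solve 0 (:1 := :1 :* :1 :* :1) refl ⟩
    cube 1# ∎))) (*-identityˡ b))

  -- If a and b were independent, both would be orthogonal to a and to b, hence both multiples of a
  -- × b.
  tangent : ∀ {a b} → InS a → InS b → T (a * b) ≈ 0# → a ≈ b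
  tangent {a} {b} (a≉0 , Na , Ta) (b≉0 , Nb , Tb) p = go (cross a b ≟ 0#)
    where
    go : Dec (cross a b ≈ 0#) → a ≈ b
    go (yes z) = let (s , fs , eq) = cross-zero z b≉0 in S-F-ratio Na Nb fs eq
    go (no C≉0) =
      let (s , fs , a≈) = perp C≉0 Ta (trans (T-cong (*-comm b a)) p)
          (s′ , fs′ , b≈) = perp C≉0 p Tb
          s′≉0 : s′ ≉ 0#
          s′≉0 z = b≉0 (trans b≈ (*-0ˡ z))
      in S-F-ratio Na Nb (F-* fs (F-inv fs′)) (begin
        a                                     ≈⟨ a≈ ⟩
        s * cross a b                         ≈⟨ *-congˡ (sym (trans (*-congʳ (trans (*-comm _ _) (inv-right s′≉0))) (*-identityˡ _))) ⟩
        s * (inv s′ * s′ * cross a b)         ≈⟨ solve 4 (λ s i t c → s :* (i :* t :* c) := s :* i :* (t :* c)) refl s (inv s′) s′ (cross a b) ⟩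
        s * inv s′ * (s′ * cross a b)         ≈⟨ *-congˡ (sym b≈) ⟩
        s * inv s′ * b ∎)

  one∈S : InS 1#
  one∈S = 1≉0 , 1^ d₁ , trans (T-cong (*-identityʳ 1#)) (T-F F-1)

  -- The sign that separates X₁ from X₂ when a = a₁. Its value 1 where the trace vanishes agrees
  -- with the condition ≠ -1 in X₁.
  ρ : Carrier → Carrier → ℤ
  ρ a b with χ (two * T (a * b)) ℤₚ.≟ -1ℤ
  ... | yes _ = -1ℤ
  ... | no _ = 1ℤ

  χ-two : ∀ x → χ (two * x) ≡ χ x
  χ-two x = ≡.trans (χ-cong (solve 1 (λ x → (:1 :+ :1) :* x := :- x) refl x)) (χ-neg x)

  ρ-zero : ∀ {a b} → T (a * b) ≈ 0# → ρ a b ≡ 1ℤ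
  ρ-zero {a} {b} p with χ (two * T (a * b)) ℤₚ.≟ -1ℤ
  ... | no _ = ≡.refl
  ... | yes eq = ⊥-elim (absurd (≡.trans (≡.sym eq) (χ-0 (*-0ʳ p))))
    where
    absurd : -1ℤ ≢ 0ℤ
    absurd ()

  ρ-χ : ∀ {a b} → T (a * b) ≉ 0# → ρ a b ≡ χ (T (a * b))
  ρ-χ {a} {b} nz with χ (two * T (a * b)) ℤₚ.≟ -1ℤ
  ... | yes eq = ≡.trans (≡.sym eq) (χ-two _)
  ... | no neq = [ ≡.sym , (λ p → ⊥-elim (neq (≡.trans (χ-two _) p))) ]′ (χ-±1 nz)

  ρ-±1 : ∀ a b → ρ a b ≡ 1ℤ ⊎ ρ a b ≡ -1ℤ
  ρ-±1 a b with χ (two * T (a * b)) ℤₚ.≟ -1ℤ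
  ... | yes _ = inj₂ ≡.refl
  ... | no _ = inj₁ ≡.refl

  ρ-² : ∀ a b → ρ a b ℤ.* ρ a b ≡ 1ℤ
  ρ-² a b = [ (λ p → ≡.cong₂ ℤ._*_ p p) , (λ p → ≡.cong₂ ℤ._*_ p p) ]′ (ρ-±1 a b)

  ρ-cong : ∀ {a b a′ b′} → a ≈ a′ → b ≈ b′ → ρ a b ≡ ρ a′ b′
  ρ-cong {a} {b} {a′} {b′} p p′ with χ (two * T (a * b)) ℤₚ.≟ -1ℤ | χ (two * T (a′ * b′)) ℤₚ.≟ -1ℤ
  ... | yes _ | yes _ = ≡.refl
  ... | no _ | no _ = ≡.refl
  ... | yes e | no ne = ⊥-elim (ne (≡.trans (χ-cong (*-congˡ (T-cong (sym (*-cong p p′))))) e))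
  ... | no ne | yes e = ⊥-elim (ne (≡.trans (χ-cong (*-congˡ (T-cong (*-cong p p′)))) e))

  -- Gram determinant of 1, a, b
  gram : ∀ {a b} → InS a → InS b → χ (T a) ℤ.* χ (T b) ≡ χ (T (a * b)) ⊎ (T a ≈ 0# ⊎ T b ≈ 0# ⊎ T (a * b) ≈ 0#)
  gram {a} {b} (_ , _ , Ta²) (_ , _ , Tb²) = go (T a ≟ 0#) (T b ≟ 0#) (T (a * b) ≟ 0#)
    where
    Δ : Carrier
    Δ = T (cross a b)
    T-prod : ∀ x y → T (x * y) ≈ x * y + φ x * φ y + φ (φ x) * φ (φ y)
    T-prod x y = trans (T≈ _) (+-cong (+-congˡ (φ-* x y)) (trans (φ-cong (φ-* x y)) (φ-* _ _)))
    Δ² : Δ * Δ ≈ - (T a * T b * T (a * b))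
    Δ² = begin
      Δ * Δ ≈⟨ *-cong Δ≈ Δ≈ ⟩
      Δ′ * Δ′
        ≈⟨ solve 6 (λ a a₁ a₂ b b₁ b₂ →
             let Δ = (a₁ :* b₂ :- a₂ :* b₁) :+ (a₂ :* b :- a :* b₂) :+ (a :* b₁ :- a₁ :* b)
                 Ta = a :+ a₁ :+ a₂ ; Tb = b :+ b₁ :+ b₂ ; Tab = a :* b :+ a₁ :* b₁ :+ a₂ :* b₂
                 pa = a :* a :+ a₁ :* a₁ :+ a₂ :* a₂ ; pb = b :* b :+ b₁ :* b₁ :+ b₂ :* b₂ in
             Δ :* Δ := :- (Ta :* Tb :* Tab) :- Ta :* Ta :* pb :- Tb :* Tb :* pa) refl a (φ a) (φ (φ a)) b (φ b) (φ (φ b)) ⟩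
      - (τ a * τ b * ππ a b) + - (τ a * τ a * ππ b b) + - (τ b * τ b * ππ a a)
        ≈⟨ +-cong (+-cong (-‿cong (*-cong (*-cong (sym (T≈ a)) (sym (T≈ b))) (sym (T-prod a b)))) (-‿cong (*-0ʳ (trans (sym (T-prod b b)) Tb²))))
             (-‿cong (*-0ʳ (trans (sym (T-prod a a)) Ta²))) ⟩
      - (T a * T b * T (a * b)) + - 0# + - 0#
        ≈⟨ solve 1 (λ x → x :- :0 :- :0 := x) refl _ ⟩
      - (T a * T b * T (a * b)) ∎
      where
      τ : Carrier → Carrier
      τ x = x + φ x + φ (φ x)
      ππ : Carrier → Carrier → Carrier
      ππ x y = x * y + φ x * φ y + φ (φ x) * φ (φ y)
      Δ′ : Carrier
      Δ′ = (φ a * φ (φ b) + - (φ (φ a) * φ b)) + (φ (φ a) * b + - (a * φ (φ b))) + (a * φ b + - (φ a * b))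
      Δ≈ : Δ ≈ Δ′
      Δ≈ = trans (T≈ _) (+-cong (+-congˡ (φ-cross a b)) (φφ-cross a b))
    go : Dec (T a ≈ 0#) → Dec (T b ≈ 0#) → Dec (T (a * b) ≈ 0#) →
      χ (T a) ℤ.* χ (T b) ≡ χ (T (a * b)) ⊎ (T a ≈ 0# ⊎ T b ≈ 0# ⊎ T (a * b) ≈ 0#)
    go (yes p) _ _ = inj₂ (inj₁ p)
    go (no _) (yes p) _ = inj₂ (inj₂ (inj₁ p))
    go (no _) (no _) (yes p) = inj₂ (inj₂ (inj₂ p))
    go (no na) (no nb) (no nab) = inj₁ (≡.trans (≡.sym (χ-* (T a) (T b))) (sign-eq (χ-² (*-nonzero na nb))
      (≡.trans (≡.sym (χ-* (T a * T b) (T (a * b)))) (≡.trans (≡.sym (χ-neg (T a * T b * T (a * b)))) (≡.trans (χ-cong (sym Δ²)) (χ-sq Δ≉0))))))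
      where
      Δ≉0 : Δ ≉ 0#
      Δ≉0 z = -nonzero (*-nonzero (*-nonzero na nb) nab) (trans (sym Δ²) (*-0ˡ z))

  ρ₁ : Carrier → ℤ
  ρ₁ = ρ 1#

  -- If no trace vanishes this is `gram`; a vanishing trace makes two of the points 1, a, b of the
  -- conic coincide. Hence `ρ a₁` and `ρ₁` differ on S by a constant sign.
  ρ-product : ∀ {a b} → InS a → InS b → ρ a b ≡ ρ₁ a ℤ.* ρ₁ b
  ρ-product {a} {b} Sa Sb = go (T (a * b) ≟ 0#) (T a ≟ 0#) (T b ≟ 0#)
    where
    at-1 : ∀ {x} → InS x → T x ≈ 0# → 1# ≈ x
    at-1 Sx p = tangent one∈S Sx (trans (T-cong (*-identityˡ _)) p)
    go : Dec (T (a * b) ≈ 0#) → Dec (T a ≈ 0#) → Dec (T b ≈ 0#) → ρ a b ≡ ρ₁ a ℤ.* ρ₁ b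
    go (yes p) _ _ = ≡.trans (ρ-zero p) (≡.sym (≡.trans (≡.cong (ρ₁ a ℤ.*_) (ρ-cong refl (sym (tangent Sa Sb p)))) (ρ-² 1# a)))
    go (no _) (yes p) _ = ≡.trans (ρ-cong (sym (at-1 Sa p)) refl) (≡.sym (≡.trans (≡.cong (ℤ._* ρ₁ b) (ρ-zero (trans (T-cong (*-identityˡ a)) p))) (ℤₚ.*-identityˡ (ρ₁ b))))
    go (no _) (no _) (yes p) = ≡.trans (ρ-cong refl (sym (at-1 Sb p))) (≡.trans (sym-ρ a) (≡.sym (≡.trans (≡.cong (ρ₁ a ℤ.*_) (ρ-zero (trans (T-cong (*-identityˡ b)) p))) (ℤₚ.*-identityʳ (ρ₁ a)))))
      where
      sym-ρ : ∀ a → ρ a 1# ≡ ρ 1# a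
      sym-ρ a with χ (two * T (a * 1#)) ℤₚ.≟ -1ℤ | χ (two * T (1# * a)) ℤₚ.≟ -1ℤ
      ... | yes _ | yes _ = ≡.refl
      ... | no _ | no _ = ≡.refl
      ... | yes e | no ne = ⊥-elim (ne (≡.trans (χ-cong (*-congˡ (T-cong (*-comm 1# a)))) e))
      ... | no ne | yes e = ⊥-elim (ne (≡.trans (χ-cong (*-congˡ (T-cong (*-comm a 1#)))) e))
    go (no nab) (no na) (no nb) = [ (λ eq → ≡.trans (ρ-χ nab) (≡.trans (≡.sym eq) (≡.sym (≡.cong₂ ℤ._*_ (at a na) (at b nb)))))
      , [ (λ z → ⊥-elim (na z)) , [ (λ z → ⊥-elim (nb z)) , (λ z → ⊥-elim (nab z)) ]′ ]′ ]′ (gram Sa Sb)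
      where
      at : ∀ x → T x ≉ 0# → ρ₁ x ≡ χ (T x)
      at x nx = ≡.trans (ρ-χ (λ z → nx (trans (T-cong (sym (*-identityˡ x))) z))) (χ-cong (T-cong (*-identityˡ x)))

  record Decomposition (v : Carrier) : Set (c ⊔ ℓ) where
    field
      coeff : Carrier
      base : Carrier
      coeff-F : InF coeff
      coeff≉0 : coeff ≉ 0#
      base-S : InS base
      v≈ : v ≈ coeff * (base * base)

  -- The coefficient is the cube root of N v in F. The quotient β has norm 1, so R4 β = R4 (N β) = 1
  -- makes it a square, and N b = 1 selects one of its two roots, since N (-1) = -1.
  decompose : ∀ {v} → v ≉ 0# → T v ≈ 0# → Decomposition v
  decompose {v} v≉0 Tv = record
    { coeff = n′ ; base = proj₁ base ; coeff-F = fn ; coeff≉0 = n≉0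
    ; base-S = base≉0 , proj₁ (proj₂ base) , trans (T-cong (proj₂ (proj₂ base))) Tβ
    ; v≈ = trans (sym (trans (*-congˡ (*-comm v (inv n′))) (inv-cancel v n≉0))) (*-congˡ (sym (proj₂ (proj₂ base))))
    }
    where
    Nv≉0 : N v ≉ 0#
    Nv≉0 = ^-nonzero d₁ v≉0
    n′ β : Carrier
    n′ = cube-root (N v)
    β = v * inv n′
    n³ : cube n′ ≈ N v
    n³ = cube-cube-root (N v) (N-inF v)
    fn : InF n′
    fn = frob-F e₂ (N-inF v)
    n≉0 : n′ ≉ 0#
    n≉0 z = Nv≉0 (trans (sym n³) (*-0ʳ z))
    β≉0 : β ≉ 0#
    β≉0 = *-nonzero v≉0 (inv-nonzero n≉0)
    Nβ : N β ≈ 1#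
    Nβ = trans (N-* v (inv n′)) (trans (*-cong (sym n³) (N-F (F-inv fn))) (trans
      (solve 2 (λ n i → n :* n :* n :* (i :* i :* i) := (n :* i) :* (n :* i) :* (n :* i)) refl n′ (inv n′))
      (trans (cube-cong (inv-right n≉0)) (trans (*-identityʳ _) (*-identityʳ _)))))
    Tβ : T β ≈ 0#
    Tβ = trans (T-cong (*-comm v (inv n′))) (trans (T-scale v (F-inv fn)) (*-0ʳ Tv))
    χβ : χ β ≡ 1ℤ
    χβ = ≡.trans (≡.sym (ℤₚ.*-identityʳ (χ β))) (≡.trans (≡.cong (χ β ℤ.*_) (≡.sym R4β)) (≡.trans (χ*R4 β) R4β))
      where
      R4β : R4 β ≡ 1ℤ
      R4β = ≡.trans (≡.sym (R4-N β)) (≡.trans (R4-cong Nβ) R4-1)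
    root = square-root χβ
    base : ∃ λ b → N b ≈ 1# × b * b ≈ β
    base = go (square-eq {N (proj₁ root)} {1#} (trans (sym (N-* _ _)) (trans (N-cong (proj₂ root)) (trans Nβ (sym (*-identityʳ 1#))))))
      where
      b = proj₁ root
      go : N b ≈ 1# ⊎ N b ≈ - 1# → ∃ λ b → N b ≈ 1# × b * b ≈ β
      go (inj₁ p) = b , p , proj₂ root
      go (inj₂ p) = - b , trans (N-cong (sym (-1*x≈-x b))) (trans (N-* (- 1#) b) (trans (*-cong (N-F (F-neg F-1)) p)
        (solve 0 (:- :1 :* :- :1 :* :- :1 :* :- :1 := :1) refl))) , trans (solve 1 (λ b → :- b :* :- b := b :* b) refl b) (proj₂ root)
    base≉0 : proj₁ base ≉ 0#
    base≉0 z = β≉0 (trans (sym (proj₂ (proj₂ base))) (*-0ˡ z))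

  square-S-injective : ∀ {a b} → N a ≈ 1# → N b ≈ 1# → a * a ≈ b * b → a ≈ b
  square-S-injective {a} {b} Na Nb p = [ (λ q → q) , (λ q → ⊥-elim (x≉-x 1≉0 (trans (sym Na) (trans (N-cong q)
    (trans (N-cong (sym (-1*x≈-x b))) (trans (N-* (- 1#) b) (trans (*-cong (N-F (F-neg F-1)) Nb) (solve 0 (:- :1 :* :- :1 :* :- :1 :* :1 := :- :1) refl)))))))) ]′ (square-eq p)

  decomposition-unique : ∀ {s s′ a b} → InF s → s ≉ 0# → InF s′ → N a ≈ 1# → N b ≈ 1# →
    s * (a * a) ≈ s′ * (b * b) → s ≈ s′ × a ≈ b
  decomposition-unique {s} {s′} {a} {b} fs s≉0 fs′ Na Nb p = s≈ , a≈b
    where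
    a²≈ : a * a ≈ inv s * s′ * (b * b)
    a²≈ = trans (sym (trans (*-congʳ (trans (*-comm _ _) (inv-right s≉0))) (*-identityˡ _))) (trans (*-assoc _ _ _) (trans (*-congˡ p) (sym (*-assoc _ _ _))))
    Nsq : ∀ {x} → N x ≈ 1# → N (x * x) ≈ 1#
    Nsq Nx = trans (N-* _ _) (trans (*-cong Nx Nx) (*-identityʳ 1#))
    a≈b : a ≈ b
    a≈b = square-S-injective Na Nb (S-F-ratio (Nsq Na) (Nsq Nb) (F-* (F-inv fs) fs′) a²≈)
    b≉0 : b ≉ 0#
    b≉0 z = 1≉0 (trans (sym Nb) (trans (N-cong z) (trans (^-congʳ 0# (ℕₚ.+-comm (q ℕ.* q ℕ.+ q) 1)) (0^ (q ℕ.* q ℕ.+ q)))))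
    s≈ : s ≈ s′
    s≈ = cancel-nonzero (*-nonzero b≉0 b≉0) (trans (*-comm _ _) (trans (*-congˡ (sym (*-cong a≈b a≈b))) (trans p (*-comm _ _))))

  -- Sums of R4 and ε along affine lines of E.

  -- Any Artin-Schreier element serves here: `Γ` does not depend on it, so all instances of
  -- `CubicSum` share the same `Γ`.
  δ : Carrier
  δ = proj₁ artin-schreier

  open Additive δ (proj₂ artin-schreier) public using (Γ; Γ²)

  -- The sum depends on w only modulo F, that is on v. If v is in F, then w = - v σ with an
  -- Artin-Schreier element σ. Otherwise v = - B σ with B in F, and w is B (1 - σ²) modulo F. These
  -- are the two normal forms.
  quadratic-line-sum : ∀ {w v s b} → φ w + - φ (φ w) ≈ v → InF s → s ≉ 0# → InS b → v ≈ s * (b * b) →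
    Γ ℤ.* ΣF (λ t → R4 (w + t)) ≡ ℤ.- (ℤ.+ 2 ℤ.* qℤ) ℤ.* (R4 s ℤ.* ρ₁ b)
  quadratic-line-sum {w} {v} {s} {b} wv fs s≉0 (b≉0 , Nb , Tb) vsb = go (InF? v)
    where
    go : Dec (InF v) → Γ ℤ.* ΣF (λ t → R4 (w + t)) ≡ ℤ.- (ℤ.+ 2 ℤ.* qℤ) ℤ.* (R4 s ℤ.* ρ₁ b)
    go (yes fv) = ≡.trans (≡.cong (Γ ℤ.*_) (sum-cong′ (elems Fₗ) (λ t → R4-cong (+-congʳ w≈))))
        (≡.trans (CubicSum.additive-case σ φσ (F-neg fv) (-nonzero v≉0)) (≡.cong (ℤ.- (ℤ.+ 2 ℤ.* qℤ) ℤ.*_)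
          (≡.trans (R4-neg v) (≡.trans (R4-cong v≈s) (≡.sym (≡.trans (≡.cong (R4 s ℤ.*_) ρb) (ℤₚ.*-identityʳ (R4 s))))))))
      where
      v≉0 : v ≉ 0#
      v≉0 z = *-nonzero s≉0 (*-nonzero b≉0 b≉0) (trans (sym vsb) z)
      σ : Carrier
      σ = - (w * inv v)
      φσ : φ σ ≈ σ + 1#
      φσ = begin
        φ (- (w * inv v))              ≈⟨ trans (φ-neg _) (-‿cong (trans (φ-* _ _) (*-cong (unshift wv fv) (F-inv fv)))) ⟩
        - ((w + - v) * inv v)          ≈⟨ solve 3 (λ w v i → :- ((w :- v) :* i) := :- (w :* i) :+ v :* i) refl w v (inv v) ⟩
        - (w * inv v) + v * inv v      ≈⟨ +-congˡ (inv-right v≉0) ⟩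
        σ + 1# ∎
      w≈ : w ≈ - v * σ
      w≈ = sym (trans (solve 3 (λ w v i → :- v :* :- (w :* i) := w :* (v :* i)) refl w v (inv v)) (trans (*-congˡ (inv-right v≉0)) (*-identityʳ w)))
      b²∈F : InF (b * b)
      b²∈F = F-cong (trans (*-congˡ vsb) (trans (sym (*-assoc _ _ _)) (trans (*-congʳ (trans (*-comm _ _) (inv-right s≉0))) (*-identityˡ _)))) (F-* (F-inv fs) fv)
      -- 1 is the only element of S in F. There T (1 · b) = 0, the case in which `ρ` is 1 by
      -- convention.
      b≈1 : b ≈ 1#
      b≈1 = S-F-ratio Nb (1^ d₁) (F-root b²∈F) (sym (*-identityʳ b))
      v≈s : v ≈ s
      v≈s = trans vsb (trans (*-congˡ (trans (*-cong b≈1 b≈1) (*-identityʳ 1#))) (*-identityʳ s))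
      ρb : ρ₁ b ≡ 1ℤ
      ρb = ρ-zero (trans (T-cong (trans (*-identityˡ b) b≈1)) (T-F F-1))
    go (no ¬fv) = ≡.trans (≡.cong (Γ ℤ.*_) (≡.trans (sum-cong′ (elems Fₗ) (λ t → R4-cong (shape t)))
          (ΣF-shift {λ t → R4 (x + t)} y fy (λ p → R4-cong (+-congˡ p)))))
        (≡.trans (CubicSum.conic-case σ φσ b n′ fn n≉0 n³ (sym σ≈) Nb fB B≉0) (≡.cong (ℤ.- (ℤ.+ 2 ℤ.* qℤ) ℤ.*_)
          (≡.cong₂ ℤ._*_ (≡.trans (R4-cong Bn) (R4-neg s)) (≡.sym ρb))))
      where
      Tv : v + φ v + φ (φ v) ≈ 0#
      Tv = trans (sym (T≈ v)) (trans (T-cong vsb) (trans (T-scale _ fs) (*-0ʳ Tb)))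
      -- T v = 0 puts B in F, and division of v by - B produces an element to which φ adds 1.
      B : Carrier
      B = v + - φ v
      fB : InF B
      fB = x-y≈0 (begin
        φ (v + - φ v) + - (v + - φ v)            ≈⟨ +-congʳ (trans (φ-+ _ _) (+-congˡ (φ-neg _))) ⟩
        φ v + - φ (φ v) + - (v + - φ v)          ≈⟨ solve 3 (λ a b c → b :- c :- (a :- b) := :- (a :+ b :+ c)) refl v (φ v) (φ (φ v)) ⟩
        - (v + φ v + φ (φ v))                    ≈⟨ trans (-‿cong Tv) -0#≈0# ⟩
        0# ∎)
      B≉0 : B ≉ 0#
      B≉0 z = ¬fv (sym (x-y≈0 z))
      σ n′ : Carrier
      σ = - (v * inv B)
      n′ = - (s * inv B)
      fn : InF n′
      fn = F-neg (F-* fs (F-inv fB))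
      n≉0 : n′ ≉ 0#
      n≉0 = -nonzero (*-nonzero s≉0 (inv-nonzero B≉0))
      φσ : φ σ ≈ σ + 1#
      φσ = begin
        φ (- (v * inv B))              ≈⟨ trans (φ-neg _) (-‿cong (trans (φ-* _ _) (*-congˡ (F-inv fB)))) ⟩
        - (φ v * inv B)                ≈⟨ solve 3 (λ v v₁ i → :- (v₁ :* i) := :- (v :* i) :+ (v :- v₁) :* i) refl v (φ v) (inv B) ⟩
        - (v * inv B) + B * inv B      ≈⟨ +-congˡ (inv-right B≉0) ⟩
        σ + 1# ∎
      σ≈ : σ ≈ n′ * (b * b)
      σ≈ = trans (-‿cong (*-congʳ vsb)) (solve 3 (λ s b i → :- (s :* (b :* b) :* i) := :- (s :* i) :* (b :* b)) refl s b (inv B))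
      n³ : cube n′ ≈ cube σ + - σ
      n³ = begin
        cube n′                        ≈⟨ sym (*-identityʳ _) ⟩
        cube n′ * 1#                   ≈⟨ *-cong (sym (N-F fn)) (sym (trans (N-* b b) (trans (*-cong Nb Nb) (*-identityʳ 1#)))) ⟩
        N n′ * N (b * b)               ≈⟨ sym (N-* _ _) ⟩
        N (n′ * (b * b))               ≈⟨ N-cong (trans (sym σ≈) (sym (+-identityʳ σ))) ⟩
        N (σ + 0#)                     ≈⟨ CubicSum.N-shift σ φσ F-0 ⟩
        cube 0# + - 0# + (cube σ + - σ) ≈⟨ solve 1 (λ x → :0 :* :0 :* :0 :- :0 :+ x := x) refl _ ⟩
        cube σ + - σ ∎
      -- x has the same difference φ x - φ² x as w, so y lies in F and can be absorbed into t.
      x y : Carrier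
      x = B * (1# + - (σ * σ))
      y = w + - x
      φx : ∀ {z z′} → φ z ≈ z′ → φ (B * (1# + - (z * z))) ≈ B * (1# + - (z′ * z′))
      φx p = trans (φ-* _ _) (*-cong fB (trans (φ-+ _ _) (+-cong φ-1 (trans (φ-neg _) (-‿cong (trans (φ-* _ _) (*-cong p p)))))))
      φx1 : φ x ≈ B * (1# + - ((σ + 1#) * (σ + 1#)))
      φx1 = φx φσ
      φx2 : φ (φ x) ≈ B * (1# + - ((σ + 1# + 1#) * (σ + 1# + 1#)))
      φx2 = trans (φ-cong φx1) (φx (trans (φ-+ σ 1#) (+-cong φσ φ-1)))
      x-diff : φ x + - φ (φ x) ≈ v
      x-diff = begin
        φ x + - φ (φ x)                ≈⟨ +-cong φx1 (-‿cong φx2) ⟩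
        B * (1# + - ((σ + 1#) * (σ + 1#))) + - (B * (1# + - ((σ + 1# + 1#) * (σ + 1# + 1#))))
          ≈⟨ solve 2 (λ B s → B :* (:1 :- (s :+ :1) :* (s :+ :1)) :- B :* (:1 :- (s :+ :1 :+ :1) :* (s :+ :1 :+ :1)) := :- (B :* s)) refl B σ ⟩
        - (B * σ)                      ≈⟨ solve 3 (λ B v i → :- (B :* :- (v :* i)) := B :* (i :* v)) refl B v (inv B) ⟩
        B * (inv B * v)                ≈⟨ inv-cancel v B≉0 ⟩
        v ∎
      fy : InF y
      fy = sym (φ-injective (x-y≈0 (begin
        φ y + - φ (φ y)                                    ≈⟨ +-cong (trans (φ-+ _ _) (+-congˡ (φ-neg _))) (-‿cong (trans (φ-cong (trans (φ-+ _ _) (+-congˡ (φ-neg _)))) (trans (φ-+ _ _) (+-congˡ (φ-neg _))))) ⟩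
        φ w + - φ x + - (φ (φ w) + - φ (φ x))              ≈⟨ solve 4 (λ a b c d → a :- b :- (c :- d) := (a :- c) :- (b :- d)) refl (φ w) (φ x) (φ (φ w)) (φ (φ x)) ⟩
        φ w + - φ (φ w) + - (φ x + - φ (φ x))              ≈⟨ +-cong wv (-‿cong x-diff) ⟩
        v + - v                                            ≈⟨ -‿inverseʳ v ⟩
        0# ∎)))
      shape : ∀ t → w + t ≈ x + (t + y)
      shape t = solve 3 (λ w x t → w :+ t := x :+ (t :+ (w :- x))) refl w x t
      Bn : B * n′ ≈ - s
      Bn = trans (solve 3 (λ B s i → B :* :- (s :* i) := :- (B :* (i :* s))) refl B s (inv B)) (-‿cong (inv-cancel s B≉0))
      m≉0 : b + φ b + φ (φ b) ≉ 0#
      m≉0 = CubicSum.Radical.m≉0 σ φσ b n′ fn n≉0 n³ (sym σ≈) Nb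
      T1b : T (1# * b) ≈ b + φ b + φ (φ b)
      T1b = trans (T-cong (*-identityˡ b)) (T≈ b)
      ρb : ρ₁ b ≡ χ (b + φ b + φ (φ b))
      ρb = ≡.trans (ρ-χ (λ z → m≉0 (trans (sym T1b) z))) (χ-cong T1b)

  qℤ≢0 : qℤ ≢ 0ℤ
  qℤ≢0 p = absurd (≡.trans (≡.sym q-suc) (ℤₚ.+-injective p))
    where
    absurd : ℕ.suc m₁ ≢ 0
    absurd ()

  cancel-q : ∀ {x y} → qℤ ℤ.* x ≡ qℤ ℤ.* y → x ≡ y
  cancel-q {x} {y} = ℤₚ.*-cancelˡ-≡ qℤ x y {{ℤ.≢-nonZero qℤ≢0}}

  -- One more factor Γ and Γ² = 4 q move the Gauss sum to the right-hand side.
  half-line-sum : ∀ {w v s b} → φ w + - φ (φ w) ≈ v → InF s → s ≉ 0# → InS b → v ≈ s * (b * b) →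
    ℤ.+ 2 ℤ.* ΣF (λ t → R4 (w + t)) ≡ ℤ.- Γ ℤ.* (R4 s ℤ.* ρ₁ b)
  half-line-sum {w} {v} {s} {b} wv fs s≉0 Sb vsb = cancel-q (cancel-2 (≡.trans (lem₁ qℤ S) (≡.trans (≡.cong (ℤ._* S) (≡.sym Γ²))
    (≡.trans (ℤₚ.*-assoc Γ Γ S) (≡.trans (≡.cong (Γ ℤ.*_) (quadratic-line-sum wv fs s≉0 Sb vsb)) (lem₂ Γ qℤ (R4 s ℤ.* ρ₁ b)))))))
    where
    S = ΣF (λ t → R4 (w + t))
    lem₁ : ∀ q s → ℤ.+ 2 ℤ.* (q ℤ.* (ℤ.+ 2 ℤ.* s)) ≡ ℤ.+ 4 ℤ.* q ℤ.* s
    lem₁ = ℤSolver.solve-∀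
    lem₂ : ∀ g q x → g ℤ.* (ℤ.- (ℤ.+ 2 ℤ.* q) ℤ.* x) ≡ ℤ.+ 2 ℤ.* (q ℤ.* (ℤ.- g ℤ.* x))
    lem₂ = ℤSolver.solve-∀

  Q₀ : ℤ
  Q₀ = ℤ.+ (3 ℕ.^ e)

  Q₀² : Q₀ ℤ.* Q₀ ≡ qℤ
  Q₀² = ≡.trans (≡.sym (ℤₚ.pos-* (3 ℕ.^ e) (3 ℕ.^ e))) (≡.cong ℤ.+_ (≡.trans (≡.sym (ℕₚ.^-distribˡ-+-* 3 e e))
    (≡.trans (≡.cong (λ t → 3 ℕ.^ (e ℕ.+ t)) (≡.sym (ℕₚ.+-identityʳ e))) (≡.sym q-pow))))

  -- Γ² = 4 Q² fixes Γ up to sign, and the later arguments treat both signs alike.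
  half-Γ : ∃ λ κ → (κ ≡ Q₀ ⊎ κ ≡ ℤ.- Q₀) × ℤ.- Γ ≡ ℤ.+ 2 ℤ.* κ
  half-Γ = [ (λ z → ℤ.- Q₀ , inj₂ ≡.refl , ≡.trans (≡.cong ℤ.-_ (ℤₚ.i-j≡0⇒i≡j Γ (ℤ.+ 2 ℤ.* Q₀) z)) (ℤₚ.neg-distribʳ-* (ℤ.+ 2) Q₀))
           , (λ z → Q₀ , inj₁ ≡.refl , ≡.trans (lem₂ Γ Q₀) (≡.trans (≡.cong (λ t → ℤ.+ 2 ℤ.* Q₀ ℤ.- t) z) (ℤₚ.+-identityʳ (ℤ.+ 2 ℤ.* Q₀)))) ]′
    (ℤₚ.i*j≡0⇒i≡0∨j≡0 (Γ ℤ.- ℤ.+ 2 ℤ.* Q₀) {Γ ℤ.+ ℤ.+ 2 ℤ.* Q₀} (≡.trans (lem₁ Γ Q₀) (≡.trans (≡.cong₂ (λ a b → a ℤ.- ℤ.+ 4 ℤ.* b) Γ² Q₀²) (ℤₚ.+-inverseʳ (ℤ.+ 4 ℤ.* qℤ)))))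
    where
    lem₁ : ∀ g x → (g ℤ.- ℤ.+ 2 ℤ.* x) ℤ.* (g ℤ.+ ℤ.+ 2 ℤ.* x) ≡ g ℤ.* g ℤ.- ℤ.+ 4 ℤ.* (x ℤ.* x)
    lem₁ = ℤSolver.solve-∀
    lem₂ : ∀ g x → ℤ.- g ≡ ℤ.+ 2 ℤ.* x ℤ.- (g ℤ.+ ℤ.+ 2 ℤ.* x)
    lem₂ = ℤSolver.solve-∀

  F-ω³ : InF (ω ^ 3)
  F-ω³ = F-^ 3 F-ω

  ω³≉0 : ω ^ 3 ≉ 0#
  ω³≉0 = ^-nonzero 3 ω≉0

  diff-scale : ∀ {s w} → InF s → φ (s * w) + - φ (φ (s * w)) ≈ s * (φ w + - φ (φ w))
  diff-scale {s} {w} fs = trans (+-cong φs (-‿cong (trans (φ-cong φs) (trans (φ-* _ _) (*-congʳ fs)))))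
    (solve 3 (λ s a b → s :* a :- s :* b := s :* (a :- b)) refl s (φ w) (φ (φ w)))
    where
    φs : φ (s * w) ≈ s * φ w
    φs = trans (φ-* s w) (*-congʳ fs)

  -- `ε-split` gives two sums of R4, the second one along ω³ w + F. Its decomposition has
  -- coefficient ω³ s and the same b, so the two values recombine to ε s.
  ε-line-sum : ∀ {w v s b} → φ w + - φ (φ w) ≈ v → InF s → s ≉ 0# → InS b → v ≈ s * (b * b) →
    ΣF (λ t → ε (w + t)) ≡ proj₁ half-Γ ℤ.* (ε s ℤ.* ρ₁ b)
  ε-line-sum {w} {v} {s} {b} wv fs s≉0 Sb vsb = cancel-2 (
    ℤ.+ 2 ℤ.* ΣF (λ t → ε (w + t))
      ≡⟪ ≡.cong (ℤ.+ 2 ℤ.*_) (≡.trans (sum-cong′ (elems Fₗ) (λ t → ε-split (w + t))) (≡.trans (ΣF-+ (λ t → R4 (w + t)) (λ t → R4 (ω ^ 3 * (w + t))))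
           (≡.cong (λ x → ΣF (λ t → R4 (w + t)) ℤ.+ x) (≡.trans (sum-cong′ (elems Fₗ) (λ t → R4-cong (distribˡ (ω ^ 3) w t)))
             (ΣF-scale {λ t → R4 (ω ^ 3 * w + t)} (ω ^ 3) F-ω³ ω³≉0 (λ p → R4-cong (+-congˡ p))))))) ⟫
    ℤ.+ 2 ℤ.* (ΣF (λ t → R4 (w + t)) ℤ.+ ΣF (λ t → R4 (ω ^ 3 * w + t)))
      ≡⟪ ℤₚ.*-distribˡ-+ (ℤ.+ 2) (ΣF (λ t → R4 (w + t))) (ΣF (λ t → R4 (ω ^ 3 * w + t))) ⟫
    ℤ.+ 2 ℤ.* ΣF (λ t → R4 (w + t)) ℤ.+ ℤ.+ 2 ℤ.* ΣF (λ t → R4 (ω ^ 3 * w + t))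
      ≡⟪ ≡.cong₂ ℤ._+_ (half-line-sum wv fs s≉0 Sb vsb) (half-line-sum (trans (diff-scale F-ω³) (*-congˡ wv)) (F-* F-ω³ fs) (*-nonzero ω³≉0 s≉0) Sb
           (trans (*-congˡ vsb) (sym (*-assoc _ _ _)))) ⟫
    ℤ.- Γ ℤ.* (R4 s ℤ.* ρ₁ b) ℤ.+ ℤ.- Γ ℤ.* (R4 (ω ^ 3 * s) ℤ.* ρ₁ b)
      ≡⟪ lem₁ (ℤ.- Γ) (R4 s) (R4 (ω ^ 3 * s)) (ρ₁ b) ⟫
    ℤ.- Γ ℤ.* ((R4 s ℤ.+ R4 (ω ^ 3 * s)) ℤ.* ρ₁ b)
      ≡⟪ ≡.cong₂ (λ x y → x ℤ.* (y ℤ.* ρ₁ b)) (proj₂ (proj₂ half-Γ)) (≡.sym (ε-split s)) ⟫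
    ℤ.+ 2 ℤ.* proj₁ half-Γ ℤ.* (ε s ℤ.* ρ₁ b)
      ≡⟪ ℤₚ.*-assoc (ℤ.+ 2) (proj₁ half-Γ) (ε s ℤ.* ρ₁ b) ⟫ ≡.refl)
    where
    lem₁ : ∀ g a b r → g ℤ.* (a ℤ.* r) ℤ.+ g ℤ.* (b ℤ.* r) ≡ g ℤ.* ((a ℤ.+ b) ℤ.* r)
    lem₁ = ℤSolver.solve-∀

  -- Elements of norm 1 and elements of F* as powers.

  N1-log : ∀ {u} → N u ≈ 1# → ∃ λ i → α ^ (i ℕ.* m₁) ≈ u
  N1-log {u} Nu = let (j , p) = log u≉0 ; d = dvd j p in
    Div._∣_.quotient d , trans (^-congʳ α (≡.sym (Div._∣_.equality d))) p
    where
    u≉0 : u ≉ 0#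
    u≉0 z = 1≉0 (trans (sym Nu) (trans (N-cong z) (trans (^-congʳ 0# (ℕₚ.+-comm (q ℕ.* q ℕ.+ q) 1)) (0^ (q ℕ.* q ℕ.+ q)))))
    dvd : ∀ j → α ^ j ≈ u → m₁ Div.∣ j
    dvd j p = Div.*-cancelʳ-∣ d₁ (order-divides (j ℕ.* d₁) (trans (sym (^-assocʳ α j d₁)) (trans (^-congˡ d₁ p) Nu)))

  F*-log : ∀ {x} → InF x → x ≉ 0# → ∃ λ i → ω ^ i ≈ x
  F*-log {x} fx x≉0 = let (j , p) = log x≉0 ; d = dvd j p in
    Div._∣_.quotient d , trans (sym (ω^-log (Div._∣_.quotient d))) (trans (^-congʳ α (≡.sym (Div._∣_.equality d))) p)
    where
    dvd : ∀ j → α ^ j ≈ x → d₁ Div.∣ j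
    dvd j p = Div.*-cancelʳ-∣ m₁ (≡.subst (Div._∣ j ℕ.* m₁) (ℕₚ.*-comm m₁ d₁) (order-divides (j ℕ.* m₁)
      (trans (sym (^-assocʳ α j m₁)) (trans (^-congˡ m₁ p) (F*-pow fx x≉0)))))

  μ^-log : ∀ i → α ^ (i ℕ.* m₁) ≈ μ ^ i
  μ^-log i = trans (^-congʳ α (≡.trans (ℕₚ.*-comm i m₁) (≡.cong (λ t → (t ℕ.∸ 1) ℕ.* i) (≡.sym q-suc)))) (sym (^-assocʳ α (q ℕ.∸ 1) i))

  N-μ^ : ∀ i → N (μ ^ i) ≈ 1#
  N-μ^ i = trans (N-cong (sym (μ^-log i))) (trans (^-assocʳ α (i ℕ.* m₁) d₁) (trans (^-congʳ α (ℕₚ.*-assoc i m₁ d₁)) (α^-multiple n i α^n)))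

  N1≉0 : ∀ {u} → N u ≈ 1# → u ≉ 0#
  N1≉0 Nu z = 1≉0 (trans (sym Nu) (trans (N-cong z) (trans (^-congʳ 0# (ℕₚ.+-comm (q ℕ.* q ℕ.+ q) 1)) (0^ (q ℕ.* q ℕ.+ q)))))

  -- The exponent of u is a multiple of q - 1, hence of 4.
  ε-N1 : ∀ {u} x → N u ≈ 1# → ε (u * x) ≡ ε x
  ε-N1 {u} x Nu = go (x ≟ 0#)
    where
    go : Dec (x ≈ 0#) → ε (u * x) ≡ ε x
    go (yes z) = ε-cong (trans (*-0ʳ z) (sym z))
    go (no x≉0) = let (i , p) = N1-log Nu ; (j , p′) = log x≉0 in
      ≡.trans (Cl-log sε-periodic (i ℕ.* m₁ ℕ.+ j) (log-* (i ℕ.* m₁) j p p′)) (≡.trans (≡.cong sε (arith i j))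
        (≡.trans (sε-periodic (i ℕ.* (2 ℕ.* ℕ.suc k)) j) (≡.sym (Cl-log sε-periodic j p′))))
      where
      arith : ∀ i j → i ℕ.* m₁ ℕ.+ j ≡ 4 ℕ.* (i ℕ.* (2 ℕ.* ℕ.suc k)) ℕ.+ j
      arith i j = ≡.trans (≡.cong (λ t → i ℕ.* t ℕ.+ j) m₁-mod8) (lem i j (ℕ.suc k))
        where
        lem : ∀ i j k → i ℕ.* (8 ℕ.* k) ℕ.+ j ≡ 4 ℕ.* (i ℕ.* (2 ℕ.* k)) ℕ.+ j
        lem = ℕSolver.solve-∀

  -- ω² lies in F, so this change of sign makes ε sum to 0 over every F-subspace of E.
  ε-ω²* : ∀ x → ε (ω * ω * x) ≡ ℤ.- ε x
  ε-ω²* x = ≡.trans (ε-sq-* ω x) (≡.trans (≡.cong (ℤ._* ε x) χ-ω) (ℤₚ.-1*i≡-i (ε x)))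

  ε-0 : ∀ {x} → x ≈ 0# → ε x ≡ 0ℤ
  ε-0 = Cl-0 sε

  ΣF-ε-multiples : ∀ u → ΣF (λ t → ε (t * u)) ≡ 0ℤ
  ΣF-ε-multiples u = x≡-x (≡.trans (≡.sym (ΣF-scale {λ t → ε (t * u)} (ω * ω) (F-* F-ω F-ω) (*-nonzero ω≉0 ω≉0) (λ p → ε-cong (*-congʳ p))))
    (≡.trans (sum-cong′ (elems Fₗ) (λ t → ≡.trans (ε-cong (*-assoc _ _ _)) (≡.trans (ε-ω²* (t * u)) (≡.sym (ℤₚ.-1*i≡-i (ε (t * u)))))))
      (≡.trans (ΣF-*ˡ -1ℤ (λ t → ε (t * u))) (ℤₚ.-1*i≡-i (ΣF (λ t → ε (t * u)))))))

  record Polar (y : Carrier) : Set (c ⊔ ℓ) where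
    field
      radius : Carrier
      unit : Carrier
      radius-F : InF radius
      radius≉0 : radius ≉ 0#
      unit-N : N unit ≈ 1#
      y≈ : y ≈ radius * unit

  -- The norm restricted to F is cubing, so the radius has to be the cube root of N y.
  polar-form : ∀ {y} → y ≉ 0# → Polar y
  polar-form {y} y≉0 = record
    { radius = n′ ; unit = inv n′ * y ; radius-F = fn ; radius≉0 = n≉0
    ; unit-N = trans (N-* (inv n′) y) (trans (*-cong (N-F (F-inv fn)) (sym n³)) (trans
        (solve 2 (λ i n → i :* i :* i :* (n :* n :* n) := (n :* i) :* (n :* i) :* (n :* i)) refl (inv n′) n′)
        (trans (cube-cong (inv-right n≉0)) (trans (*-identityʳ _) (*-identityʳ _)))))
    ; y≈ = sym (inv-cancel y n≉0) }
    where
    n′ : Carrier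
    n′ = cube-root (N y)
    n³ : cube n′ ≈ N y
    n³ = cube-cube-root (N y) (N-inF y)
    fn : InF n′
    fn = frob-F e₂ (N-inF y)
    n≉0 : n′ ≉ 0#
    n≉0 z = ^-nonzero d₁ y≉0 (trans (sym n³) (*-0ʳ z))

  -- Sums over E and over the elements of norm 1.

  ΣE Σ𝒩 : (Carrier → ℤ) → ℤ
  ΣE = sum (elems Eₗ)
  Σ𝒩 = sum (elems 𝒩ₗ)

  -- Each nonzero y is t u for exactly one t in F* and one u of norm 1; the equality is obtained by
  -- inserting delta functions and exchanging the sums.
  sum-polar : ∀ {h} → Resp h → Σ𝒩 (λ u → ΣF (λ t → when (¬? (t ≟ 0#)) (h (t * u)))) ≡ ΣE (λ y → when (¬? (y ≟ 0#)) (h y))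
  sum-polar {h} rh =
    Σ𝒩 (λ u → ΣF (λ t → when (¬? (t ≟ 0#)) (h (t * u))))
      ≡⟪ sum-cong′ (elems 𝒩ₗ) (λ u → sum-cong′ (elems Fₗ) (λ t → ≡.sym (sum-delta (t * u ≟_) (λ y → when (¬? (t ≟ 0#)) (h y)) (when (¬? (t ≟ 0#)) (h (t * u))) Eₗ
           (λ _ _ _ _ p p′ → trans (sym p) p′) (complete Eₗ (t * u) tt)
           (λ y _ p → when-cong (¬? (t ≟ 0#)) (¬? (t ≟ 0#)) (λ z → z) (λ z → z) (λ _ → rh (sym p)))))) ⟫
    Σ𝒩 (λ u → ΣF (λ t → ΣE (F₃ u t)))
      ≡⟪ sum-cong′ (elems 𝒩ₗ) (λ u → sum-swap (elems Fₗ) (elems Eₗ) (F₃ u)) ⟫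
    Σ𝒩 (λ u → ΣE (λ y → ΣF (λ t → F₃ u t y)))
      ≡⟪ sum-swap (elems 𝒩ₗ) (elems Eₗ) (λ u y → ΣF (λ t → F₃ u t y)) ⟫
    ΣE (λ y → Σ𝒩 (λ u → ΣF (λ t → F₃ u t y)))
      ≡⟪ sum-cong′ (elems Eₗ) (λ y → at y (y ≟ 0#)) ⟫ ≡.refl
    where
    F₃ : Carrier → Carrier → Carrier → ℤ
    F₃ u t y = when (t * u ≟ y) (when (¬? (t ≟ 0#)) (h y))
    F₃-none : ∀ u t y → ¬ (t * u ≈ y × t ≉ 0#) → F₃ u t y ≡ 0ℤ
    F₃-none u t y ¬p with t * u ≟ y | t ≟ 0#
    ... | no _ | _ = ≡.refl
    ... | yes _ | yes _ = ≡.refl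
    ... | yes a | no b = ⊥-elim (¬p (a , b))
    at : ∀ y (d : Dec (y ≈ 0#)) → Σ𝒩 (λ u → ΣF (λ t → F₃ u t y)) ≡ when (¬? d) (h y)
    at y (yes z) = ≡.trans (sum-cong (sound 𝒩ₗ) (λ u Nu → ≡.trans (sum-cong′ (elems Fₗ) (λ t → F₃-none u t y (λ (a , b) → *-nonzero b (N1≉0 Nu) (trans a z)))) (ΣM.sum-ε (elems Fₗ)))) (ΣM.sum-ε (elems 𝒩ₗ))
    at y (no y≉0) = ≡.trans (sum-cong (sound 𝒩ₗ) (λ u Nu → row u Nu (u ≟ unit)))
        (sum-delta (_≟ unit) (λ _ → h y) (h y) 𝒩ₗ (λ _ _ _ _ p p′ → trans p (sym p′)) (Any.map sym (complete 𝒩ₗ unit unit-N)) (λ _ _ _ → ≡.refl))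
      where
      open Polar (polar-form y≉0)
      row : ∀ u → N u ≈ 1# → (d : Dec (u ≈ unit)) → ΣF (λ t → F₃ u t y) ≡ when d (h y)
      row u Nu (yes p) = ≡.trans (sum-cong′ (elems Fₗ) (λ t → flat t (t ≟ radius))) (ΣF-delta {λ _ → h y} radius-F (λ _ → ≡.refl))
        where
        flat : ∀ t (d : Dec (t ≈ radius)) → F₃ u t y ≡ when d (h y)
        flat t (yes e) = ≡.trans (when-yes (t * u ≟ y) _ (trans (*-cong e p) (sym y≈))) (when-yes (¬? (t ≟ 0#)) (h y) (λ z → radius≉0 (trans (sym e) z)))
        flat t (no ne) = F₃-none u t y (λ (a , b) → ne (cancel-nonzero (N1≉0 unit-N) (trans (*-comm _ _) (trans (*-congˡ (sym p)) (trans a (trans y≈ (*-comm _ _)))))))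
      row u Nu (no ¬p) = ≡.trans (sum-cong (sound Fₗ) (λ t ft → F₃-none u t y (λ (a , b) → ¬p (sym (S-F-ratio unit-N Nu (F-* (F-inv radius-F) ft)
          (trans (sym (trans (*-congʳ (trans (*-comm _ _) (inv-right radius≉0))) (*-identityˡ _))) (trans (*-assoc _ _ _) (trans (*-congˡ (trans (sym y≈) (sym a))) (sym (*-assoc _ _ _))))))))))
        (ΣM.sum-ε (elems Fₗ))

  ΣE-shift : ∀ {h} a → Resp h → ΣE (λ y → h (a + y)) ≡ ΣE h
  ΣE-shift {h} a rh = sum-bij Eₗ Eₗ _≟_ sym trans sym trans (a +_) (- a +_) (λ _ _ → tt) (λ _ _ → tt)
    (λ x y _ _ p → trans (+-congˡ (sym p)) (solve 2 (λ a x → :- a :+ (a :+ x) := x) refl a x))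
    (λ x y _ _ p → trans (+-congˡ (sym p)) (solve 2 (λ a y → a :+ (:- a :+ y) := y) refl a y)) h (λ _ _ _ _ → rh)

  ΣE-scale : ∀ {h} a → a ≉ 0# → Resp h → ΣE (λ y → h (a * y)) ≡ ΣE h
  ΣE-scale {h} a a≉0 rh = sum-bij Eₗ Eₗ _≟_ sym trans sym trans (a *_) (inv a *_) (λ _ _ → tt) (λ _ _ → tt)
    (λ x y _ _ p → trans (*-congˡ (sym p)) (trans (sym (*-assoc _ _ _)) (trans (*-congʳ (trans (*-comm _ _) (inv-right a≉0))) (*-identityˡ x))))
    (λ x y _ _ p → trans (*-congˡ (sym p)) (inv-cancel y a≉0)) h (λ _ _ _ _ → rh)

  ΣE-ε : ΣE ε ≡ 0ℤ
  ΣE-ε = x≡-x (≡.trans (≡.sym (ΣE-scale (ω * ω) (*-nonzero ω≉0 ω≉0) ε-cong)) (≡.trans (sum-cong′ (elems Eₗ) (λ t →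
    ≡.trans (ε-ω²* t) (≡.sym (ℤₚ.-1*i≡-i (ε t))))) (≡.trans (sum-*ˡ (elems Eₗ) -1ℤ ε) (ℤₚ.-1*i≡-i (ΣE ε)))))

  remove-0 : ∀ {a p} {A : Set a} (xs : List A) {P : A → Set p} (P? : ∀ x → Dec (P x)) (h : A → ℤ) →
    sum xs h ≡ sum xs (λ x → when (P? x) (h x)) ℤ.+ sum xs (λ x → when (¬? (P? x)) (h x))
  remove-0 xs P? h = ≡.trans (sum-cong′ xs (λ x → at x (P? x))) (sum-+ xs (λ x → when (P? x) (h x)) (λ x → when (¬? (P? x)) (h x)))
    where
    at : ∀ {p} {P : Set p} x (d : Dec P) → h x ≡ when d (h x) ℤ.+ when (¬? d) (h x)
    at x (yes _) = ≡.sym (ℤₚ.+-identityʳ (h x))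
    at x (no _) = ≡.sym (ℤₚ.+-identityˡ (h x))

  cross-1 : ∀ w → cross w 1# ≈ φ w + - φ (φ w)
  cross-1 w = +-cong (trans (*-congˡ (trans (φ-cong φ-1) φ-1)) (*-identityʳ _)) (-‿cong (trans (*-congˡ φ-1) (*-identityʳ _)))

  -- for N u = 1, multiplication by u carries cross w u to the case u = 1
  cross-unit : ∀ {u} w → N u ≈ 1# → u * cross (u * w) u ≈ φ w + - φ (φ w)
  cross-unit {u} w Nu = begin
    u * cross (u * w) u
      ≈⟨ *-congˡ (+-cong (*-congʳ (φ-* u w)) (-‿cong (*-congʳ (trans (φ-cong (φ-* u w)) (φ-* _ _))))) ⟩
    u * (φ u * φ w * φ (φ u) + - (φ (φ u) * φ (φ w) * φ u))
      ≈⟨ solve 5 (λ a b c x y → a :* (b :* x :* c :- c :* y :* b) := a :* b :* c :* (x :- y)) refl u (φ u) (φ (φ u)) (φ w) (φ (φ w)) ⟩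
    u * φ u * φ (φ u) * (φ w + - φ (φ w))
      ≈⟨ trans (*-congʳ (trans (sym (N≈ u)) Nu)) (*-identityˡ _) ⟩
    φ w + - φ (φ w) ∎

  diff-zero : ∀ {w} → φ w + - φ (φ w) ≈ 0# → InF w
  diff-zero p = sym (φ-injective (x-y≈0 p))

  T-diff : ∀ w → T (φ w + - φ (φ w)) ≈ 0#
  T-diff w = trans (T-cong (trans (sym (cross-1 w)) (sym (*-identityˡ _)))) (T-cross-right w 1#)

  -- The sign function of the line classes and the counts derived from it.

  module Signs (a₁ : Carrier) (Sa₁ : InS a₁) where

    open Classes a₁ public

    abstract
      -- The undetermined sign of Γ and the sign that relates a₁ to 1 are absorbed in one constant ±
      -- Q.
      κ : ℤ
      κ = proj₁ half-Γ ℤ.* ρ₁ a₁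

      κ-def : κ ≡ proj₁ half-Γ ℤ.* ρ₁ a₁
      κ-def = ≡.refl

    κ-value : κ ≡ Q₀ ⊎ κ ≡ ℤ.- Q₀
    κ-value = ≡.subst (λ t → t ≡ Q₀ ⊎ t ≡ ℤ.- Q₀) (≡.sym κ-def) (go (proj₁ (proj₂ half-Γ)) (ρ-±1 1# a₁))
      where
      neg : ∀ a → a ℤ.* -1ℤ ≡ ℤ.- a
      neg = ℤSolver.solve-∀
      go : proj₁ half-Γ ≡ Q₀ ⊎ proj₁ half-Γ ≡ ℤ.- Q₀ → ρ₁ a₁ ≡ 1ℤ ⊎ ρ₁ a₁ ≡ -1ℤ → proj₁ half-Γ ℤ.* ρ₁ a₁ ≡ Q₀ ⊎ proj₁ half-Γ ℤ.* ρ₁ a₁ ≡ ℤ.- Q₀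
      go (inj₁ p) (inj₁ p′) = inj₁ (≡.trans (≡.cong₂ ℤ._*_ p p′) (ℤₚ.*-identityʳ Q₀))
      go (inj₁ p) (inj₂ p′) = inj₂ (≡.trans (≡.cong₂ ℤ._*_ p p′) (neg Q₀))
      go (inj₂ p) (inj₁ p′) = inj₂ (≡.trans (≡.cong₂ ℤ._*_ p p′) (ℤₚ.*-identityʳ (ℤ.- Q₀)))
      go (inj₂ p) (inj₂ p′) = inj₁ (≡.trans (≡.cong₂ ℤ._*_ p p′) (≡.trans (neg (ℤ.- Q₀)) (ℤₚ.neg-involutive Q₀)))

    κ² : κ ℤ.* κ ≡ qℤ
    κ² = [ (λ p → ≡.trans (≡.cong₂ ℤ._*_ p p) Q₀²) , (λ p → ≡.trans (≡.cong₂ ℤ._*_ p p) (≡.trans (sq Q₀) Q₀²)) ]′ κ-value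
      where
      sq : ∀ a → ℤ.- a ℤ.* ℤ.- a ≡ a ℤ.* a
      sq = ℤSolver.solve-∀

    -- G is the ±1-valued function on {T = 0} ∖ 0 that separates 𝒯₁ (value 1) from 𝒯₂; elsewhere it is 0.
    G′ : ∀ v → Dec (v ≈ 0#) → Dec (T v ≈ 0#) → ℤ
    G′ v (yes _) _ = 0ℤ
    G′ v (no _) (no _) = 0ℤ
    G′ v (no v≉0) (yes Tv) = let open Decomposition (decompose v≉0 Tv) in ε coeff ℤ.* ρ a₁ base

    G : Carrier → ℤ
    G v = G′ v (v ≟ 0#) (T v ≟ 0#)

    G-0 : ∀ {v} → v ≈ 0# → G v ≡ 0ℤ
    G-0 {v} p with v ≟ 0#
    ... | yes _ = ≡.refl
    ... | no ¬p = ⊥-elim (¬p p)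

    G-T : ∀ {v} → T v ≉ 0# → G v ≡ 0ℤ
    G-T {v} ¬p with v ≟ 0# | T v ≟ 0#
    ... | yes _ | _ = ≡.refl
    ... | no _ | no _ = ≡.refl
    ... | no _ | yes p = ⊥-elim (¬p p)

    G-value : ∀ {v s b} → InF s → s ≉ 0# → InS b → v ≈ s * (b * b) → G v ≡ ε s ℤ.* ρ a₁ b
    G-value {v} {s} {b} fs s≉0 (b≉0 , Nb , Tb) p = go (v ≟ 0#) (T v ≟ 0#)
      where
      go : (d : Dec (v ≈ 0#)) (d′ : Dec (T v ≈ 0#)) → G′ v d d′ ≡ ε s ℤ.* ρ a₁ b
      go (yes z) _ = ⊥-elim (*-nonzero s≉0 (*-nonzero b≉0 b≉0) (trans (sym p) z))
      go (no _) (no nz) = ⊥-elim (nz (trans (T-cong p) (trans (T-scale _ fs) (*-0ʳ Tb))))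
      go (no v≉0) (yes Tv) = let open Decomposition (decompose v≉0 Tv)
                                 (s≈ , b≈) = decomposition-unique coeff-F coeff≉0 fs (proj₁ (proj₂ base-S)) Nb (trans (sym v≈) p)
        in ≡.cong₂ ℤ._*_ (ε-cong s≈) (ρ-cong refl b≈)

    G-cong : Resp G
    G-cong {v} {v′} p = go (v ≟ 0#) (T v ≟ 0#)
      where
      go : Dec (v ≈ 0#) → Dec (T v ≈ 0#) → G v ≡ G v′
      go (yes z) _ = ≡.trans (G-0 z) (≡.sym (G-0 (trans (sym p) z)))
      go (no _) (no nz) = ≡.trans (G-T nz) (≡.sym (G-T (λ z → nz (trans (T-cong p) z))))
      go (no v≉0) (yes Tv) = let open Decomposition (decompose v≉0 Tv) in
        ≡.trans (G-value coeff-F coeff≉0 base-S v≈) (≡.sym (G-value coeff-F coeff≉0 base-S (trans (sym p) v≈)))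

    G-±1 : ∀ {v} → v ≉ 0# → T v ≈ 0# → G v ≡ 1ℤ ⊎ G v ≡ -1ℤ
    G-±1 {v} v≉0 Tv = let open Decomposition (decompose v≉0 Tv) in
      ≡.subst (λ t → t ≡ 1ℤ ⊎ t ≡ -1ℤ) (≡.sym (G-value coeff-F coeff≉0 base-S v≈)) (±1-* (ε-±1 coeff≉0) (ρ-±1 a₁ base))

    G-sign : ∀ v → Sign (G v)
    G-sign v = go (v ≟ 0#) (T v ≟ 0#)
      where
      go : Dec (v ≈ 0#) → Dec (T v ≈ 0#) → Sign (G v)
      go (yes z) _ = inj₁ (G-0 z)
      go (no _) (no nz) = inj₁ (G-T nz)
      go (no v≉0) (yes Tv) = inj₂ (G-±1 v≉0 Tv)

    diff-sum : ∀ w → ΣF (λ t → ε (w + t)) ≡ κ ℤ.* G (φ w + - φ (φ w))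
    diff-sum w = go (v ≟ 0#)
      where
      v : Carrier
      v = φ w + - φ (φ w)
      go : Dec (v ≈ 0#) → ΣF (λ t → ε (w + t)) ≡ κ ℤ.* G v
      -- Here w lies in F, so the sum is that of ε over F, which vanishes.
      go (yes z) = ≡.trans (sum-cong′ (elems Fₗ) (λ t → ε-cong (+-comm w t))) (≡.trans (ΣF-shift {ε} w (diff-zero z) ε-cong)
        (≡.trans (sum-cong′ (elems Fₗ) (λ t → ε-cong (sym (*-identityʳ t)))) (≡.trans (ΣF-ε-multiples 1#) (≡.sym (≡.trans (≡.cong (κ ℤ.*_) (G-0 z)) (ℤₚ.*-zeroʳ κ))))))
      go (no v≉0) = let open Decomposition (decompose v≉0 (T-diff w)) in
        ≡.trans (ε-line-sum refl coeff-F coeff≉0 base-S v≈) (≡.trans (≡.cong (λ t → proj₁ half-Γ ℤ.* (ε coeff ℤ.* t))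
          (≡.trans (≡.sym (≡.trans (≡.cong (ρ₁ a₁ ℤ.*_) (ρ-product Sa₁ base-S)) (≡.trans (≡.sym (ℤₚ.*-assoc (ρ₁ a₁) (ρ₁ a₁) (ρ₁ base)))
             (≡.trans (≡.cong (ℤ._* ρ₁ base) (ρ-² 1# a₁)) (ℤₚ.*-identityˡ (ρ₁ base)))))) ≡.refl))
          (≡.trans (regroup (proj₁ half-Γ) (ε coeff) (ρ₁ a₁) (ρ a₁ base)) (≡.cong₂ ℤ._*_ (≡.sym κ-def) (≡.sym (G-value coeff-F coeff≉0 base-S v≈)))))
        where
        regroup : ∀ a b c d → a ℤ.* (b ℤ.* (c ℤ.* d)) ≡ a ℤ.* c ℤ.* (b ℤ.* d)
        regroup = ℤSolver.solve-∀

    -- A factor of norm 1 does not change ε, so dividing by u reduces to sums along cosets of F.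
    line-sum : ∀ {u} w → N u ≈ 1# → ΣF (λ t → ε (w + t * u)) ≡ κ ℤ.* G (u * cross w u)
    line-sum {u} w Nu = ≡.trans (sum-cong′ (elems Fₗ) (λ t → ≡.trans (ε-cong (trans (+-cong (sym uw) (*-comm t u)) (sym (distribˡ u w′ t)))) (ε-N1 (w′ + t) Nu)))
      (≡.trans (diff-sum w′) (≡.cong (κ ℤ.*_) (G-cong (trans (sym (cross-unit w′ Nu)) (*-congˡ (cross-cong uw refl))))))
      where
      w′ : Carrier
      w′ = inv u * w
      uw : u * w′ ≈ w
      uw = inv-cancel w (N1≉0 Nu)

    d₁ℤ : ℤ.+ d₁ ≡ qℤ ℤ.* qℤ ℤ.+ qℤ ℤ.+ 1ℤ
    d₁ℤ = ≡.trans (ℤₚ.pos-+ (q ℕ.* q ℕ.+ q) 1) (≡.cong (ℤ._+ 1ℤ) (≡.trans (ℤₚ.pos-+ (q ℕ.* q) q) (≡.cong (ℤ._+ qℤ) (ℤₚ.pos-* q q))))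

    Σ𝒩-const : ∀ j → Σ𝒩 (λ _ → j) ≡ (qℤ ℤ.* qℤ ℤ.+ qℤ ℤ.+ 1ℤ) ℤ.* j
    Σ𝒩-const j = ≡.trans (sum-const (elems 𝒩ₗ) j) (≡.cong (ℤ._* j) (≡.trans (≡.cong ℤ.+_ 𝒩ₗ-size) d₁ℤ))

    -- After multiplication by κ the sum becomes one of ε over all w + t u. The value at w occurs q²
    -- + q + 1 times and every other element of E once; as ε sums to 0 over E, (q² + q) ε w remains.
    -- Finally κ² = q is cancelled.
    star-sum : ∀ w → Σ𝒩 (λ u → G (u * cross w u)) ≡ κ ℤ.* ((qℤ ℤ.+ 1ℤ) ℤ.* ε w)
    star-sum w = cancel-q (≡.trans (≡.cong (ℤ._* X) (≡.sym κ²)) (≡.trans (ℤₚ.*-assoc κ κ X) (≡.trans (≡.cong (κ ℤ.*_) κX) (lem₂ κ qℤ (ε w)))))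
      where
      X = Σ𝒩 (λ u → G (u * cross w u))
      lem₂ : ∀ k q e → k ℤ.* ((q ℤ.* q ℤ.+ q) ℤ.* e) ≡ q ℤ.* (k ℤ.* ((q ℤ.+ 1ℤ) ℤ.* e))
      lem₂ = ℤSolver.solve-∀
      h : Carrier → ℤ
      h y = ε (w + y)
      rh : Resp h
      rh p = ε-cong (+-congˡ p)
      tail : ΣE (λ y → when (¬? (y ≟ 0#)) (h y)) ≡ ℤ.- ε w
      tail = ≡.trans (≡.sym (drop (ΣE (λ y → when (y ≟ 0#) (h y))) (ΣE (λ y → when (¬? (y ≟ 0#)) (h y))))) (≡.trans (≡.cong₂ ℤ._-_ (≡.trans (≡.sym (remove-0 (elems Eₗ) (λ y → y ≟ 0#) h)) (≡.trans (ΣE-shift {ε} w ε-cong) ΣE-ε))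
          (sum-delta (_≟ 0#) h (ε w) Eₗ (λ _ _ _ _ p p′ → trans p (sym p′)) (Any.map sym (complete Eₗ 0# tt)) (λ y _ z → ε-cong (trans (+-congˡ z) (+-identityʳ w)))))
        (ℤₚ.+-identityˡ (ℤ.- ε w)))
        where
        drop : ∀ a b → (a ℤ.+ b) ℤ.- a ≡ b
        drop = ℤSolver.solve-∀
      κX : κ ℤ.* X ≡ (qℤ ℤ.* qℤ ℤ.+ qℤ) ℤ.* ε w
      κX =
        κ ℤ.* X
          ≡⟪ ≡.trans (≡.sym (sum-*ˡ (elems 𝒩ₗ) κ (λ u → G (u * cross w u)))) (sum-cong (sound 𝒩ₗ) (λ u Nu → ≡.sym (line-sum w Nu))) ⟫
        Σ𝒩 (λ u → ΣF (λ t → h (t * u)))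
          ≡⟪ ≡.trans (sum-cong′ (elems 𝒩ₗ) (λ u → remove-0 (elems Fₗ) (λ t → t ≟ 0#) (λ t → h (t * u)))) (sum-+ (elems 𝒩ₗ) (λ u → ΣF (λ t → when (t ≟ 0#) (h (t * u)))) (λ u → ΣF (λ t → when (¬? (t ≟ 0#)) (h (t * u))))) ⟫
        Σ𝒩 (λ u → ΣF (λ t → when (t ≟ 0#) (h (t * u)))) ℤ.+ Σ𝒩 (λ u → ΣF (λ t → when (¬? (t ≟ 0#)) (h (t * u))))
          ≡⟪ ≡.cong₂ ℤ._+_ (≡.trans (sum-cong′ (elems 𝒩ₗ) (λ u → ≡.trans (ΣF-delta {λ t → h (t * u)} F-0 (λ p → rh (*-congʳ p))) (ε-cong (trans (+-congˡ (zeroˡ u)) (+-identityʳ w)))))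
               (Σ𝒩-const (ε w))) (≡.trans (sum-polar rh) tail) ⟫
        (qℤ ℤ.* qℤ ℤ.+ qℤ ℤ.+ 1ℤ) ℤ.* ε w ℤ.+ ℤ.- ε w
          ≡⟪ lem qℤ (ε w) ⟫ ≡.refl
        where
        lem : ∀ q e → (q ℤ.* q ℤ.+ q ℤ.+ 1ℤ) ℤ.* e ℤ.+ ℤ.- e ≡ (q ℤ.* q ℤ.+ q) ℤ.* e
        lem = ℤSolver.solve-∀

    -- G² is 1 except at the single u of norm 1 proportional to w, where the cross product vanishes.
    star-square-sum : ∀ {w} → w ≉ 0# → Σ𝒩 (λ u → G (u * cross w u) ℤ.* G (u * cross w u)) ≡ qℤ ℤ.* qℤ ℤ.+ qℤ
    star-square-sum {w} w≉0 = ≡.trans (≡.sym (drop (Σ𝒩 (λ u → when (u ≟ unit) 1ℤ)) Y)) (≡.trans (≡.cong₂ ℤ._-_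
        (≡.trans (≡.sym (sum-+ (elems 𝒩ₗ) (λ u → when (u ≟ unit) 1ℤ) (λ u → G (u * cross w u) ℤ.* G (u * cross w u))))
          (≡.trans (sum-cong (sound 𝒩ₗ) (λ u Nu → at u Nu (u ≟ unit))) (Σ𝒩-const 1ℤ)))
        (sum-delta (_≟ unit) (λ _ → 1ℤ) 1ℤ 𝒩ₗ (λ _ _ _ _ p p′ → trans p (sym p′)) (Any.map sym (complete 𝒩ₗ unit unit-N)) (λ _ _ _ → ≡.refl))) (lem qℤ))
      where
      open Polar (polar-form w≉0)
      Y = Σ𝒩 (λ u → G (u * cross w u) ℤ.* G (u * cross w u))
      drop : ∀ a b → (a ℤ.+ b) ℤ.- a ≡ b
      drop = ℤSolver.solve-∀
      lem : ∀ q → (q ℤ.* q ℤ.+ q ℤ.+ 1ℤ) ℤ.* 1ℤ ℤ.- 1ℤ ≡ q ℤ.* q ℤ.+ q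
      lem = ℤSolver.solve-∀
      at : ∀ u → N u ≈ 1# → (d : Dec (u ≈ unit)) → when d 1ℤ ℤ.+ G (u * cross w u) ℤ.* G (u * cross w u) ≡ 1ℤ
      at u Nu (yes p) = ≡.cong (λ t → 1ℤ ℤ.+ t ℤ.* t) (G-0 (*-0ʳ (trans (cross-cong y≈ p) (trans (cross-scaleˡ unit unit radius-F) (*-0ʳ (cross-self unit))))))
      at u Nu (no ¬p) = ≡.trans (ℤₚ.+-identityˡ (G (u * cross w u) ℤ.* G (u * cross w u))) (sq-1 (G-±1 (*-nonzero (N1≉0 Nu) C≉0) (T-cross-right w u)))
        where
        C≉0 : cross w u ≉ 0#
        C≉0 z = let (s , fs , eq) = cross-zero z (N1≉0 Nu) in
          ¬p (sym (S-F-ratio unit-N Nu (F-* (F-inv radius-F) fs)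
            (trans (sym (trans (*-congʳ (trans (*-comm _ _) (inv-right radius≉0))) (*-identityˡ unit))) (trans (*-assoc _ _ _) (trans (*-congˡ (trans (sym y≈) eq)) (sym (*-assoc _ _ _)))))))

    star-count : ∀ {w} → w ≉ 0# →
      ℤ.+ 2 ℤ.* Σ𝒩 (λ u → when (G (u * cross w u) ℤₚ.≟ 1ℤ) 1ℤ) ≡ (qℤ ℤ.+ 1ℤ) ℤ.* (qℤ ℤ.+ κ ℤ.* ε w) ×
      ℤ.+ 2 ℤ.* Σ𝒩 (λ u → when (G (u * cross w u) ℤₚ.≟ -1ℤ) 1ℤ) ≡ (qℤ ℤ.+ 1ℤ) ℤ.* (qℤ ℤ.- κ ℤ.* ε w)
    star-count {w} w≉0 = let (p , m) = count-signs (λ u → G (u * cross w u)) (sound 𝒩ₗ) (λ u _ → G-sign (u * cross w u)) in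
      ≡.trans p (≡.trans (≡.cong₂ ℤ._+_ (star-square-sum w≉0) (star-sum w)) (lem₊ qℤ κ (ε w))) ,
      ≡.trans m (≡.trans (≡.cong₂ ℤ._-_ (star-square-sum w≉0) (star-sum w)) (lem₋ qℤ κ (ε w)))
      where
      lem₊ : ∀ q k e → q ℤ.* q ℤ.+ q ℤ.+ k ℤ.* ((q ℤ.+ 1ℤ) ℤ.* e) ≡ (q ℤ.+ 1ℤ) ℤ.* (q ℤ.+ k ℤ.* e)
      lem₊ = ℤSolver.solve-∀
      lem₋ : ∀ q k e → q ℤ.* q ℤ.+ q ℤ.- k ℤ.* ((q ℤ.+ 1ℤ) ℤ.* e) ≡ (q ℤ.+ 1ℤ) ℤ.* (q ℤ.- k ℤ.* e)
      lem₋ = ℤSolver.solve-∀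

    line-count : ∀ {u w} → N u ≈ 1# → cross w u ≉ 0# →
      ℤ.+ 2 ℤ.* ΣF (λ t → when (ε (w + t * u) ℤₚ.≟ 1ℤ) 1ℤ) ≡ qℤ ℤ.+ κ ℤ.* G (u * cross w u) ×
      ℤ.+ 2 ℤ.* ΣF (λ t → when (ε (w + t * u) ℤₚ.≟ -1ℤ) 1ℤ) ≡ qℤ ℤ.- κ ℤ.* G (u * cross w u)
    line-count {u} {w} Nu C≉0 = let (p , m) = count-signs (λ t → ε (w + t * u)) (sound Fₗ) (λ t ft → inj₂ (ε-±1 (nz t ft))) in
      ≡.trans p (≡.cong₂ ℤ._+_ sq (line-sum w Nu)) , ≡.trans m (≡.cong₂ ℤ._-_ sq (line-sum w Nu))
      where
      nz : ∀ t → InF t → w + t * u ≉ 0#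
      nz t ft z = C≉0 (trans (sym (trans (cross-+ˡ w (t * u) u) (trans (+-congˡ (trans (cross-scaleˡ u u ft) (*-0ʳ (cross-self u)))) (+-identityʳ _))))
        (trans (cross-cong z refl) (trans (+-cong (*-0ˡ φ-0) (-‿cong (*-0ˡ (trans (φ-cong φ-0) φ-0)))) (-‿inverseʳ 0#))))
      sq : ΣF (λ t → ε (w + t * u) ℤ.* ε (w + t * u)) ≡ qℤ
      sq = ≡.trans (ΣF-cong (λ t ft → sq-1 (ε-±1 (nz t ft)))) (≡.trans (ΣF-const 1ℤ) (ℤₚ.*-identityʳ qℤ))

    multiples-count : ∀ {u} → u ≉ 0# →
      ℤ.+ 2 ℤ.* ΣF (λ t → when (ε (t * u) ℤₚ.≟ 1ℤ) 1ℤ) ≡ qℤ ℤ.- 1ℤ ×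
      ℤ.+ 2 ℤ.* ΣF (λ t → when (ε (t * u) ℤₚ.≟ -1ℤ) 1ℤ) ≡ qℤ ℤ.- 1ℤ
    multiples-count {u} u≉0 = let (p , m) = count-signs (λ t → ε (t * u)) (sound Fₗ) (λ t ft → sg t (t ≟ 0#)) in
      ≡.trans p (≡.trans (≡.cong₂ ℤ._+_ sq (ΣF-ε-multiples u)) (ℤₚ.+-identityʳ (qℤ ℤ.- 1ℤ))) ,
      ≡.trans m (≡.trans (≡.cong₂ ℤ._-_ sq (ΣF-ε-multiples u)) (ℤₚ.+-identityʳ (qℤ ℤ.- 1ℤ)))
      where
      sg : ∀ t → Dec (t ≈ 0#) → Sign (ε (t * u))
      sg t (yes z) = inj₁ (ε-0 (*-0ˡ z))
      sg t (no nz) = inj₂ (ε-±1 (*-nonzero nz u≉0))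
      sq : ΣF (λ t → ε (t * u) ℤ.* ε (t * u)) ≡ qℤ ℤ.- 1ℤ
      sq = ≡.trans (≡.sym (drop (ΣF (λ t → when (t ≟ 0#) 1ℤ)) (ΣF (λ t → ε (t * u) ℤ.* ε (t * u))))) (≡.cong₂ ℤ._-_
        (≡.trans (≡.sym (ΣF-+ (λ t → when (t ≟ 0#) 1ℤ) (λ t → ε (t * u) ℤ.* ε (t * u)))) (≡.trans (ΣF-cong (λ t _ → at t (t ≟ 0#))) (≡.trans (ΣF-const 1ℤ) (ℤₚ.*-identityʳ qℤ))))
        (ΣF-delta {λ _ → 1ℤ} F-0 (λ _ → ≡.refl)))
        where
        drop : ∀ a b → (a ℤ.+ b) ℤ.- a ≡ b
        drop = ℤSolver.solve-∀
        at : ∀ t → (d : Dec (t ≈ 0#)) → when d 1ℤ ℤ.+ ε (t * u) ℤ.* ε (t * u) ≡ 1ℤ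
        at t (yes z) = ≡.cong (λ x → 1ℤ ℤ.+ x ℤ.* x) (ε-0 (*-0ˡ z))
        at t (no nz) = ≡.trans (ℤₚ.+-identityˡ (ε (t * u) ℤ.* ε (t * u))) (sq-1 (ε-±1 (*-nonzero nz u≉0)))

    Eℤ : ΣE (λ _ → 1ℤ) ≡ qℤ ℤ.* (qℤ ℤ.* qℤ)
    Eℤ = ≡.trans (sum-const (elems Eₗ) 1ℤ) (≡.trans (ℤₚ.*-identityʳ (ℤ.+ size Eₗ)) (≡.trans (≡.cong ℤ.+_ Eₗ-size)
      (≡.trans (ℤₚ.pos-* q (q ℕ.* (q ℕ.* 1))) (≡.cong (qℤ ℤ.*_) (≡.trans (≡.cong (λ t → ℤ.+ (q ℕ.* t)) (ℕₚ.*-identityʳ q)) (ℤₚ.pos-* q q))))))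

    ΣE-F : ∀ {h} → Resp h → ΣE (λ y → when (InF? y) (h y)) ≡ ΣF h
    ΣE-F {h} rh = ≡.trans (sum-cong′ (elems Eₗ) (λ y → ≡.sym (expand y (InF? y)))) (≡.trans (sum-swap (elems Eₗ) (elems Fₗ) (λ y t → when (y ≟ t) (h t)))
      (ΣF-cong (λ t _ → sum-delta (_≟ t) (λ _ → h t) (h t) Eₗ (λ _ _ _ _ p p′ → trans p (sym p′)) (Any.map sym (complete Eₗ t tt)) (λ _ _ _ → ≡.refl))))
      where
      expand : ∀ y (d : Dec (InF y)) → ΣF (λ t → when (y ≟ t) (h t)) ≡ when d (h y)
      expand y (yes f) = sum-delta (y ≟_) h (h y) Fₗ (λ _ _ _ _ p p′ → trans (sym p) p′) (complete Fₗ y f) (λ _ _ p → rh (sym p))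
      expand y (no nf) = sum-none (y ≟_) h (sound Fₗ) (λ t ft p → nf (F-cong (sym p) ft))

    -- w ↦ φ w - φ² w maps E onto the hyperplane T = 0 with fibres w + F, so q times the size is q³.
    hyperplane-size : ΣE (λ z → when (T z ≟ 0#) 1ℤ) ≡ qℤ ℤ.* qℤ
    hyperplane-size = cancel-q (≡.trans (≡.sym (sum-*ˡ (elems Eₗ) qℤ (λ z → when (T z ≟ 0#) 1ℤ))) (≡.trans (sum-cong′ (elems Eₗ) (λ z → ≡.sym (fiber z (T z ≟ 0#))))
      (≡.trans (≡.sym (sum-swap (elems Eₗ) (elems Eₗ) (λ w z → when (D w ≟ z) 1ℤ))) (≡.trans (sum-cong′ (elems Eₗ) (λ w →
        sum-delta (D w ≟_) (λ _ → 1ℤ) 1ℤ Eₗ (λ _ _ _ _ p p′ → trans (sym p) p′) (complete Eₗ (D w) tt) (λ _ _ _ → ≡.refl))) Eℤ))))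
      where
      D : Carrier → Carrier
      D w = φ w + - φ (φ w)
      D-+ : ∀ a b → D (a + b) ≈ D a + D b
      D-+ a b = trans (+-cong (φ-+ a b) (-‿cong (trans (φ-cong (φ-+ a b)) (φ-+ _ _)))) (solve 4 (λ a b c d → a :+ b :- (c :+ d) := a :- c :+ (b :- d)) refl _ _ _ _)
      fiber : ∀ z (d : Dec (T z ≈ 0#)) → ΣE (λ w → when (D w ≟ z) 1ℤ) ≡ qℤ ℤ.* when d 1ℤ
      fiber z (no nz) = ≡.trans (sum-none (λ w → D w ≟ z) (λ _ → 1ℤ) (sound Eₗ) (λ w _ p → nz (trans (T-cong (sym p)) (T-diff w)))) (≡.sym (ℤₚ.*-zeroʳ qℤ))
      fiber z (yes Tz) = let (w₀ , p) = hilbert-90 Tz in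
        ≡.trans (≡.sym (ΣE-shift {λ w → when (D w ≟ z) 1ℤ} w₀ (λ {x} {y} p → when-cong (D x ≟ z) (D y ≟ z) (trans (+-cong (φ-cong (sym p)) (-‿cong (φ-cong (φ-cong (sym p))))))
            (trans (+-cong (φ-cong p) (-‿cong (φ-cong (φ-cong p))))) (λ _ → ≡.refl))))
          (≡.trans (sum-cong′ (elems Eₗ) (λ w → when-cong (D (w₀ + w) ≟ z) (InF? w)
              (λ e → diff-zero (trans (solve 2 (λ a b → b := a :+ b :- a) refl z (D w)) (trans (+-congʳ (trans (+-congʳ (sym p)) (trans (sym (D-+ w₀ w)) e))) (-‿inverseʳ z))))
              (λ f → trans (D-+ w₀ w) (trans (+-cong p (trans (+-cong refl (-‿cong (φ-cong f))) (-‿inverseʳ (φ w)))) (+-identityʳ z)))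
              (λ _ → ≡.refl))) (≡.trans (ΣE-F {λ _ → 1ℤ} (λ _ → ≡.refl)) (ΣF-const 1ℤ)))

    G-ω² : ∀ v → G (ω * ω * v) ≡ ℤ.- G v
    G-ω² v = go (v ≟ 0#) (T v ≟ 0#)
      where
      go : Dec (v ≈ 0#) → Dec (T v ≈ 0#) → G (ω * ω * v) ≡ ℤ.- G v
      go (yes z) _ = ≡.trans (G-0 (*-0ʳ z)) (≡.sym (≡.cong ℤ.-_ (G-0 z)))
      go (no _) (no nz) = ≡.trans (G-T (λ z → nz (domain (trans (sym (T-scale v (F-* F-ω F-ω))) z) (*-nonzero ω≉0 ω≉0)))) (≡.sym (≡.cong ℤ.-_ (G-T nz)))
      go (no v≉0) (yes Tv) = let open Decomposition (decompose v≉0 Tv) in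
        ≡.trans (G-value (F-* (F-* F-ω F-ω) coeff-F) (*-nonzero (*-nonzero ω≉0 ω≉0) coeff≉0) base-S (trans (*-congˡ v≈) (sym (*-assoc _ _ _))))
          (≡.trans (≡.cong (ℤ._* ρ a₁ base) (ε-ω²* coeff)) (≡.trans (≡.sym (ℤₚ.neg-distribˡ-* (ε coeff) (ρ a₁ base))) (≡.cong ℤ.-_ (≡.sym (G-value coeff-F coeff≉0 base-S v≈)))))

    hyperplane-count :
      ℤ.+ 2 ℤ.* ΣE (λ z → when (G z ℤₚ.≟ 1ℤ) 1ℤ) ≡ qℤ ℤ.* qℤ ℤ.- 1ℤ ×
      ℤ.+ 2 ℤ.* ΣE (λ z → when (G z ℤₚ.≟ -1ℤ) 1ℤ) ≡ qℤ ℤ.* qℤ ℤ.- 1ℤ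
    hyperplane-count = let (p , m) = count-signs G (sound Eₗ) (λ z _ → G-sign z) in
      ≡.trans p (≡.trans (≡.cong₂ ℤ._+_ sq ΣG) (ℤₚ.+-identityʳ (qℤ ℤ.* qℤ ℤ.- 1ℤ))) , ≡.trans m (≡.trans (≡.cong₂ ℤ._-_ sq ΣG) (ℤₚ.+-identityʳ (qℤ ℤ.* qℤ ℤ.- 1ℤ)))
      where
      ΣG : ΣE G ≡ 0ℤ
      ΣG = x≡-x (≡.trans (≡.sym (ΣE-scale (ω * ω) (*-nonzero ω≉0 ω≉0) G-cong)) (≡.trans (sum-cong′ (elems Eₗ) (λ t →
        ≡.trans (G-ω² t) (≡.sym (ℤₚ.-1*i≡-i (G t))))) (≡.trans (sum-*ˡ (elems Eₗ) -1ℤ G) (ℤₚ.-1*i≡-i (ΣE G)))))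
      sq : ΣE (λ z → G z ℤ.* G z) ≡ qℤ ℤ.* qℤ ℤ.- 1ℤ
      sq = ≡.trans (≡.sym (drop (ΣE (λ z → when (z ≟ 0#) 1ℤ)) (ΣE (λ z → G z ℤ.* G z)))) (≡.cong₂ ℤ._-_
        (≡.trans (≡.sym (sum-+ (elems Eₗ) (λ z → when (z ≟ 0#) 1ℤ) (λ z → G z ℤ.* G z))) (≡.trans (sum-cong′ (elems Eₗ) (λ z → at z (z ≟ 0#) (T z ≟ 0#))) hyperplane-size))
        (sum-delta (_≟ 0#) (λ _ → 1ℤ) 1ℤ Eₗ (λ _ _ _ _ p p′ → trans p (sym p′)) (Any.map sym (complete Eₗ 0# tt)) (λ _ _ _ → ≡.refl)))
        where
        drop : ∀ a b → (a ℤ.+ b) ℤ.- a ≡ b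
        drop = ℤSolver.solve-∀
        at : ∀ z → (d : Dec (z ≈ 0#)) (d′ : Dec (T z ≈ 0#)) → when d 1ℤ ℤ.+ G z ℤ.* G z ≡ when d′ 1ℤ
        at z (yes p) (yes _) = ≡.cong (λ x → 1ℤ ℤ.+ x ℤ.* x) (G-0 p)
        at z (yes p) (no nz) = ⊥-elim (nz (trans (T-cong p) T-0))
        at z (no _) (no nz) = ≡.cong (λ x → 0ℤ ℤ.+ x ℤ.* x) (G-T nz)
        at z (no z≉0) (yes Tz) = ≡.trans (ℤₚ.+-identityˡ (G z ℤ.* G z)) (sq-1 (G-±1 z≉0 Tz))

    χ-test : ∀ y → (χ₂≡-1 y → χ y ≡ -1ℤ) × (χ y ≡ -1ℤ → χ₂≡-1 y)
    χ-test y = (λ (y≉0 , nsq) → [ (λ p → ⊥-elim (nsq (square-root p))) , (λ p → p) ]′ (χ-±1 y≉0)) ,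
      (λ p → (λ z → absurd₀ (≡.trans (≡.sym p) (χ-0 z))) , λ (w , eq) → case w eq p (w ≟ 0#))
      where
      absurd₀ : -1ℤ ≢ 0ℤ
      absurd₀ ()
      absurd₁ : -1ℤ ≢ 1ℤ
      absurd₁ ()
      case : ∀ w → w * w ≈ y → χ y ≡ -1ℤ → Dec (w ≈ 0#) → ⊥
      case w eq p (yes z) = absurd₀ (≡.trans (≡.sym p) (χ-0 (trans (sym eq) (*-0ˡ z))))
      case w eq p (no nz) = absurd₁ (≡.trans (≡.sym p) (≡.trans (χ-cong (sym eq)) (χ-sq nz)))

    X₁-ρ : ∀ {a} → InX₁ a → ρ a₁ a ≡ 1ℤ
    X₁-ρ {a} (_ , nχ) with χ (two * T (a₁ * a)) ℤₚ.≟ -1ℤ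
    ... | yes p = ⊥-elim (nχ (proj₂ (χ-test _) p))
    ... | no _ = ≡.refl

    ρ-X₁ : ∀ {a} → InS a → ρ a₁ a ≡ 1ℤ → InX₁ a
    ρ-X₁ {a} Sa p = Sa , λ h → go h p
      where
      go : χ₂≡-1 (two * T (a₁ * a)) → ρ a₁ a ≡ 1ℤ → ⊥
      go h p with χ (two * T (a₁ * a)) ℤₚ.≟ -1ℤ
      go h () | yes _
      go h p | no n = n (proj₁ (χ-test _) h)

    ρ-X₂ : ∀ {a} → InS a → ρ a₁ a ≡ -1ℤ → InX₂ a
    ρ-X₂ Sa p = Sa , λ x₁ → absurd (≡.trans (≡.sym (X₁-ρ x₁)) p)
      where
      absurd : 1ℤ ≢ -1ℤ
      absurd ()

    X₂-ρ : ∀ {a} → InX₂ a → ρ a₁ a ≡ -1ℤ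
    X₂-ρ {a} (Sa , nx) = [ (λ p → ⊥-elim (nx (ρ-X₁ Sa p))) , (λ p → p) ]′ (ρ-±1 a₁ a)

    ε-ω^4* : ∀ j k → ε (ω ^ (4 ℕ.* j) * ω ^ k) ≡ sε (3 ℕ.* k)
    ε-ω^4* j k = ≡.trans (ε-cong (sym (^-homo-* ω (4 ℕ.* j) k))) (≡.trans (ε-ω^ (4 ℕ.* j ℕ.+ k)) (≡.trans (≡.cong sε (arith j k)) (sε-periodic (3 ℕ.* j) (3 ℕ.* k))))
      where
      arith : ∀ j k → 3 ℕ.* (4 ℕ.* j ℕ.+ k) ≡ 4 ℕ.* (3 ℕ.* j) ℕ.+ 3 ℕ.* k
      arith = ℕSolver.solve-∀

    -- N u = 1 forces s = 1 and u = μ^i in the orbit, whence u v = ω^(4j + l) a²; the factor ω^(4j)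
    -- does not affect ε.
    orbit-G : ∀ {u v a b} l → N u ≈ 1# → InS a → b ≈ ω ^ l * (a * a) → InOrbit (u , v) (1# , b) → G (u * v) ≡ sε (3 ℕ.* l) ℤ.* ρ a₁ a
    orbit-G {u} {v} {a} {b} l Nu Sa b≈ (i , j , s , (fs , s≉0) , u≈ , v≈) =
      ≡.trans (G-value (F-* (F-^ (4 ℕ.* j) F-ω) (F-^ l F-ω)) (*-nonzero (^-nonzero (4 ℕ.* j) ω≉0) (^-nonzero l ω≉0)) Sa uv≈)
        (≡.cong (ℤ._* ρ a₁ a) (ε-ω^4* j l))
      where
      u≈μ : u ≈ μ ^ i
      u≈μ = S-F-ratio Nu (N-μ^ i) fs (trans u≈ (*-congˡ (*-identityʳ _)))
      s≈1 : s ≈ 1#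
      s≈1 = cancel-nonzero (N1≉0 (N-μ^ i)) (trans (*-comm _ _) (trans (*-congˡ (sym (*-identityʳ _))) (trans (sym u≈) (trans u≈μ (sym (*-identityʳ _))))))
      uv≈ : u * v ≈ ω ^ (4 ℕ.* j) * ω ^ l * (a * a)
      uv≈ = trans (*-congʳ u≈μ) (trans v≈ (trans (*-congʳ s≈1) (trans (*-identityˡ _) (trans (*-congˡ b≈) (sym (*-assoc _ _ _))))))

    -- ε (ω^l) is 1, 1, -1, -1 for l = 0, 1, 2, 3. This is the sign of `ρ a₁` on the part of S that
    -- each of the four kinds of orbits uses.
    T₁-G : ∀ {u v h} → N u ≈ 1# → InT₁ ((u , v) , h) → G (u * v) ≡ 1ℤ
    T₁-G Nu (a , inj₁ (x₁ , inj₁ o)) = ≡.trans (orbit-G 0 Nu (proj₁ x₁) (sym (*-identityˡ _)) o) (≡.cong (1ℤ ℤ.*_) (X₁-ρ x₁))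
    T₁-G Nu (a , inj₁ (x₁ , inj₂ o)) = ≡.trans (orbit-G 1 Nu (proj₁ x₁) (*-congʳ (sym (*-identityʳ ω))) o) (≡.cong (1ℤ ℤ.*_) (X₁-ρ x₁))
    T₁-G Nu (a , inj₂ (x₂ , inj₁ o)) = ≡.trans (orbit-G 2 Nu (proj₁ x₂) refl o) (≡.cong (-1ℤ ℤ.*_) (X₂-ρ x₂))
    T₁-G Nu (a , inj₂ (x₂ , inj₂ o)) = ≡.trans (orbit-G 3 Nu (proj₁ x₂) refl o) (≡.cong (-1ℤ ℤ.*_) (X₂-ρ x₂))

    G-T₁ : ∀ {u v h} → N u ≈ 1# → G (u * v) ≡ 1ℤ → InT₁ ((u , v) , h)
    G-T₁ {u} {v} {h} Nu g = go (div4 (proj₁ lg))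
      where
      v′ : Carrier
      v′ = u * v
      v′≉0 : v′ ≉ 0#
      v′≉0 z = absurd (≡.trans (≡.sym (G-0 z)) g)
        where
        absurd : 0ℤ ≢ 1ℤ
        absurd ()
      open Decomposition (decompose v′≉0 (proj₂ h))
      lg = F*-log coeff-F coeff≉0
      value : ε coeff ℤ.* ρ a₁ base ≡ 1ℤ
      value = ≡.trans (≡.sym (G-value coeff-F coeff≉0 base-S v≈)) g
      ulog = N1-log Nu
      orbit : ∀ j l {b} → ω ^ (4 ℕ.* j ℕ.+ l) ≈ coeff → b ≈ ω ^ l * (base * base) → InOrbit (u , v) (1# , b)
      orbit j l p b≈ = proj₁ ulog , j , 1# , (F-1 , 1≉0) ,
        trans u≈ (sym (trans (*-identityˡ _) (*-identityʳ _))) ,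
        trans (*-congʳ (sym u≈)) (trans v≈ (trans (*-congʳ (trans (sym p) (^-homo-* ω (4 ℕ.* j) l))) (trans (*-assoc _ _ _) (trans (*-congˡ (sym b≈)) (sym (*-identityˡ _))))))
        where
        u≈ : u ≈ μ ^ proj₁ ulog
        u≈ = trans (sym (proj₂ ulog)) (μ^-log (proj₁ ulog))
      ρ-is : ∀ j l {s} → ω ^ (4 ℕ.* j ℕ.+ l) ≈ coeff → sε (3 ℕ.* l) ≡ s → s ℤ.* s ≡ 1ℤ → ρ a₁ base ≡ s
      ρ-is j l {s} p sl ss = ≡.sym (sign-eq ss (≡.trans (≡.cong (ℤ._* ρ a₁ base) (≡.sym (≡.trans (ε-cong (trans (sym p) (^-homo-* ω (4 ℕ.* j) l))) (≡.trans (ε-ω^4* j l) sl)))) value))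
      go : (∃ λ j → proj₁ lg ≡ 4 ℕ.* j ⊎ proj₁ lg ≡ 4 ℕ.* j ℕ.+ 1 ⊎ proj₁ lg ≡ 4 ℕ.* j ℕ.+ 2 ⊎ proj₁ lg ≡ 4 ℕ.* j ℕ.+ 3) → InT₁ ((u , v) , h)
      go (j , inj₁ p) = let eq = trans (^-congʳ ω (≡.trans (ℕₚ.+-identityʳ _) (≡.sym p))) (proj₂ lg) in
        base , inj₁ (ρ-X₁ base-S (ρ-is j 0 eq ≡.refl ≡.refl) , inj₁ (orbit j 0 eq (sym (*-identityˡ _))))
      go (j , inj₂ (inj₁ p)) = let eq = trans (^-congʳ ω (≡.sym p)) (proj₂ lg) in
        base , inj₁ (ρ-X₁ base-S (ρ-is j 1 eq ≡.refl ≡.refl) , inj₂ (orbit j 1 eq (*-congʳ (sym (*-identityʳ ω)))))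
      go (j , inj₂ (inj₂ (inj₁ p))) = let eq = trans (^-congʳ ω (≡.sym p)) (proj₂ lg) in
        base , inj₂ (ρ-X₂ base-S (ρ-is j 2 eq ≡.refl ≡.refl) , inj₁ (orbit j 2 eq refl))
      go (j , inj₂ (inj₂ (inj₂ p))) = let eq = trans (^-congʳ ω (≡.sym p)) (proj₂ lg) in
        base , inj₂ (ρ-X₂ base-S (ρ-is j 3 eq ≡.refl ≡.refl) , inj₂ (orbit j 3 eq refl))

    orbit-∼ : ∀ {u v u′ v′ b s} → InF* s → u′ ≈ s * u → v′ ≈ s * v → InOrbit (u , v) b → InOrbit (u′ , v′) b
    orbit-∼ {s = s} (fs , s≉0) p p′ (i , j , t , (ft , t≉0) , u≈ , v≈) = i , j , s * t , (F-* fs ft , *-nonzero s≉0 t≉0) ,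
      trans p (trans (*-congˡ u≈) (sym (*-assoc _ _ _))) ,
      trans (*-congˡ p′) (trans (solve 3 (λ m s v → m :* (s :* v) := s :* (m :* v)) refl _ s _) (trans (*-congˡ v≈) (sym (*-assoc _ _ _))))

    T₁-∼ : ∀ {x y} → x ∼ y → InT₁ x → InT₁ y
    T₁-∼ (s , fs , p , p′) (a , inj₁ (x₁ , inj₁ o)) = a , inj₁ (x₁ , inj₁ (orbit-∼ fs p p′ o))
    T₁-∼ (s , fs , p , p′) (a , inj₁ (x₁ , inj₂ o)) = a , inj₁ (x₁ , inj₂ (orbit-∼ fs p p′ o))
    T₁-∼ (s , fs , p , p′) (a , inj₂ (x₂ , inj₁ o)) = a , inj₂ (x₂ , inj₁ (orbit-∼ fs p p′ o))
    T₁-∼ (s , fs , p , p′) (a , inj₂ (x₂ , inj₂ o)) = a , inj₂ (x₂ , inj₂ (orbit-∼ fs p p′ o))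

  -- Vectors over F and independence by counting.

  Vec-F : Vec4 → Set ℓ
  Vec-F a = ∀ i → InF (a i)

  _≈ᵥ_ : Vec4 → Vec4 → Set ℓ
  a ≈ᵥ b = ∀ i → a i ≈ b i

  C² C³ C⁴ : Set c
  C² = Carrier × Carrier
  C³ = Carrier × C²
  C⁴ = Carrier × C³

  _≈₂_ : C² → C² → Set ℓ
  (x , y) ≈₂ (x′ , y′) = x ≈ x′ × y ≈ y′

  _≈₃_ : C³ → C³ → Set ℓ
  (x , y) ≈₃ (x′ , y′) = x ≈ x′ × y ≈₂ y′

  _≈₄_ : C⁴ → C⁴ → Set ℓ
  (x , y) ≈₄ (x′ , y′) = x ≈ x′ × y ≈₃ y′

  F² : C² → Set ℓ
  F² (x , y) = InF x × InF y

  F³ : C³ → Set ℓ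
  F³ (x , y) = InF x × F² y

  F⁴ : C⁴ → Set ℓ
  F⁴ (x , y) = InF x × F³ y

  F²ₗ : Enum _≈₂_ F²
  F²ₗ = product Fₗ Fₗ

  F³ₗ : Enum _≈₃_ F³
  F³ₗ = product Fₗ F²ₗ

  F⁴ₗ : Enum _≈₄_ F⁴
  F⁴ₗ = product Fₗ F³ₗ

  F³-size : size F³ₗ ≡ q ℕ.* (q ℕ.* q)
  F³-size = ≡.trans (length-pairs (elems Fₗ) (elems F²ₗ)) (≡.cong₂ ℕ._*_ Fₗ-size
    (≡.trans (length-pairs (elems Fₗ) (elems Fₗ)) (≡.cong₂ ℕ._*_ Fₗ-size Fₗ-size)))

  F⁴-size : size F⁴ₗ ≡ q ℕ.* (q ℕ.* (q ℕ.* q))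
  F⁴-size = ≡.trans (length-pairs (elems Fₗ) (elems F³ₗ)) (≡.cong₂ ℕ._*_ Fₗ-size F³-size)

  vec : C⁴ → Vec4
  vec (x , y , z , t) F.zero = x
  vec (x , y , z , t) (F.suc F.zero) = y
  vec (x , y , z , t) (F.suc (F.suc F.zero)) = z
  vec (x , y , z , t) (F.suc (F.suc (F.suc F.zero))) = t

  unvec : Vec4 → C⁴
  unvec a = a F.zero , a (F.suc F.zero) , a (F.suc (F.suc F.zero)) , a (F.suc (F.suc (F.suc F.zero)))

  all4? : ∀ {p} {P : Fin 4 → Set p} → (∀ i → Dec (P i)) → Dec (∀ i → P i)
  all4? = Fₚ.all?

  Span₃ : Vec4 → Vec4 → Vec4 → Vec4 → Set (c ⊔ ℓ)
  Span₃ a b d x = ∃ λ s → ∃ λ t → ∃ λ r → InF s × InF t × InF r × (∀ i → x i ≈ s * a i + t * b i + r * d i)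

  span₃? : ∀ a b d x → Dec (Span₃ a b d x)
  span₃? a b d x with search F³ₗ (λ (s , t , r) → all4? (λ i → x i ≟ s * a i + t * b i + r * d i))
    (λ (p , p′ , p″) h i → trans (h i) (+-cong (+-cong (*-congʳ p) (*-congʳ p′)) (*-congʳ p″)))
  ... | yes ((s , t , r) , (fs , ft , fr) , h) = yes (s , t , r , fs , ft , fr , h)
  ... | no none = no λ (s , t , r , fs , ft , fr , h) → none ((s , t , r) , (fs , ft , fr) , h)

  1<q : 1 ℕ.< q
  1<q = ≡.subst (1 ℕ.<_) (≡.sym (≡.trans q-suc (≡.cong ℕ.suc m₁-mod8))) (ℕ.s≤s (ℕ.s≤s ℕ.z≤n))

  -- Three vectors span at most q³ of the q⁴ vectors of F⁴. Counting takes the place of a theory of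
  -- dimension.
  outside : ∀ a b d → ∃ λ x → Vec-F x × ¬ Span₃ a b d x
  outside a b d = go (search F⁴ₗ (λ z → ¬? (span₃? a b d (vec z))) (λ p n h → n (resp p h)))
    where
    resp : ∀ {z z′} → z ≈₄ z′ → Span₃ a b d (vec z′) → Span₃ a b d (vec z)
    resp {z} {z′} (p₀ , p₁ , p₂ , p₃) (s , t , r , fs , ft , fr , h) = s , t , r , fs , ft , fr , λ i → trans (at i) (h i)
      where
      at : ∀ i → vec z i ≈ vec z′ i
      at F.zero = p₀
      at (F.suc F.zero) = p₁
      at (F.suc (F.suc F.zero)) = p₂
      at (F.suc (F.suc (F.suc F.zero))) = p₃
    vec-F : ∀ {z} → F⁴ z → Vec-F (vec z)
    vec-F (f₀ , f₁ , f₂ , f₃) F.zero = f₀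
    vec-F (f₀ , f₁ , f₂ , f₃) (F.suc F.zero) = f₁
    vec-F (f₀ , f₁ , f₂ , f₃) (F.suc (F.suc F.zero)) = f₂
    vec-F (f₀ , f₁ , f₂ , f₃) (F.suc (F.suc (F.suc F.zero))) = f₃
    comb : C³ → C⁴
    comb (s , t , r) = unvec (λ i → s * a i + t * b i + r * d i)
    go : Dec (∃ λ z → F⁴ z × ¬ Span₃ a b d (vec z)) → ∃ λ x → Vec-F x × ¬ Span₃ a b d x
    go (yes (z , fz , n)) = vec z , vec-F fz , n
    go (no none) = ⊥-elim (ℕₚ.<⇒≱ lt (≡.subst₂ ℕ._≤_ F⁴-size (≡.trans (Listₚ.length-map comb (elems F³ₗ)) F³-size)
        (length-≤ {_∼_ = _≈₄_} (λ (p₀ , p₁ , p₂ , p₃) → sym p₀ , sym p₁ , sym p₂ , sym p₃)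
          (λ (p₀ , p₁ , p₂ , p₃) (r₀ , r₁ , r₂ , r₃) → trans p₀ r₀ , trans p₁ r₁ , trans p₂ r₂ , trans p₃ r₃)
          (uniq F⁴ₗ) (All.map (λ {z} → covered z) (sound F⁴ₗ)))))
      where
      lt : q ℕ.* (q ℕ.* q) ℕ.< q ℕ.* (q ℕ.* (q ℕ.* q))
      lt = ≡.subst (q ℕ.* (q ℕ.* q) ℕ.<_) (ℕₚ.*-comm (q ℕ.* (q ℕ.* q)) q) (ℕₚ.m<m*n (q ℕ.* (q ℕ.* q)) q {{q³-nonZero}} 1<q)
        where
        q-nonZero : ℕ.NonZero q
        q-nonZero = ℕ.>-nonZero (ℕₚ.<-trans (ℕ.s≤s ℕ.z≤n) 1<q)
        q³-nonZero : ℕ.NonZero (q ℕ.* (q ℕ.* q))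
        q³-nonZero = ℕₚ.m*n≢0 q (q ℕ.* q) {{q-nonZero}} {{ℕₚ.m*n≢0 q q {{q-nonZero}} {{q-nonZero}}}}
      covered : ∀ z → F⁴ z → Any (z ≈₄_) (map comb (elems F³ₗ))
      covered z fz with span₃? a b d (vec z)
      ... | no n = ⊥-elim (none (z , fz , n))
      ... | yes (s , t , r , fs , ft , fr , h) = Anyₚ.map⁺ (Any.map (λ (p , p′ , p″) →
              let at = λ i → trans (h i) (+-cong (+-cong (*-congʳ p) (*-congʳ p′)) (*-congʳ p″)) in
              at F.zero , at (F.suc F.zero) , at (F.suc (F.suc F.zero)) , at (F.suc (F.suc (F.suc F.zero))))
            (complete F³ₗ (s , t , r) (fs , ft , fr)))

  -- Points and lines of PG(3,q).

  Span₂ : Vec4 → Vec4 → Vec4 → Set (c ⊔ ℓ)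
  Span₂ a b x = ∃ λ s → ∃ λ t → InF s × InF t × (∀ i → x i ≈ s * a i + t * b i)

  Span₂-left : ∀ a b → Span₂ a b a
  Span₂-left a b = 1# , 0# , F-1 , F-0 , λ i → solve 2 (λ a b → a := :1 :* a :+ :0 :* b) refl (a i) (b i)

  Span₂-right : ∀ a b → Span₂ a b b
  Span₂-right a b = 0# , 1# , F-0 , F-1 , λ i → solve 2 (λ a b → b := :0 :* a :+ :1 :* b) refl (a i) (b i)

  Span₂-trans : ∀ {a b a′ b′ x} → Span₂ a′ b′ a → Span₂ a′ b′ b → Span₂ a b x → Span₂ a′ b′ x
  Span₂-trans {a} {b} {a′} {b′} (s , t , fs , ft , h) (s′ , t′ , fs′ , ft′ , h′) (s″ , t″ , fs″ , ft″ , h″) =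
    s″ * s + t″ * s′ , s″ * t + t″ * t′ , F-+ (F-* fs″ fs) (F-* ft″ fs′) , F-+ (F-* fs″ ft) (F-* ft″ ft′) , λ i →
      trans (h″ i) (trans (+-cong (*-congˡ (h i)) (*-congˡ (h′ i))) (solve 8 (λ s t s′ t′ s″ t″ a b →
        s″ :* (s :* a :+ t :* b) :+ t″ :* (s′ :* a :+ t′ :* b) := (s″ :* s :+ t″ :* s′) :* a :+ (s″ :* t :+ t″ :* t′) :* b) refl s t s′ t′ s″ t″ (a′ i) (b′ i)))

  ≈P-refl : ∀ r → r ≈P r
  ≈P-refl r = 1# , (F-1 , 1≉0) , λ i → sym (*-identityˡ _)

  ≈P-sym : ∀ {r r′} → r ≈P r′ → r′ ≈P r
  ≈P-sym (s , (fs , s≉0) , h) = inv s , (F-inv fs , inv-nonzero s≉0) , λ i → sym (trans (*-congˡ (h i)) (trans (sym (*-assoc _ _ _))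
    (trans (*-congʳ (trans (*-comm _ _) (inv-right s≉0))) (*-identityˡ _))))

  ≈P-trans : ∀ {r r′ r″} → r ≈P r′ → r′ ≈P r″ → r ≈P r″
  ≈P-trans (s , (fs , s≉0) , h) (s′ , (fs′ , s′≉0) , h′) = s′ * s , (F-* fs′ fs , *-nonzero s′≉0 s≉0) , λ i →
    trans (h′ i) (trans (*-congˡ (h i)) (sym (*-assoc _ _ _)))

  ≈P? : ∀ r r′ → Dec (r ≈P r′)
  ≈P? (r , _) (r′ , _) with search Fₗ (λ s → ¬? (s ≟ 0#) ×-dec all4? (λ i → r′ i ≟ s * r i))
    (λ p (n , h) → (λ z → n (trans p z)) , λ i → trans (h i) (*-congʳ p))
  ... | yes (s , fs , n , h) = yes (s , (fs , n) , h)
  ... | no none = no λ (s , (fs , n) , h) → none (s , fs , n , h)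

  on? : ∀ r L → Dec (r on L)
  on? (r , _) (((a , _) , (b , _)) , _) with search F²ₗ (λ (s , t) → all4? (λ i → r i ≟ s * a i + t * b i))
    (λ (p , p′) h i → trans (h i) (+-cong (*-congʳ p) (*-congʳ p′)))
  ... | yes ((s , t) , (fs , ft) , h) = yes (s , t , fs , ft , h)
  ... | no none = no λ (s , t , fs , ft , h) → none ((s , t) , (fs , ft) , h)

  on-≈P : ∀ {r r′} L → r ≈P r′ → r on L → r′ on L
  on-≈P {r , _} {r′ , _} (((a , _) , (b , _)) , _) (c′ , (fc , _) , h′) (s , t , fs , ft , h) = c′ * s , c′ * t , F-* fc fs , F-* fc ft , λ i →
    trans (h′ i) (trans (*-congˡ (h i)) (solve 5 (λ k s t a b → k :* (s :* a :+ t :* b) := k :* s :* a :+ k :* t :* b) refl c′ s t (a i) (b i)))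

  ≈L-refl : ∀ L → L ≈L L
  ≈L-refl L r = (λ p → p) , (λ p → p)

  ≈L-sym : ∀ {L M} → L ≈L M → M ≈L L
  ≈L-sym h r = proj₂ (h r) , proj₁ (h r)

  ≈L-trans : ∀ {L M K} → L ≈L M → M ≈L K → L ≈L K
  ≈L-trans h h′ r = (λ p → proj₁ (h′ r) (proj₁ (h r) p)) , (λ p → proj₂ (h r) (proj₂ (h′ r) p))

  proportional : ∀ {a b : Vec4} {s t s′ t′} (r r′ : Pt3) → InF s → InF t → InF s′ → InF t′ →
    (∀ i → proj₁ r i ≈ s * a i + t * b i) → (∀ i → proj₁ r′ i ≈ s′ * a i + t′ * b i) → s * t′ ≈ s′ * t → r ≈P r′
  proportional {a} {b} {s} {t} {s′} {t′} (r , _ , r≉0) (r′ , _ , r′≉0) fs ft fs′ ft′ h h′ D = go (s ≟ 0#) (t ≟ 0#)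
    where
    finish : ∀ k → InF k → s′ ≈ k * s → t′ ≈ k * t → ∃ λ k → InF* k × (∀ i → r′ i ≈ k * r i)
    finish k fk p p′ = k , (fk , λ z → r′≉0 (λ i → trans (eq i) (*-0ˡ z))) , eq
      where
      eq : ∀ i → r′ i ≈ k * r i
      eq i = trans (h′ i) (trans (+-cong (*-congʳ p) (*-congʳ p′)) (trans (solve 5 (λ k s t a b → k :* s :* a :+ k :* t :* b := k :* (s :* a :+ t :* b)) refl k s t (a i) (b i)) (*-congˡ (sym (h i)))))
    go : Dec (s ≈ 0#) → Dec (t ≈ 0#) → ∃ λ k → InF* k × (∀ i → r′ i ≈ k * r i)
    go (no s≉0) _ = finish (s′ * inv s) (F-* fs′ (F-inv fs)) (ratio-≈ s′ s≉0)
      (cancel-nonzero s≉0 (trans D (trans (*-congʳ (ratio-≈ s′ s≉0)) (solve 3 (λ k s t → k :* s :* t := s :* (k :* t)) refl _ s t))))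
    go (yes s≈0) (no t≉0) = finish (t′ * inv t) (F-* ft′ (F-inv ft))
      (trans (domain (trans (*-comm t s′) (trans (sym D) (*-0ˡ s≈0))) t≉0) (sym (*-0ʳ s≈0))) (ratio-≈ t′ t≉0)
    go (yes s≈0) (yes t≈0) = ⊥-elim (r≉0 (λ i → trans (h i) (trans (+-cong (*-0ˡ s≈0) (*-0ˡ t≈0)) (+-identityʳ 0#))))

  -- Cramer's rule. The determinant is not 0, since by `proportional` the two points would otherwise
  -- be equal.
  spans : ∀ {a b} (r r′ : Pt3) → ¬ (r ≈P r′) → Span₂ a b (proj₁ r) → Span₂ a b (proj₁ r′) →
    Span₂ (proj₁ r) (proj₁ r′) a × Span₂ (proj₁ r) (proj₁ r′) b
  spans {a} {b} r r′ n (s , t , fs , ft , h) (s′ , t′ , fs′ , ft′ , h′) =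
    (i * t′ , - (i * t) , F-* fi ft′ , F-neg (F-* fi ft) , λ j → sym (trans (+-cong (*-congˡ (h j)) (*-congˡ (h′ j)))
      (trans (solve 7 (λ i s t s′ t′ a b → i :* t′ :* (s :* a :+ t :* b) :+ :- (i :* t) :* (s′ :* a :+ t′ :* b) := (s :* t′ :- s′ :* t) :* i :* a) refl i s t s′ t′ (a j) (b j)) (unit (a j))))) ,
    (- (i * s′) , i * s , F-neg (F-* fi fs′) , F-* fi fs , λ j → sym (trans (+-cong (*-congˡ (h j)) (*-congˡ (h′ j)))
      (trans (solve 7 (λ i s t s′ t′ a b → :- (i :* s′) :* (s :* a :+ t :* b) :+ i :* s :* (s′ :* a :+ t′ :* b) := (s :* t′ :- s′ :* t) :* i :* b) refl i s t s′ t′ (a j) (b j)) (unit (b j)))))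
    where
    D i : Carrier
    D = s * t′ + - (s′ * t)
    i = inv D
    fi : InF i
    fi = F-inv (F-+ (F-* fs ft′) (F-neg (F-* fs′ ft)))
    D≉0 : D ≉ 0#
    D≉0 z = n (proportional r r′ fs ft fs′ ft′ h h′ (x-y≈0 z))
    unit : ∀ x → D * i * x ≈ x
    unit x = trans (*-congʳ (inv-right D≉0)) (*-identityˡ x)

  line-unique : ∀ r r′ L M → ¬ (r ≈P r′) → r on L → r′ on L → r on M → r′ on M → L ≈L M
  line-unique r r′ L@((a , b) , _) M@((a′ , b′) , _) n rL r′L rM r′M x = into L M rL r′L rM r′M , into M L rM r′M rL r′L
    where
    into : ∀ L M → r on L → r′ on L → r on M → r′ on M → x on L → x on M
    into ((a , b) , _) ((a′ , b′) , _) rL r′L rM r′M xL = let (sa , sb) = spans r r′ n rL r′L in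
      Span₂-trans rM r′M (Span₂-trans sa sb xL)

  join : ∀ r r′ → ¬ (r ≈P r′) → Ln3
  join r r′ n = (r , r′) , λ s t fs ft h → independent s t fs ft h (t ≟ 0#)
    where
    independent : ∀ s t → InF s → InF t → (∀ i → s * proj₁ r i + t * proj₁ r′ i ≈ 0#) → Dec (t ≈ 0#) → (s ≈ 0#) × (t ≈ 0#)
    independent s t fs ft h (yes t≈0) = go (s ≟ 0#) , t≈0
      where
      go : Dec (s ≈ 0#) → s ≈ 0#
      go (yes z) = z
      go (no s≉0) = ⊥-elim (proj₂ (proj₂ r) (λ i → domain (trans (sym (trans (+-congˡ (*-0ˡ t≈0)) (+-identityʳ _))) (h i)) s≉0))
    independent s t fs ft h (no t≉0) = ⊥-elim (n (k₁ , (F-neg (F-* fs (F-inv ft)) , λ z → proj₂ (proj₂ r′) (λ i → trans (eq i) (*-0ˡ z))) , eq))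
      where
      k₁ : Carrier
      k₁ = - (s * inv t)
      eq : ∀ i → proj₁ r′ i ≈ k₁ * proj₁ r i
      eq i = cancel-nonzero t≉0 (x-y≈0 (begin
        t * proj₁ r′ i + - (t * (k₁ * proj₁ r i))
          ≈⟨ solve 5 (λ s t i a b → t :* b :- t :* (:- (s :* i) :* a) := s :* a :+ t :* b :+ (t :* i :- :1) :* (s :* a)) refl s t (inv t) (proj₁ r i) (proj₁ r′ i) ⟩
        s * proj₁ r i + t * proj₁ r′ i + (t * inv t + - 1#) * (s * proj₁ r i)
          ≈⟨ +-cong (h i) (*-0ˡ (trans (+-congʳ (inv-right t≉0)) (-‿inverseʳ 1#))) ⟩
        0# + 0#
          ≈⟨ +-identityʳ 0# ⟩
        0# ∎))

  join-left : ∀ r r′ n → r on join r r′ n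
  join-left r r′ n = Span₂-left (proj₁ r) (proj₁ r′)

  join-right : ∀ r r′ n → r′ on join r r′ n
  join-right r r′ n = Span₂-right (proj₁ r) (proj₁ r′)

  new-point : ∀ a b d → Σ Pt3 λ x → ¬ Span₃ a b d (proj₁ x)
  new-point a b d = let (x , fx , n) = outside a b d in
    (x , fx , λ z → n (0# , 0# , 0# , F-0 , F-0 , F-0 , λ i → trans (z i) (solve 3 (λ a b d → :0 := :0 :* a :+ :0 :* b :+ :0 :* d) refl (a i) (b i) (d i)))) , n

  Span₃-first : ∀ {a b d} (x y : Pt3) → proj₁ x ≈ᵥ a → x ≈P y → Span₃ a b d (proj₁ y)
  Span₃-first {a} {b} {d} x y p (s , (fs , _) , h) = s , 0# , 0# , fs , F-0 , F-0 , λ i → trans (h i) (trans (*-congˡ (p i))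
    (solve 4 (λ s a b d → s :* a := s :* a :+ :0 :* b :+ :0 :* d) refl s (a i) (b i) (d i)))

  -- A nonzero t would express d by r, a and b.
  no-component : ∀ {r a b d x : Vec4} {s t} → ¬ Span₃ r a b d → InF s → InF t → (∀ i → x i ≈ s * r i + t * d i) → Span₂ a b x → t ≈ 0#
  no-component {r} {a} {b} {d} {x} {s} {t} n fs ft h (s′ , t′ , fs′ , ft′ , h′) with t ≟ 0#
  ... | yes z = z
  ... | no t≉0 = ⊥-elim (n (- (s * i) , s′ * i , t′ * i , F-neg (F-* fs fi) , F-* fs′ fi , F-* ft′ fi , λ j → sym (begin
      - (s * i) * r j + s′ * i * a j + t′ * i * b j
        ≈⟨ solve 7 (λ s i s′ t′ r a b → :- (s :* i) :* r :+ s′ :* i :* a :+ t′ :* i :* b := i :* (s′ :* a :+ t′ :* b :- s :* r)) refl s i s′ t′ (r j) (a j) (b j) ⟩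
      i * (s′ * a j + t′ * b j + - (s * r j))
        ≈⟨ *-congˡ (+-congʳ (trans (sym (h′ j)) (h j))) ⟩
      i * (s * r j + t * d j + - (s * r j))
        ≈⟨ solve 5 (λ i s r t d → i :* (s :* r :+ t :* d :- s :* r) := t :* (i :* d)) refl i s (r j) t (d j) ⟩
      t * (i * d j)
        ≈⟨ inv-cancel (d j) t≉0 ⟩
      d j ∎)))
    where
    i = inv t
    fi = F-inv ft

  -- Without a component along d, the point x is a nonzero multiple of r.
  descend : ∀ {r a b x d : Vec4} {s t} (X : Pt3) → proj₁ X ≈ᵥ x → InF s → t ≈ 0# → (∀ i → x i ≈ s * r i + t * d i) → Span₂ a b x → Span₂ a b r
  descend {r} {a} {b} {x} {d} {s} {t} (y , _ , y≉0) p fs t≈0 h (s′ , t′ , fs′ , ft′ , h′) =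
    inv s * s′ , inv s * t′ , F-* (F-inv fs) fs′ , F-* (F-inv fs) ft′ , λ i → cancel-nonzero s≉0 (begin
      s * r i                                            ≈⟨ sym (eq i) ⟩
      x i                                                ≈⟨ h′ i ⟩
      s′ * a i + t′ * b i                                ≈⟨ sym (inv-cancel _ s≉0) ⟩
      s * (inv s * (s′ * a i + t′ * b i))                ≈⟨ *-congˡ (solve 5 (λ k s t a b → k :* (s :* a :+ t :* b) := k :* s :* a :+ k :* t :* b) refl (inv s) s′ t′ (a i) (b i)) ⟩
      s * (inv s * s′ * a i + inv s * t′ * b i) ∎)
    where
    eq : ∀ i → x i ≈ s * r i
    eq i = trans (h i) (trans (+-congˡ (*-0ˡ t≈0)) (+-identityʳ _))
    s≉0 : s ≉ 0#
    s≉0 z = y≉0 (λ i → trans (p i) (trans (eq i) (*-0ˡ z)))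

  -- The line joins r to a point outside the plane spanned by r and M.
  avoid : ∀ r M → ¬ (r on M) → ∃ λ L → r on L × (∀ x → x on L → ¬ (x on M))
  avoid r M@((a , b) , _) n = join r d rd , join-left r d rd , λ x (s , t , fs , ft , h) xM →
      n (descend {r = proj₁ r} {d = proj₁ d} x (λ _ → refl) fs (no-component (proj₂ np) fs ft h xM) h xM)
    where
    np = new-point (proj₁ r) (proj₁ a) (proj₁ b)
    d = proj₁ np
    rd : ¬ (r ≈P d)
    rd p = proj₂ np (Span₃-first r d (λ _ → refl) p)

  -- three lines through r that are not coplanar, the first one through p, witnessed by a line meeting only the first two
  record Tripod (r p : Pt3) : Set (c ⊔ ℓ) where
    field
      L₀ L₁ L₂ M : Ln3
      r₀ : r on L₀
      p₀ : p on L₀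
      r₁ : r on L₁
      p₁ : ¬ (p on L₁)
      r₂ : r on L₂
      x₀ x₁ : Pt3
      x₀L : x₀ on L₀
      x₀M : x₀ on M
      x₁L : x₁ on L₁
      x₁M : x₁ on M
      M₂ : ∀ x → x on L₂ → ¬ (x on M)

  -- d is taken off the line r p, and f off the plane r p d. The line M = p d meets r p and r d but
  -- not r f.
  tripod : ∀ r p → ¬ (r ≈P p) → Tripod r p
  tripod r p n = record
    { L₀ = join r p n ; L₁ = join r d rd ; L₂ = join r f rf ; M = join p d pd
    ; r₀ = join-left r p n ; p₀ = join-right r p n ; r₁ = join-left r d rd ; r₂ = join-left r f rf
    ; p₁ = λ pL → n (≈P-sym {p} {r} (collapse pL))
    ; x₀ = p ; x₁ = d ; x₀L = join-right r p n ; x₀M = join-left p d pd ; x₁L = join-right r d rd ; x₁M = join-right p d pd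
    ; M₂ = λ x (s , t , fs , ft , h) xM → dependent (descend {r = proj₁ r} {d = proj₁ f} x (λ _ → refl) fs (no-component (proj₂ nf) fs ft h xM) h xM) }
    where
    nd = new-point (proj₁ r) (proj₁ p) (proj₁ p)
    d = proj₁ nd
    nf = new-point (proj₁ r) (proj₁ p) (proj₁ d)
    f = proj₁ nf
    rd : ¬ (r ≈P d)
    rd e = proj₂ nd (Span₃-first r d (λ _ → refl) e)
    rf : ¬ (r ≈P f)
    rf e = proj₂ nf (Span₃-first r f (λ _ → refl) e)
    pd : ¬ (p ≈P d)
    pd (s , (fs , _) , h) = proj₂ nd (0# , s , 0# , F-0 , fs , F-0 , λ i → trans (h i) (solve 3 (λ s r p → s :* p := :0 :* r :+ s :* p :+ :0 :* p) refl s (proj₁ r i) (proj₁ p i)))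
    collapse : Span₂ (proj₁ r) (proj₁ d) (proj₁ p) → p ≈P r
    collapse (s , t , fs , ft , h) = ≈P-sym {r} {p} (s , (fs , λ z → proj₂ (proj₂ p) (λ i → trans (eq i) (*-0ˡ z))) , eq)
      where
      t≈0 : t ≈ 0#
      t≈0 = no-component {r = proj₁ r} {a = proj₁ p} {b = proj₁ p} (proj₂ nd) fs ft h (Span₂-left (proj₁ p) (proj₁ p))
      eq : ∀ i → proj₁ p i ≈ s * proj₁ r i
      eq i = trans (h i) (trans (+-congˡ (*-0ˡ t≈0)) (+-identityʳ _))
    dependent : ¬ Span₂ (proj₁ p) (proj₁ d) (proj₁ r)
    dependent (s , t , fs , ft , h) = n (≈P-sym {p} {r} (s , (fs , λ z → proj₂ (proj₂ r) (λ i → trans (eq i) (*-0ˡ z))) , eq))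
      where
      t≈0 : t ≈ 0#
      t≈0 = no-component {r = proj₁ p} {a = proj₁ r} {b = proj₁ r} (λ (a , b , c , fa , fb , fc , h) → proj₂ nd (b + c , a , 0# , F-+ fb fc , fa , F-0 , λ i → trans (h i)
              (solve 5 (λ a b c p r → a :* p :+ b :* r :+ c :* r := (b :+ c) :* r :+ a :* p :+ :0 :* p) refl a b c (proj₁ p i) (proj₁ r i))))
            fs ft h (Span₂-left (proj₁ r) (proj₁ r))
      eq : ∀ i → proj₁ r i ≈ s * proj₁ p i
      eq i = trans (h i) (trans (+-congˡ (*-0ˡ t≈0)) (+-identityʳ _))

  dot : Pt3 → Vec4 → Carrier
  dot (γ , _) r = γ F.zero * r F.zero + γ (F.suc F.zero) * r (F.suc F.zero) +
    γ (F.suc (F.suc F.zero)) * r (F.suc (F.suc F.zero)) + γ (F.suc (F.suc (F.suc F.zero))) * r (F.suc (F.suc (F.suc F.zero)))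

  dot-F : ∀ π {r} → Vec-F r → InF (dot π r)
  dot-F (γ , fγ , _) fr = F-+ (F-+ (F-+ (F-* (fγ _) (fr _)) (F-* (fγ _) (fr _))) (F-* (fγ _) (fr _))) (F-* (fγ _) (fr _))

  dot-lin : ∀ π {a b x s t} → (∀ i → x i ≈ s * a i + t * b i) → dot π x ≈ s * dot π a + t * dot π b
  dot-lin (γ , _) {a} {b} {x} {s} {t} h = trans (+-cong (+-cong (+-cong (*-congˡ (h _)) (*-congˡ (h _))) (*-congˡ (h _))) (*-congˡ (h _)))
    (trans (+-cong (+-cong (+-cong (d _ _ _) (d _ _ _)) (d _ _ _)) (d _ _ _))
      (solve 10 (λ s t a b c d e f g h → s :* a :+ t :* b :+ (s :* c :+ t :* d) :+ (s :* e :+ t :* f) :+ (s :* g :+ t :* h) := s :* (a :+ c :+ e :+ g) :+ t :* (b :+ d :+ f :+ h)) refl s t _ _ _ _ _ _ _ _))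
    where
    d : ∀ g a b → g * (s * a + t * b) ≈ s * (g * a) + t * (g * b)
    d g a b = solve 5 (λ g s t a b → g :* (s :* a :+ t :* b) := s :* (g :* a) :+ t :* (g :* b)) refl g s t a b

  onPlane? : ∀ r π → Dec (r onPlane π)
  onPlane? (r , _) π with dot π r ≟ 0#
  ... | yes p = yes (lift p)
  ... | no n = no λ (lift p) → n p

  onPlane-≈P : ∀ {r r′} π → r ≈P r′ → r onPlane π → r′ onPlane π
  onPlane-≈P {r , _} {r′ , _} π (s , _ , h) (lift p) = lift (trans (dot-lin π {r} {r} {r′} {s} {0#} (λ i → trans (h i) (solve 2 (λ s r → s :* r := s :* r :+ :0 :* r) refl s (r i))))
    (trans (+-cong (*-0ʳ p) (zeroˡ _)) (+-identityʳ 0#)))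

  -- For d and f that are independent together with r, either d lies on π or some f + k d does; r is
  -- then joined to it.
  plane-line : ∀ r π → r onPlane π → ∃ λ L → r on L × lineOf π L
  plane-line r π (lift rπ) = go (dot π (proj₁ d) ≟ 0#)
    where
    nd = new-point (proj₁ r) (proj₁ r) (proj₁ r)
    d = proj₁ nd
    make : ∀ f → dot π (proj₁ f) ≈ 0# → ¬ (r ≈P f) → ∃ λ L → r on L × lineOf π L
    make f p n = join r f n , join-left r f n , λ x (s , t , fs , ft , h) → lift (trans (dot-lin π h) (trans (+-cong (*-0ʳ rπ) (*-0ʳ p)) (+-identityʳ 0#)))
    go : Dec (dot π (proj₁ d) ≈ 0#) → ∃ λ L → r on L × lineOf π L
    go (yes p) = make d p (λ e → proj₂ nd (Span₃-first r d (λ _ → refl) e))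
    go (no nz) = make (g , fg , λ z → out 0# F-0 (λ i → trans (z i) (sym (zeroˡ _)))) dot-g (λ (s , (fs , _) , h) → out s fs h)
      where
      nf = new-point (proj₁ r) (proj₁ d) (proj₁ d)
      f = proj₁ nf
      k₁ : Carrier
      k₁ = - (dot π (proj₁ f) * inv (dot π (proj₁ d)))
      fk : InF k₁
      fk = F-neg (F-* (dot-F π (proj₁ (proj₂ f))) (F-inv (dot-F π (proj₁ (proj₂ d)))))
      g : Vec4
      g i = 1# * proj₁ f i + k₁ * proj₁ d i
      fg : Vec-F g
      fg i = F-+ (F-* F-1 (proj₁ (proj₂ f) i)) (F-* fk (proj₁ (proj₂ d) i))
      dot-g : dot π g ≈ 0#
      dot-g = trans (dot-lin π {proj₁ f} {proj₁ d} {g} {1#} {k₁} (λ _ → refl)) (trans (solve 3 (λ a b i → :1 :* a :+ :- (a :* i) :* b := a :- a :* (b :* i)) refl (dot π (proj₁ f)) (dot π (proj₁ d)) (inv (dot π (proj₁ d))))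
        (trans (+-congˡ (-‿cong (trans (*-congˡ (inv-right nz)) (*-identityʳ _)))) (-‿inverseʳ _)))
      out : ∀ s → InF s → ¬ (∀ i → g i ≈ s * proj₁ r i)
      out s fs h = proj₂ nf (s , - k₁ , 0# , fs , F-neg fk , F-0 , λ i → trans (solve 3 (λ f k₁ d → f := (:1 :* f :+ k₁ :* d) :+ :- k₁ :* d :+ :0 :* d) refl (proj₁ f i) k₁ (proj₁ d i)) (+-congʳ (+-congʳ (h i))))

  line-meets-plane : ∀ π L → ¬ lineOf π L → HasCardMod _≈P_ (λ x → x onPlane π × x on L) 1
  line-meets-plane π L@((a , b) , ind) n = (x ∷ []) , ≡.refl , ((xπ , (B , - A , fB , F-neg fA , λ _ → refl)) ∷ []) , ([] ∷ []) ,
      λ y (lift yπ , (s , t , fs , ft , h)) → here (proportional y x fs ft fB (F-neg fA) h (λ _ → refl) (x-y≈0 (trans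
        (solve 4 (λ s t A B → s :* :- A :- B :* t := :- (s :* A :+ t :* B)) refl s t A B) (trans (-‿cong (trans (sym (dot-lin π h)) yπ)) -0#≈0#))))
    where
    A B : Carrier
    A = dot π (proj₁ a)
    B = dot π (proj₁ b)
    fA = dot-F π (proj₁ (proj₂ a))
    fB = dot-F π (proj₁ (proj₂ b))
    xv : Vec4
    xv i = B * proj₁ a i + - A * proj₁ b i
    x : Pt3
    x = xv , (λ i → F-+ (F-* fB (proj₁ (proj₂ a) i)) (F-* (F-neg fA) (proj₁ (proj₂ b) i))) , λ z →
      let (B0 , A0) = ind B (- A) fB (F-neg fA) z in
      n (λ y (s , t , fs , ft , h) → lift (trans (dot-lin π h) (trans (+-cong (*-0ʳ (trans (sym (-‿involutive A)) (trans (-‿cong A0) -0#≈0#))) (*-0ʳ B0)) (+-identityʳ 0#))))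
    xπ : x onPlane π
    xπ = lift (trans (dot-lin π {proj₁ a} {proj₁ b} {xv} {B} { - A} (λ _ → refl)) (solve 2 (λ A B → B :* A :+ :- A :* B := :0) refl A B))

  points-on-line : ∀ L → HasCardMod _≈P_ (λ x → x on L) (ℕ.suc q)
  points-on-line L@((a , b) , ind) = (b ∷ elems en) , ≡.cong ℕ.suc (≡.trans (proj₂ affine) Fₗ-size) ,
      (Span₂-right (proj₁ a) (proj₁ b) ∷ All.map (λ {x} (t , ft , h) → 1# , t , F-1 , ft , λ i → trans (h i) (+-congʳ (sym (*-identityˡ _)))) (sound en)) ,
      (All.map (λ {x} (t , ft , h) (s , (fs , _) , h′) → 1≉0 (proj₁ (ind 1# (t + - s) F-1 (F-+ ft (F-neg fs)) (λ i → trans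
         (solve 4 (λ a b t s → :1 :* a :+ (t :- s) :* b := (a :+ t :* b) :- s :* b) refl (proj₁ a i) (proj₁ b i) t s)
         (trans (+-cong (trans (sym (h i)) (h′ i)) refl) (-‿inverseʳ _)))))) (sound en) ∷ uniq en) ,
      comp
    where
    pt : ∀ t → InF t → Pt3
    pt t ft = (λ i → proj₁ a i + t * proj₁ b i) , (λ i → F-+ (proj₁ (proj₂ a) i) (F-* ft (proj₁ (proj₂ b) i))) ,
      λ z → 1≉0 (proj₁ (ind 1# t F-1 ft (λ i → trans (+-congʳ (*-identityˡ _)) (z i))))
    Aff : Pt3 → Set (c ⊔ ℓ)
    Aff x = ∃ λ t → InF t × (∀ i → proj₁ x i ≈ proj₁ a i + t * proj₁ b i)
    affine : Σ (Enum _≈P_ Aff) λ e′ → size e′ ≡ size Fₗ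
    affine = mapEnum {_≋_ = _≈P_} {P′ = Aff} Fₗ pt (λ t ft → t , ft , λ _ → refl) inj
      (λ x (t , ft , h) → t , ft , λ t′ ft′ p → 1# , (F-1 , 1≉0) , λ i → trans (+-congˡ (*-congʳ (sym p))) (trans (sym (h i)) (sym (*-identityˡ _))))
      where
      inj : ∀ t t′ ft ft′ → pt t ft ≈P pt t′ ft′ → t ≈ t′
      inj t t′ ft ft′ (s , (fs , _) , h) = sym (x-y≈0 (trans (+-congˡ (-‿cong (sym (trans (*-congʳ s≈1) (*-identityˡ t))))) (proj₂ rel)))
        where
        rel : (1# + - s ≈ 0#) × (t′ + - (s * t) ≈ 0#)
        rel = ind (1# + - s) (t′ + - (s * t)) (F-+ F-1 (F-neg fs)) (F-+ ft′ (F-neg (F-* fs ft))) (λ i → trans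
          (solve 5 (λ s t t′ a b → (:1 :- s) :* a :+ (t′ :- s :* t) :* b := (a :+ t′ :* b) :- s :* (a :+ t :* b)) refl s t t′ (proj₁ a i) (proj₁ b i))
          (trans (+-congʳ (h i)) (-‿inverseʳ _)))
        s≈1 : s ≈ 1#
        s≈1 = sym (x-y≈0 (proj₁ rel))
    en = proj₁ affine
    comp : ∀ x → x on L → Any (x ≈P_) (b ∷ elems en)
    comp x (s , t , fs , ft , h) = go (s ≟ 0#)
      where
      go : Dec (s ≈ 0#) → Any (x ≈P_) (b ∷ elems en)
      go (yes z) = here (proportional x b fs ft F-0 F-1 h (proj₂ (proj₂ (proj₂ (proj₂ (Span₂-right (proj₁ a) (proj₁ b)))))) (trans (*-identityʳ s) (trans z (sym (zeroˡ t)))))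
      go (no s≉0) = there (Any.map (λ {y} p → ≈P-trans {x} {pt k₁ fk} {y} x≈ p) (complete en (pt k₁ fk) (k₁ , fk , λ _ → refl)))
        where
        k₁ = inv s * t
        fk = F-* (F-inv fs) ft
        x≈ : x ≈P pt k₁ fk
        x≈ = proportional {proj₁ a} {proj₁ b} x (pt k₁ fk) fs ft F-1 fk h (λ i → +-congʳ (sym (*-identityˡ _))) (trans (inv-cancel t s≉0) (sym (*-identityˡ t)))

  -- The bilinear form of the quadric.

  T-linˡ : ∀ {s t} x y w → InF s → InF t → T ((s * x + t * y) * w) ≈ s * T (x * w) + t * T (y * w)
  T-linˡ {s} {t} x y w fs ft = trans (T-cong (solve 5 (λ s t x y w → (s :* x :+ t :* y) :* w := s :* (x :* w) :+ t :* (y :* w)) refl s t x y w))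
    (trans (T-+ _ _) (+-cong (T-scale _ fs) (T-scale _ ft)))

  T-linʳ : ∀ {s t} x y w → InF s → InF t → T (w * (s * x + t * y)) ≈ s * T (w * x) + t * T (w * y)
  T-linʳ x y w fs ft = trans (T-cong (*-comm _ _)) (trans (T-linˡ x y w fs ft) (+-cong (*-congˡ (T-cong (*-comm _ _))) (*-congˡ (T-cong (*-comm _ _)))))

  left right : QPt → Carrier
  left x = proj₁ (proj₁ x)
  right x = proj₂ (proj₁ x)

  singular : ∀ x → T (left x * right x) ≈ 0#
  singular x = proj₂ (proj₂ x)

  polarity : QPt → QPt → Carrier
  polarity x y = T (left x * right y) + T (left y * right x)

  Qf-comb : ∀ {s t} x y → InF s → InF t → Qf ((s · proj₁ x) ⊕ (t · proj₁ y)) ≈ s * t * polarity x y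
  Qf-comb {s} {t} x y fs ft = begin
    T ((s * left x + t * left y) * (s * right x + t * right y))
      ≈⟨ T-linˡ (left x) (left y) _ fs ft ⟩
    s * T (left x * (s * right x + t * right y)) + t * T (left y * (s * right x + t * right y))
      ≈⟨ +-cong (*-congˡ (T-linʳ (right x) (right y) (left x) fs ft)) (*-congˡ (T-linʳ (right x) (right y) (left y) fs ft)) ⟩
    s * (s * T (left x * right x) + t * T (left x * right y)) + t * (s * T (left y * right x) + t * T (left y * right y))
      ≈⟨ solve 6 (λ s t a b c d → s :* (s :* a :+ t :* b) :+ t :* (s :* c :+ t :* d) := s :* t :* (b :+ c) :+ (s :* s :* a :+ t :* t :* d)) refl s t _ _ _ _ ⟩
    s * t * polarity x y + (s * s * T (left x * right x) + t * t * T (left y * right y))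
      ≈⟨ trans (+-congˡ (trans (+-cong (*-0ʳ (singular x)) (*-0ʳ (singular y))) (+-identityʳ 0#))) (+-identityʳ _) ⟩
    s * t * polarity x y ∎

  collinear⇒polar : ∀ x y → Collinear x y → polarity x y ≈ 0#
  collinear⇒polar x y h = trans (sym (trans (*-congʳ (*-identityʳ 1#)) (*-identityˡ _))) (trans (sym (Qf-comb x y F-1 F-1)) (h 1# 1# F-1 F-1))

  polar⇒collinear : ∀ x y → polarity x y ≈ 0# → Collinear x y
  polar⇒collinear x y h s t fs ft = trans (Qf-comb x y fs ft) (*-0ʳ h)

  ∼-sym : ∀ {x y} → x ∼ y → y ∼ x
  ∼-sym {x} {y} (s , (fs , s≉0) , p , p′) = inv s , (F-inv fs , inv-nonzero s≉0) , undo p , undo p′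
    where
    undo : ∀ {a b} → b ≈ s * a → a ≈ inv s * b
    undo eq = sym (trans (*-congˡ eq) (trans (sym (*-assoc _ _ _)) (trans (*-congʳ (trans (*-comm _ _) (inv-right s≉0))) (*-identityˡ _))))

  ∼-trans : ∀ {x y z} → x ∼ y → y ∼ z → x ∼ z
  ∼-trans (s , (fs , s≉0) , p , p′) (t , (ft , t≉0) , r , r′) = t * s , (F-* ft fs , *-nonzero t≉0 s≉0) ,
    trans r (trans (*-congˡ p) (sym (*-assoc _ _ _))) , trans r′ (trans (*-congˡ p′) (sym (*-assoc _ _ _)))

  lpoint : ∀ u v → u ≉ 0# → T (u * v) ≈ 0# → QPt
  lpoint u v u≉0 h = (u , v) , (λ z → u≉0 (proj₁ z)) , h

  rpoint : ∀ v → v ≉ 0# → QPt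
  rpoint v v≉0 = (0# , v) , (λ z → v≉0 (proj₂ z)) , trans (T-cong (zeroˡ v)) T-0

  record Correspondence : Set (c ⊔ ℓ) where
    no-eta-equality
    field
      kl      : QPt → Ln3
      isKlein : IsKleinCorrespondence kl
      p       : Pt3
      p-star  : ∀ L → image kl InΠ₁ L ⇔ star p L
      π       : Pt3
      π-lines : ∀ L → image kl InΠ₂ L ⇔ lineOf π L

  -- The points of PG(3,q) as families of points of the quadric.

  module Klein (𝒦 : Correspondence) where

    open Correspondence 𝒦
    open IsKleinCorrespondence isKlein

    p-on : ∀ x → right x ≈ 0# → p on kl x
    p-on x z = Equivalence.to (p-star (kl x)) (x , z , ≈L-refl (kl x))

    on-p : ∀ x → p on kl x → right x ≈ 0#
    on-p x h = let (y , z , eq) = Equivalence.from (p-star (kl x)) h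
                   (s , _ , _ , eq′) = injective y x eq
               in trans eq′ (*-0ʳ z)

    π-in : ∀ x → left x ≈ 0# → lineOf π (kl x)
    π-in x z = Equivalence.to (π-lines (kl x)) (x , z , ≈L-refl (kl x))

    in-π : ∀ x → lineOf π (kl x) → left x ≈ 0#
    in-π x h = let (y , z , eq) = Equivalence.from (π-lines (kl x)) h
                   (s , _ , eq′ , _) = injective y x eq
               in trans eq′ (*-0ʳ z)

    lineOf-≈L : ∀ {L M} → L ≈L M → lineOf π L → lineOf π M
    lineOf-≈L h l r rM = l r (proj₂ (h r) rM)

    on-∼ : ∀ r {x y} → x ∼ y → r on kl x → r on kl y
    on-∼ r {x} {y} h = proj₁ (wellDefined x y h r)

    clique : ∀ r x y → r on kl x → r on kl y → polarity x y ≈ 0#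
    clique r x y hx hy = collinear⇒polar x y (meet⇒collinear x y (r , hx , hy))

    -- Otherwise some line through r would miss the line of z, although the two points are
    -- collinear. This turns incidence with r into a condition on the bilinear form.
    maximal : ∀ r z → (∀ y → r on kl y → polarity z y ≈ 0#) → r on kl z
    maximal r z h = go (on? r (kl z))
      where
      go : Dec (r on kl z) → r on kl z
      go (yes o) = o
      go (no n) = let (L , rL , av) = avoid r (kl z) n
                      (y , eq) = surjective L
                      (x , xz , xy) = collinear⇒meet z y (polar⇒collinear z y (h y (proj₂ (eq r) rL)))
                  in ⊥-elim (av x (proj₁ (eq x) xy) xz)

    polarity-comb : ∀ {s t} x y z w → InF s → InF t → left z ≈ s * left x + t * left y → right z ≈ s * right x + t * right y →
      polarity z w ≈ s * polarity x w + t * polarity y w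
    polarity-comb {s} {t} x y z w fs ft l r = trans (+-cong (trans (T-cong (*-congʳ l)) (T-linˡ (left x) (left y) (right w) fs ft))
        (trans (T-cong (*-congˡ r)) (T-linʳ (right x) (right y) (left w) fs ft)))
      (solve 6 (λ s t a b c d → s :* a :+ t :* b :+ (s :* c :+ t :* d) := s :* (a :+ c) :+ t :* (b :+ d)) refl s t _ _ _ _)

    -- The correspondence is only a bijection with an incidence property; `maximal` is what makes
    -- the lines through r a linear subspace of the quadric.
    comb : ∀ r {s t} x y z → InF s → InF t → left z ≈ s * left x + t * left y → right z ≈ s * right x + t * right y →
      r on kl x → r on kl y → r on kl z
    comb r x y z fs ft l r′ hx hy = maximal r z (λ w hw → trans (polarity-comb x y z w fs ft l r′)
      (trans (+-cong (*-0ʳ (clique r x w hx hw)) (*-0ʳ (clique r y w hy hw))) (+-identityʳ 0#)))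

    -- A line in π through p would correspond to a point with both coordinates 0.
    p∉π : ¬ (p onPlane π)
    p∉π h = let (L , pL , l) = plane-line p π h
                (x , eq) = surjective L
            in proj₁ (proj₂ x) (in-π x (lineOf-≈L {L} {kl x} (≈L-sym {kl x} {L} eq) l) , on-p x (proj₂ (eq p) pL))

    same : ∀ r r′ x y → ¬ (r ≈P r′) → r on kl x → r′ on kl x → r on kl y → r′ on kl y → x ∼ y
    same r r′ x y n a b c d = injective x y (line-unique r r′ (kl x) (kl y) n a b c d)

    -- w is the left coordinate of the point belonging to the line r p; its right coordinate is 0
    -- because the line passes through p.
    base-point : ∀ r → ¬ (r ≈P p) → ∃ λ w → Σ (w ≉ 0#) λ nz → (∀ h → r on kl (lpoint w 0# nz h)) ×
      (∀ x → right x ≈ 0# → r on kl x → ∃ λ s → InF s × left x ≈ s * w)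
    base-point r n = w , w≉0 , on-base , λ x z o → let (s , (fs , _) , l , _) = same r p x₀ x n x₀r x₀p o (p-on x z) in s , fs , l
      where
      L = join r p n
      x₀ = proj₁ (surjective L)
      eq = proj₂ (surjective L)
      x₀r : r on kl x₀
      x₀r = proj₂ (eq r) (join-left r p n)
      x₀p : p on kl x₀
      x₀p = proj₂ (eq p) (join-right r p n)
      w : Carrier
      w = left x₀
      v≈0 : right x₀ ≈ 0#
      v≈0 = on-p x₀ x₀p
      w≉0 : w ≉ 0#
      w≉0 z = proj₁ (proj₂ x₀) (z , v≈0)
      on-base : ∀ h → r on kl (lpoint w 0# w≉0 h)
      on-base h = on-∼ r {x₀} {lpoint w 0# w≉0 h} (1# , (F-1 , 1≉0) , sym (*-identityˡ w) , sym (trans (*-identityˡ _) v≈0)) x₀r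

    T-*0 : ∀ w → T (w * 0#) ≈ 0#
    T-*0 w = trans (T-cong (zeroʳ w)) T-0

    base-polarity : ∀ w nz h x → polarity (lpoint w 0# nz h) x ≈ T (w * right x)
    base-polarity w nz h x = trans (+-congˡ (T-*0 (left x))) (+-identityʳ _)

    -- The type of a point r on π: the line r p contributes (w, 0), and the lines of π through r
    -- contribute the (0, v) with v orthogonal to w.
    PlaneType : Pt3 → Carrier → Set (c ⊔ ℓ)
    PlaneType r w = w ≉ 0# × (∀ x → r on kl x → (∃ λ s → InF s × left x ≈ s * w) × T (w * right x) ≈ 0#) ×
      (∀ x → (∃ λ s → InF s × left x ≈ s * w) → T (w * right x) ≈ 0# → r on kl x)

    plane-type : ∀ r → r onPlane π → ∃ λ w → PlaneType r w
    plane-type r rπ = w , w≉0 , (λ x o → fst x o , T-right x o) , snd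
      where
      r≉p : ¬ (r ≈P p)
      r≉p h = p∉π (onPlane-≈P {r} {p} π h rπ)
      bp = base-point r r≉p
      w = proj₁ bp
      w≉0 = proj₁ (proj₂ bp)
      x₀ = lpoint w 0# w≉0 (T-*0 w)
      x₀r : r on kl x₀
      x₀r = proj₁ (proj₂ (proj₂ bp)) (T-*0 w)
      pl = plane-line r π rπ
      y₀ = proj₁ (surjective (proj₁ pl))
      eq = proj₂ (surjective (proj₁ pl))
      y₀r : r on kl y₀
      y₀r = proj₂ (eq r) (proj₁ (proj₂ pl))
      u₀≈0 : left y₀ ≈ 0#
      u₀≈0 = in-π y₀ (lineOf-≈L {proj₁ pl} {kl y₀} (≈L-sym {kl y₀} {proj₁ pl} eq) (proj₂ (proj₂ pl)))
      v₀≉0 : right y₀ ≉ 0#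
      v₀≉0 z = proj₁ (proj₂ y₀) (u₀≈0 , z)
      T-right : ∀ x → r on kl x → T (w * right x) ≈ 0#
      T-right x o = trans (sym (base-polarity w w≉0 (T-*0 w) x)) (clique r x₀ x x₀r o)
      T-left : ∀ x → r on kl x → T (left x * right y₀) ≈ 0#
      T-left x o = trans (sym (trans (+-congˡ (trans (T-cong (*-0ˡ u₀≈0)) T-0)) (+-identityʳ _))) (clique r x y₀ o y₀r)
      fst : ∀ x → r on kl x → ∃ λ s → InF s × left x ≈ s * w
      fst x o = go (cross (left x) w ≟ 0#)
        where
        go : Dec (cross (left x) w ≈ 0#) → ∃ λ s → InF s × left x ≈ s * w
        go (yes z) = cross-zero z w≉0
        -- Both right coordinates are then multiples of the same cross product. Subtracting a
        -- multiple of y₀ clears that of x and leaves a line through r and p, which has to be the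
        -- base line.
        go (no C≉0) =
          let (s , fs , v₀≈) = perp C≉0 (T-left x o) (T-right y₀ y₀r)
              (t , ft , v≈) = perp C≉0 (singular x) (T-right x o)
              s≉0 = λ z → v₀≉0 (trans v₀≈ (*-0ˡ z))
              u≉0 = λ z → C≉0 (trans (cross-cong z refl) (trans (+-cong (*-0ˡ φ-0) (-‿cong (*-0ˡ (trans (φ-cong φ-0) φ-0)))) (-‿inverseʳ 0#)))
              z = lpoint (left x) 0# u≉0 (T-*0 (left x))
          in proj₂ (proj₂ (proj₂ bp)) z refl (comb r {1#} { - (t * inv s)} x y₀ z F-1 (F-neg (F-* ft (F-inv fs)))
               (sym (trans (+-cong (*-identityˡ _) (*-0ʳ u₀≈0)) (+-identityʳ _)))
               (sym (trans (+-cong (trans (*-identityˡ _) v≈) (*-congˡ v₀≈)) (trans (solve 4 (λ t i s C → t :* C :+ :- (t :* i) :* (s :* C) := t :* C :- (s :* i) :* (t :* C)) refl t (inv s) s _)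
                 (trans (+-congˡ (-‿cong (trans (*-congʳ (inv-right s≉0)) (*-identityˡ _)))) (-‿inverseʳ _))))) o y₀r)
      snd : ∀ x → (∃ λ s → InF s × left x ≈ s * w) → T (w * right x) ≈ 0# → r on kl x
      snd x (s , fs , l) h = maximal r x (λ y o → let (t , ft , l′) = fst y o in
        trans (+-cong (trans (T-cong (trans (*-congʳ l) (*-assoc _ _ _))) (trans (T-scale _ fs) (*-0ʳ (T-right y o))))
          (trans (T-cong (trans (*-congʳ l′) (*-assoc _ _ _))) (trans (T-scale _ ft) (*-0ʳ h)))) (+-identityʳ 0#))

    -- Off π and away from p, the lines through r form the graph of u ↦ cross w u.
    Type : Pt3 → Carrier → Set (c ⊔ ℓ)
    Type r w = w ≉ 0# × (∀ x → r on kl x → right x ≈ cross w (left x)) × (∀ x → right x ≈ cross w (left x) → r on kl x)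

    off-plane : ∀ r → ¬ (r onPlane π) → ∀ x → r on kl x → left x ≉ 0#
    off-plane r n x o z = n (π-in x z r o)

    -- Take three independent lines through r, the first of them through p. A suitable multiple w of
    -- the base vector makes the second right coordinate a cross product with w; orthogonality to
    -- the second line then gives the third the same scale, and these three lines determine the
    -- rest.
    affine-type : ∀ r → ¬ (r ≈P p) → ¬ (r onPlane π) → ∃ λ w → Type r w
    affine-type r r≉p r∉π = w , w≉0 , fst , snd
      where
      open Tripod (tripod r p r≉p)
      bp = base-point r r≉p
      w₀ = proj₁ bp
      w₀≉0 = proj₁ (proj₂ bp)
      y₀ = lpoint w₀ 0# w₀≉0 (T-*0 w₀)
      y₀r : r on kl y₀
      y₀r = proj₁ (proj₂ (proj₂ bp)) (T-*0 w₀)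
      sL₁ = surjective L₁
      sL₂ = surjective L₂
      sM = surjective M
      y₁ = proj₁ sL₁
      y₂ = proj₁ sL₂
      m = proj₁ sM
      y₁r : r on kl y₁
      y₁r = proj₂ (proj₂ sL₁ r) r₁
      y₂r : r on kl y₂
      y₂r = proj₂ (proj₂ sL₂ r) r₂
      y₀L : kl y₀ ≈L L₀
      y₀L = line-unique r p (kl y₀) L₀ r≉p y₀r (p-on y₀ refl) r₀ p₀
      m₀ : polarity m y₀ ≈ 0#
      m₀ = collinear⇒polar m y₀ (meet⇒collinear m y₀ (x₀ , proj₂ (proj₂ sM x₀) x₀M , proj₂ (y₀L x₀) x₀L))
      m₁′ : polarity m y₁ ≈ 0#
      m₁′ = collinear⇒polar m y₁ (meet⇒collinear m y₁ (x₁ , proj₂ (proj₂ sM x₁) x₁M , proj₂ (proj₂ sL₁ x₁) x₁L))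
      m₂ : polarity m y₂ ≉ 0#
      m₂ z = let (x , xm , xy) = collinear⇒meet m y₂ (polar⇒collinear m y₂ z) in M₂ x (proj₁ (proj₂ sL₂ x) xy) (proj₁ (proj₂ sM x) xm)
      no-right : ∀ z → z ≉ 0# → ¬ (∀ (nz : z ≉ 0#) → r on kl (rpoint z nz))
      no-right z nz h = off-plane r r∉π (rpoint z nz) (h nz) refl
      u₁ v₁ u₂ v₂ : Carrier
      u₁ = left y₁
      v₁ = right y₁
      u₂ = left y₂
      v₂ = right y₂
      T-w₀ : ∀ x → r on kl x → T (w₀ * right x) ≈ 0#
      T-w₀ x o = trans (sym (base-polarity w₀ w₀≉0 (T-*0 w₀) x)) (clique r y₀ x y₀r o)
      v₁≉0 : v₁ ≉ 0#
      v₁≉0 z = p₁ (proj₁ (proj₂ sL₁ p) (p-on y₁ z))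
      -- If u₁ were a multiple of w₀, subtracting that multiple of y₀ from y₁ would leave a point
      -- with left coordinate 0, that is a line of π through r.
      C₁≉0 : cross w₀ u₁ ≉ 0#
      C₁≉0 z = let (s , fs , eq) = cross-zero {u₁} {w₀} (trans (cross-neg w₀ u₁) (trans (-‿cong z) -0#≈0#)) w₀≉0 in
        no-right v₁ v₁≉0 (λ nz → comb r {1#} { - s} y₁ y₀ (rpoint v₁ nz) F-1 (F-neg fs)
          (sym (trans (+-cong (trans (*-identityˡ _) eq) refl) (solve 2 (λ s w → s :* w :+ :- s :* w := :0) refl s w₀)))
          (sym (trans (+-cong (*-identityˡ _) (zeroʳ _)) (+-identityʳ _))) y₁r y₀r)
      c₁-data = perp C₁≉0 (T-w₀ y₁ y₁r) (singular y₁)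
      c₁ : Carrier
      c₁ = proj₁ c₁-data
      fc₁ = proj₁ (proj₂ c₁-data)
      w : Carrier
      w = c₁ * w₀
      w≉0 : w ≉ 0#
      w≉0 = *-nonzero (λ z → v₁≉0 (trans (proj₂ (proj₂ c₁-data)) (*-0ˡ z))) w₀≉0
      C₁ C₂ : Carrier
      C₁ = cross w u₁
      C₂ = cross w u₂
      v₁≈ : v₁ ≈ C₁
      v₁≈ = trans (proj₂ (proj₂ c₁-data)) (sym (cross-scaleˡ w₀ u₁ fc₁))
      C₁′≉0 : C₁ ≉ 0#
      C₁′≉0 z = v₁≉0 (trans v₁≈ z)
      y : QPt
      y = lpoint w 0# w≉0 (T-*0 w)
      yr : r on kl y
      yr = on-∼ r {y₀} {y} (c₁ , (fc₁ , λ z → w≉0 (*-0ˡ z)) , refl , sym (zeroʳ _)) y₀r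
      my : polarity m y ≈ 0#
      my = trans (+-cong (T-*0 (left m)) (trans (T-cong (*-assoc _ _ _)) (T-scale _ fc₁)))
        (trans (+-identityˡ _) (*-0ʳ (trans (sym (trans (+-congʳ (T-*0 (left m))) (+-identityˡ _))) m₀)))
      T-w : ∀ x → r on kl x → T (w * right x) ≈ 0#
      T-w x o = trans (sym (base-polarity w w≉0 (T-*0 w) x)) (clique r y x yr o)
      polarity-sym : ∀ a b → polarity a b ≈ polarity b a
      polarity-sym a b = +-comm _ _
      -- m is orthogonal to y₁ and to y, but not to y₂.
      not-comb : ∀ {s t} → InF s → InF t → ¬ (u₂ ≈ s * u₁ + t * w × v₂ ≈ s * v₁ + t * 0#)
      not-comb {s} {t} fs ft (l , l′) = m₂ (trans (polarity-sym m y₂) (trans (polarity-comb y₁ y y₂ m fs ft l l′)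
        (trans (+-cong (*-0ʳ (trans (polarity-sym y₁ m) m₁′)) (*-0ʳ (trans (polarity-sym y m) my))) (+-identityʳ 0#))))
      C₂≉0 : C₂ ≉ 0#
      C₂≉0 z = go (v₂ ≟ 0#)
        where
        ratio = cross-zero {u₂} {w} (trans (cross-neg w u₂) (trans (-‿cong z) -0#≈0#)) w≉0
        s = proj₁ ratio
        fs = proj₁ (proj₂ ratio)
        l = proj₂ (proj₂ ratio)
        go : Dec (v₂ ≈ 0#) → ⊥
        go (yes v₂≈0) = not-comb F-0 fs (trans l (sym (trans (+-congʳ (zeroˡ _)) (+-identityˡ _))) , trans v₂≈0 (sym (trans (+-cong (zeroˡ _) (zeroʳ _)) (+-identityʳ 0#))))
        go (no v₂≉0) = no-right v₂ v₂≉0 (λ nz → comb r {1#} { - s} y₂ y (rpoint v₂ nz) F-1 (F-neg fs)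
          (sym (trans (+-cong (trans (*-identityˡ _) l) refl) (solve 2 (λ s w → s :* w :+ :- s :* w := :0) refl s w)))
          (sym (trans (+-cong (*-identityˡ _) (zeroʳ _)) (+-identityʳ _))) y₂r yr)
      c₂-data = perp C₂≉0 (T-w y₂ y₂r) (singular y₂)
      c₂ : Carrier
      c₂ = proj₁ c₂-data
      fc₂ = proj₁ (proj₂ c₂-data)
      v₂≈ : v₂ ≈ c₂ * C₂
      v₂≈ = proj₂ (proj₂ c₂-data)
      E₁₂ : Carrier
      E₁₂ = T (u₁ * C₂)
      E₂₁ : T (u₂ * C₁) ≈ - E₁₂
      E₂₁ = +-inverseˡ-unique _ _ (trans (+-comm _ _) (T-cross-swap u₁ w u₂))
      -- If `E₁₂` = 0, then u₂ is a combination of u₁ and w. Either y₂ is the same combination of y₁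
      -- and y, or the difference is a line of π through r.
      E≉0 : E₁₂ ≉ 0#
      E≉0 z = conclude (k₁ ≟ 0#)
        where
        parallel = perp C₁′≉0 (T-cross-left w u₂) z
        s = proj₁ parallel
        fs = proj₁ (proj₂ parallel)
        C₂≈ : C₂ ≈ s * C₁
        C₂≈ = proj₂ (proj₂ parallel)
        residual : cross w (1# * u₂ + - s * u₁) ≈ 0#
        residual = trans (cross-+ʳ w _ _) (trans (+-cong (cross-scaleʳ w u₂ F-1) (cross-scaleʳ w u₁ (F-neg fs)))
          (trans (+-congʳ (*-congˡ C₂≈)) (solve 2 (λ s C → :1 :* (s :* C) :+ :- s :* C := :0) refl s C₁)))
        rest = cross-zero {1# * u₂ + - s * u₁} {w} (trans (cross-neg w _) (trans (-‿cong residual) -0#≈0#)) w≉0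
        t = proj₁ rest
        ft = proj₁ (proj₂ rest)
        u₂≈ : u₂ ≈ s * u₁ + t * w
        u₂≈ = trans (solve 3 (λ a s b → a := s :* b :+ (:1 :* a :+ :- s :* b)) refl u₂ s u₁) (+-congˡ (proj₂ (proj₂ rest)))
        k₁ : Carrier
        k₁ = (c₂ + - 1#) * s
        conclude : Dec (k₁ ≈ 0#) → ⊥
        conclude (yes k≈0) = not-comb fs ft (u₂≈ , trans v₂≈ (trans (*-congˡ C₂≈) (x-y≈0 (trans
          (+-congˡ (-‿cong (+-congʳ (*-congˡ v₁≈)))) (trans (solve 4 (λ c s C t → c :* (s :* C) :- (s :* C :+ t :* :0) := (c :- :1) :* s :* C) refl c₂ s C₁ t) (*-0ˡ k≈0))))))
        conclude (no k≉0) = no-right (k₁ * C₁) (*-nonzero k≉0 C₁′≉0) (λ nz →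
          comb r {1#} { - 1#} y₂ z₁ (rpoint (k₁ * C₁) nz) F-1 (F-neg F-1)
            (sym (trans (+-cong (trans (*-identityˡ _) u₂≈) refl) (solve 1 (λ x → x :+ :- :1 :* x := :0) refl _)))
            (sym (trans (+-cong (*-congˡ (trans v₂≈ (*-congˡ C₂≈))) refl)
              (solve 3 (λ c s C → :1 :* (c :* (s :* C)) :+ :- :1 :* (s :* C) := (c :- :1) :* s :* C) refl c₂ s C₁)))
            y₂r (comb r {s} {t} y₁ y z₁ fs ft refl (trans (sym (+-identityʳ _)) (+-cong (*-congˡ (sym v₁≈)) (sym (zeroʳ t)))) y₁r yr))
          where
          z₁ : QPt
          z₁ = (s * u₁ + t * w , s * C₁) , (λ (a , b) → off-plane r r∉π y₂ y₂r (trans u₂≈ a)) ,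
            trans (T-cong (*-comm _ _)) (trans (T-linʳ u₁ w _ fs ft) (trans (+-cong (*-0ʳ (trans (T-cong (*-assoc _ _ _)) (trans (T-scale _ fs) (*-0ʳ (trans (T-cong (*-comm _ _)) (T-cross-right w u₁))))))
              (*-0ʳ (trans (T-cong (*-assoc _ _ _)) (trans (T-scale _ fs) (*-0ʳ (trans (T-cong (*-comm _ _)) (T-cross-left w u₁))))))) (+-identityʳ 0#)))
      -- Orthogonality of y₁ and y₂ reads (c₂ - 1) `E₁₂` = 0.
      c₂≈1 : c₂ ≈ 1#
      c₂≈1 = x-y≈0 (domain (trans (solve 2 (λ E c → E :* (c :- :1) := c :* E :- E) refl E₁₂ c₂)
        (trans (sym (+-cong (trans (T-cong (trans (*-congˡ v₂≈) (solve 3 (λ a b c → a :* (b :* c) := b :* (a :* c)) refl u₁ c₂ C₂))) (T-scale _ fc₂)) (trans (T-cong (*-congˡ v₁≈)) E₂₁)))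
          (clique r y₁ y₂ y₁r y₂r))) E≉0)
      v₂≈C₂ : v₂ ≈ C₂
      v₂≈C₂ = trans v₂≈ (trans (*-congʳ c₂≈1) (*-identityˡ C₂))
      fst : ∀ x → r on kl x → right x ≈ cross w (left x)
      fst x o = x-y≈0 (trans (proj₂ (proj₂ dd)) (*-0ˡ s≈0))
        where
        -- The deviation D is orthogonal to w, u₁ and u₂. The first two make it a multiple of C₁,
        -- and `E₁₂` ≠ 0 makes that multiple 0.
        D : Carrier
        D = right x + - cross w (left x)
        T-D : ∀ a → T (a * D) ≈ T (a * right x) + - T (a * cross w (left x))
        T-D a = trans (T-cong (solve 3 (λ a v C → a :* (v :- C) := a :* (:1 :* v :+ :- :1 :* C)) refl a (right x) (cross w (left x))))
          (trans (T-linʳ (right x) (cross w (left x)) a F-1 (F-neg F-1)) (solve 2 (λ a b → :1 :* a :+ :- :1 :* b := a :- b) refl _ _))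
        Dw : T (w * D) ≈ 0#
        Dw = trans (T-D w) (trans (+-cong (T-w x o) (-‿cong (T-cross-left w (left x)))) (-‿inverseʳ 0#))
        D-at : ∀ b → r on kl b → right b ≈ cross w (left b) → T (left b * D) ≈ 0#
        D-at b ob vb = trans (T-D (left b)) (trans (+-congˡ (trans (sym (+-inverseˡ-unique _ _ (trans (+-comm _ _) (T-cross-swap (left b) w (left x))))) (T-cong (*-congˡ (sym vb))))) (clique r b x ob o))
        dd = perp C₁′≉0 Dw (D-at y₁ y₁r v₁≈)
        s≈0 : proj₁ dd ≈ 0#
        s≈0 = domain (begin
          E₁₂ * proj₁ dd              ≈⟨ trans (*-comm _ _) (sym (trans (*-congˡ (trans (-‿cong E₂₁) (-‿involutive E₁₂))) refl)) ⟩
          proj₁ dd * - T (u₂ * C₁)    ≈⟨ solve 2 (λ s t → s :* :- t := :- (s :* t)) refl (proj₁ dd) _ ⟩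
          - (proj₁ dd * T (u₂ * C₁))  ≈⟨ -‿cong (sym (trans (T-cong (trans (*-congˡ (proj₂ (proj₂ dd))) (solve 3 (λ a b c → a :* (b :* c) := b :* (a :* c)) refl u₂ (proj₁ dd) C₁))) (T-scale _ (proj₁ (proj₂ dd))))) ⟩
          - T (u₂ * D)                ≈⟨ trans (-‿cong (D-at y₂ y₂r v₂≈C₂)) -0#≈0# ⟩
          0# ∎) E≉0
      snd : ∀ x → right x ≈ cross w (left x) → r on kl x
      snd x h = maximal r x (λ z o → trans (+-cong (T-cong (*-congˡ (fst z o))) (T-cong (*-congˡ h))) (T-cross-swap (left x) w (left z)))

    cross-0 : ∀ {w} u → w ≈ 0# → cross w u ≈ 0#
    cross-0 u z = trans (+-cong (*-0ˡ (trans (φ-cong z) φ-0)) (-‿cong (*-0ˡ (trans (φ-cong (trans (φ-cong z) φ-0)) φ-0)))) (-‿inverseʳ 0#)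

    cross-0ʳ : ∀ w {u} → u ≈ 0# → cross w u ≈ 0#
    cross-0ʳ w {u} z = trans (cross-neg u w) (trans (-‿cong (cross-0 w z)) -0#≈0#)

    graph : ∀ w u → u ≉ 0# → QPt
    graph w u u≉0 = lpoint u (cross w u) u≉0 (T-cross-right w u)

    -- α is not in F, so w and w α are independent. The argument w α thus detects the scale of w in
    -- what follows.
    α-cross : ∀ {w} → w ≉ 0# → cross w (w * α) ≉ 0#
    α-cross {w} w≉0 z = let (s , fs , eq) = cross-zero {w * α} {w} (trans (cross-neg w _) (trans (-‿cong z) -0#≈0#)) w≉0 in
      α∉F (F-cong (cancel-nonzero w≉0 (trans (*-comm w s) (sym eq))) fs)

    type-not-p : ∀ {r w} → Type r w → ¬ (r ≈P p)
    type-not-p {r} {w} (w≉0 , to , from) e = α-cross w≉0 (on-p x (on-≈P {r} {p} (kl x) e (from x refl)))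
      where
      x = graph w (w * α) (*-nonzero w≉0 α≉0)

    type-not-π : ∀ {r w} → Type r w → ¬ (r onPlane π)
    type-not-π {r} {w} (w≉0 , to , from) h = proj₁ (proj₂ x) (in-π x (lineOf-≈L {proj₁ pl} {kl x} (≈L-sym {kl x} {proj₁ pl} eq) (proj₂ (proj₂ pl))) ,
        trans (to x (proj₂ (eq r) (proj₁ (proj₂ pl)))) (cross-0ʳ w (in-π x (lineOf-≈L {proj₁ pl} {kl x} (≈L-sym {kl x} {proj₁ pl} eq) (proj₂ (proj₂ pl))))))
      where
      pl = plane-line r π h
      x = proj₁ (surjective (proj₁ pl))
      eq = proj₂ (surjective (proj₁ pl))

    -- The lines of (w, 0) and (w α, w × w α) meet. Their common point is neither p nor on π, so it
    -- has a type, and the two lines force that type to be w.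
    type-exists : ∀ w → w ≉ 0# → ∃ λ r → Type r w
    type-exists w w≉0 = r , w≉0 , (λ x o → trans (to x o) (cross-cong w′≈w refl)) , (λ x h → from x (trans h (cross-cong (sym w′≈w) refl)))
      where
      u₁ : Carrier
      u₁ = w * α
      x₀ x₁ : QPt
      x₀ = lpoint w 0# w≉0 (T-*0 w)
      x₁ = graph w u₁ (*-nonzero w≉0 α≉0)
      met = collinear⇒meet x₀ x₁ (polar⇒collinear x₀ x₁ (trans (+-cong (T-cross-left w u₁) (T-*0 u₁)) (+-identityʳ 0#)))
      r = proj₁ met
      r₀ : r on kl x₀
      r₀ = proj₁ (proj₂ met)
      r₁ : r on kl x₁
      r₁ = proj₂ (proj₂ met)
      r≉p : ¬ (r ≈P p)
      r≉p e = α-cross w≉0 (on-p x₁ (on-≈P {r} {p} (kl x₁) e r₁))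
      r∉π : ¬ (r onPlane π)
      r∉π h = let (w″ , nz , to , _) = plane-type r h
                  (s , fs , eq) = proj₁ (to x₀ r₀)
                  (t , ft , eq′) = proj₁ (to x₁ r₁)
              in α-cross w≉0 (trans (cross-cong eq eq′) (trans (cross-scaleˡ w″ _ fs) (*-0ʳ (trans (cross-scaleʳ w″ w″ ft) (*-0ʳ (cross-self w″))))))
      ty = affine-type r r≉p r∉π
      w′ = proj₁ ty
      to = proj₁ (proj₂ (proj₂ ty))
      from = proj₂ (proj₂ (proj₂ ty))
      ratio = cross-zero {w′} {w} (sym (to x₀ r₀)) w≉0
      w′≈w : w′ ≈ w
      w′≈w = trans (proj₂ (proj₂ ratio)) (trans (*-congʳ (cancel-nonzero (α-cross w≉0) (trans (*-comm _ _) (trans (sym (trans (to x₁ r₁)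
        (trans (cross-cong (proj₂ (proj₂ ratio)) refl) (cross-scaleˡ w u₁ (proj₁ (proj₂ ratio)))))) (sym (*-identityʳ _)))))) (*-identityˡ w))

    -- Two different points of the same type would have two different lines in common.
    type-unique : ∀ {r r′ w w′} → Type r w → Type r′ w′ → w ≈ w′ → r ≈P r′
    type-unique {r} {r′} {w} {w′} (w≉0 , to , from) (w′≉0 , to′ , from′) e = go (≈P? r r′)
      where
      x₀ x₁ : QPt
      x₀ = graph w w w≉0
      x₁ = graph w (w * α) (*-nonzero w≉0 α≉0)
      go : Dec (r ≈P r′) → r ≈P r′
      go (yes q) = q
      go (no n) = let (s , _ , _ , eq) = same r r′ x₀ x₁ n (from x₀ refl) (from′ x₀ (cross-cong e refl)) (from x₁ refl) (from′ x₁ (cross-cong e refl))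
                  in ⊥-elim (α-cross w≉0 (trans eq (*-0ʳ (cross-self w))))

    type-injective : ∀ {r r′ w w′} → Type r w → Type r′ w′ → r ≈P r′ → w ≈ w′
    type-injective {r} {r′} {w} {w′} (w≉0 , to , from) (w′≉0 , to′ , from′) e =
      let x₀ = graph w w w≉0
          x₁ = graph w (w * α) (*-nonzero w≉0 α≉0)
          at₀ = to′ x₀ (on-≈P {r} {r′} (kl x₀) e (from x₀ refl))
          at₁ = to′ x₁ (on-≈P {r} {r′} (kl x₁) e (from x₁ refl))
          (s , fs , w′≈) = cross-zero {w′} {w} (trans (sym at₀) (cross-self w)) w≉0
      in sym (trans w′≈ (trans (*-congʳ (cancel-nonzero (α-cross w≉0) (trans (*-comm _ _) (trans (sym (trans at₁ (trans (cross-cong w′≈ refl) (cross-scaleˡ w _ fs)))) (sym (*-identityʳ _)))))) (*-identityˡ w)))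

    data Kind (r : Pt3) : Set (c ⊔ ℓ) where
      centre : r ≈P p → Kind r
      plane : r onPlane π → Kind r
      affine : ∀ w → Type r w → Kind r

    kind : ∀ r → Kind r
    kind r = go (≈P? r p) (onPlane? r π)
      where
      go : Dec (r ≈P p) → Dec (r onPlane π) → Kind r
      go (yes e) _ = centre e
      go (no _) (yes h) = plane h
      go (no n) (no n′) = let (w , t) = affine-type r n n′ in affine w t

  Q : ℕ
  Q = 3 ℕ.^ e

  Q*Q : Q ℕ.* Q ≡ q
  Q*Q = ℤₚ.+-injective (≡.trans (ℤₚ.pos-* Q Q) Q₀²)

  -- Makes the truncated subtraction in `k₋` agree with the one in ℤ.
  Q≤q : Q ℕ.≤ q
  Q≤q = go Q ≡.refl
    where
    go : ∀ j → j ≡ Q → Q ℕ.≤ q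
    go ℕ.zero z = ≡.subst (ℕ._≤ q) z ℕ.z≤n
    go (ℕ.suc j) z = ≡.subst (Q ℕ.≤_) Q*Q (ℕₚ.m≤m*n Q Q {{≡.subst ℕ.NonZero z _}})

  q-Q : qℤ ℤ.- Q₀ ≡ ℤ.+ (q ℕ.∸ Q)
  q-Q = ≡.trans (ℤₚ.m-n≡m⊖n q Q) (ℤₚ.⊖-≥ Q≤q)

  q+1ℤ : qℤ ℤ.+ 1ℤ ≡ ℤ.+ (q ℕ.+ 1)
  q+1ℤ = ≡.sym (ℤₚ.pos-+ q 1)

  -- Q² = q is neither 0 nor 1.
  Q₀-not : ∀ {x} → x ℤ.* x ≡ 0ℤ ⊎ x ℤ.* x ≡ 1ℤ → Q₀ ≢ x
  Q₀-not (inj₁ z) ≡.refl = qℤ≢0 (≡.trans (≡.sym Q₀²) z)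
  Q₀-not (inj₂ o) ≡.refl = ℕₚ.<-irrefl (ℤₚ.+-injective (≡.trans (≡.sym o) Q₀²)) 1<q

  k₋ k₊ : ℕ
  k₋ = ((q ℕ.+ 1) ℕ.* (q ℕ.∸ Q)) ℕ./ 2
  k₊ = ((q ℕ.+ 1) ℕ.* (q ℕ.+ Q)) ℕ./ 2

  module Configuration (a₁ : Carrier) (Sa₁ : InS a₁) (𝒦 : Correspondence) where

    open Signs a₁ Sa₁
    open Correspondence 𝒦
    open Klein 𝒦
    open IsKleinCorrespondence isKlein

    -- The classes of lines.

    -- 𝓛₁ for s = 1 and 𝓛₂ for s = -1. Requiring norm 1 on the left makes the vector representing a
    -- point unique, so that G can be evaluated on it.
    𝓣 : ℤ → Ln3 → Set (c ⊔ ℓ)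
    𝓣 s L = ∃ λ x → N (left x) ≈ 1# × G (left x * right x) ≡ s × kl x ≈L L

    normalize : ∀ x → left x ≉ 0# → ∃ λ x′ → N (left x′) ≈ 1# × x ∼ x′
    normalize x u≉0 = ((unit , inv radius * right x) , (λ (z , _) → N1≉0 unit-N z) ,
        trans (T-cong (trans (*-comm _ _) (*-assoc _ _ _))) (trans (T-scale _ (F-inv radius-F)) (*-0ʳ (domain (trans (sym (T-scale _ radius-F))
          (trans (T-cong (trans (solve 3 (λ r v u → r :* (v :* u) := r :* u :* v) refl radius (right x) unit) (*-congʳ (sym y≈)))) (singular x))) radius≉0)))) ,
        unit-N , inv radius , (F-inv radius-F , inv-nonzero radius≉0) ,
        sym (trans (*-congˡ y≈) (trans (sym (*-assoc _ _ _)) (trans (*-congʳ (trans (*-comm _ _) (inv-right radius≉0))) (*-identityˡ _)))) , refl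
      where open Polar (polar-form u≉0)

    T₁-left : ∀ x → InT₁ x → left x ≉ 0#
    T₁-left x (a , inj₁ (_ , inj₁ (i , j , s , (fs , s≉0) , u≈ , _))) z = *-nonzero s≉0 (*-nonzero (N1≉0 (N-μ^ i)) 1≉0) (trans (sym u≈) z)
    T₁-left x (a , inj₁ (_ , inj₂ (i , j , s , (fs , s≉0) , u≈ , _))) z = *-nonzero s≉0 (*-nonzero (N1≉0 (N-μ^ i)) 1≉0) (trans (sym u≈) z)
    T₁-left x (a , inj₂ (_ , inj₁ (i , j , s , (fs , s≉0) , u≈ , _))) z = *-nonzero s≉0 (*-nonzero (N1≉0 (N-μ^ i)) 1≉0) (trans (sym u≈) z)
    T₁-left x (a , inj₂ (_ , inj₂ (i , j , s , (fs , s≉0) , u≈ , _))) z = *-nonzero s≉0 (*-nonzero (N1≉0 (N-μ^ i)) 1≉0) (trans (sym u≈) z)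

    T₁→𝓣 : ∀ L → image kl InT₁ L → 𝓣 1ℤ L
    T₁→𝓣 L (x , t , eq) = let (x′ , Nx , x∼) = normalize x (T₁-left x t) in
      x′ , Nx , T₁-G {left x′} {right x′} {proj₂ x′} Nx (T₁-∼ {x} {x′} x∼ t) ,
      ≈L-trans {kl x′} {kl x} {L} (≈L-sym {kl x} {kl x′} (wellDefined x x′ x∼)) eq

    𝓣→T₁ : ∀ L → 𝓣 1ℤ L → image kl InT₁ L
    𝓣→T₁ L (x , Nx , g , eq) = x , G-T₁ {left x} {right x} {proj₂ x} Nx g , eq

    T₂→𝓣 : ∀ L → image kl InT₂ L → 𝓣 -1ℤ L
    T₂→𝓣 L (x , (v≉0 , u≉0 , nt) , eq) = x′ , Nx , [ (λ g → ⊥-elim (nt (T₁-∼ {x′} {x} (∼-sym {x} {x′} x∼) (G-T₁ {left x′} {right x′} {proj₂ x′} Nx g)))) , (λ g → g) ]′ (G-±1 (*-nonzero (N1≉0 Nx) v′≉0) (singular x′)) ,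
        ≈L-trans {kl x′} {kl x} {L} (≈L-sym {kl x} {kl x′} (wellDefined x x′ x∼)) eq
      where
      nm = normalize x u≉0
      x′ = proj₁ nm
      Nx = proj₁ (proj₂ nm)
      x∼ = proj₂ (proj₂ nm)
      v′≉0 : right x′ ≉ 0#
      v′≉0 z = let (s , _ , _ , eq) = ∼-sym {x} {x′} x∼ in v≉0 (trans eq (*-0ʳ z))

    𝓣-right : ∀ {x s} → s ≡ 1ℤ ⊎ s ≡ -1ℤ → G (left x * right x) ≡ s → right x ≉ 0#
    𝓣-right s± g z = ±1≢0 s± (≡.trans (≡.sym g) (G-0 (*-0ʳ z)))

    𝓣→T₂ : ∀ L → 𝓣 -1ℤ L → image kl InT₂ L
    𝓣→T₂ L (x , Nx , g , eq) = x , (𝓣-right {x} (inj₂ ≡.refl) g , N1≉0 Nx , λ t → 1≢-1 (≡.trans (≡.sym (T₁-G {left x} {right x} {proj₂ x} Nx t)) g)) , eq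

    LC : Fin 4 → Ln3 → Set (c ⊔ ℓ)
    LC = fourClasses (star p) (lineOf π) (image kl InT₁) (image kl InT₂)

    -- The four classes with points of the quadric as witnesses, which is the form in which lines
    -- are compared and counted.
    data LineKind (L : Ln3) : Fin 4 → Set (c ⊔ ℓ) where
      k0 : ∀ x → kl x ≈L L → right x ≈ 0# → LineKind L F.zero
      k1 : ∀ x → kl x ≈L L → left x ≈ 0# → LineKind L (F.suc F.zero)
      k2 : 𝓣 1ℤ L → LineKind L (F.suc (F.suc F.zero))
      k3 : 𝓣 -1ℤ L → LineKind L (F.suc (F.suc (F.suc F.zero)))

    lineKind : ∀ L → ∃ λ j → LineKind L j
    lineKind L = go (right x ≟ 0#) (left x ≟ 0#)
      where
      x = proj₁ (surjective L)
      eq = proj₂ (surjective L)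
      go : Dec (right x ≈ 0#) → Dec (left x ≈ 0#) → ∃ λ j → LineKind L j
      go (yes z) _ = _ , k0 x eq z
      go (no _) (yes z) = _ , k1 x eq z
      go (no v≉0) (no u≉0) = sg (G-±1 (*-nonzero (N1≉0 (proj₁ (proj₂ nm))) v′≉0) (singular x′))
        where
        nm = normalize x u≉0
        x′ = proj₁ nm
        eq′ : kl x′ ≈L L
        eq′ = ≈L-trans {kl x′} {kl x} {L} (≈L-sym {kl x} {kl x′} (wellDefined x x′ (proj₂ (proj₂ nm)))) eq
        v′≉0 : right x′ ≉ 0#
        v′≉0 z = let (s , _ , _ , e₁) = ∼-sym {x} {x′} (proj₂ (proj₂ nm)) in v≉0 (trans e₁ (*-0ʳ z))
        sg : G (left x′ * right x′) ≡ 1ℤ ⊎ G (left x′ * right x′) ≡ -1ℤ → ∃ λ j → LineKind L j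
        sg (inj₁ g) = _ , k2 (x′ , proj₁ (proj₂ nm) , g , eq′)
        sg (inj₂ g) = _ , k3 (x′ , proj₁ (proj₂ nm) , g , eq′)

    lineKind→LC : ∀ L {j} → LineKind L j → LC j L
    lineKind→LC L (k0 x eq z) = proj₁ (eq p) (p-on x z)
    lineKind→LC L (k1 x eq z) = lineOf-≈L {kl x} {L} eq (π-in x z)
    lineKind→LC L (k2 t) = 𝓣→T₁ L t
    lineKind→LC L (k3 t) = 𝓣→T₂ L t

    LC→lineKind : ∀ L j → LC j L → LineKind L j
    LC→lineKind L F.zero h = let (x , eq) = surjective L in k0 x eq (on-p x (proj₂ (eq p) h))
    LC→lineKind L (F.suc F.zero) h = let (x , eq) = surjective L in k1 x eq (in-π x (lineOf-≈L {L} {kl x} (≈L-sym {kl x} {L} eq) h))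
    LC→lineKind L (F.suc (F.suc F.zero)) h = k2 (T₁→𝓣 L h)
    LC→lineKind L (F.suc (F.suc (F.suc F.zero))) h = k3 (T₂→𝓣 L h)

    same-line : ∀ {L} x y → kl x ≈L L → kl y ≈L L → x ∼ y
    same-line {L} x y a b = injective x y (≈L-trans {kl x} {L} {kl y} a (≈L-sym {kl y} {L} b))

    lineKind-unique : ∀ L {i j} → LineKind L i → LineKind L j → i ≡ j
    lineKind-unique L = go
      where
      right0 : ∀ {x y} → x ∼ y → right x ≈ 0# → right y ≈ 0#
      right0 (_ , _ , _ , e₁) z = trans e₁ (*-0ʳ z)
      left0 : ∀ {x y} → x ∼ y → left x ≈ 0# → left y ≈ 0#
      left0 (_ , _ , e₁ , _) z = trans e₁ (*-0ʳ z)
      a01 : ∀ x y → kl x ≈L L → kl y ≈L L → right x ≈ 0# → left y ≈ 0# → ⊥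
      a01 x y ex ey z z′ = proj₁ (proj₂ y) (z′ , right0 {x} {y} (same-line {L} x y ex ey) z)
      a0T : ∀ x s → s ≡ 1ℤ ⊎ s ≡ -1ℤ → kl x ≈L L → right x ≈ 0# → 𝓣 s L → ⊥
      a0T x s s± ex z (y , Ny , g , ey) = 𝓣-right {y} s± g (right0 {x} {y} (same-line {L} x y ex ey) z)
      a1T : ∀ x s → kl x ≈L L → left x ≈ 0# → 𝓣 s L → ⊥
      a1T x s ex z (y , Ny , g , ey) = N1≉0 Ny (left0 {x} {y} (same-line {L} x y ex ey) z)
      aTT : 𝓣 1ℤ L → 𝓣 -1ℤ L → ⊥
      aTT (x , Nx , g , ex) (y , Ny , g′ , ey) = let (s , (fs , _) , l , r) = same-line {L} x y ex ey
                                                     l≈ = S-F-ratio Ny Nx fs l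
                                                     s≈1 = cancel-nonzero (N1≉0 Nx) (trans (*-comm _ _) (trans (sym l) (trans l≈ (sym (*-identityʳ _)))))
        in 1≢-1 (≡.trans (≡.sym g) (≡.trans (G-cong (*-cong (sym l≈) (sym (trans r (trans (*-congʳ s≈1) (*-identityˡ _)))))) g′))
      go : ∀ {i j} → LineKind L i → LineKind L j → i ≡ j
      go (k0 _ _ _) (k0 _ _ _) = ≡.refl
      go (k1 _ _ _) (k1 _ _ _) = ≡.refl
      go (k2 _) (k2 _) = ≡.refl
      go (k3 _) (k3 _) = ≡.refl
      go (k0 x ex z) (k1 y ey z′) = ⊥-elim (a01 x y ex ey z z′)
      go (k1 y ey z′) (k0 x ex z) = ⊥-elim (a01 x y ex ey z z′)
      go (k0 x ex z) (k2 t) = ⊥-elim (a0T x _ (inj₁ ≡.refl) ex z t)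
      go (k2 t) (k0 x ex z) = ⊥-elim (a0T x _ (inj₁ ≡.refl) ex z t)
      go (k0 x ex z) (k3 t) = ⊥-elim (a0T x _ (inj₂ ≡.refl) ex z t)
      go (k3 t) (k0 x ex z) = ⊥-elim (a0T x _ (inj₂ ≡.refl) ex z t)
      go (k1 x ex z) (k2 t) = ⊥-elim (a1T x _ ex z t)
      go (k2 t) (k1 x ex z) = ⊥-elim (a1T x _ ex z t)
      go (k1 x ex z) (k3 t) = ⊥-elim (a1T x _ ex z t)
      go (k3 t) (k1 x ex z) = ⊥-elim (a1T x _ ex z t)
      go (k2 t) (k3 t′) = ⊥-elim (aTT t t′)
      go (k3 t) (k2 t′) = ⊥-elim (aTT t′ t)

    lines-disjoint : ∀ L i j → LC i L → LC j L → i ≡ j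
    lines-disjoint L i j a b = lineKind-unique L (LC→lineKind L i a) (LC→lineKind L j b)

    -- Numbers of lines of 𝓛₁ and 𝓛₂ through points of each kind.

    star-size : ∀ {w} s → s ≡ 1ℤ ⊎ s ≡ -1ℤ → w ≉ 0# →
      ℤ.+ 2 ℤ.* Σ𝒩 (λ u → when (G (u * cross w u) ℤₚ.≟ s) 1ℤ) ≡ (qℤ ℤ.+ 1ℤ) ℤ.* (qℤ ℤ.+ s ℤ.* κ ℤ.* ε w)
    star-size {w} _ (inj₁ ≡.refl) w≉0 = ≡.trans (proj₁ (star-count {w} w≉0)) (≡.cong (λ t → (qℤ ℤ.+ 1ℤ) ℤ.* (qℤ ℤ.+ t ℤ.* ε w)) (≡.sym (ℤₚ.*-identityˡ κ)))
    star-size {w} _ (inj₂ ≡.refl) w≉0 = ≡.trans (proj₂ (star-count {w} w≉0)) (≡.cong ((qℤ ℤ.+ 1ℤ) ℤ.*_) (lem qℤ κ (ε w)))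
      where
      lem : ∀ q k e → q ℤ.- k ℤ.* e ≡ q ℤ.+ -1ℤ ℤ.* k ℤ.* e
      lem = ℤSolver.solve-∀

    -- For a point of type w these lines correspond to the points (u, w × u) with u of norm 1 and
    -- the prescribed value of G.
    star-card : ∀ {r w} s {j} → s ≡ 1ℤ ⊎ s ≡ -1ℤ → Type r w → ℤ.+ 2 ℤ.* ℤ.+ j ≡ (qℤ ℤ.+ 1ℤ) ℤ.* (qℤ ℤ.+ s ℤ.* κ ℤ.* ε w) →
      HasCardMod _≈L_ (λ L → 𝓣 s L × r on L) j
    star-card {r} {w} s {j} s± (w≉0 , to , from) eq = card-of (proj₁ me , ≡.trans (proj₂ me) (ℤₚ.+-injective (cancel-2 (≡.trans (≡.cong (ℤ.+ 2 ℤ.*_)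
        (size-filter G? resp 𝒩ₗ)) (≡.trans (star-size s s± w≉0) (≡.sym eq))))))
      where
      G? : ∀ u → Dec (G (u * cross w u) ≡ s)
      G? u = G (u * cross w u) ℤₚ.≟ s
      resp : ∀ {u u′} → u ≈ u′ → G (u * cross w u) ≡ s → G (u′ * cross w u′) ≡ s
      resp p g = ≡.trans (G-cong (*-cong (sym p) (cross-cong refl (sym p)))) g
      pt : ∀ u → N u ≈ 1# × G (u * cross w u) ≡ s → QPt
      pt u (Nu , _) = graph w u (N1≉0 Nu)
      me = mapEnum {_≋_ = _≈L_} {P′ = λ L → 𝓣 s L × r on L} (filterEnum G? resp 𝒩ₗ) (λ u h → kl (pt u h))
        (λ u h → (pt u h , proj₁ h , proj₂ h , ≈L-refl (kl (pt u h))) , from (pt u h) refl)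
        (λ u u′ h h′ e₁ → let (t , (ft , _) , l , _) = injective (pt u h) (pt u′ h′) e₁ in sym (S-F-ratio (proj₁ h′) (proj₁ h) ft l))
        (λ L ((x , Nx , g , ex) , rL) → let rx = to x (proj₂ (ex r) rL) in
          left x , (Nx , ≡.trans (G-cong (*-congˡ (sym rx))) g) , λ u h p →
            ≈L-trans {L} {kl x} {kl (pt u h)} (≈L-sym {kl x} {L} ex) (wellDefined x (pt u h) (1# , (F-1 , 1≉0) ,
              trans (sym p) (sym (*-identityˡ _)) , trans (cross-cong refl (sym p)) (trans (sym rx) (sym (*-identityˡ _))))))

    -- sm and sp are the values of ε on 𝒫₁ and on 𝒫₂; which of them is 1 depends on the sign of κ.

    𝓟 : ℤ → Pt3 → Set (c ⊔ ℓ)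
    𝓟 s r = ∃ λ w → Type r w × ε w ≡ s

    abstract
      sign-data : ∃ λ s → (s ≡ 1ℤ ⊎ s ≡ -1ℤ) × s ℤ.* κ ≡ ℤ.- Q₀
      sign-data = [ (λ p → -1ℤ , inj₂ ≡.refl , ≡.trans (ℤₚ.-1*i≡-i κ) (≡.cong ℤ.-_ p)) , (λ p → 1ℤ , inj₁ ≡.refl , ≡.trans (ℤₚ.*-identityˡ κ) p) ]′ κ-value

    sm sp : ℤ
    sm = proj₁ sign-data
    sp = ℤ.- sm

    sm± : sm ≡ 1ℤ ⊎ sm ≡ -1ℤ
    sm± = proj₁ (proj₂ sign-data)

    sp± : sp ≡ 1ℤ ⊎ sp ≡ -1ℤ
    sp± = neg± sm±

    smκ : sm ℤ.* κ ≡ ℤ.- Q₀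
    smκ = proj₂ (proj₂ sign-data)

    spκ : sp ℤ.* κ ≡ Q₀
    spκ = ≡.trans (≡.sym (ℤₚ.neg-distribˡ-* sm κ)) (≡.trans (≡.cong ℤ.-_ smκ) (ℤₚ.neg-involutive Q₀))

    ε-exists : ∀ {s} → s ≡ 1ℤ ⊎ s ≡ -1ℤ → ∃ λ w → w ≉ 0# × ε w ≡ s
    ε-exists (inj₁ ≡.refl) = 1# , 1≉0 , Cl-log sε-periodic 0 refl
    ε-exists (inj₂ ≡.refl) = ω * ω * 1# , *-nonzero (*-nonzero ω≉0 ω≉0) 1≉0 , ≡.trans (ε-ω²* 1#) (≡.cong ℤ.-_ (Cl-log sε-periodic 0 refl))

    𝓟-exists : ∀ {s} → s ≡ 1ℤ ⊎ s ≡ -1ℤ → ∃ λ r → 𝓟 s r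
    𝓟-exists s± = let (w , w≉0 , ew) = ε-exists s± ; (r , t) = type-exists w w≉0 in r , w , t , ew

    twice-k₋ : ∀ {x} → x ≡ qℤ ℤ.- Q₀ → ∀ {j} → ℤ.+ 2 ℤ.* ℤ.+ j ≡ (qℤ ℤ.+ 1ℤ) ℤ.* x → j ≡ k₋
    twice-k₋ px eq = half-≡ (≡.trans eq (≡.trans (≡.cong₂ ℤ._*_ q+1ℤ (≡.trans px q-Q)) (≡.sym (ℤₚ.pos-* (q ℕ.+ 1) (q ℕ.∸ Q)))))

    twice-k₊ : ∀ {x} → x ≡ qℤ ℤ.+ Q₀ → ∀ {j} → ℤ.+ 2 ℤ.* ℤ.+ j ≡ (qℤ ℤ.+ 1ℤ) ℤ.* x → j ≡ k₊
    twice-k₊ px eq = half-≡ (≡.trans eq (≡.trans (≡.cong₂ ℤ._*_ q+1ℤ (≡.trans px (≡.sym (ℤₚ.pos-+ q Q)))) (≡.sym (ℤₚ.pos-* (q ℕ.+ 1) (q ℕ.+ Q)))))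

    size-of : ∀ {w} s → s ≡ 1ℤ ⊎ s ≡ -1ℤ → w ≉ 0# → ∃ λ j → ℤ.+ 2 ℤ.* ℤ.+ j ≡ (qℤ ℤ.+ 1ℤ) ℤ.* (qℤ ℤ.+ s ℤ.* κ ℤ.* ε w)
    size-of {w} s s± w≉0 = size (filterEnum (λ u → G (u * cross w u) ℤₚ.≟ s) resp 𝒩ₗ) ,
        ≡.trans (≡.cong (ℤ.+ 2 ℤ.*_) (size-filter (λ u → G (u * cross w u) ℤₚ.≟ s) resp 𝒩ₗ)) (star-size s s± w≉0)
      where
      resp : ∀ {u u′} → u ≈ u′ → G (u * cross w u) ≡ s → G (u′ * cross w u′) ≡ s
      resp p g = ≡.trans (G-cong (*-cong (sym p) (cross-cong refl (sym p)))) g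

    StarCard : Pt3 → ℤ → ℕ → Set (c ⊔ ℓ)
    StarCard r s j = HasCardMod _≈L_ (λ L → 𝓣 s L × r on L) j

    star-card-k : ∀ {r w} s → s ≡ 1ℤ ⊎ s ≡ -1ℤ → Type r w → (s ℤ.* κ ℤ.* ε w ≡ ℤ.- Q₀ → HasCardMod _≈L_ (λ L → 𝓣 s L × r on L) k₋) ×
      (s ℤ.* κ ℤ.* ε w ≡ Q₀ → HasCardMod _≈L_ (λ L → 𝓣 s L × r on L) k₊)
    star-card-k {r} {w} s s± t = (λ h → ≡.subst (StarCard r s) (twice-k₋ {qℤ ℤ.+ s ℤ.* κ ℤ.* ε w} (≡.cong (λ x → qℤ ℤ.+ x) h) {proj₁ sz} (proj₂ sz)) (star-card {r} {w} s {proj₁ sz} s± t (proj₂ sz))) ,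
        (λ h → ≡.subst (StarCard r s) (twice-k₊ {qℤ ℤ.+ s ℤ.* κ ℤ.* ε w} (≡.cong (λ x → qℤ ℤ.+ x) h) {proj₁ sz} (proj₂ sz)) (star-card {r} {w} s {proj₁ sz} s± t (proj₂ sz)))
      where
      sz = size-of {w} s s± (proj₁ t)

    rearrange : ∀ s x → s ℤ.* κ ℤ.* x ≡ s ℤ.* (x ℤ.* κ)
    rearrange s x = lem s κ x
      where
      lem : ∀ s k x → s ℤ.* k ℤ.* x ≡ s ℤ.* (x ℤ.* k)
      lem = ℤSolver.solve-∀

    at-sign : ∀ {x} s → x ℤ.* κ ≡ ℤ.- Q₀ → s ℤ.* κ ℤ.* x ≡ ℤ.- (s ℤ.* Q₀)
    at-sign {x} s h = ≡.trans (rearrange s x) (≡.trans (≡.cong (s ℤ.*_) h) (≡.sym (ℤₚ.neg-distribʳ-* s Q₀)))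

    at-sign′ : ∀ {x} s → x ℤ.* κ ≡ Q₀ → s ℤ.* κ ℤ.* x ≡ s ℤ.* Q₀
    at-sign′ {x} s h = ≡.trans (rearrange s x) (≡.cong (s ℤ.*_) h)

    1*Q : 1ℤ ℤ.* Q₀ ≡ Q₀
    1*Q = ℤₚ.*-identityˡ Q₀

    -1*Q : -1ℤ ℤ.* Q₀ ≡ ℤ.- Q₀
    -1*Q = ℤₚ.-1*i≡-i Q₀

    ε-at : ∀ {s x y} → s ℤ.* κ ≡ y → x ≡ s → x ℤ.* κ ≡ y
    ε-at h p = ≡.trans (≡.cong (ℤ._* κ) p) h

    m-plus : ∀ {r} → 𝓟 sm r → StarCard r 1ℤ k₋
    m-plus {r} (w , t , ew) = proj₁ (star-card-k {r} {w} 1ℤ (inj₁ ≡.refl) t) (≡.trans (at-sign {ε w} 1ℤ (ε-at smκ ew)) (≡.cong ℤ.-_ 1*Q))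

    m-minus : ∀ {r} → 𝓟 sm r → StarCard r -1ℤ k₊
    m-minus {r} (w , t , ew) = proj₂ (star-card-k {r} {w} -1ℤ (inj₂ ≡.refl) t) (≡.trans (at-sign {ε w} -1ℤ (ε-at smκ ew)) (≡.trans (≡.cong ℤ.-_ -1*Q) (ℤₚ.neg-involutive Q₀)))

    p-plus : ∀ {r} → 𝓟 sp r → StarCard r 1ℤ k₊
    p-plus {r} (w , t , ew) = proj₂ (star-card-k {r} {w} 1ℤ (inj₁ ≡.refl) t) (≡.trans (at-sign′ {ε w} 1ℤ (ε-at spκ ew)) 1*Q)

    p-minus : ∀ {r} → 𝓟 sp r → StarCard r -1ℤ k₋
    p-minus {r} (w , t , ew) = proj₁ (star-card-k {r} {w} -1ℤ (inj₂ ≡.refl) t) (≡.trans (at-sign′ {ε w} -1ℤ (ε-at spκ ew)) -1*Q)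

    -- The divisions by 2 in k₋ and k₊ leave no remainder.
    2k₋ : ℤ.+ 2 ℤ.* ℤ.+ k₋ ≡ (qℤ ℤ.+ 1ℤ) ℤ.* (qℤ ℤ.- Q₀)
    2k₋ = let (w , w≉0 , ew) = ε-exists sm± ; (j , eq) = size-of {w} 1ℤ (inj₁ ≡.refl) w≉0
              h = ≡.trans (at-sign {ε w} 1ℤ (ε-at smκ ew)) (≡.cong ℤ.-_ 1*Q)
          in ≡.subst (λ t → ℤ.+ 2 ℤ.* ℤ.+ t ≡ (qℤ ℤ.+ 1ℤ) ℤ.* (qℤ ℤ.- Q₀)) (twice-k₋ {qℤ ℤ.+ 1ℤ ℤ.* κ ℤ.* ε w} (≡.cong (λ x → qℤ ℤ.+ x) h) {j} eq)
               (≡.trans eq (≡.cong (λ x → (qℤ ℤ.+ 1ℤ) ℤ.* (qℤ ℤ.+ x)) h))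

    2k₊ : ℤ.+ 2 ℤ.* ℤ.+ k₊ ≡ (qℤ ℤ.+ 1ℤ) ℤ.* (qℤ ℤ.+ Q₀)
    2k₊ = let (w , w≉0 , ew) = ε-exists sp± ; (j , eq) = size-of {w} 1ℤ (inj₁ ≡.refl) w≉0
              h = ≡.trans (at-sign′ {ε w} 1ℤ (ε-at spκ ew)) 1*Q
          in ≡.subst (λ t → ℤ.+ 2 ℤ.* ℤ.+ t ≡ (qℤ ℤ.+ 1ℤ) ℤ.* (qℤ ℤ.+ Q₀)) (twice-k₊ {qℤ ℤ.+ 1ℤ ℤ.* κ ℤ.* ε w} (≡.cong (λ x → qℤ ℤ.+ x) h) {j} eq)
               (≡.trans eq (≡.cong (λ x → (qℤ ℤ.+ 1ℤ) ℤ.* (qℤ ℤ.+ x)) h))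

    cancel-q+1 : ∀ {x y} → (qℤ ℤ.+ 1ℤ) ℤ.* x ≡ (qℤ ℤ.+ 1ℤ) ℤ.* y → x ≡ y
    cancel-q+1 {x} {y} eq = ℤₚ.*-cancelˡ-≡ (ℤ.+ ℕ.suc q) x y (≡.trans (≡.cong (ℤ._* x) s≡) (≡.trans eq (≡.cong (ℤ._* y) (≡.sym s≡))))
      where
      s≡ : ℤ.+ ℕ.suc q ≡ qℤ ℤ.+ 1ℤ
      s≡ = ≡.trans (≡.cong ℤ.+_ (ℕₚ.+-comm 1 q)) (≡.sym q+1ℤ)

    plane-type₁ : ∀ r → r onPlane π → ∃ λ w → N w ≈ 1# × PlaneType r w
    plane-type₁ r h = unit , unit-N , N1≉0 unit-N ,
        (λ x o → let ((s , fs , l) , t) = to x o in (s * radius , F-* fs radius-F , trans l (trans (*-congˡ y≈) (sym (*-assoc _ _ _)))) ,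
          domain (trans (sym (T-scale _ radius-F)) (trans (T-cong (trans (sym (*-assoc _ _ _)) (*-congʳ (sym y≈)))) t)) radius≉0) ,
        (λ x (s , fs , l) t → from x (s * inv radius , F-* fs (F-inv radius-F) , trans l (trans (*-congˡ unit≈) (sym (*-assoc _ _ _))))
          (trans (T-cong (trans (*-congʳ y≈) (*-assoc _ _ _))) (trans (T-scale _ radius-F) (*-0ʳ t))))
      where
      pt = plane-type r h
      w≉0 = proj₁ (proj₂ pt)
      to = proj₁ (proj₂ (proj₂ pt))
      from = proj₂ (proj₂ (proj₂ pt))
      open Polar (polar-form w≉0)
      unit≈ : unit ≈ inv radius * proj₁ pt
      unit≈ = sym (trans (*-congˡ y≈) (trans (sym (*-assoc _ _ _)) (trans (*-congʳ (trans (*-comm _ _) (inv-right radius≉0))) (*-identityˡ _))))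

    hyper : ℤ → ℕ
    hyper s = size (filterEnum {Q = λ z → G z ≡ s} (λ z → G z ℤₚ.≟ s) (λ p g → ≡.trans (G-cong (sym p)) g) Eₗ)

    -- For a point of π with w normalized to norm 1, the lines in question are those of the points
    -- (w, v); z = w v runs through the elements of the hyperplane T = 0 with sign s.
    hyper-card : ∀ s → s ≡ 1ℤ ⊎ s ≡ -1ℤ → ∀ r → r onPlane π → StarCard r s (hyper s)
    hyper-card s s± r h = card-of me
      where
      pt = plane-type₁ r h
      w = proj₁ pt
      Nw = proj₁ (proj₂ pt)
      w≉0 = proj₁ (proj₂ (proj₂ pt))
      to = proj₁ (proj₂ (proj₂ (proj₂ pt)))
      from = proj₂ (proj₂ (proj₂ (proj₂ pt)))
      T0 : ∀ {z} → G z ≡ s → T (w * (inv w * z)) ≈ 0#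
      T0 {z} g = go (T z ≟ 0#)
        where
        go : Dec (T z ≈ 0#) → T (w * (inv w * z)) ≈ 0#
        go (yes t) = trans (T-cong (inv-cancel z w≉0)) t
        go (no n) = ⊥-elim (±1≢0 s± (≡.trans (≡.sym g) (G-T n)))
      pt′ : ∀ z → ⊤ {ℓ} × G z ≡ s → QPt
      pt′ z (_ , g) = lpoint w (inv w * z) w≉0 (T0 g)
      me = mapEnum {_≋_ = _≈L_} {P′ = λ L → 𝓣 s L × r on L} (filterEnum {Q = λ z → G z ≡ s} (λ z → G z ℤₚ.≟ s) (λ p g → ≡.trans (G-cong (sym p)) g) Eₗ)
        (λ z g → kl (pt′ z g))
        (λ z g → (pt′ z g , Nw , ≡.trans (G-cong (inv-cancel z w≉0)) (proj₂ g) , ≈L-refl (kl (pt′ z g))) , from (pt′ z g) (1# , F-1 , sym (*-identityˡ w)) (T0 (proj₂ g)))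
        (λ z z′ g g′ e₁ → let (t , _ , l , l′) = injective (pt′ z g) (pt′ z′ g′) e₁
                              t≈1 = cancel-nonzero w≉0 (trans (*-comm w t) (trans (sym l) (sym (*-identityʳ w))))
          in sym (cancel-nonzero (inv-nonzero w≉0) (trans l′ (trans (*-congʳ t≈1) (*-identityˡ _)))))
        (λ L ((x , Nx , g , ex) , rL) → let ((t , ft , l) , _) = to x (proj₂ (ex r) rL)
                                            l≈ = S-F-ratio Nx Nw ft l
          in w * right x , (tt , ≡.trans (G-cong (*-congʳ (sym l≈))) g) , λ z g′ p →
            ≈L-trans {L} {kl x} {kl (pt′ z g′)} (≈L-sym {kl x} {L} ex) (wellDefined x (pt′ z g′) (1# , (F-1 , 1≉0) , trans (sym l≈) (sym (*-identityˡ _)) ,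
              trans (*-congˡ (sym p)) (trans (sym (*-assoc _ _ _)) (*-congʳ (trans (*-comm _ _) (inv-right w≉0)))))))

    2hyper : ℤ.+ 2 ℤ.* ℤ.+ hyper 1ℤ ≡ (qℤ ℤ.+ 1ℤ) ℤ.* (qℤ ℤ.- 1ℤ)
    2hyper = ≡.trans (≡.cong (ℤ.+ 2 ℤ.*_) (size-filter (λ z → G z ℤₚ.≟ 1ℤ) (λ p g → ≡.trans (G-cong (sym p)) g) Eₗ)) (≡.trans (proj₁ hyperplane-count) (lem qℤ))
      where
      lem : ∀ q → q ℤ.* q ℤ.- 1ℤ ≡ (q ℤ.+ 1ℤ) ℤ.* (q ℤ.- 1ℤ)
      lem = ℤSolver.solve-∀

    centre-card : ∀ s → s ≡ 1ℤ ⊎ s ≡ -1ℤ → ∀ r → r ≈P p → StarCard r s 0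
    centre-card s s± r e₁ = card-empty λ L ((x , Nx , g , ex) , rL) → 𝓣-right {x} s± g (on-p x (proj₂ (ex p) (on-≈P {r} {p} L e₁ rL)))

    -- Recognizing the class of a point from the number of lines of 𝓛₁ through it.

    card-cong : ∀ {r j j′} → StarCard r 1ℤ j → StarCard r 1ℤ j′ → j ≡ j′
    card-cong = card-unique {_∼_ = _≈L_} (λ {L} {M} → ≈L-sym {L} {M}) (λ {L} {M} {K} → ≈L-trans {L} {M} {K})

    X-unique : ∀ {r j j′ x x′} → StarCard r 1ℤ j → StarCard r 1ℤ j′ → ℤ.+ 2 ℤ.* ℤ.+ j ≡ (qℤ ℤ.+ 1ℤ) ℤ.* x → ℤ.+ 2 ℤ.* ℤ.+ j′ ≡ (qℤ ℤ.+ 1ℤ) ℤ.* x′ → x ≡ x′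
    X-unique {r} a b p p′ = cancel-q+1 (≡.trans (≡.sym p) (≡.trans (≡.cong (λ t → ℤ.+ 2 ℤ.* ℤ.+ t) (card-cong {r} a b)) p′))

    -- The number is written as (q + 1) x / 2, where x is 0 at p, q - 1 on π, and q ± Q elsewhere.
    -- As q - Q and q + Q differ from each other and from the first two values, the classes defined
    -- by counting contain neither p nor points of π.
    determine : ∀ {r j x} → StarCard r 1ℤ j → ℤ.+ 2 ℤ.* ℤ.+ j ≡ (qℤ ℤ.+ 1ℤ) ℤ.* x →
      (x ≡ 0ℤ) ⊎ (x ≡ qℤ ℤ.- 1ℤ) ⊎ (𝓟 sm r × x ≡ qℤ ℤ.- Q₀) ⊎ (𝓟 sp r × x ≡ qℤ ℤ.+ Q₀)
    determine {r} {j} {x} card eq = go (kind r)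
      where
      go : Kind r → (x ≡ 0ℤ) ⊎ (x ≡ qℤ ℤ.- 1ℤ) ⊎ (𝓟 sm r × x ≡ qℤ ℤ.- Q₀) ⊎ (𝓟 sp r × x ≡ qℤ ℤ.+ Q₀)
      go (centre e₁) = inj₁ (X-unique {r} card (centre-card 1ℤ (inj₁ ≡.refl) r e₁) eq (≡.sym (ℤₚ.*-zeroʳ (qℤ ℤ.+ 1ℤ))))
      go (plane h) = inj₂ (inj₁ (X-unique {r} card (hyper-card 1ℤ (inj₁ ≡.refl) r h) eq 2hyper))
      go (affine w t) = [ (λ ew → inj₂ (inj₂ (inj₁ ((w , t , ew) , X-unique {r} card (m-plus {r} (w , t , ew)) eq 2k₋))))
        , (λ ew → inj₂ (inj₂ (inj₂ ((w , t , ew) , X-unique {r} card (p-plus {r} (w , t , ew)) eq 2k₊)))) ]′ (dichotomy (ε-±1 (proj₁ t)) sm±)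

    solve-Q : ∀ {x y} → qℤ ℤ.- y ≡ qℤ ℤ.- x → x ≡ y
    solve-Q {x} {y} eq = ≡.trans (lem qℤ x) (≡.trans (≡.cong (λ t → qℤ ℤ.- t) (≡.sym eq)) (≡.sym (lem qℤ y)))
      where
      lem : ∀ q x → x ≡ q ℤ.- (q ℤ.- x)
      lem = ℤSolver.solve-∀

    -Q₀-not : ∀ {x} → x ℤ.* x ≡ 0ℤ ⊎ x ℤ.* x ≡ 1ℤ → ℤ.- Q₀ ≢ x
    -Q₀-not {x} h eq = Q₀-not {ℤ.- x} (≡.subst (λ t → t ≡ 0ℤ ⊎ t ≡ 1ℤ) (≡.sym (lem x)) h) (≡.trans (≡.sym (ℤₚ.neg-involutive Q₀)) (≡.cong ℤ.-_ eq))
      where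
      lem : ∀ x → ℤ.- x ℤ.* ℤ.- x ≡ x ℤ.* x
      lem = ℤSolver.solve-∀

    q≢Q : qℤ ≢ Q₀
    q≢Q eq = Q₀-not {1ℤ} (inj₂ ≡.refl) (cancel-q (≡.trans (≡.cong (ℤ._* Q₀) eq) (≡.trans Q₀² (≡.sym (ℤₚ.*-identityʳ qℤ)))))

    q≢-Q : qℤ ≢ ℤ.- Q₀
    q≢-Q eq = -Q₀-not {1ℤ} (inj₂ ≡.refl) (cancel-q (≡.trans (≡.cong (ℤ._* (ℤ.- Q₀)) eq) (≡.trans (lem Q₀) (≡.trans Q₀² (≡.sym (ℤₚ.*-identityʳ qℤ))))))
      where
      lem : ∀ x → ℤ.- x ℤ.* ℤ.- x ≡ x ℤ.* x
      lem = ℤSolver.solve-∀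

    Q≢-Q : Q₀ ≢ ℤ.- Q₀
    Q≢-Q eq = Q₀-not {0ℤ} (inj₁ ≡.refl) (x≡-x eq)

    class₂ : ∀ {r} → StarCard r 1ℤ k₋ → 𝓟 sm r
    class₂ {r} card = go (determine {r} card 2k₋)
      where
      go : (qℤ ℤ.- Q₀ ≡ 0ℤ) ⊎ (qℤ ℤ.- Q₀ ≡ qℤ ℤ.- 1ℤ) ⊎ (𝓟 sm r × qℤ ℤ.- Q₀ ≡ qℤ ℤ.- Q₀) ⊎ (𝓟 sp r × qℤ ℤ.- Q₀ ≡ qℤ ℤ.+ Q₀) → 𝓟 sm r
      go (inj₁ z) = ⊥-elim (q≢Q (ℤₚ.i-j≡0⇒i≡j qℤ Q₀ z))
      go (inj₂ (inj₁ z)) = ⊥-elim (Q₀-not {1ℤ} (inj₂ ≡.refl) (solve-Q (≡.sym z)))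
      go (inj₂ (inj₂ (inj₁ (h , _)))) = h
      go (inj₂ (inj₂ (inj₂ (_ , z)))) = ⊥-elim (Q≢-Q (solve-Q (≡.trans (≡.cong (λ t → qℤ ℤ.+ t) (ℤₚ.neg-involutive Q₀)) (≡.sym z))))

    class₃ : ∀ {r} → StarCard r 1ℤ k₊ → 𝓟 sp r
    class₃ {r} card = go (determine {r} card 2k₊)
      where
      minus : qℤ ℤ.- (ℤ.- Q₀) ≡ qℤ ℤ.+ Q₀
      minus = ≡.cong (λ t → qℤ ℤ.+ t) (ℤₚ.neg-involutive Q₀)
      go : (qℤ ℤ.+ Q₀ ≡ 0ℤ) ⊎ (qℤ ℤ.+ Q₀ ≡ qℤ ℤ.- 1ℤ) ⊎ (𝓟 sm r × qℤ ℤ.+ Q₀ ≡ qℤ ℤ.- Q₀) ⊎ (𝓟 sp r × qℤ ℤ.+ Q₀ ≡ qℤ ℤ.+ Q₀) → 𝓟 sp r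
      go (inj₁ z) = ⊥-elim (q≢-Q (ℤₚ.i-j≡0⇒i≡j qℤ (ℤ.- Q₀) (≡.trans minus z)))
      go (inj₂ (inj₁ z)) = ⊥-elim (-Q₀-not {1ℤ} (inj₂ ≡.refl) (solve-Q (≡.trans (≡.sym z) (≡.sym minus))))
      go (inj₂ (inj₂ (inj₁ (_ , z)))) = ⊥-elim (Q≢-Q (≡.sym (solve-Q {ℤ.- Q₀} {Q₀} (≡.trans (≡.sym z) (≡.sym minus)))))
      go (inj₂ (inj₂ (inj₂ (h , _)))) = h

    PC : Fin 4 → Pt3 → Set (c ⊔ ℓ)
    PC = fourClasses (λ r → r ≈P p) (λ r → r onPlane π)
      (λ r → HasCardMod _≈L_ (λ L → image kl InT₁ L × (r on L)) k₋)
      (λ r → HasCardMod _≈L_ (λ L → image kl InT₁ L × (r on L)) k₊)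

    -- The point classes described by types. `class₂` and `class₃` show that they agree with the
    -- classes defined by counting.
    data PointKind (r : Pt3) : Fin 4 → Set (c ⊔ ℓ) where
      c0 : r ≈P p → PointKind r F.zero
      c1 : r onPlane π → PointKind r (F.suc F.zero)
      c2 : 𝓟 sm r → PointKind r (F.suc (F.suc F.zero))
      c3 : 𝓟 sp r → PointKind r (F.suc (F.suc (F.suc F.zero)))

    pointKind : ∀ r → ∃ λ k → PointKind r k
    pointKind r = go (kind r)
      where
      go : Kind r → ∃ λ k → PointKind r k
      go (centre h) = _ , c0 h
      go (plane h) = _ , c1 h
      go (affine w t) = [ (λ h → _ , c2 (w , t , h)) , (λ h → _ , c3 (w , t , h)) ]′ (dichotomy (ε-±1 (proj₁ t)) sm±)

    image→𝓣 : ∀ {r j} → HasCardMod _≈L_ (λ L → image kl InT₁ L × (r on L)) j → StarCard r 1ℤ j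
    image→𝓣 = card-resp (λ L (t , o) → T₁→𝓣 L t , o) (λ L (t , o) → 𝓣→T₁ L t , o)

    𝓣→image : ∀ {r j} → StarCard r 1ℤ j → HasCardMod _≈L_ (λ L → image kl InT₁ L × (r on L)) j
    𝓣→image = card-resp (λ L (t , o) → 𝓣→T₁ L t , o) (λ L (t , o) → T₁→𝓣 L t , o)

    pointKind→PC : ∀ {r j} → PointKind r j → PC j r
    pointKind→PC (c0 h) = h
    pointKind→PC (c1 h) = h
    pointKind→PC {r} (c2 h) = 𝓣→image {r} (m-plus {r} h)
    pointKind→PC {r} (c3 h) = 𝓣→image {r} (p-plus {r} h)

    PC→pointKind : ∀ r j → PC j r → PointKind r j
    PC→pointKind r F.zero h = c0 h
    PC→pointKind r (F.suc F.zero) h = c1 h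
    PC→pointKind r (F.suc (F.suc F.zero)) h = c2 (class₂ {r} (image→𝓣 {r} h))
    PC→pointKind r (F.suc (F.suc (F.suc F.zero))) h = c3 (class₃ {r} (image→𝓣 {r} h))

    pointKind-unique : ∀ {r i j} → PointKind r i → PointKind r j → i ≡ j
    pointKind-unique {r} = go
      where
      s≢-s : ∀ {s} → s ≡ 1ℤ ⊎ s ≡ -1ℤ → s ≢ ℤ.- s
      s≢-s (inj₁ ≡.refl) ()
      s≢-s (inj₂ ≡.refl) ()
      a01 : r ≈P p → r onPlane π → ⊥
      a01 h h′ = p∉π (onPlane-≈P {r} {p} π h h′)
      a0 : ∀ {s} → r ≈P p → 𝓟 s r → ⊥
      a0 h (w , t , _) = type-not-p {r} {w} t h
      a1 : ∀ {s} → r onPlane π → 𝓟 s r → ⊥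
      a1 h (w , t , _) = type-not-π {r} {w} t h
      a23 : 𝓟 sm r → 𝓟 sp r → ⊥
      a23 (w , t , h) (w′ , t′ , h′) = s≢-s sm± (≡.trans (≡.sym h) (≡.trans (ε-cong (type-injective {r} {r} {w} {w′} t t′ (≈P-refl r))) h′))
      go : ∀ {i j} → PointKind r i → PointKind r j → i ≡ j
      go (c0 _) (c0 _) = ≡.refl
      go (c1 _) (c1 _) = ≡.refl
      go (c2 _) (c2 _) = ≡.refl
      go (c3 _) (c3 _) = ≡.refl
      go (c0 h) (c1 h′) = ⊥-elim (a01 h h′)
      go (c1 h) (c0 h′) = ⊥-elim (a01 h′ h)
      go (c0 h) (c2 h′) = ⊥-elim (a0 h h′)
      go (c2 h) (c0 h′) = ⊥-elim (a0 h′ h)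
      go (c0 h) (c3 h′) = ⊥-elim (a0 h h′)
      go (c3 h) (c0 h′) = ⊥-elim (a0 h′ h)
      go (c1 h) (c2 h′) = ⊥-elim (a1 h h′)
      go (c2 h) (c1 h′) = ⊥-elim (a1 h′ h)
      go (c1 h) (c3 h′) = ⊥-elim (a1 h h′)
      go (c3 h) (c1 h′) = ⊥-elim (a1 h′ h)
      go (c2 h) (c3 h′) = ⊥-elim (a23 h h′)
      go (c3 h) (c2 h′) = ⊥-elim (a23 h′ h)

    pointKind-exists : ∀ j → ∃ λ r → PointKind r j
    pointKind-exists F.zero = p , c0 (≈P-refl p)
    pointKind-exists (F.suc F.zero) = a , c1 (π-in x refl a (Span₂-left (proj₁ a) (proj₁ (proj₂ (proj₁ (kl x))))))
      where
      x = rpoint 1# 1≉0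
      a = proj₁ (proj₁ (kl x))
    pointKind-exists (F.suc (F.suc F.zero)) = let (r , h) = 𝓟-exists sm± in r , c2 h
    pointKind-exists (F.suc (F.suc (F.suc F.zero))) = let (r , h) = 𝓟-exists sp± in r , c3 h

    lineKind-exists : ∀ j → ∃ λ L → LineKind L j
    lineKind-exists F.zero = kl x , k0 x (≈L-refl (kl x)) refl
      where
      x = lpoint 1# 0# 1≉0 (T-*0 1#)
    lineKind-exists (F.suc F.zero) = kl x , k1 x (≈L-refl (kl x)) refl
      where
      x = rpoint 1# 1≉0
    -- T vanishes on F, so the points (1, z) with z in F* are on the quadric; the factor ω² changes
    -- the sign of G and so reaches the other class.
    lineKind-exists (F.suc (F.suc j)) = choose (G-±1 1≉0 (T-F F-1)) j
      where
      make : ∀ {s} z → InF z → G z ≡ s → ∃ λ L → 𝓣 s L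
      make z fz g = kl x , x , 1^ d₁ , ≡.trans (G-cong (*-identityˡ z)) g , ≈L-refl (kl x)
        where
        x = lpoint 1# z 1≉0 (trans (T-cong (*-identityˡ z)) (T-F fz))
      choose : G 1# ≡ 1ℤ ⊎ G 1# ≡ -1ℤ → ∀ j → ∃ λ L → LineKind L (F.suc (F.suc j))
      choose (inj₁ g) F.zero = let (L , t) = make 1# F-1 g in L , k2 t
      choose (inj₁ g) (F.suc F.zero) = let (L , t) = make (ω * ω * 1#) (F-* (F-* F-ω F-ω) F-1) (≡.trans (G-ω² 1#) (≡.cong ℤ.-_ g)) in L , k3 t
      choose (inj₂ g) F.zero = let (L , t) = make (ω * ω * 1#) (F-* (F-* F-ω F-ω) F-1) (≡.trans (G-ω² 1#) (≡.cong ℤ.-_ g)) in L , k2 t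
      choose (inj₂ g) (F.suc F.zero) = let (L , t) = make 1# F-1 g in L , k3 t

    same-point : ∀ {x y} → left x ≈ left y → right x ≈ right y → kl x ≈L kl y
    same-point {x} {y} l r = wellDefined x y (1# , (F-1 , 1≉0) , trans (sym l) (sym (*-identityˡ _)) , trans (sym r) (sym (*-identityˡ _)))

    -- Numbers of lines through a point.

    LinesThrough : Pt3 → Fin 4 → ℕ → Set (c ⊔ ℓ)
    LinesThrough r j m = HasCardMod _≈L_ (λ L → LineKind L j × (r on L)) m

    through-𝓣₁ : ∀ {r m} → StarCard r 1ℤ m → LinesThrough r (F.suc (F.suc F.zero)) m
    through-𝓣₁ = card-resp (λ L (t , o) → k2 t , o) (λ { L (k2 t , o) → t , o })

    through-𝓣₂ : ∀ {r m} → StarCard r -1ℤ m → LinesThrough r (F.suc (F.suc (F.suc F.zero))) m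
    through-𝓣₂ = card-resp (λ L (t , o) → k3 t , o) (λ { L (k3 t , o) → t , o })

    through-centre₀ : ∀ r → r ≈P p → LinesThrough r F.zero (size 𝒩ₗ)
    through-centre₀ r h = card-of (mapEnum {_≋_ = _≈L_} {P′ = λ L → LineKind L F.zero × (r on L)} 𝒩ₗ (λ u Nu → kl (pt u Nu))
        (λ u Nu → k0 (pt u Nu) (≈L-refl (kl (pt u Nu))) refl , on-≈P {p} {r} (kl (pt u Nu)) (≈P-sym {r} {p} h) (p-on (pt u Nu) refl))
        (λ u u′ Nu Nu′ e₁ → let (s , (fs , _) , l , _) = injective (pt u Nu) (pt u′ Nu′) e₁ in sym (S-F-ratio Nu′ Nu fs l))
        (λ { L (k0 x ex z , _) → onto L x ex z }))
      where
      pt : ∀ u → N u ≈ 1# → QPt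
      pt u Nu = lpoint u 0# (N1≉0 Nu) (T-*0 u)
      onto : ∀ L x → kl x ≈L L → right x ≈ 0# → ∃ λ u → N u ≈ 1# × (∀ u′ Nu′ → u ≈ u′ → L ≈L kl (pt u′ Nu′))
      onto L x ex z = left x′ , Nx′ , λ u′ Nu′ p′ → ≈L-trans {L} {kl x} {kl (pt u′ Nu′)} (≈L-sym {kl x} {L} ex)
          (≈L-trans {kl x} {kl x′} {kl (pt u′ Nu′)} (wellDefined x x′ x∼) (same-point {x′} {pt u′ Nu′} p′ (trans (proj₂ (proj₂ (proj₂ x∼))) (*-0ʳ z))))
        where
        nm = normalize x (λ z′ → proj₁ (proj₂ x) (z′ , z))
        x′ = proj₁ nm
        Nx′ = proj₁ (proj₂ nm)
        x∼ = proj₂ (proj₂ nm)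

    through-centre₁ : ∀ r → r ≈P p → LinesThrough r (F.suc F.zero) 0
    through-centre₁ r h = card-empty (λ { L (k1 x ex z , o) → proj₁ (proj₂ x) (z , on-p x (proj₂ (ex p) (on-≈P {r} {p} L h o))) })

    through-plane₀ : ∀ r → r onPlane π → LinesThrough r F.zero 1
    through-plane₀ r h = card-one (kl y) (k0 y (≈L-refl (kl y)) refl , from y (1# , F-1 , sym (*-identityˡ w)) (T-*0 w)) (λ { L (k0 x ex z , o) → unique L x ex z o })
      where
      pt = plane-type r h
      w = proj₁ pt
      w≉0 = proj₁ (proj₂ pt)
      to = proj₁ (proj₂ (proj₂ pt))
      from = proj₂ (proj₂ (proj₂ pt))
      y = lpoint w 0# w≉0 (T-*0 w)
      unique : ∀ L x → kl x ≈L L → right x ≈ 0# → r on L → L ≈L kl y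
      unique L x ex z o = let ((s , fs , l) , _) = to x (proj₂ (ex r) o) in
        ≈L-trans {L} {kl x} {kl y} (≈L-sym {kl x} {L} ex) (≈L-sym {kl y} {kl x} (wellDefined y x
          (s , (fs , λ s≈0 → proj₁ (proj₂ x) (trans l (*-0ˡ s≈0) , z)) , l , trans z (sym (zeroʳ s)))))

    -- The number q + 1 of points on the line T = 0 in the projective plane of E over F, left as the
    -- length of an enumeration.
    flags : ℕ
    flags = size (filterEnum {Q = λ z → T z ≈ 0#} (λ z → T z ≟ 0#) (λ p h → trans (T-cong (sym p)) h) 𝒩ₗ)

    through-plane₁ : ∀ r → r onPlane π → LinesThrough r (F.suc F.zero) flags
    through-plane₁ r h = card-of (mapEnum {_≋_ = _≈L_} {P′ = λ L → LineKind L (F.suc F.zero) × (r on L)}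
        (filterEnum {Q = λ z → T z ≈ 0#} (λ z → T z ≟ 0#) (λ p h → trans (T-cong (sym p)) h) 𝒩ₗ) (λ z h → kl (pt′ z h))
        (λ z h → k1 (pt′ z h) (≈L-refl (kl (pt′ z h))) refl , from (pt′ z h) (0# , F-0 , sym (zeroˡ w)) (trans (T-cong (inv-cancel z w≉0)) (proj₂ h)))
        (λ z z′ h h′ e₁ → let (s , (fs , _) , _ , l) = injective (pt′ z h) (pt′ z′ h′) e₁ in
          sym (S-F-ratio (proj₁ h′) (proj₁ h) fs (cancel-nonzero (inv-nonzero w≉0) (trans l (solve 3 (λ s i z → s :* (i :* z) := i :* (s :* z)) refl s (inv w) z)))))
        (λ { L (k1 x ex z , o) → onto L x ex z o }))
      where
      pt = plane-type r h
      w = proj₁ pt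
      w≉0 = proj₁ (proj₂ pt)
      to = proj₁ (proj₂ (proj₂ pt))
      from = proj₂ (proj₂ (proj₂ pt))
      pt′ : ∀ z → N z ≈ 1# × T z ≈ 0# → QPt
      pt′ z (Nz , _) = rpoint (inv w * z) (*-nonzero (inv-nonzero w≉0) (N1≉0 Nz))
      onto : ∀ L x → kl x ≈L L → left x ≈ 0# → r on L → ∃ λ z → (N z ≈ 1# × T z ≈ 0#) × (∀ z′ h → z ≈ z′ → L ≈L kl (pt′ z′ h))
      onto L x ex u≈0 o = unit , (unit-N , domain (trans (sym (T-scale _ radius-F)) (trans (T-cong (sym y≈)) (proj₂ (to x (proj₂ (ex r) o))))) radius≉0) ,
          λ z′ h p → ≈L-trans {L} {kl x} {kl (pt′ z′ h)} (≈L-sym {kl x} {L} ex) (≈L-sym {kl (pt′ z′ h)} {kl x} (wellDefined (pt′ z′ h) x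
            (radius , (radius-F , radius≉0) , trans u≈0 (sym (zeroʳ radius)) ,
              cancel-nonzero w≉0 (trans y≈ (trans (*-congˡ (trans p (sym (inv-cancel z′ w≉0)))) (solve 3 (λ s w y → s :* (w :* y) := w :* (s :* y)) refl radius w (inv w * z′)))))))
        where
        v≉0 : right x ≉ 0#
        v≉0 z = proj₁ (proj₂ x) (u≈0 , z)
        open Polar (polar-form (*-nonzero w≉0 v≉0))

    through-affine₀ : ∀ {r w} → Type r w → LinesThrough r F.zero 1
    through-affine₀ {r} {w} (w≉0 , to , from) = card-one (kl y) (k0 y (≈L-refl (kl y)) (cross-self w) , from y refl) (λ { L (k0 x ex z , o) → unique L x ex z o })
      where
      y = graph w w w≉0
      unique : ∀ L x → kl x ≈L L → right x ≈ 0# → r on L → L ≈L kl y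
      unique L x ex z o = let (s , fs , l) = cross-zero {left x} {w} (trans (cross-neg w _) (trans (-‿cong (trans (sym (to x (proj₂ (ex r) o))) z)) -0#≈0#)) w≉0 in
        ≈L-trans {L} {kl x} {kl y} (≈L-sym {kl x} {L} ex) (≈L-sym {kl y} {kl x} (wellDefined y x
          (s , (fs , λ s≈0 → proj₁ (proj₂ x) (trans l (*-0ˡ s≈0) , z)) , l , trans z (sym (*-0ʳ (cross-self w))))))

    through-affine₁ : ∀ {r w} → Type r w → LinesThrough r (F.suc F.zero) 0
    through-affine₁ {r} {w} (w≉0 , to , from) = card-empty (λ { L (k1 x ex z , o) → proj₁ (proj₂ x) (z , trans (to x (proj₂ (ex r) o)) (cross-0ʳ w z)) })

    linesThrough : ∀ i j → ∃ λ m → ∀ r → PointKind r i → LinesThrough r j m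
    linesThrough F.zero F.zero = _ , λ { r (c0 h) → through-centre₀ r h }
    linesThrough F.zero (F.suc F.zero) = _ , λ { r (c0 h) → through-centre₁ r h }
    linesThrough F.zero (F.suc (F.suc F.zero)) = _ , λ { r (c0 h) → through-𝓣₁ {r} (centre-card 1ℤ (inj₁ ≡.refl) r h) }
    linesThrough F.zero (F.suc (F.suc (F.suc F.zero))) = _ , λ { r (c0 h) → through-𝓣₂ {r} (centre-card -1ℤ (inj₂ ≡.refl) r h) }
    linesThrough (F.suc F.zero) F.zero = _ , λ { r (c1 h) → through-plane₀ r h }
    linesThrough (F.suc F.zero) (F.suc F.zero) = _ , λ { r (c1 h) → through-plane₁ r h }
    linesThrough (F.suc F.zero) (F.suc (F.suc F.zero)) = _ , λ { r (c1 h) → through-𝓣₁ {r} (hyper-card 1ℤ (inj₁ ≡.refl) r h) }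
    linesThrough (F.suc F.zero) (F.suc (F.suc (F.suc F.zero))) = _ , λ { r (c1 h) → through-𝓣₂ {r} (hyper-card -1ℤ (inj₂ ≡.refl) r h) }
    linesThrough (F.suc (F.suc F.zero)) F.zero = _ , λ { r (c2 (w , t , _)) → through-affine₀ {r} {w} t }
    linesThrough (F.suc (F.suc F.zero)) (F.suc F.zero) = _ , λ { r (c2 (w , t , _)) → through-affine₁ {r} {w} t }
    linesThrough (F.suc (F.suc F.zero)) (F.suc (F.suc F.zero)) = _ , λ { r (c2 h) → through-𝓣₁ {r} (m-plus {r} h) }
    linesThrough (F.suc (F.suc F.zero)) (F.suc (F.suc (F.suc F.zero))) = _ , λ { r (c2 h) → through-𝓣₂ {r} (m-minus {r} h) }
    linesThrough (F.suc (F.suc (F.suc F.zero))) F.zero = _ , λ { r (c3 (w , t , _)) → through-affine₀ {r} {w} t }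
    linesThrough (F.suc (F.suc (F.suc F.zero))) (F.suc F.zero) = _ , λ { r (c3 (w , t , _)) → through-affine₁ {r} {w} t }
    linesThrough (F.suc (F.suc (F.suc F.zero))) (F.suc (F.suc F.zero)) = _ , λ { r (c3 h) → through-𝓣₁ {r} (p-plus {r} h) }
    linesThrough (F.suc (F.suc (F.suc F.zero))) (F.suc (F.suc (F.suc F.zero))) = _ , λ { r (c3 h) → through-𝓣₂ {r} (p-minus {r} h) }

    -- Numbers of points on a line.

    PointsOn : Ln3 → Fin 4 → ℕ → Set (c ⊔ ℓ)
    PointsOn L j m = HasCardMod _≈P_ (λ r → PointKind r j × (r on L)) m

    AffineOn : Ln3 → ℤ → ℕ → Set (c ⊔ ℓ)
    AffineOn L s m = HasCardMod _≈P_ (λ r → 𝓟 s r × (r on L)) m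

    on-𝓟₁ : ∀ {L m} → AffineOn L sm m → PointsOn L (F.suc (F.suc F.zero)) m
    on-𝓟₁ = card-resp (λ L (t , o) → c2 t , o) (λ { L (c2 t , o) → t , o })

    on-𝓟₂ : ∀ {L m} → AffineOn L sp m → PointsOn L (F.suc (F.suc (F.suc F.zero))) m
    on-𝓟₂ = card-resp (λ L (t , o) → c3 t , o) (λ { L (c3 t , o) → t , o })

    -- the affine points of κ(u, cross w₀ u) have the types w₀ + t u
    affine-points : ∀ {L s m} x w₀ → kl x ≈L L → N (left x) ≈ 1# → cross w₀ (left x) ≈ right x → s ≡ 1ℤ ⊎ s ≡ -1ℤ →
      ℤ.+ 2 ℤ.* ΣF (λ t → when (ε (w₀ + t * left x) ℤₚ.≟ s) 1ℤ) ≡ ℤ.+ m → AffineOn L s (m DM./ 2)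
    affine-points {L} {s} {m} x w₀ ex Nu cr s± count = card-of (proj₁ me , ≡.trans (proj₂ me)
        (half-≡ {size en} {m} (≡.trans (≡.cong (ℤ.+ 2 ℤ.*_) (size-filter E? resp Fₗ)) count)))
      where
      u = left x
      W : Carrier → Carrier
      W t = w₀ + t * u
      E? : ∀ t → Dec (ε (W t) ≡ s)
      E? t = ε (W t) ℤₚ.≟ s
      resp : ∀ {t t′} → t ≈ t′ → ε (W t) ≡ s → ε (W t′) ≡ s
      resp p h = ≡.trans (ε-cong (+-congˡ (*-congʳ (sym p)))) h
      en = filterEnum E? resp Fₗ
      W≉0 : ∀ {t} → ε (W t) ≡ s → W t ≉ 0#
      W≉0 h z = ±1≢0 s± (≡.trans (≡.sym h) (ε-0 z))
      cross-W : ∀ t → InF t → cross (W t) u ≈ right x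
      cross-W t ft = trans (cross-+ˡ w₀ (t * u) u) (trans (+-cong cr (trans (cross-scaleˡ u u ft) (*-0ʳ (cross-self u)))) (+-identityʳ _))
      pt : ∀ t → InF t × ε (W t) ≡ s → ∃ λ r → Type r (W t)
      pt t (_ , h) = type-exists (W t) (W≉0 h)
      onto : ∀ r → 𝓟 s r × (r on L) → ∃ λ t → (InF t × ε (W t) ≡ s) × (∀ t′ h → t ≈ t′ → r ≈P proj₁ (pt t′ h))
      onto r ((w , ty , ew) , o) = t , (ft , ≡.trans (ε-cong (sym w≈)) ew) , λ t′ h p →
          type-unique {r} {proj₁ (pt t′ h)} {w} {W t′} ty (proj₂ (pt t′ h)) (trans w≈ (+-congˡ (*-congʳ p)))
        where
        D = w + - 1# * w₀
        D0 : cross D u ≈ 0#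
        D0 = trans (cross-+ˡ w _ u) (trans (+-cong (trans (sym (proj₁ (proj₂ ty) x (proj₂ (ex r) o))) (sym cr)) (cross-scaleˡ w₀ u (F-neg F-1)))
          (solve 1 (λ a → a :+ :- :1 :* a := :0) refl (cross w₀ u)))
        ratio = cross-zero {D} {u} D0 (N1≉0 Nu)
        t = proj₁ ratio
        ft = proj₁ (proj₂ ratio)
        w≈ : w ≈ W t
        w≈ = trans (solve 2 (λ a b → a := b :+ (a :+ :- :1 :* b)) refl w w₀) (+-congˡ (proj₂ (proj₂ ratio)))
      me = mapEnum {_≋_ = _≈P_} {P′ = λ r → 𝓟 s r × (r on L)} en (λ t h → proj₁ (pt t h))
        (λ t h → (W t , proj₂ (pt t h) , proj₂ h) , proj₁ (ex (proj₁ (pt t h))) (proj₂ (proj₂ (proj₂ (pt t h))) x (sym (cross-W t (proj₁ h)))))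
        (λ t t′ h h′ e₁ → cancel-nonzero (N1≉0 Nu) (trans (*-comm u t) (trans (cancel-w₀ (type-injective {proj₁ (pt t h)} {proj₁ (pt t′ h′)} {W t} {W t′} (proj₂ (pt t h)) (proj₂ (pt t′ h′)) e₁)) (*-comm t′ u))))
        onto
        where
        cancel-w₀ : ∀ {a b} → w₀ + a ≈ w₀ + b → a ≈ b
        cancel-w₀ {a} {b} h = trans (solve 2 (λ a w → a := w :+ a :- w) refl a w₀) (trans (+-congʳ h) (solve 2 (λ a w → w :+ a :- w := a) refl b w₀))

    -- The right coordinate is 0, so w₀ = 0 is admissible and the affine points have the types t u.
    -- At t = 0 the value of ε is 0, which leaves (q - 1) / 2 points for each sign.
    flag-points : ∀ {L s} x → kl x ≈L L → right x ≈ 0# → s ≡ 1ℤ ⊎ s ≡ -1ℤ → AffineOn L s (m₁ DM./ 2)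
    flag-points {L} {s} x ex z s± = affine-points {L} {s} {m₁} x′ 0# (≈L-trans {kl x′} {kl x} {L} (≈L-sym {kl x} {kl x′} (wellDefined x x′ x∼)) ex) Nx′
        (trans (cross-0 (left x′) refl) (sym (trans (proj₂ (proj₂ (proj₂ x∼))) (*-0ʳ z)))) s±
        (≡.trans (≡.cong (ℤ.+ 2 ℤ.*_) (sum-cong′ (elems Fₗ) (λ t → when-cong (ε (0# + t * left x′) ℤₚ.≟ s) (ε (t * left x′) ℤₚ.≟ s)
          (≡.trans (ε-cong (sym (+-identityˡ _)))) (≡.trans (ε-cong (+-identityˡ _))) (λ _ → ≡.refl)))) (≡.trans (count s±) q-1))
      where
      nm = normalize x (λ z′ → proj₁ (proj₂ x) (z′ , z))
      x′ = proj₁ nm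
      Nx′ = proj₁ (proj₂ nm)
      x∼ = proj₂ (proj₂ nm)
      count : s ≡ 1ℤ ⊎ s ≡ -1ℤ → ℤ.+ 2 ℤ.* ΣF (λ t → when (ε (t * left x′) ℤₚ.≟ s) 1ℤ) ≡ qℤ ℤ.- 1ℤ
      count (inj₁ ≡.refl) = proj₁ (multiples-count (N1≉0 Nx′))
      count (inj₂ ≡.refl) = proj₂ (multiples-count (N1≉0 Nx′))
      q-1 : qℤ ℤ.- 1ℤ ≡ ℤ.+ m₁
      q-1 = ≡.cong (λ t → ℤ.+ t ℤ.- 1ℤ) q-suc

    𝓣-points : ∀ {L s g x} → 𝓣 g L → g ≡ 1ℤ ⊎ g ≡ -1ℤ → s ≡ 1ℤ ⊎ s ≡ -1ℤ → qℤ ℤ.+ s ℤ.* κ ℤ.* g ≡ ℤ.+ x → AffineOn L s (x DM./ 2)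
    𝓣-points {L} {s} {g} {m} (x , Nx , gx , ex) g± s± val = affine-points {L} {s} {m} x w₀ ex Nx cr s± (≡.trans (count s±) (≡.trans (≡.cong (λ t → qℤ ℤ.+ s ℤ.* κ ℤ.* t)
        (≡.trans (G-cong (*-congˡ cr)) gx)) val))
      where
      u = left x
      -- Hilbert 90 for u v, transported by the factor u of norm 1, solves w₀ × u = v.
      h90 = hilbert-90 (singular x)
      w₀ = u * proj₁ h90
      cr : cross w₀ u ≈ right x
      cr = cancel-nonzero (N1≉0 Nx) (trans (cross-unit (proj₁ h90) Nx) (proj₂ h90))
      C≉0 : cross w₀ u ≉ 0#
      C≉0 z = 𝓣-right {x} g± gx (trans (sym cr) z)
      count : s ≡ 1ℤ ⊎ s ≡ -1ℤ → ℤ.+ 2 ℤ.* ΣF (λ t → when (ε (w₀ + t * u) ℤₚ.≟ s) 1ℤ) ≡ qℤ ℤ.+ s ℤ.* κ ℤ.* G (u * cross w₀ u)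
      count (inj₁ ≡.refl) = ≡.trans (proj₁ (line-count Nx C≉0)) (≡.cong (λ t → qℤ ℤ.+ t ℤ.* G (u * cross w₀ u)) (≡.sym (ℤₚ.*-identityˡ κ)))
      count (inj₂ ≡.refl) = ≡.trans (proj₂ (line-count Nx C≉0)) (lem qℤ κ (G (u * cross w₀ u)))
        where
        lem : ∀ q k e → q ℤ.- k ℤ.* e ≡ q ℤ.+ -1ℤ ℤ.* k ℤ.* e
        lem = ℤSolver.solve-∀

    meets-plane : ∀ {L} x → kl x ≈L L → left x ≉ 0# → PointsOn L (F.suc F.zero) 1
    meets-plane {L} x ex u≉0 = card-resp (λ r (h , o) → c1 h , o) (λ { r (c1 h , o) → h , o })
      (line-meets-plane π L (λ l → u≉0 (in-π x (lineOf-≈L {L} {kl x} (≈L-sym {kl x} {L} ex) l))))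

    misses-p : ∀ {L} x → kl x ≈L L → right x ≉ 0# → PointsOn L F.zero 0
    misses-p {L} x ex v≉0 = card-empty (λ { r (c0 h , o) → v≉0 (on-p x (proj₂ (ex p) (on-≈P {r} {p} L h o))) })

    through-p : ∀ {L} x → kl x ≈L L → right x ≈ 0# → PointsOn L F.zero 1
    through-p x ex z = card-one p (c0 (≈P-refl p) , proj₁ (ex p) (p-on x z)) (λ { r (c0 h , _) → h })

    -- A line of 𝓛₁ has (q - Q) / 2 points in 𝒫₁ and (q + Q) / 2 in 𝒫₂; for a line of 𝓛₂ the two
    -- numbers are exchanged.
    Q-minus : qℤ ℤ.+ sm ℤ.* κ ℤ.* 1ℤ ≡ ℤ.+ (q ℕ.∸ Q)
    Q-minus = ≡.trans (≡.cong (λ t → qℤ ℤ.+ t) (≡.trans (ℤₚ.*-identityʳ (sm ℤ.* κ)) smκ)) q-Q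

    Q-minus′ : qℤ ℤ.+ sp ℤ.* κ ℤ.* -1ℤ ≡ ℤ.+ (q ℕ.∸ Q)
    Q-minus′ = ≡.trans (≡.cong (λ t → qℤ ℤ.+ t) (≡.trans (≡.cong (ℤ._* -1ℤ) spκ) (≡.trans (ℤₚ.*-comm Q₀ -1ℤ) -1*Q))) q-Q

    Q-plus : qℤ ℤ.+ sp ℤ.* κ ℤ.* 1ℤ ≡ ℤ.+ (q ℕ.+ Q)
    Q-plus = ≡.trans (≡.cong (λ t → qℤ ℤ.+ t) (≡.trans (ℤₚ.*-identityʳ (sp ℤ.* κ)) spκ)) (≡.sym (ℤₚ.pos-+ q Q))

    Q-plus′ : qℤ ℤ.+ sm ℤ.* κ ℤ.* -1ℤ ≡ ℤ.+ (q ℕ.+ Q)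
    Q-plus′ = ≡.trans (≡.cong (λ t → qℤ ℤ.+ t) (≡.trans (≡.cong (ℤ._* -1ℤ) smκ) (≡.trans (ℤₚ.*-comm (ℤ.- Q₀) -1ℤ) (≡.trans (ℤₚ.-1*i≡-i (ℤ.- Q₀)) (ℤₚ.neg-involutive Q₀))))) (≡.sym (ℤₚ.pos-+ q Q))

    pointsOn : ∀ i j → ∃ λ m → ∀ L → LineKind L j → PointsOn L i m
    pointsOn F.zero F.zero = _ , λ { L (k0 x ex z) → through-p {L} x ex z }
    pointsOn (F.suc F.zero) F.zero = _ , λ { L (k0 x ex z) → meets-plane {L} x ex (λ z′ → proj₁ (proj₂ x) (z′ , z)) }
    pointsOn (F.suc (F.suc F.zero)) F.zero = _ , λ { L (k0 x ex z) → on-𝓟₁ {L} (flag-points {L} x ex z sm±) }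
    pointsOn (F.suc (F.suc (F.suc F.zero))) F.zero = _ , λ { L (k0 x ex z) → on-𝓟₂ {L} (flag-points {L} x ex z sp±) }
    pointsOn F.zero (F.suc F.zero) = _ , λ { L (k1 x ex z) → misses-p {L} x ex (λ z′ → proj₁ (proj₂ x) (z , z′)) }
    pointsOn (F.suc F.zero) (F.suc F.zero) = _ , λ { L (k1 x ex z) →
      card-resp (λ r o → c1 (lineOf-≈L {kl x} {L} ex (π-in x z) r o) , o) (λ r → proj₂) (points-on-line L) }
    pointsOn (F.suc (F.suc F.zero)) (F.suc F.zero) = 0 , λ { L (k1 x ex z) → card-empty (λ { r (c2 (w , t , _) , o) → type-not-π {r} {w} t (lineOf-≈L {kl x} {L} ex (π-in x z) r o) }) }
    pointsOn (F.suc (F.suc (F.suc F.zero))) (F.suc F.zero) = 0 , λ { L (k1 x ex z) → card-empty (λ { r (c3 (w , t , _) , o) → type-not-π {r} {w} t (lineOf-≈L {kl x} {L} ex (π-in x z) r o) }) }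
    pointsOn F.zero (F.suc (F.suc F.zero)) = _ , λ { L (k2 (x , Nx , g , ex)) → misses-p {L} x ex (𝓣-right {x} (inj₁ ≡.refl) g) }
    pointsOn (F.suc F.zero) (F.suc (F.suc F.zero)) = _ , λ { L (k2 (x , Nx , g , ex)) → meets-plane {L} x ex (N1≉0 Nx) }
    pointsOn (F.suc (F.suc F.zero)) (F.suc (F.suc F.zero)) = _ , λ { L (k2 t) → on-𝓟₁ {L} (𝓣-points {L} t (inj₁ ≡.refl) sm± Q-minus) }
    pointsOn (F.suc (F.suc (F.suc F.zero))) (F.suc (F.suc F.zero)) = _ , λ { L (k2 t) → on-𝓟₂ {L} (𝓣-points {L} t (inj₁ ≡.refl) sp± Q-plus) }
    pointsOn F.zero (F.suc (F.suc (F.suc F.zero))) = _ , λ { L (k3 (x , Nx , g , ex)) → misses-p {L} x ex (𝓣-right {x} (inj₂ ≡.refl) g) }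
    pointsOn (F.suc F.zero) (F.suc (F.suc (F.suc F.zero))) = _ , λ { L (k3 (x , Nx , g , ex)) → meets-plane {L} x ex (N1≉0 Nx) }
    pointsOn (F.suc (F.suc F.zero)) (F.suc (F.suc (F.suc F.zero))) = _ , λ { L (k3 t) → on-𝓟₁ {L} (𝓣-points {L} t (inj₂ ≡.refl) sm± Q-plus′) }
    pointsOn (F.suc (F.suc (F.suc F.zero))) (F.suc (F.suc (F.suc F.zero))) = _ , λ { L (k3 t) → on-𝓟₂ {L} (𝓣-points {L} t (inj₂ ≡.refl) sp± Q-minus′) }

    -- The decomposition, assembled from both families of counts.

    tactical : SymmetricTacticalDecomposition Pt3 _≈P_ Ln3 _≈L_ _on_ 4 4 PC LC
    tactical = record
      { pointClassNonempty = λ j → let (r , h) = pointKind-exists j in r , pointKind→PC {r} {j} h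
      ; pointCovered = λ r → let (j , h) = pointKind r in j , pointKind→PC {r} {j} h
      ; pointDisjoint = λ r i j h h′ → pointKind-unique {r} (PC→pointKind r i h) (PC→pointKind r j h′)
      ; lineClassNonempty = λ j → let (L , h) = lineKind-exists j in L , lineKind→LC L h
      ; lineCovered = λ L → let (j , h) = lineKind L in j , lineKind→LC L h
      ; lineDisjoint = lines-disjoint
      ; pointsOnLine = λ i j → let (m , h) = pointsOn i j in m , λ L l →
          card-resp (λ r (t , o) → pointKind→PC {r} {i} t , o) (λ r (t , o) → PC→pointKind r i t , o) (h L (LC→lineKind L j l))
      ; linesThroughPoint = λ i j → let (m , h) = linesThrough i j in m , λ r t →
          card-resp (λ L (l , o) → lineKind→LC L l , o) (λ L (l , o) → LC→lineKind L j l , o) (h r (PC→pointKind r i t))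
      } , ≡.refl

-- 9 ≡ 1 modulo 8. The form 8 (k + 1) also records that q exceeds 1.
3^2e-mod8 : ∀ e → 1 ℕ.≤ e → ∃ λ k → 3 ℕ.^ (2 ℕ.* e) ≡ ℕ.suc (8 ℕ.* ℕ.suc k)
3^2e-mod8 (ℕ.suc ℕ.zero) _ = 0 , ≡.refl
3^2e-mod8 (ℕ.suc (ℕ.suc e)) _ = let (k , eq) = 3^2e-mod8 (ℕ.suc e) (ℕ.s≤s ℕ.z≤n) in
  9 ℕ.* k ℕ.+ 9 , ≡.trans (≡.cong (3 ℕ.^_) (ℕₚ.*-suc 2 (ℕ.suc e))) (≡.trans (≡.cong (λ t → 3 ℕ.* (3 ℕ.* t)) eq) (step k))
  where
  step : ∀ k → 3 ℕ.* (3 ℕ.* ℕ.suc (8 ℕ.* ℕ.suc k)) ≡ ℕ.suc (8 ℕ.* ℕ.suc (9 ℕ.* k ℕ.+ 9))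
  step = ℕSolver.solve-∀

mainTheorem2 : ∀ {c ℓ : Level} (e : ℕ) → 1 ℕ.≤ e →
    (R : CommutativeRing c ℓ) →
    IsFiniteField R ((3 ℕ.^ (2 ℕ.* e)) ℕ.^ 3) →
    (α : CommutativeRing.Carrier R) →
    let open Setup R (3 ℕ.^ (2 ℕ.* e)) α in
    IsPrimitive α →
    (a₁ : Carrier) → InS a₁ →
    (κ : QPt → Ln3) → IsKleinCorrespondence κ →
    (p : Pt3) → (∀ L → image κ InΠ₁ L ⇔ star p L) →
    (π : Pt3) → (∀ L → image κ InΠ₂ L ⇔ lineOf π L) →
    let open Classes a₁ in
    SymmetricTacticalDecomposition Pt3 _≈P_ Ln3 _≈L_ _on_ 4 4
      (fourClasses
        (λ r → r ≈P p)
        (λ r → r onPlane π)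
        (λ r → HasCardMod _≈L_ (λ L → image κ InT₁ L × (r on L))
                 (((3 ℕ.^ (2 ℕ.* e) ℕ.+ 1) ℕ.* (3 ℕ.^ (2 ℕ.* e) ℕ.∸ 3 ℕ.^ e)) ℕ./ 2))
        (λ r → HasCardMod _≈L_ (λ L → image κ InT₁ L × (r on L))
                 (((3 ℕ.^ (2 ℕ.* e) ℕ.+ 1) ℕ.* (3 ℕ.^ (2 ℕ.* e) ℕ.+ 3 ℕ.^ e)) ℕ./ 2)))
      (fourClasses (star p) (lineOf π) (image κ InT₁) (image κ InT₂))
mainTheorem2 e 1≤e R fin α generates a₁ Sa₁ κ isKlein p p-star π π-lines =
  Configuration.tactical a₁ Sa₁ correspondence
  where
  q-data = 3^2e-mod8 e 1≤e
  setting : Setting _ _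
  setting = record
    { R = R ; e = e ; k = proj₁ q-data ; q = 3 ℕ.^ (2 ℕ.* e) ; m₁ = 8 ℕ.* ℕ.suc (proj₁ q-data)
    ; q-pow = ≡.refl ; q-suc = proj₂ q-data ; m₁-mod8 = ≡.refl ; fin = fin ; α = α ; generates = generates }
  open TightSets setting
  correspondence : Correspondence
  correspondence = record { kl = κ ; isKlein = isKlein ; p = p ; p-star = p-star ; π = π ; π-lines = π-lines }
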